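{- Let $\sigma=\mu/\nu$ and $\tau=\rho/\kappa$ be any skew shapes (with $\mu,\nu,\rho,\kappa$ partitions). For every natural number $m\ge 1$ and every $l\in\{0,1,\dots,m\}$, the sequence of plethysm coefficients \[ \mathsf{A}_{l,m}(\sigma,\tau)=\Big(a^{\sigma^{l,m}\{j\}}_{\tau^{l,m}[j],(m)}\Big)_{j\in\mathbb{N}} \] is eventually constant.
   Context: For partitions $\alpha,\beta$, $\alpha+\beta:=(\alpha_1+\beta_1,\alpha_2+\beta_2,\dots)$ and $\alpha\sqcup\beta$ is the partition obtained by concatenating the parts of $\alpha$ and $\beta$ and reordering into weakly decreasing order; $(a^b)$ denotes the partition with $b$ parts equal to $a$, and $(j)$ the one-part partition. For $m\in\mathbb{N}$, $l\in\{0,\dots,m\}$, a partition $\alpha$ and $j\in\mathbb{N}_0$, define $\alpha^{l,m}\{j\}:=(\alpha+(lj))\sqcup((m-l)^j)$ and $\alpha^{l,m}[j]:=\alpha+(j)$ if $m+l$ is even, $\alpha^{l,m}[j]:=\alpha\sqcup(1^j)$ if $m+l$ is odd. For a skew shape $\sigma=\mu/\nu$ (given by partitions $\mu,\nu$), set $\sigma^{l,m}\{j\}:=(\mu^{l,m}\{j\})/\nu$ and $\sigma^{l,m}[j]:=(\mu^{l,m}[j])/\nu$. Let $s_\lambda$ be the Schur function, $\circ$ plethysm, $\langle\cdot,\cdot\rangle$ the Hall inner product, and $c^\nu_{\lambda,\mu}$ the Littlewood–Richardson coefficients ($s_\lambda s_\mu=\sum_\nu c^\nu_{\lambda,\mu}s_\nu$).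 The skew Schur function is $s_{\nu/\lambda}:=\sum_\mu c^\nu_{\lambda,\mu}s_\mu$, and for partitions $\alpha,\beta,\lambda,\mu,\nu$ the plethysm coefficient is $a^{\nu/\lambda}_{\alpha/\beta,\mu}:=\langle s_{\alpha/\beta}\circ s_\mu, s_{\nu/\lambda}\rangle$ (for a partition $\nu$, $\nu$ is identified with $\nu/\emptyset$). A sequence stabilises (is eventually constant) if it is constant from some index on. -}

module Defs where

open import Data.Nat using (ℕ; zero; suc; _+_; _*_; _∸_; _≡ᵇ_; _<ᵇ_; _≤ᵇ_; _≤_; _≥_)
open import Data.Integer using (ℤ; +_; -_) renaming (_+_ to _+ℤ_; _*_ to _*ℤ_)
open import Data.Bool using (Bool; true; false; _∧_; if_then_else_; not)
open import Data.List using (List; []; _∷_; length; map; concatMap; concat; filterᵇ; replicate; upTo; _++_; foldr)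
open import Data.Nat.ListAction using (sum)
open import Data.List.Relation.Unary.All using (All)
open import Data.List.Relation.Unary.Linked using (Linked)
open import Data.Product using (_×_; _,_; proj₁; proj₂)

IsPartition : List ℕ → Set
IsPartition α = Linked _≥_ α × All (λ x → 1 ≤ x) α

size : List ℕ → ℕ
size = sum

_⊕_ : List ℕ → List ℕ → List ℕ
[] ⊕ ys = ys
(x ∷ xs) ⊕ [] = x ∷ xs
(x ∷ xs) ⊕ (y ∷ ys) = (x + y) ∷ (xs ⊕ ys)

insertD : ℕ → List ℕ → List ℕ
insertD x [] = x ∷ []
insertD x (y ∷ ys) = if y <ᵇ x then x ∷ y ∷ ys else y ∷ insertD x ys

sortD : List ℕ → List ℕ
sortD = foldr insertD []

isZero : ℕ → Bool
isZero n = n ≡ᵇ 0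

_⊔_ : List ℕ → List ℕ → List ℕ
α ⊔ β = sortD (filterᵇ (λ x → not (isZero x)) (α ++ β))

single : ℕ → List ℕ
single zero = []
single (suc j) = suc j ∷ []

rect : ℕ → ℕ → List ℕ
rect a b = replicate b a

isEven : ℕ → Bool
isEven zero = true
isEven (suc zero) = false
isEven (suc (suc n)) = isEven n

curly : ℕ → ℕ → List ℕ → ℕ → List ℕ
curly l m α j = (α ⊕ single (l * j)) ⊔ rect (m ∸ l) j

square : ℕ → ℕ → List ℕ → ℕ → List ℕ
square l m α j = if isEven (m + l) then α ⊕ single j else α ⊔ rect 1 j

allRows : ℕ → ℕ → List (List ℕ)
allRows zero k = [] ∷ []
allRows (suc len) k = concatMap (λ a → map (a ∷_) (allRows len k)) (upTo k)

fillings : List ℕ → ℕ → List (List (List ℕ))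
fillings [] k = [] ∷ []
fillings (r ∷ rs) k = concatMap (λ row → map (row ∷_) (fillings rs k)) (allRows r k)

weakInc : List ℕ → Bool
weakInc [] = true
weakInc (x ∷ []) = true
weakInc (x ∷ y ∷ ys) = (x ≤ᵇ y) ∧ weakInc (y ∷ ys)

weakDec : List ℕ → Bool
weakDec [] = true
weakDec (x ∷ []) = true
weakDec (x ∷ y ∷ ys) = (y ≤ᵇ x) ∧ weakDec (y ∷ ys)

colStrict : List ℕ → List ℕ → Bool
colStrict (x ∷ xs) (y ∷ ys) = (x <ᵇ y) ∧ colStrict xs ys
colStrict _ _ = true

isSSYT : List (List ℕ) → Bool
isSSYT [] = true
isSSYT (r ∷ []) = weakInc r
isSSYT (r ∷ r' ∷ rs) = weakInc r ∧ (colStrict r r' ∧ isSSYT (r' ∷ rs))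

lookupD : List (List ℕ) → ℕ → List ℕ
lookupD [] _ = []
lookupD (x ∷ xs) zero = x
lookupD (x ∷ xs) (suc k) = lookupD xs k

eqL : List ℕ → List ℕ → Bool
eqL [] [] = true
eqL (x ∷ xs) (y ∷ ys) = (x ≡ᵇ y) ∧ eqL xs ys
eqL _ _ = false

-- exponent vector (in n variables) of the monomial of a tableau whose
-- letter k stands for the monomial with exponent vector (lookupD alph k)
weight : ℕ → List (List ℕ) → List (List ℕ) → List ℕ
weight n alph T = foldr (λ k acc → lookupD alph k ⊕ acc) (replicate n 0) (concat T)

-- coefficient of x^γ in s_shape(y_1,...,y_M), y_k = x^(alph_k)
countSSYT : List ℕ → List (List ℕ) → List ℕ → ℕ
countSSYT shape alph γ =
  length (filterᵇ (λ T → isSSYT T ∧ eqL (weight (length γ) alph T) γ)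
                  (fillings shape (length alph)))

unitVecs : ℕ → List (List ℕ)
unitVecs n = map (λ i → map (λ j → if i ≡ᵇ j then 1 else 0) (upTo n)) (upTo n)

comps : ℕ → ℕ → List (List ℕ)
comps zero m = if m ≡ᵇ 0 then [] ∷ [] else []
comps (suc n) m = concatMap (λ a → map (a ∷_) (comps n (m ∸ a))) (upTo (suc m))

kostka : List ℕ → List ℕ → ℕ
kostka sh γ = countSSYT sh (unitVecs (length γ)) γ

splits : List ℕ → List (List ℕ × List ℕ)
splits [] = ([] , []) ∷ []
splits (g ∷ gs) = concatMap (λ a → map (λ p → (a ∷ proj₁ p , (g ∸ a) ∷ proj₂ p)) (splits gs)) (upTo (suc g))

insertions : ℕ → List ℕ → List (List ℕ)
insertions x [] = (x ∷ []) ∷ []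
insertions x (y ∷ ys) = (x ∷ y ∷ ys) ∷ map (y ∷_) (insertions x ys)

perms : ℕ → List (List ℕ)
perms zero = [] ∷ []
perms (suc n) = concatMap (insertions n) (perms n)

inversions : List ℕ → ℕ
inversions [] = 0
inversions (x ∷ xs) = length (filterᵇ (λ y → y <ᵇ x) xs) + inversions xs

sign : List ℕ → ℤ
sign p = if isEven (inversions p) then + 1 else - (+ 1)

sumℤ : List ℤ → ℤ
sumℤ = foldr _+ℤ_ (+ 0)

-- π + δ - w(δ), entrywise π_i + p_i - i
expo : ℕ → List ℕ → List ℕ → List ℕ
expo i (a ∷ as) (b ∷ bs) = (a + b ∸ i) ∷ expo (suc i) as bs
expo _ _ _ = []

expoOK : ℕ → List ℕ → List ℕ → Bool
expoOK i (a ∷ as) (b ∷ bs) = (i ≤ᵇ a + b) ∧ expoOK (suc i) as bs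
expoOK _ _ _ = true

-- Coefficient of s_π in a symmetric polynomial f in n = length π
-- variables (f given by its monomial coefficients):
-- the coefficient of x^(π+δ) in a_δ · f.
schurCoeff : (List ℕ → ℤ) → List ℕ → ℤ
schurCoeff f π =
  sumℤ (map (λ p → if expoOK 0 π p then sign p *ℤ f (expo 0 π p) else + 0)
            (perms (length π)))

parts : ℕ → List (List ℕ)
parts d = map (filterᵇ (λ x → not (isZero x))) (filterᵇ weakDec (comps d d))

LR : List ℕ → List ℕ → List ℕ → ℤ
LR ν lam μ = schurCoeff
  (λ γ → + sum (map (λ s → kostka lam (proj₁ s) * kostka μ (proj₂ s)) (splits γ))) ν

-- [s_π](s_μ ∘ s_(m)) : s_μ evaluated at all monomials of degree m
plethHm : List ℕ → ℕ → List ℕ → ℤ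
plethHm μ m π = schurCoeff (λ γ → + countSSYT μ (comps (length γ) m) γ) π

-- a^{ν/λ}_{α/β,(m)} = ⟨ s_{α/β} ∘ s_(m) , s_{ν/λ} ⟩
-- with s_{α/β} = Σ_μ c^α_{β,μ} s_μ, s_{ν/λ} = Σ_π c^ν_{λ,π} s_π,
-- and the Schur basis orthonormal.
plethCoeff : List ℕ → List ℕ → List ℕ → List ℕ → ℕ → ℤ
plethCoeff ν lam α β m =
  sumℤ (map (λ π → sumℤ (map (λ μ → LR α β μ *ℤ plethHm μ m π) (parts (size α ∸ size β)))
                    *ℤ LR ν lam π)
            (parts (size ν ∸ size lam)))

seqA : ℕ → ℕ → List ℕ → List ℕ → List ℕ → List ℕ → ℕ → ℤ
seqA l m μ ν ρ κ j = plethCoeff (curly l m μ j) ν (square l m ρ j) κ m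

{-# OPTIONS --safe #-}
-- Let h_k and e_k be encoded by even and odd letters, so that a symmetric function becomes a function on
-- words, i.e. a supersymmetric function of even variables x_i and odd variables y_i.  The coefficient of
-- s_λ is extracted by multiplying with a Weyl denominator and reading off the highest weight; the order of
-- the variables is arbitrary, since moving an odd variable past an even one ("odd reflection") only moves
-- one box of λ.  For λ = μ^{l,m}{j} take the order y_1, …, y_{m-l}, x_1, x_2, …: passing from j to j + 1
-- then adds to the highest weight the exponents of z = y_1 ⋯ y_{m-l} x_1^l, which is the heaviest monomial
-- of degree m and has the parity of m + l.  In the same way the weight of ρ^{l,m}[j] grows by one in its
-- first variable, which has the parity of z.  All weights involved dominate the highest weight, so for j
-- large every contribution contains z in the first part of the outer shape, and removing it is a bijection
-- between the contributions for j + 1 and for j.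
module Submission where

open import Defs
open import Level using (0ℓ)
open import Algebra.Bundles using (CommutativeMonoid)
open import Data.Nat using (ℕ; zero; suc; pred; _+_; _*_; _∸_; _≤_; _<_; _≥_; z≤n; s≤s; s≤s⁻¹; _≡ᵇ_; _<ᵇ_; _≤ᵇ_)
import Data.Nat.Properties as ℕₚ
open import Data.Nat.ListAction using (sum)
import Data.Nat.Tactic.RingSolver as ℕSolver
open import Data.Integer using (ℤ; +_; -_) renaming (_+_ to _+ℤ_; _*_ to _*ℤ_)
import Data.Integer.Properties as ℤₚ
open import Data.Integer.Tactic.RingSolver using (solve-∀)
open import Data.Bool using (Bool; true; false; if_then_else_; not; _xor_; _∧_)
open import Data.Bool.Properties using (∧-assoc; ∧-identityʳ)
open import Data.Empty using (⊥; ⊥-elim)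
open import Data.List using (List; []; _∷_; map; concat; concatMap; _++_; _∷ʳ_; length; replicate; upTo; filterᵇ; foldr; zipWith)
import Data.List.Properties as Listₚ
open import Data.List.Membership.Propositional using (_∈_)
open import Data.List.Relation.Unary.All as All using (All; []; _∷_)
import Data.List.Relation.Unary.All.Properties as AllP
open import Data.List.Relation.Unary.Any using (here; there)
open import Data.List.Relation.Unary.Linked using (Linked; []; [-]; _∷_)
import Data.List.Relation.Unary.Linked.Properties as Linkedₚ
open import Data.List.Relation.Binary.Permutation.Propositional using (_↭_; ↭-refl; ↭-sym; ↭-trans; prep; swap; refl; trans; ↭-reflexive)
import Data.List.Relation.Binary.Permutation.Propositional.Properties as Perm
open import Data.List.Reverse using (Reverse; []; _∶_∶ʳ_; reverseView)
open import Data.Product using (Σ; ∃; _×_; _,_; proj₁; proj₂)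
open import Relation.Nullary using (yes; no; ¬_)
open import Relation.Binary.PropositionalEquality as ≡ using (_≡_; cong; cong₂; sym; subst; module ≡-Reasoning)

-- The definitions only evaluate words of even letters. Odd variables become available because both
-- ingredients extend to mixed words: the Kostka numbers, and the coefficients `W m ξ γ` of the
-- plethysm, which must be supersymmetric in the outer word ξ and in the inner word γ. For γ the
-- reason is that a monomial with an odd number of odd variables is itself odd: when y = - x is
-- substituted for an odd y and an even x, the monomials x^(c+1) v and x^c y v cancel. The two sums
-- over intermediate partitions are absorbed by the Schur expansion, and a plethysm coefficient
-- becomes one nested extraction, `coefficient`. "Heaviest" refers to the sum of the first M and of
-- the first M + 1 exponents, where M = m - l. On a monomial it is at most Q = M + m, with equality
-- only for z. From j to j + 1 the weight of the shape built from μ grows by Q and the number of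
-- monomials by one, so Q times that number minus the weight stays bounded, whereas the first part
-- of the outer shape grows. Skewing by ν and κ costs no more than a constant.

antidiag : ℕ → List (ℕ × ℕ)
antidiag zero    = (0 , 0) ∷ []
antidiag (suc n) = (0 , suc n) ∷ map (λ (i , j) → suc i , j) (antidiag n)

steps : ℕ → List (ℕ × ℕ)
steps zero    = (0 , 0) ∷ []
steps (suc n) = (0 , suc n) ∷ (1 , n) ∷ []

-- The ways to take part of n away: at most one unit if the flag is set, any amount otherwise.
take≤ : Bool → ℕ → List (ℕ × ℕ)
take≤ true  = steps
take≤ false = antidiag

-- Sums over antidiagonals and bounded removals

module Sums (M : CommutativeMonoid 0ℓ 0ℓ) where
  open CommutativeMonoid M renaming (Carrier to C; refl to ≈-refl; sym to ≈-sym; trans to ≈-trans)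
  open import Relation.Binary.Reasoning.Setoid setoid

  ∑ : {X : Set} → List X → (X → C) → C
  ∑ []       f = ε
  ∑ (x ∷ xs) f = f x ∙ ∑ xs f

  private variable X Y : Set

  ∑-cong-All : ∀ {xs : List X} {f g} → All (λ x → f x ≈ g x) xs → ∑ xs f ≈ ∑ xs g
  ∑-cong-All []       = ≈-refl
  ∑-cong-All (p ∷ ps) = ∙-cong p (∑-cong-All ps)

  ∑-cong : ∀ (xs : List X) {f g} → (∀ x → f x ≈ g x) → ∑ xs f ≈ ∑ xs g
  ∑-cong xs h = ∑-cong-All (All.universal h xs)

  ∑-ε : ∀ (xs : List X) {f} → (∀ x → f x ≈ ε) → ∑ xs f ≈ ε
  ∑-ε []       h = ≈-refl
  ∑-ε (x ∷ xs) h = ≈-trans (∙-cong (h x) (∑-ε xs h)) (identityˡ ε)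

  ∑-++ : ∀ (xs {ys} : List X) f → ∑ (xs ++ ys) f ≈ ∑ xs f ∙ ∑ ys f
  ∑-++ []       f = ≈-sym (identityˡ _)
  ∑-++ (x ∷ xs) f = ≈-trans (∙-congˡ (∑-++ xs f)) (≈-sym (assoc _ _ _))

  ∑-map : ∀ (h : X → Y) xs f → ∑ (map h xs) f ≈ ∑ xs (λ x → f (h x))
  ∑-map h []       f = ≈-refl
  ∑-map h (x ∷ xs) f = ∙-congˡ (∑-map h xs f)

  ∑-concatMap : ∀ (h : X → List Y) xs f → ∑ (concatMap h xs) f ≈ ∑ xs (λ x → ∑ (h x) f)
  ∑-concatMap h []       f = ≈-refl
  ∑-concatMap h (x ∷ xs) f = ≈-trans (∑-++ (h x) f) (∙-congˡ (∑-concatMap h xs f))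

  interchange : ∀ a b c d → (a ∙ b) ∙ (c ∙ d) ≈ (a ∙ c) ∙ (b ∙ d)
  interchange a b c d = begin
    (a ∙ b) ∙ (c ∙ d) ≈⟨ assoc a b _ ⟩
    a ∙ (b ∙ (c ∙ d)) ≈⟨ ∙-congˡ (≈-trans (≈-sym (assoc b c d)) (≈-trans (∙-congʳ (comm b c)) (assoc c b d))) ⟩
    a ∙ (c ∙ (b ∙ d)) ≈⟨ ≈-sym (assoc a c _) ⟩
    (a ∙ c) ∙ (b ∙ d) ∎

  ∑-∙ : ∀ (xs : List X) f g → ∑ xs (λ x → f x ∙ g x) ≈ ∑ xs f ∙ ∑ xs g
  ∑-∙ []       f g = ≈-sym (identityˡ ε)
  ∑-∙ (x ∷ xs) f g = ≈-trans (∙-congˡ (∑-∙ xs f g)) (interchange _ _ _ _)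

  ∑-comm : ∀ (xs : List X) (ys : List Y) (f : X → Y → C) →
           ∑ xs (λ x → ∑ ys (f x)) ≈ ∑ ys (λ y → ∑ xs (λ x → f x y))
  ∑-comm []       ys f = ≈-sym (∑-ε ys (λ _ → ≈-refl))
  ∑-comm (x ∷ xs) ys f = ≈-trans (∙-congˡ (∑-comm xs ys f)) (≈-sym (∑-∙ ys (f x) _))

  ∑-↭ : ∀ {xs ys : List X} f → xs ↭ ys → ∑ xs f ≈ ∑ ys f
  ∑-↭ f refl         = ≈-refl
  ∑-↭ f (prep x p)   = ∙-congˡ (∑-↭ f p)
  ∑-↭ f (swap x y p) = ≈-trans (∙-congˡ (∙-congˡ (∑-↭ f p)))
    (≈-trans (≈-sym (assoc _ _ _)) (≈-trans (∙-congʳ (comm _ _)) (assoc _ _ _)))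
  ∑-↭ f (trans p q)  = ≈-trans (∑-↭ f p) (∑-↭ f q)

  ∑-antidiag-suc : ∀ n f → ∑ (antidiag (suc n)) f ≈ f (0 , suc n) ∙ ∑ (antidiag n) (λ (i , j) → f (suc i , j))
  ∑-antidiag-suc n f = ∙-congˡ (∑-map _ (antidiag n) f)

  ∑-antidiag-snoc : ∀ n f → ∑ (antidiag (suc n)) f ≈ ∑ (antidiag n) (λ (i , j) → f (i , suc j)) ∙ f (suc n , 0)
  ∑-antidiag-snoc zero    f = ∙-cong (≈-sym (identityʳ _)) (identityʳ _)
  ∑-antidiag-snoc (suc n) f = begin
    ∑ (antidiag (suc (suc n))) f
      ≈⟨ ∑-antidiag-suc (suc n) f ⟩
    f (0 , suc (suc n)) ∙ ∑ (antidiag (suc n)) (λ (i , j) → f (suc i , j))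
      ≈⟨ ∙-congˡ (∑-antidiag-snoc n _) ⟩
    f (0 , suc (suc n)) ∙ (∑ (antidiag n) (λ (i , j) → f (suc i , suc j)) ∙ f (suc (suc n) , 0))
      ≈⟨ ≈-sym (assoc _ _ _) ⟩
    f (0 , suc (suc n)) ∙ ∑ (antidiag n) (λ (i , j) → f (suc i , suc j)) ∙ f (suc (suc n) , 0)
      ≈⟨ ∙-congʳ (≈-sym (∑-antidiag-suc n _)) ⟩
    ∑ (antidiag (suc n)) (λ (i , j) → f (i , suc j)) ∙ f (suc (suc n) , 0) ∎

  ∑-antidiag-flip : ∀ n f → ∑ (antidiag n) f ≈ ∑ (antidiag n) (λ (i , j) → f (j , i))
  ∑-antidiag-flip zero    f = ≈-refl
  ∑-antidiag-flip (suc n) f = begin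
    ∑ (antidiag (suc n)) f
      ≈⟨ ∑-antidiag-suc n f ⟩
    f (0 , suc n) ∙ ∑ (antidiag n) (λ (i , j) → f (suc i , j))
      ≈⟨ comm _ _ ⟩
    ∑ (antidiag n) (λ (i , j) → f (suc i , j)) ∙ f (0 , suc n)
      ≈⟨ ∙-congʳ (∑-antidiag-flip n _) ⟩
    ∑ (antidiag n) (λ (i , j) → f (suc j , i)) ∙ f (0 , suc n)
      ≈⟨ ≈-sym (∑-antidiag-snoc n _) ⟩
    ∑ (antidiag (suc n)) (λ (i , j) → f (j , i)) ∎

  -- On the antidiagonal of `suc (m + n)` exactly one of `i > m` and `j > n` holds. The cut later
  -- turns a vanishing full sum into an equality of two partial ones, and splits off a square on
  -- which an antisymmetric summand cancels.
  ∑-antidiag-split : ∀ m n f → ∑ (antidiag (suc (m + n))) f ≈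
    ∑ (antidiag n) (λ (r , j) → f (suc (m + r) , j)) ∙ ∑ (antidiag m) (λ (i , r) → f (i , suc (n + r)))
  ∑-antidiag-split zero n f = begin
    ∑ (antidiag (suc n)) f
      ≈⟨ ∑-antidiag-suc n f ⟩
    f (0 , suc n) ∙ ∑ (antidiag n) (λ (i , j) → f (suc i , j))
      ≈⟨ comm _ _ ⟩
    ∑ (antidiag n) (λ (i , j) → f (suc i , j)) ∙ f (0 , suc n)
      ≈⟨ ∙-congˡ (≈-trans (reflexive (cong (λ k → f (0 , suc k)) (sym (ℕₚ.+-identityʳ n)))) (≈-sym (identityʳ _))) ⟩
    ∑ (antidiag n) (λ (i , j) → f (suc i , j)) ∙ (f (0 , suc (n + 0)) ∙ ε) ∎
  ∑-antidiag-split (suc m) n f = begin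
    ∑ (antidiag (suc (suc (m + n)))) f
      ≈⟨ ∑-antidiag-suc (suc (m + n)) f ⟩
    f (0 , suc (suc (m + n))) ∙ ∑ (antidiag (suc (m + n))) (λ (i , j) → f (suc i , j))
      ≈⟨ ∙-cong (reflexive (cong (λ k → f (0 , suc k)) (≡.trans (cong suc (ℕₚ.+-comm m n)) (sym (ℕₚ.+-suc n m)))))
                (∑-antidiag-split m n _) ⟩
    f (0 , suc (n + suc m)) ∙ (A ∙ B)
      ≈⟨ ≈-trans (≈-sym (assoc _ _ _)) (≈-trans (∙-congʳ (comm _ _)) (assoc _ _ _)) ⟩
    A ∙ (f (0 , suc (n + suc m)) ∙ B)
      ≈⟨ ∙-congˡ (≈-sym (∑-antidiag-suc m _)) ⟩
    A ∙ ∑ (antidiag (suc m)) (λ (i , r) → f (i , suc (n + r))) ∎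
    where
    A = ∑ (antidiag n) (λ (r , j) → f (suc (suc (m + r)) , j))
    B = ∑ (antidiag m) (λ (i , r) → f (suc i , suc (n + r)))

  private
    ∑∑ : Bool → Bool → ℕ → (ℕ → ℕ → ℕ → C) → C
    ∑∑ p q n f = ∑ (take≤ p n) (λ (i , j) → ∑ (take≤ q j) (λ (i′ , k) → f i i′ k))

    any-any : ∀ n f → ∑∑ false false n f ≈ ∑∑ false false n (λ i i′ k → f i′ i k)
    any-any zero    f = ≈-refl
    any-any (suc n) f = begin
      ∑∑ false false (suc n) f
        ≈⟨ ∑-antidiag-suc n _ ⟩
      ∑ (antidiag (suc n)) (λ (i′ , k) → f 0 i′ k) ∙ ∑∑ false false n (λ i → f (suc i))
        ≈⟨ ∙-cong (∑-antidiag-snoc n _) (any-any n _) ⟩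
      (∑ (antidiag n) (λ (i , k) → f 0 i (suc k)) ∙ f 0 (suc n) 0) ∙ ∑ (antidiag n) (λ (i , j) → ∑ (antidiag j) (λ (i′ , k) → f (suc i′) i k))
        ≈⟨ ≈-trans (assoc _ _ _) (≈-trans (∙-congˡ (comm _ _)) (≈-sym (assoc _ _ _))) ⟩
      (∑ (antidiag n) (λ (i , k) → f 0 i (suc k)) ∙ ∑ (antidiag n) (λ (i , j) → ∑ (antidiag j) (λ (i′ , k) → f (suc i′) i k))) ∙ f 0 (suc n) 0
        ≈⟨ ∙-cong (≈-sym (∑-∙ (antidiag n) _ _)) (≈-sym (identityʳ _)) ⟩
      ∑ (antidiag n) (λ (i , j) → f 0 i (suc j) ∙ ∑ (antidiag j) (λ (i′ , k) → f (suc i′) i k)) ∙ (f 0 (suc n) 0 ∙ ε)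
        ≈⟨ ∙-congʳ (∑-cong (antidiag n) (λ (i , j) → ≈-sym (∑-antidiag-suc j _))) ⟩
      ∑ (antidiag n) (λ (i , j) → ∑ (antidiag (suc j)) (λ (i′ , k) → f i′ i k)) ∙ (f 0 (suc n) 0 ∙ ε)
        ≈⟨ ≈-sym (∑-antidiag-snoc n _) ⟩
      ∑∑ false false (suc n) (λ i i′ k → f i′ i k) ∎

    any-one : ∀ n f → ∑∑ false true n f ≈ ∑∑ true false n (λ i i′ k → f i′ i k)
    any-one zero    f = ≈-refl
    any-one (suc n) f = begin
      ∑∑ false true (suc n) f
        ≈⟨ ∑-antidiag-snoc n _ ⟩
      ∑ (antidiag n) (λ (i , j) → ∑ (steps (suc j)) (λ (i′ , k) → f i i′ k)) ∙ (f (suc n) 0 0 ∙ ε)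
        ≈⟨ ∙-cong (≈-trans (∑-cong (antidiag n) (λ (i , j) → ∙-congˡ (identityʳ _))) (∑-∙ (antidiag n) _ _)) (identityʳ _) ⟩
      (∑ (antidiag n) (λ (i , j) → f i 0 (suc j)) ∙ ∑ (antidiag n) (λ (i , j) → f i 1 j)) ∙ f (suc n) 0 0
        ≈⟨ ≈-trans (assoc _ _ _) (≈-trans (∙-congˡ (comm _ _)) (≈-sym (assoc _ _ _))) ⟩
      (∑ (antidiag n) (λ (i , j) → f i 0 (suc j)) ∙ f (suc n) 0 0) ∙ ∑ (antidiag n) (λ (i , j) → f i 1 j)
        ≈⟨ ∙-congʳ (≈-sym (∑-antidiag-snoc n _)) ⟩
      ∑ (antidiag (suc n)) (λ (i , j) → f i 0 j) ∙ ∑ (antidiag n) (λ (i , j) → f i 1 j)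
        ≈⟨ ∙-congˡ (≈-sym (identityʳ _)) ⟩
      ∑∑ true false (suc n) (λ i i′ k → f i′ i k) ∎

    one-one : ∀ n f → ∑∑ true true n f ≈ ∑∑ true true n (λ i i′ k → f i′ i k)
    one-one zero          f = ≈-refl
    one-one (suc zero)    f = begin
      (f 0 0 1 ∙ (f 0 1 0 ∙ ε)) ∙ ((f 1 0 0 ∙ ε) ∙ ε) ≈⟨ ∙-cong (∙-congˡ (identityʳ _)) (≈-trans (identityʳ _) (identityʳ _)) ⟩
      (f 0 0 1 ∙ f 0 1 0) ∙ f 1 0 0 ≈⟨ ≈-trans (assoc _ _ _) (≈-trans (∙-congˡ (comm _ _)) (≈-sym (assoc _ _ _))) ⟩
      (f 0 0 1 ∙ f 1 0 0) ∙ f 0 1 0 ≈⟨ ≈-sym (∙-cong (∙-congˡ (identityʳ _)) (≈-trans (identityʳ _) (identityʳ _))) ⟩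
      (f 0 0 1 ∙ (f 1 0 0 ∙ ε)) ∙ ((f 0 1 0 ∙ ε) ∙ ε) ∎
    one-one (suc (suc n)) f = begin
      (f 0 0 (suc (suc n)) ∙ (f 0 1 (suc n) ∙ ε)) ∙ ((f 1 0 (suc n) ∙ (f 1 1 n ∙ ε)) ∙ ε)
        ≈⟨ ∙-cong (∙-congˡ (identityʳ _)) (≈-trans (identityʳ _) (∙-congˡ (identityʳ _))) ⟩
      (f 0 0 (suc (suc n)) ∙ f 0 1 (suc n)) ∙ (f 1 0 (suc n) ∙ f 1 1 n)
        ≈⟨ interchange _ _ _ _ ⟩
      (f 0 0 (suc (suc n)) ∙ f 1 0 (suc n)) ∙ (f 0 1 (suc n) ∙ f 1 1 n)
        ≈⟨ ≈-sym (∙-cong (∙-congˡ (identityʳ _)) (≈-trans (identityʳ _) (∙-congˡ (identityʳ _)))) ⟩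
      (f 0 0 (suc (suc n)) ∙ (f 1 0 (suc n) ∙ ε)) ∙ ((f 0 1 (suc n) ∙ (f 1 1 n ∙ ε)) ∙ ε) ∎

  -- Removing any amount stands for a factor 1/(1 - t), removing at most one unit for 1 + t; the
  -- four cases say that such factors commute, also when cut off at total amount `n`.
  ∑-take≤-comm : ∀ p q n (f : ℕ → ℕ → ℕ → C) →
    ∑ (take≤ p n) (λ (i , j) → ∑ (take≤ q j) (λ (i′ , k) → f i i′ k)) ≈
    ∑ (take≤ q n) (λ (i′ , j) → ∑ (take≤ p j) (λ (i , k) → f i i′ k))
  ∑-take≤-comm false false n f = any-any n f
  ∑-take≤-comm false true  n f = any-one n f
  ∑-take≤-comm true  false n f = ≈-sym (any-one n (λ i i′ → f i′ i))
  ∑-take≤-comm true  true  n f = one-one n f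

open Sums ℤₚ.+-0-commutativeMonoid

private variable X Y : Set

∑-*ˡ : ∀ c (xs : List X) f → c *ℤ ∑ xs f ≡ ∑ xs (λ x → c *ℤ f x)
∑-*ˡ c []       f = ℤₚ.*-zeroʳ c
∑-*ˡ c (x ∷ xs) f = ≡.trans (ℤₚ.*-distribˡ-+ c (f x) _) (cong (c *ℤ f x +ℤ_) (∑-*ˡ c xs f))

∑-*ʳ : ∀ c (xs : List X) f → ∑ xs f *ℤ c ≡ ∑ xs (λ x → f x *ℤ c)
∑-*ʳ c xs f = ≡.trans (ℤₚ.*-comm _ c) (≡.trans (∑-*ˡ c xs f) (∑-cong xs (λ x → ℤₚ.*-comm c (f x))))

∑-neg : ∀ (xs : List X) f → - ∑ xs f ≡ ∑ xs (λ x → - f x)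
∑-neg []       f = ≡.refl
∑-neg (x ∷ xs) f = ≡.trans (ℤₚ.neg-distrib-+ (f x) _) (cong (- f x +ℤ_) (∑-neg xs f))

All-concatMap : ∀ {P : Y → Set} (h : X → List Y) {xs} → All (λ x → All P (h x)) xs → All P (concatMap h xs)
All-concatMap h ps = AllP.concat⁺ (AllP.map⁺ ps)

x≡-x⇒x≡0 : ∀ x → x ≡ - x → x ≡ + 0
x≡-x⇒x≡0 (+ zero) _ = ≡.refl

+-interchange : ∀ a b c d → a + b + (c + d) ≡ a + c + (b + d)
+-interchange = ℕSolver.solve-∀

sg : ℕ → ℤ
sg zero    = + 1
sg (suc n) = - sg n

sg-+ : ∀ m n → sg (m + n) ≡ sg m *ℤ sg n
sg-+ zero    n = sym (ℤₚ.*-identityˡ (sg n))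
sg-+ (suc m) n = ≡.trans (cong -_ (sg-+ m n)) (ℤₚ.neg-distribˡ-* (sg m) (sg n))

sg² : ∀ n → sg n *ℤ sg n ≡ + 1
sg² zero    = ≡.refl
sg² (suc n) = ≡.trans (lem (sg n)) (sg² n)
  where
  lem : ∀ x → - x *ℤ - x ≡ x *ℤ x
  lem = solve-∀

-- Operations applied letter by letter, and mutually inverse removals

-- All ways to apply g to each entry, the labels being added up.
cw : (X → List (ℕ × X)) → List X → List (ℕ × List X)
cw g []       = (0 , []) ∷ []
cw g (x ∷ xs) = concatMap (λ (t , y) → map (λ (t′ , ys) → t + t′ , y ∷ ys) (cw g xs)) (g x)

∑-cw : ∀ (g : X → List (ℕ × X)) x xs f →
  ∑ (cw g (x ∷ xs)) f ≡ ∑ (g x) (λ (t , y) → ∑ (cw g xs) (λ (t′ , ys) → f (t + t′ , y ∷ ys)))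
∑-cw g x xs f = ≡.trans (∑-concatMap _ (g x) f) (∑-cong (g x) (λ _ → ∑-map _ (cw g xs) f))

-- The labels travel with the operations: `s` belongs to `g` or `g′` and `t` to `h` or `h′`,
-- whichever acts first.
Exchange : (g h h′ g′ : X → List (ℕ × X)) → Set
Exchange {X} g h h′ g′ = ∀ x (f : ℕ → ℕ → X → ℤ) →
  ∑ (g x) (λ (s , y) → ∑ (h y) (λ (t , z) → f s t z)) ≡ ∑ (h′ x) (λ (t , y) → ∑ (g′ y) (λ (s , z) → f s t z))

∑-cw-cw : ∀ (g h : X → List (ℕ × X)) x xs (f : ℕ → ℕ → List X → ℤ) →
  ∑ (cw g (x ∷ xs)) (λ (s , y) → ∑ (cw h y) (λ (t , z) → f s t z)) ≡
  ∑ (g x) (λ (s , y) → ∑ (h y) (λ (t , z) → ∑ (cw g xs) (λ (s′ , ys) → ∑ (cw h ys) (λ (t′ , zs) → f (s + s′) (t + t′) (z ∷ zs)))))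
∑-cw-cw g h x xs f = ≡.trans (∑-cw g x xs _) (∑-cong (g x) (λ (s , y) →
  ≡.trans (∑-cong (cw g xs) (λ (s′ , ys) → ∑-cw h y ys _)) (∑-comm (cw g xs) (h y) _)))

cw-exchange : ∀ {g h h′ g′ : X → List (ℕ × X)} → Exchange g h h′ g′ → Exchange (cw g) (cw h) (cw h′) (cw g′)
cw-exchange         c []       f = ≡.refl
cw-exchange {g = g} {h} {h′} {g′} c (x ∷ xs) f = begin
  ∑ (cw g (x ∷ xs)) (λ (s , y) → ∑ (cw h y) (λ (t , z) → f s t z))
    ≡⟨ ∑-cw-cw g h x xs f ⟩
  ∑ (g x) (λ (s , y) → ∑ (h y) (λ (t , z) → ∑ (cw g xs) (λ (s′ , ys) → ∑ (cw h ys) (λ (t′ , zs) → f (s + s′) (t + t′) (z ∷ zs)))))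
    ≡⟨ c x _ ⟩
  ∑ (h′ x) (λ (t , y) → ∑ (g′ y) (λ (s , z) → ∑ (cw g xs) (λ (s′ , ys) → ∑ (cw h ys) (λ (t′ , zs) → f (s + s′) (t + t′) (z ∷ zs)))))
    ≡⟨ ∑-cong (h′ x) (λ (t , y) → ∑-cong (g′ y) (λ (s , z) → cw-exchange c xs _)) ⟩
  ∑ (h′ x) (λ (t , y) → ∑ (g′ y) (λ (s , z) → ∑ (cw h′ xs) (λ (t′ , ys) → ∑ (cw g′ ys) (λ (s′ , zs) → f (s + s′) (t + t′) (z ∷ zs)))))
    ≡⟨ sym (∑-cw-cw h′ g′ x xs (λ t s → f s t)) ⟩
  ∑ (cw h′ (x ∷ xs)) (λ (t , y) → ∑ (cw g′ y) (λ (s , z) → f s t z)) ∎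
  where open ≡-Reasoning

cw-↭ : ∀ (g : X → List (ℕ × X)) {xs ys} (φ : ℕ → List X → ℤ) →
  (∀ t {us vs} → us ↭ vs → φ t us ≡ φ t vs) → xs ↭ ys →
  ∑ (cw g xs) (λ (t , us) → φ t us) ≡ ∑ (cw g ys) (λ (t , us) → φ t us)
cw-↭ g φ inv refl = ≡.refl
cw-↭ g φ inv (prep {xs} {ys} x p) = ≡.trans (∑-cw g x xs _) (≡.trans
  (∑-cong (g x) (λ (t , y) → cw-↭ g (λ t′ us → φ (t + t′) (y ∷ us)) (λ t′ q → inv (t + t′) (prep y q)) p)) (sym (∑-cw g x ys _)))
cw-↭ g φ inv (swap {xs} {ys} x y p) = begin
  ∑ (cw g (x ∷ y ∷ xs)) (λ (t , us) → φ t us)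
    ≡⟨ expand x y xs ⟩
  ∑ (g x) (λ (s , x′) → ∑ (g y) (λ (t , y′) → ∑ (cw g xs) (λ (r , us) → φ (s + (t + r)) (x′ ∷ y′ ∷ us))))
    ≡⟨ ∑-cong (g x) (λ (s , x′) → ∑-cong (g y) (λ (t , y′) → ≡.trans
         (∑-cong (cw g xs) (λ (r , us) → ≡.trans (inv _ (swap x′ y′ ↭-refl)) (cong (λ k → φ k (y′ ∷ x′ ∷ us)) (ex s t r))))
         (cw-↭ g (λ r us → φ (t + (s + r)) (y′ ∷ x′ ∷ us)) (λ r q → inv _ (prep y′ (prep x′ q))) p))) ⟩
  ∑ (g x) (λ (s , x′) → ∑ (g y) (λ (t , y′) → ∑ (cw g ys) (λ (r , us) → φ (t + (s + r)) (y′ ∷ x′ ∷ us))))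
    ≡⟨ ∑-comm (g x) (g y) _ ⟩
  ∑ (g y) (λ (t , y′) → ∑ (g x) (λ (s , x′) → ∑ (cw g ys) (λ (r , us) → φ (t + (s + r)) (y′ ∷ x′ ∷ us))))
    ≡⟨ sym (expand y x ys) ⟩
  ∑ (cw g (y ∷ x ∷ ys)) (λ (t , us) → φ t us) ∎
  where
  open ≡-Reasoning
  ex : ∀ s t r → s + (t + r) ≡ t + (s + r)
  ex s t r = ≡.trans (sym (ℕₚ.+-assoc s t r)) (≡.trans (cong (_+ r) (ℕₚ.+-comm s t)) (ℕₚ.+-assoc t s r))
  expand : ∀ x y xs → ∑ (cw g (x ∷ y ∷ xs)) (λ (t , us) → φ t us) ≡
    ∑ (g x) (λ (s , x′) → ∑ (g y) (λ (t , y′) → ∑ (cw g xs) (λ (r , us) → φ (s + (t + r)) (x′ ∷ y′ ∷ us))))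
  expand x y xs = ≡.trans (∑-cw g x (y ∷ xs) _) (∑-cong (g x) (λ _ → ∑-cw g y xs _))
cw-↭ g φ inv (trans p q) = ≡.trans (cw-↭ g φ inv p) (cw-↭ g φ inv q)

antidiag-sum : ∀ n → All (λ (i , j) → i + j ≡ n) (antidiag n)
antidiag-sum zero    = ≡.refl ∷ []
antidiag-sum (suc n) = ≡.refl ∷ AllP.map⁺ (All.map (cong suc) (antidiag-sum n))

take≤-sum : ∀ b n → All (λ (i , j) → i + j ≡ n) (take≤ b n)
take≤-sum false n       = antidiag-sum n
take≤-sum true  zero    = ≡.refl ∷ []
take≤-sum true  (suc n) = ≡.refl ∷ ≡.refl ∷ []

∑-antidiag-last : ∀ r (g : ℕ → ℕ → ℤ) → (∀ i j → g i (suc j) ≡ + 0) → ∑ (antidiag r) (λ (i , j) → g i j) ≡ g r 0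
∑-antidiag-last zero    g h = ℤₚ.+-identityʳ _
∑-antidiag-last (suc r) g h = ≡.trans (∑-antidiag-snoc r (λ (i , j) → g i j))
  (≡.trans (cong (_+ℤ g (suc r) 0) (∑-ε (antidiag r) (λ (i , j) → h i j))) (ℤₚ.+-identityˡ _))

-- (1 - t) times the geometric series is 1. After the two removals are interchanged, the terms with
-- `i′ = 1` are those with `i′ = 0` shifted by one and cancel all but the first; `ψ` sees only the
-- total amount removed, which makes them comparable.
antidiag-inverse : ∀ n (ψ : ℕ → ℕ → ℤ) →
  ∑ (antidiag n) (λ (i , j) → ∑ (steps j) (λ (i′ , k) → sg i′ *ℤ ψ (i + i′) k)) ≡ ψ 0 n
antidiag-inverse zero    ψ = lem (ψ 0 0)
  where
  lem : ∀ x → + 1 *ℤ x +ℤ + 0 +ℤ + 0 ≡ x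
  lem = solve-∀
antidiag-inverse (suc n) ψ = begin
  ∑ (antidiag (suc n)) (λ (i , j) → ∑ (steps j) (λ (i′ , k) → sg i′ *ℤ ψ (i + i′) k))
    ≡⟨ ∑-take≤-comm false true (suc n) (λ i i′ k → sg i′ *ℤ ψ (i + i′) k) ⟩
  ∑ (antidiag (suc n)) (λ (i , k) → + 1 *ℤ ψ (i + 0) k) +ℤ (∑ (antidiag n) (λ (i , k) → - + 1 *ℤ ψ (i + 1) k) +ℤ + 0)
    ≡⟨ cong₂ _+ℤ_ (≡.trans (∑-cong (antidiag (suc n)) (λ (i , k) → ≡.trans (ℤₚ.*-identityˡ _) (cong (λ r → ψ r k) (ℕₚ.+-identityʳ i))))
                           (∑-antidiag-suc n (λ (i , k) → ψ i k)))
         (cong (_+ℤ + 0) (≡.trans (∑-cong (antidiag n) (λ (i , k) → ≡.trans (ℤₚ.-1*i≡-i _) (cong (λ r → - ψ r k) (ℕₚ.+-comm i 1))))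
                           (sym (∑-neg (antidiag n) _)))) ⟩
  (ψ 0 (suc n) +ℤ A) +ℤ (- A +ℤ + 0)
    ≡⟨ lem _ A ⟩
  ψ 0 (suc n) ∎
  where
  open ≡-Reasoning
  A = ∑ (antidiag n) (λ (i , k) → ψ (suc i) k)
  lem : ∀ x a → (x +ℤ a) +ℤ (- a +ℤ + 0) ≡ x
  lem = solve-∀

-- For `b = true` the pair is 1 + t and 1/(1 + t); multiplying `ψ r` by `sg r` reduces it to the
-- pair above.
∑-take≤-inverse : ∀ b n (ψ : ℕ → ℕ → ℤ) →
  ∑ (take≤ b n) (λ (i , j) → ∑ (take≤ (not b) j) (λ (i′ , k) → sg i′ *ℤ ψ (i + i′) k)) ≡ ψ 0 n
∑-take≤-inverse false n ψ = antidiag-inverse n ψ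
∑-take≤-inverse true n ψ = begin
  ∑ (steps n) (λ (i , j) → ∑ (antidiag j) (λ (i′ , k) → sg i′ *ℤ ψ (i + i′) k))
    ≡⟨ ∑-take≤-comm true false n (λ i i′ k → sg i′ *ℤ ψ (i + i′) k) ⟩
  ∑ (antidiag n) (λ (i′ , j) → ∑ (steps j) (λ (i , k) → sg i′ *ℤ ψ (i + i′) k))
    ≡⟨ ∑-cong (antidiag n) (λ (i′ , j) → ∑-cong (steps j) (λ (i , k) →
         ≡.trans (lem i i′ (ψ (i + i′) k)) (cong (λ r → sg i *ℤ (sg r *ℤ ψ r k)) (ℕₚ.+-comm i i′)))) ⟩
  ∑ (antidiag n) (λ (i′ , j) → ∑ (steps j) (λ (i , k) → sg i *ℤ (sg (i′ + i) *ℤ ψ (i′ + i) k)))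
    ≡⟨ antidiag-inverse n (λ r k → sg r *ℤ ψ r k) ⟩
  + 1 *ℤ ψ 0 n
    ≡⟨ ℤₚ.*-identityˡ _ ⟩
  ψ 0 n ∎
  where
  open ≡-Reasoning
  assoc′ : ∀ a b c → a *ℤ a *ℤ (b *ℤ c) ≡ a *ℤ ((a *ℤ b) *ℤ c)
  assoc′ = solve-∀
  lem : ∀ i i′ x → sg i′ *ℤ x ≡ sg i *ℤ (sg (i + i′) *ℤ x)
  lem i i′ x = ≡.trans (sym (ℤₚ.*-identityˡ _)) (≡.trans (cong (_*ℤ (sg i′ *ℤ x)) (sym (sg² i)))
    (≡.trans (assoc′ (sg i) (sg i′) x) (cong (λ s → sg i *ℤ (s *ℤ x)) (sym (sg-+ i i′)))))
-- Supersymmetric functionals and the extraction of coefficients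

Letter : Set
Letter = Bool × ℕ

Word : Set
Word = List Letter

-- Adjoining a variable x of parity `q` sends h_n to the sum of the x^i h_(n-i) if x is even and to
-- h_n + x h_(n-1) if x is odd; for e_n the two roles are exchanged. The label is the exponent of x.
low : Bool → Letter → List (ℕ × Letter)
low q (p , n) = map (λ (i , j) → i , (p , j)) (take≤ (p xor q) n)

lowers : Bool → Word → List (ℕ × Word)
lowers q = cw (low q)

∑-low : ∀ q p n f → ∑ (low q (p , n)) f ≡ ∑ (take≤ (p xor q) n) (λ (i , j) → f (i , (p , j)))
∑-low q p n f = ∑-map _ (take≤ (p xor q) n) f

∑-lowers : ∀ q p n w f → ∑ (lowers q ((p , n) ∷ w)) f ≡
  ∑ (take≤ (p xor q) n) (λ (i , j) → ∑ (lowers q w) (λ (t , w′) → f (i + t , (p , j) ∷ w′)))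
∑-lowers q p n w f = ≡.trans (∑-cw (low q) (p , n) w f) (∑-low q p n _)

∑-low-low : ∀ q r p n (f : ℕ → ℕ → Letter → ℤ) →
  ∑ (low q (p , n)) (λ (s , y) → ∑ (low r y) (λ (t , z) → f s t z)) ≡
  ∑ (take≤ (p xor q) n) (λ (i , j) → ∑ (take≤ (p xor r) j) (λ (i′ , k) → f i i′ (p , k)))
∑-low-low q r p n f = ≡.trans (∑-low q p n _) (∑-cong (take≤ (p xor q) n) (λ (i , j) → ∑-low r p j _))

low-comm : ∀ q r → Exchange (low q) (low r) (low r) (low q)
low-comm q r (p , n) f = ≡.trans (∑-low-low q r p n f) (≡.trans
  (∑-take≤-comm (p xor q) (p xor r) n (λ i i′ k → f i i′ (p , k))) (sym (∑-low-low r q p n (λ t s → f s t))))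

lowers-comm : ∀ q r → Exchange (lowers q) (lowers r) (lowers r) (lowers q)
lowers-comm q r = cw-exchange (low-comm q r)

xor-notʳ : ∀ p q → p xor (not q) ≡ not (p xor q)
xor-notʳ true  true  = ≡.refl
xor-notʳ true  false = ≡.refl
xor-notʳ false true  = ≡.refl
xor-notʳ false false = ≡.refl

-- Adjoining x with parity `q` and then - x with the opposite parity changes nothing: the
-- cancellation property of supersymmetric functions. The sign `sg t′` comes from the minus in - x.
lowers-inverse : ∀ q w (ψ : ℕ → Word → ℤ) →
  ∑ (lowers q w) (λ (t , w₁) → ∑ (lowers (not q) w₁) (λ (t′ , w₂) → sg t′ *ℤ ψ (t + t′) w₂)) ≡ ψ 0 w
lowers-inverse q []            ψ = lem (ψ 0 [])
  where
  lem : ∀ x → + 1 *ℤ x +ℤ + 0 +ℤ + 0 ≡ x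
  lem = solve-∀
lowers-inverse q ((p , n) ∷ w) ψ = begin
  ∑ (lowers q ((p , n) ∷ w)) (λ (t , w₁) → ∑ (lowers (not q) w₁) (λ (t′ , w₂) → sg t′ *ℤ ψ (t + t′) w₂))
    ≡⟨ ∑-cw-cw (low q) (low (not q)) (p , n) w (λ t t′ w₂ → sg t′ *ℤ ψ (t + t′) w₂) ⟩
  ∑ (low q (p , n)) (λ (s , y) → ∑ (low (not q) y) (λ (t , z) →
    ∑ (lowers q w) (λ (s′ , ys) → ∑ (lowers (not q) ys) (λ (t′ , zs) → sg (t + t′) *ℤ ψ (s + s′ + (t + t′)) (z ∷ zs)))))
    ≡⟨ ∑-cong (low q (p , n)) (λ (s , y) → ∑-cong (low (not q) y) (λ (t , z) →
        ≡.trans (∑-cong (lowers q w) (λ (s′ , ys) → ∑-cong (lowers (not q) ys) (λ (t′ , zs) →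
          lem s s′ t t′ (z ∷ zs))))
        (lowers-inverse q w (λ r zs → sg t *ℤ ψ (s + t + r) (z ∷ zs))))) ⟩
  ∑ (low q (p , n)) (λ (s , y) → ∑ (low (not q) y) (λ (t , z) → sg t *ℤ ψ (s + t + 0) (z ∷ w)))
    ≡⟨ ∑-low-low q (not q) p n _ ⟩
  ∑ (take≤ (p xor q) n) (λ (i , j) → ∑ (take≤ (p xor (not q)) j) (λ (i′ , k) → sg i′ *ℤ ψ (i + i′ + 0) ((p , k) ∷ w)))
    ≡⟨ cong (λ b → ∑ (take≤ (p xor q) n) (λ (i , j) → ∑ (take≤ b j) (λ (i′ , k) → sg i′ *ℤ ψ (i + i′ + 0) ((p , k) ∷ w)))) (xor-notʳ p q) ⟩
  ∑ (take≤ (p xor q) n) (λ (i , j) → ∑ (take≤ (not (p xor q)) j) (λ (i′ , k) → sg i′ *ℤ ψ (i + i′ + 0) ((p , k) ∷ w)))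
    ≡⟨ ∑-take≤-inverse (p xor q) n (λ r k → ψ (r + 0) ((p , k) ∷ w)) ⟩
  ψ 0 ((p , n) ∷ w) ∎
  where
  open ≡-Reasoning
  ring : ∀ a b c → a *ℤ b *ℤ c ≡ b *ℤ (a *ℤ c)
  ring = solve-∀
  lem : ∀ s s′ t t′ u → sg (t + t′) *ℤ ψ (s + s′ + (t + t′)) u ≡ sg t′ *ℤ (sg t *ℤ ψ (s + t + (s′ + t′)) u)
  lem s s′ t t′ u rewrite sg-+ t t′ | +-interchange s s′ t t′ = ring (sg t) (sg t′) _

-- F stands for the pairing of a symmetric function with products of complete symmetric functions h_k
-- (even letters) and elementary ones e_k (odd letters); rel is the identity Σ (-1)^j h_i e_j = 0.
record Super (F : Word → ℤ) : Set where
  field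
    perm : ∀ {u v} → u ↭ v → F u ≡ F v
    drop : ∀ p w → F ((p , 0) ∷ w) ≡ F w
    rel  : ∀ k w → ∑ (antidiag (suc k)) (λ (i , j) → sg j *ℤ F ((false , i) ∷ (true , j) ∷ w)) ≡ + 0
open Super

Super-∑ : ∀ (xs : List X) {F : X → Word → ℤ} → (∀ x → Super (F x)) → Super (λ w → ∑ xs (λ x → F x w))
Super-∑ xs S .perm p   = ∑-cong xs (λ x → S x .perm p)
Super-∑ xs S .drop p w = ∑-cong xs (λ x → S x .drop p w)
Super-∑ xs {F} S .rel k w = ≡.trans
  (∑-cong (antidiag (suc k)) (λ (i , j) → ∑-*ˡ (sg j) xs _))
  (≡.trans (∑-comm (antidiag (suc k)) xs _) (∑-ε xs (λ x → S x .rel k w)))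

Super-* : ∀ c {F} → Super F → Super (λ w → c *ℤ F w)
Super-* c S .perm p   = cong (c *ℤ_) (S .perm p)
Super-* c S .drop p w = cong (c *ℤ_) (S .drop p w)
Super-* c {F} S .rel k w = ≡.trans (∑-cong (antidiag (suc k)) (λ (i , j) → lem c (sg j) _))
  (≡.trans (sym (∑-*ˡ c (antidiag (suc k)) _)) (≡.trans (cong (c *ℤ_) (S .rel k w)) (ℤₚ.*-zeroʳ c)))
  where
  lem : ∀ a b c → b *ℤ (a *ℤ c) ≡ a *ℤ (b *ℤ c)
  lem = solve-∀

Super-∷ : ∀ x {F} → Super F → Super (λ w → F (x ∷ w))
Super-∷ x S .perm p   = S .perm (prep x p)
Super-∷ x S .drop p w = ≡.trans (S .perm (swap x (p , 0) ↭-refl)) (S .drop p (x ∷ w))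
Super-∷ x {F} S .rel k w = ≡.trans (∑-cong (antidiag (suc k)) (λ (i , j) → cong (sg j *ℤ_)
  (S .perm (↭-trans (swap x _ ↭-refl) (prep _ (swap x _ ↭-refl)))))) (S .rel k (x ∷ w))

-- A new variable multiplies the generating function of the h_i by 1/(1 - t) or 1 + t, and that of
-- the e_j, taken with signs, by the inverse factor. The product that occurs in `rel` is therefore
-- unaffected.
lowers-rel : ∀ q k (ψ : ℕ → ℕ → ℕ → ℤ) →
  ∑ (antidiag k) (λ (i , j) → sg j *ℤ ∑ (take≤ q i) (λ (a , i′) → ∑ (take≤ (not q) j) (λ (c , j′) → ψ (a + c) i′ j′))) ≡
  ∑ (antidiag k) (λ (i , j) → sg j *ℤ ψ 0 i j)
lowers-rel q k ψ = begin
  ∑ (antidiag k) (λ (i , j) → sg j *ℤ ∑ (take≤ q i) (λ (a , i′) → ∑ (take≤ (not q) j) (λ (c , j′) → ψ (a + c) i′ j′)))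
    ≡⟨ ∑-antidiag-flip k _ ⟩
  ∑ (antidiag k) (λ (j , i) → sg j *ℤ ∑ (take≤ q i) (λ (a , i′) → ∑ (take≤ (not q) j) (λ (c , j′) → ψ (a + c) i′ j′)))
    ≡⟨ ∑-cong (antidiag k) (λ (j , i) → ∑-*ˡ (sg j) (take≤ q i) _) ⟩
  ∑ (antidiag k) (λ (j , i) → ∑ (take≤ q i) (λ (a , i′) → sg j *ℤ ∑ (take≤ (not q) j) (λ (c , j′) → ψ (a + c) i′ j′)))
    ≡⟨ ∑-take≤-comm false q k (λ j a i′ → sg j *ℤ ∑ (take≤ (not q) j) (λ (c , j′) → ψ (a + c) i′ j′)) ⟩
  ∑ (take≤ q k) (λ (a , k₁) → ∑ (antidiag k₁) (λ (j , i′) → sg j *ℤ ∑ (take≤ (not q) j) (λ (c , j′) → ψ (a + c) i′ j′)))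
    ≡⟨ ∑-cong (take≤ q k) (λ (a , k₁) → ≡.trans (∑-antidiag-flip k₁ _) (≡.trans
         (∑-cong-All (take≤-All k₁ a)) (∑-take≤-comm false (not q) k₁ (λ i′ c j′ → sg c *ℤ (sg j′ *ℤ ψ (a + c) i′ j′))))) ⟩
  ∑ (take≤ q k) (λ (a , k₁) → ∑ (take≤ (not q) k₁) (λ (c , k₂) → ∑ (antidiag k₂) (λ (i′ , j′) → sg c *ℤ (sg j′ *ℤ ψ (a + c) i′ j′))))
    ≡⟨ ∑-cong (take≤ q k) (λ (a , k₁) → ∑-cong (take≤ (not q) k₁) (λ (c , k₂) → sym (∑-*ˡ (sg c) (antidiag k₂) _))) ⟩
  ∑ (take≤ q k) (λ (a , k₁) → ∑ (take≤ (not q) k₁) (λ (c , k₂) → sg c *ℤ ∑ (antidiag k₂) (λ (i′ , j′) → sg j′ *ℤ ψ (a + c) i′ j′)))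
    ≡⟨ ∑-take≤-inverse q k (λ r k₂ → ∑ (antidiag k₂) (λ (i′ , j′) → sg j′ *ℤ ψ r i′ j′)) ⟩
  ∑ (antidiag k) (λ (i , j) → sg j *ℤ ψ 0 i j) ∎
  where
  open ≡-Reasoning
  ring : ∀ a b c → a *ℤ b *ℤ c ≡ a *ℤ (b *ℤ c)
  ring = solve-∀
  take≤-All : ∀ k₁ a → All (λ (i′ , j) → sg j *ℤ ∑ (take≤ (not q) j) (λ (c , j′) → ψ (a + c) i′ j′) ≡
                        ∑ (take≤ (not q) j) (λ (c , j′) → sg c *ℤ (sg j′ *ℤ ψ (a + c) i′ j′))) (antidiag k₁)
  take≤-All k₁ a = All.universal (λ (i′ , j) → ≡.trans (∑-*ˡ (sg j) (take≤ (not q) j) _)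
    (∑-cong-All (All.map (λ { {c , j′} ≡.refl → ≡.trans (cong (_*ℤ ψ (a + c) i′ j′) (sg-+ c j′)) (ring (sg c) (sg j′) _) })
      (take≤-sum (not q) j)))) (antidiag k₁)

lowers-super : ∀ q {φ : ℕ → Word → ℤ} → (∀ t → Super (φ t)) → Super (λ w → ∑ (lowers q w) (λ (t , w′) → φ t w′))
lowers-super q {φ} S .perm p = cw-↭ (low q) φ (λ t → S t .perm) p
lowers-super q {φ} S .drop p w = ≡.trans (∑-lowers q p 0 w _) (≡.trans (lem (p xor q))
  (∑-cong (lowers q w) (λ (t , w′) → S t .drop p w′)))
  where
  lem : ∀ b {f : ℕ → ℕ → ℤ} → ∑ (take≤ b 0) (λ (i , j) → f i j) ≡ f 0 0
  lem true  = ℤₚ.+-identityʳ _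
  lem false = ℤₚ.+-identityʳ _
lowers-super q {φ} S .rel k w = begin
  ∑ (antidiag (suc k)) (λ (i , j) → sg j *ℤ ∑ (lowers q ((false , i) ∷ (true , j) ∷ w)) (λ (t , w′) → φ t w′))
    ≡⟨ ∑-cong (antidiag (suc k)) (λ (i , j) → cong (sg j *ℤ_) (≡.trans (∑-lowers q false i ((true , j) ∷ w) (λ (t , w′) → φ t w′))
         (∑-cong (take≤ q i) (λ (a , i′) → ≡.trans (∑-lowers q true j w (λ (t , w′) → φ (a + t) ((false , i′) ∷ w′)))
           (∑-cong (take≤ (not q) j) (λ (c , j′) → ∑-cong (lowers q w) (λ (t , w′) →
             cong (λ r → φ r ((false , i′) ∷ (true , j′) ∷ w′)) (sym (ℕₚ.+-assoc a c t))))))))) ⟩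
  ∑ (antidiag (suc k)) (λ (i , j) → sg j *ℤ ∑ (take≤ q i) (λ (a , i′) → ∑ (take≤ (not q) j) (λ (c , j′) → ψ (a + c) i′ j′)))
    ≡⟨ lowers-rel q (suc k) ψ ⟩
  ∑ (antidiag (suc k)) (λ (i , j) → sg j *ℤ ψ 0 i j)
    ≡⟨ ∑-cong (antidiag (suc k)) (λ (i , j) → ∑-*ˡ (sg j) (lowers q w) _) ⟩
  ∑ (antidiag (suc k)) (λ (i , j) → ∑ (lowers q w) (λ (t , w′) → sg j *ℤ φ t ((false , i) ∷ (true , j) ∷ w′)))
    ≡⟨ ∑-comm (antidiag (suc k)) (lowers q w) _ ⟩
  ∑ (lowers q w) (λ (t , w′) → ∑ (antidiag (suc k)) (λ (i , j) → sg j *ℤ φ t ((false , i) ∷ (true , j) ∷ w′)))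
    ≡⟨ ∑-ε (lowers q w) (λ (t , w′) → S t .rel k w′) ⟩
  + 0 ∎
  where
  open ≡-Reasoning
  ψ : ℕ → ℕ → ℕ → ℤ
  ψ r i j = ∑ (lowers q w) (λ (t , w′) → φ (r + t) ((false , i) ∷ (true , j) ∷ w′))

-- Multiplication by the factors 1 - z/x (for z of the parity of x) and 1/(1 + z/x) (for the opposite
-- parity), where x is the first variable and z runs through the later ones.  Hence Ext extracts a
-- coefficient of the Schur expansion, at the highest weight for the given order of the variables.
bern : Bool → ℕ → (Word → ℤ) → Word → ℤ
bern s a F w = ∑ (lowers (not s) w) (λ (t , w′) → sg t *ℤ F ((s , a + t) ∷ w′))

Ext : (Word → ℤ) → Word → ℤ
Ext F []            = F []
Ext F ((s , a) ∷ w) = Ext (bern s a F) w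

bern-super : ∀ s a {F} → Super F → Super (bern s a F)
bern-super s a S = lowers-super (not s) (λ t → Super-* (sg t) (Super-∷ (s , a + t) S))

bern-cong : ∀ s a {F G} → (∀ w → F w ≡ G w) → ∀ w → bern s a F w ≡ bern s a G w
bern-cong s a h w = ∑-cong (lowers (not s) w) (λ (t , w′) → cong (sg t *ℤ_) (h _))

Ext-cong : ∀ w {F G} → (∀ w → F w ≡ G w) → Ext F w ≡ Ext G w
Ext-cong []            h = h []
Ext-cong ((s , a) ∷ w) h = Ext-cong w (bern-cong s a h)

Ext-∑ : ∀ (xs : List X) (F : X → Word → ℤ) w → Ext (λ u → ∑ xs (λ x → F x u)) w ≡ ∑ xs (λ x → Ext (F x) w)
Ext-∑ xs F []            = ≡.refl
Ext-∑ xs F ((s , a) ∷ w) = ≡.trans (Ext-cong w (λ u → ≡.trans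
  (∑-cong (lowers (not s) u) (λ (t , u′) → ∑-*ˡ (sg t) xs _)) (∑-comm (lowers (not s) u) xs _))) (Ext-∑ xs (λ x → bern s a (F x)) w)

Ext-* : ∀ c F w → Ext (λ u → c *ℤ F u) w ≡ c *ℤ Ext F w
Ext-* c F []            = ≡.refl
Ext-* c F ((s , a) ∷ w) = ≡.trans (Ext-cong w (λ u → ≡.trans
  (∑-cong (lowers (not s) u) (λ (t , u′) → lem (sg t) c _)) (sym (∑-*ˡ c (lowers (not s) u) _)))) (Ext-* c (bern s a F) w)
  where
  lem : ∀ a b c → a *ℤ (b *ℤ c) ≡ b *ℤ (a *ℤ c)
  lem = solve-∀

Ext-super : ∀ w {G : Word → Word → ℤ} → (∀ u → Super (G u)) → Super (λ v → Ext (λ u → G u v) w)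
Ext-super []            S = S []
Ext-super ((s , a) ∷ w) S = Ext-super w (λ u → Super-∑ (lowers (not s) u) (λ (t , u′) → Super-* (sg t) (S _)))

-- The odd reflection: an even and an odd variable exchange places and one box changes sides.
bern-reflect : ∀ {F} → Super F → ∀ a b w → bern true b (bern false (suc a) F) w ≡ bern false a (bern true (suc b) F) w
bern-reflect {F} S a b w = begin
  bern true b (bern false (suc a) F) w
    ≡⟨ ∑-cong (lowers false w) (λ (c , w₁) → ≡.trans (cong (sg c *ℤ_) (∑-lowers true true (b + c) w₁ _))
         (≡.trans (∑-*ˡ (sg c) (antidiag (b + c)) _) (≡.trans (∑-cong (antidiag (b + c)) (λ (r , j) → ∑-*ˡ (sg c) (lowers true w₁) _))
         (∑-comm (antidiag (b + c)) (lowers true w₁) _)))) ⟩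
  ∑ (lowers false w) (λ (c , w₁) → ∑ (lowers true w₁) (λ (d , w₂) → ∑ (antidiag (b + c)) (λ (r , j) →
    sg c *ℤ (sg (r + d) *ℤ F ((false , suc (a + (r + d))) ∷ (true , j) ∷ w₂)))))
    ≡⟨ ∑-cong (lowers false w) (λ (c , w₁) → ∑-cong (lowers true w₁) (λ (d , w₂) → exchange c d w₂)) ⟩
  ∑ (lowers false w) (λ (c , w₁) → ∑ (lowers true w₁) (λ (d , w₂) → ∑ (antidiag (a + d)) (λ (r , j) →
    sg d *ℤ (sg (r + c) *ℤ F ((true , suc (b + (r + c))) ∷ (false , j) ∷ w₂)))))
    ≡⟨ lowers-comm false true w (λ c d w₂ → ∑ (antidiag (a + d)) (λ (r , j) →
         sg d *ℤ (sg (r + c) *ℤ F ((true , suc (b + (r + c))) ∷ (false , j) ∷ w₂)))) ⟩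
  ∑ (lowers true w) (λ (d , w₁) → ∑ (lowers false w₁) (λ (c , w₂) → ∑ (antidiag (a + d)) (λ (r , j) →
    sg d *ℤ (sg (r + c) *ℤ F ((true , suc (b + (r + c))) ∷ (false , j) ∷ w₂)))))
    ≡⟨ ∑-cong (lowers true w) (λ (d , w₁) → sym (≡.trans (cong (sg d *ℤ_) (∑-lowers false false (a + d) w₁ _))
         (≡.trans (∑-*ˡ (sg d) (antidiag (a + d)) _) (≡.trans (∑-cong (antidiag (a + d)) (λ (r , j) → ∑-*ˡ (sg d) (lowers false w₁) _))
         (∑-comm (antidiag (a + d)) (lowers false w₁) _))))) ⟩
  bern false a (bern true (suc b) F) w ∎
  where
  open ≡-Reasoning
  -- Both sides are parts of one sum over a full antidiagonal, which vanishes.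
  exchange : ∀ c d w₂ →
    ∑ (antidiag (b + c)) (λ (r , j) → sg c *ℤ (sg (r + d) *ℤ F ((false , suc (a + (r + d))) ∷ (true , j) ∷ w₂))) ≡
    ∑ (antidiag (a + d)) (λ (r , j) → sg d *ℤ (sg (r + c) *ℤ F ((true , suc (b + (r + c))) ∷ (false , j) ∷ w₂)))
  exchange c d w₂ = conclude (b + c) (sg c *ℤ sg d) A B
    (≡.trans (sym split) (S .rel (a + d + (b + c)) w₂)) left right
    where
    T : ℕ → ℕ → ℤ
    T i j = F ((false , i) ∷ (true , j) ∷ w₂)
    A = ∑ (antidiag (b + c)) (λ (r , j) → sg j *ℤ T (suc (a + d + r)) j)
    B = ∑ (antidiag (a + d)) (λ (i , r) → sg r *ℤ T i (suc (b + c + r)))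
    split : ∑ (antidiag (suc (a + d + (b + c)))) (λ (i , j) → sg j *ℤ T i j) ≡ A +ℤ (- sg (b + c)) *ℤ B
    split = ≡.trans (∑-antidiag-split (a + d) (b + c) (λ (i , j) → sg j *ℤ T i j)) (cong (A +ℤ_)
      (≡.trans (∑-cong (antidiag (a + d)) (λ (i , r) → ≡.trans (cong (λ s → - s *ℤ T i (suc (b + c + r))) (sg-+ (b + c) r))
        (ring₁ (sg (b + c)) (sg r) _))) (sym (∑-*ˡ (- sg (b + c)) (antidiag (a + d)) _))))
      where
      ring₁ : ∀ x y z → - (x *ℤ y) *ℤ z ≡ - x *ℤ (y *ℤ z)
      ring₁ = solve-∀
    conclude : ∀ n e A B → A +ℤ (- sg n) *ℤ B ≡ + 0 → ∀ {x y} → x ≡ e *ℤ (sg n *ℤ A) → y ≡ e *ℤ B → x ≡ y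
    conclude n e A B h p q = ≡.trans p (≡.trans (cong (e *ℤ_) (begin
      sg n *ℤ A ≡⟨ ring₂ (sg n) A B ⟩
      sg n *ℤ (A +ℤ (- sg n) *ℤ B) +ℤ (sg n *ℤ sg n) *ℤ B ≡⟨ cong₂ (λ u v → sg n *ℤ u +ℤ v *ℤ B) h (sg² n) ⟩
      sg n *ℤ + 0 +ℤ + 1 *ℤ B ≡⟨ ring₃ (sg n) B ⟩
      B ∎)) (sym q))
      where
      ring₂ : ∀ s A B → s *ℤ A ≡ s *ℤ (A +ℤ (- s) *ℤ B) +ℤ (s *ℤ s) *ℤ B
      ring₂ = solve-∀
      ring₃ : ∀ s B → s *ℤ + 0 +ℤ + 1 *ℤ B ≡ B
      ring₃ = solve-∀
    left : ∑ (antidiag (b + c)) (λ (r , j) → sg c *ℤ (sg (r + d) *ℤ F ((false , suc (a + (r + d))) ∷ (true , j) ∷ w₂))) ≡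
           (sg c *ℤ sg d) *ℤ (sg (b + c) *ℤ A)
    left = ≡.trans (∑-cong-All (All.map (λ { {r , j} e → lem r j e }) (take≤-sum false (b + c))))
      (≡.trans (sym (∑-*ˡ (sg c *ℤ sg d) (antidiag (b + c)) _)) (cong ((sg c *ℤ sg d) *ℤ_) (sym (∑-*ˡ (sg (b + c)) (antidiag (b + c)) _))))
      where
      ring₄ : ∀ c d r j T → j *ℤ j ≡ + 1 → c *ℤ ((r *ℤ d) *ℤ T) ≡ (c *ℤ d) *ℤ ((r *ℤ j) *ℤ (j *ℤ T))
      ring₄ c d r j T h = ≡.trans (≡.trans (ring₅ c d r T) (cong (λ x → (c *ℤ d) *ℤ ((x *ℤ r) *ℤ T)) (sym h))) (ring₆ c d r j T)
        where
        ring₅ : ∀ c d r T → c *ℤ ((r *ℤ d) *ℤ T) ≡ (c *ℤ d) *ℤ ((+ 1 *ℤ r) *ℤ T)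
        ring₅ = solve-∀
        ring₆ : ∀ c d r j T → (c *ℤ d) *ℤ ((j *ℤ j *ℤ r) *ℤ T) ≡ (c *ℤ d) *ℤ ((r *ℤ j) *ℤ (j *ℤ T))
        ring₆ = solve-∀
      lem : ∀ r j → r + j ≡ b + c → sg c *ℤ (sg (r + d) *ℤ T (suc (a + (r + d))) j) ≡
            (sg c *ℤ sg d) *ℤ (sg (b + c) *ℤ (sg j *ℤ T (suc (a + d + r)) j))
      lem r j e rewrite sym e | sg-+ r d | sg-+ r j | ≡.trans (cong (λ k → a + k) (ℕₚ.+-comm r d)) (sym (ℕₚ.+-assoc a d r))
        = ring₄ (sg c) (sg d) (sg r) (sg j) _ (sg² j)
    right : ∑ (antidiag (a + d)) (λ (r , j) → sg d *ℤ (sg (r + c) *ℤ F ((true , suc (b + (r + c))) ∷ (false , j) ∷ w₂))) ≡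
            (sg c *ℤ sg d) *ℤ B
    right = ≡.trans (∑-antidiag-flip (a + d) _) (≡.trans (∑-cong (antidiag (a + d)) (λ (j , r) → lem j r))
      (sym (∑-*ˡ (sg c *ℤ sg d) (antidiag (a + d)) _)))
      where
      ring₇ : ∀ c d r T → d *ℤ ((r *ℤ c) *ℤ T) ≡ (c *ℤ d) *ℤ (r *ℤ T)
      ring₇ = solve-∀
      lem : ∀ j r → sg d *ℤ (sg (r + c) *ℤ F ((true , suc (b + (r + c))) ∷ (false , j) ∷ w₂)) ≡
            (sg c *ℤ sg d) *ℤ (sg r *ℤ T j (suc (b + c + r)))
      lem j r rewrite sg-+ r c | ≡.trans (cong (λ k → b + k) (ℕₚ.+-comm r c)) (sym (ℕₚ.+-assoc b c r))
        | S .perm (swap (true , suc (b + c + r)) (false , j) (↭-refl {x = w₂})) = ring₇ (sg c) (sg d) (sg r) _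

evens : List ℕ → Word
evens = map (false ,_)

length-evens : ∀ γ → length (evens γ) ≡ length γ
length-evens []      = ≡.refl
length-evens (_ ∷ γ) = cong suc (length-evens γ)

Ext-snoc-zero : ∀ {F} → Super F → ∀ w p → Ext F (w ++ (p , 0) ∷ []) ≡ Ext F w
Ext-snoc-zero {F} S []            p = ≡.trans (lem (F ((p , 0) ∷ []))) (S .drop p [])
  where
  lem : ∀ x → + 1 *ℤ x +ℤ + 0 ≡ x
  lem = solve-∀
Ext-snoc-zero     S ((s , a) ∷ w) p = Ext-snoc-zero (bern-super s a S) w p

-- An odd variable of exponent zero is appended and moved to the front by odd reflections. It takes
-- one box from every row it passes, so in the end it carries the whole first column; `map suc π`
-- guarantees that each row has a box to give.
Ext-column : ∀ {F} → Super F → ∀ π → Ext F (evens (map suc π)) ≡ Ext F ((true , length π) ∷ evens π)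
Ext-column {F} S π = begin
  Ext F (evens (map suc π))                    ≡⟨ sym (Ext-snoc-zero S (evens (map suc π)) true) ⟩
  Ext F (evens (map suc π) ++ (true , 0) ∷ []) ≡⟨ go S π ⟩
  Ext F ((true , length π) ∷ evens π)          ∎
  where
  open ≡-Reasoning
  go : ∀ {F} → Super F → ∀ π → Ext F (evens (map suc π) ++ (true , 0) ∷ []) ≡ Ext F ((true , length π) ∷ evens π)
  go S []      = ≡.refl
  go S (p ∷ π) = ≡.trans (go (bern-super false (suc p) S) π) (Ext-cong (evens π) (bern-reflect S p (length π)))

-- Alternants

picks : List X → List (ℕ × X × List X)
picks []       = []
picks (x ∷ xs) = (0 , x , xs) ∷ map (λ (k , y , r) → suc k , y , x ∷ r) (picks xs)

∑-picks : ∀ (x : X) xs f → ∑ (picks (x ∷ xs)) f ≡ f (0 , x , xs) +ℤ ∑ (picks xs) (λ (k , y , r) → f (suc k , y , x ∷ r))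
∑-picks x xs f = cong (f (0 , x , xs) +ℤ_) (∑-map _ (picks xs) f)

picks-length : ∀ (xs : List X) → All (λ (k , y , r) → length xs ≡ suc (length r)) (picks xs)
picks-length []       = []
picks-length (x ∷ xs) = ≡.refl ∷ AllP.map⁺ (All.map (cong suc) (picks-length xs))

-- The second position is counted after the first entry is gone, so choosing the same two entries in
-- the other order changes the sum of the positions by one.
picks-anti : ∀ (xs : List X) (φ : X → X → List X → ℤ) →
  ∑ (picks xs) (λ (k , x , r) → ∑ (picks r) (λ (k′ , y , r′) → sg (k + k′) *ℤ φ x y r′)) ≡
  - ∑ (picks xs) (λ (k , x , r) → ∑ (picks r) (λ (k′ , y , r′) → sg (k + k′) *ℤ φ y x r′))
picks-anti []       φ = ≡.refl
picks-anti (x ∷ xs) φ = begin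
  _ ≡⟨ expand φ ⟩
  A +ℤ ((- + 1) *ℤ B +ℤ S φ′)
    ≡⟨ cong (λ s → A +ℤ ((- + 1) *ℤ B +ℤ s)) (picks-anti xs φ′) ⟩
  A +ℤ ((- + 1) *ℤ B +ℤ - S (λ x y → φ′ y x))
    ≡⟨ ring A B _ ⟩
  - (B +ℤ ((- + 1) *ℤ A +ℤ S (λ x y → φ′ y x)))
    ≡⟨ cong -_ (sym (expand (λ x y → φ y x))) ⟩
  _ ∎
  where
  open ≡-Reasoning
  ring : ∀ a b s → a +ℤ ((- + 1) *ℤ b +ℤ - s) ≡ - (b +ℤ ((- + 1) *ℤ a +ℤ s))
  ring = solve-∀
  φ′ : _ → _ → List _ → ℤ
  φ′ y z r = φ y z (x ∷ r)
  S : (_ → _ → List _ → ℤ) → ℤ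
  S φ = ∑ (picks xs) (λ (k , x , r) → ∑ (picks r) (λ (k′ , y , r′) → sg (k + k′) *ℤ φ x y r′))
  A = ∑ (picks xs) (λ (k , y , r) → sg k *ℤ φ x y r)
  B = ∑ (picks xs) (λ (k , y , r) → sg k *ℤ φ y x r)
  sg-lem : ∀ k z → sg (suc k + 0) *ℤ z ≡ (- + 1) *ℤ (sg k *ℤ z)
  sg-lem k z rewrite ℕₚ.+-identityʳ k = lem (sg k) z
    where
    lem : ∀ a z → - a *ℤ z ≡ (- + 1) *ℤ (a *ℤ z)
    lem = solve-∀
  sg-lem₂ : ∀ k k′ z → sg (suc k + suc k′) *ℤ z ≡ sg (k + k′) *ℤ z
  sg-lem₂ k k′ z rewrite ℕₚ.+-suc k k′ | ℤₚ.neg-involutive (sg (k + k′)) = ≡.refl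
  expand : ∀ φ → ∑ (picks (x ∷ xs)) (λ (k , x , r) → ∑ (picks r) (λ (k′ , y , r′) → sg (k + k′) *ℤ φ x y r′)) ≡
    ∑ (picks xs) (λ (k , y , r) → sg k *ℤ φ x y r) +ℤ
      ((- + 1) *ℤ ∑ (picks xs) (λ (k , y , r) → sg k *ℤ φ y x r) +ℤ S (λ y z r → φ y z (x ∷ r)))
  expand φ = ≡.trans (∑-picks x xs (λ (k , x , r) → ∑ (picks r) (λ (k′ , y , r′) → sg (k + k′) *ℤ φ x y r′)))
    (cong (∑ (picks xs) (λ (k , y , r) → sg k *ℤ φ x y r) +ℤ_)
    (≡.trans (∑-cong (picks xs) (λ (k , y , r) → ≡.trans (∑-picks x r (λ (k′ , z , r′) → sg (suc k + k′) *ℤ φ y z r′))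
       (cong₂ _+ℤ_ (sg-lem k (φ y x r)) (∑-cong (picks r) (λ (k′ , z , r′) → sg-lem₂ k k′ (φ y z (x ∷ r′)))))))
    (≡.trans (∑-∙ (picks xs) _ _) (cong (_+ℤ S (λ y z r → φ y z (x ∷ r))) (sym (∑-*ˡ (- + 1) (picks xs) _))))))

picks-cw : ∀ (g : X → List (ℕ × X)) xs (φ : ℕ → ℕ → X → List X → ℤ) →
  ∑ (cw g xs) (λ (t , ys) → ∑ (picks ys) (λ (k , y , r) → φ t k y r)) ≡
  ∑ (picks xs) (λ (k , x , r) → ∑ (g x) (λ (t , y) → ∑ (cw g r) (λ (t′ , r′) → φ (t + t′) k y r′)))
picks-cw g []       φ = ≡.refl
picks-cw g (x ∷ xs) φ = begin
  ∑ (cw g (x ∷ xs)) (λ (t , ys) → ∑ (picks ys) (λ (k , y , r) → φ t k y r))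
    ≡⟨ ∑-cw g x xs _ ⟩
  ∑ (g x) (λ (t , y) → ∑ (cw g xs) (λ (t′ , ys) → ∑ (picks (y ∷ ys)) (λ (k , z , r) → φ (t + t′) k z r)))
    ≡⟨ ∑-cong (g x) (λ (t , y) → ≡.trans (∑-cong (cw g xs) (λ (t′ , ys) → ∑-picks y ys (λ (k , z , r) → φ (t + t′) k z r)))
         (≡.trans (∑-∙ (cw g xs) _ _) (cong (∑ (cw g xs) (λ (t′ , ys) → φ (t + t′) 0 y ys) +ℤ_)
           (picks-cw g xs (λ t′ k z r → φ (t + t′) (suc k) z (y ∷ r)))))) ⟩
  ∑ (g x) (λ (t , y) → ∑ (cw g xs) (λ (t′ , ys) → φ (t + t′) 0 y ys) +ℤ
    ∑ (picks xs) (λ (k , x′ , r) → ∑ (g x′) (λ (s , z) → ∑ (cw g r) (λ (s′ , r′) → φ (t + (s + s′)) (suc k) z (y ∷ r′)))))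
    ≡⟨ ∑-∙ (g x) _ _ ⟩
  A +ℤ ∑ (g x) (λ (t , y) → ∑ (picks xs) (λ (k , x′ , r) → ∑ (g x′) (λ (s , z) → ∑ (cw g r) (λ (s′ , r′) → φ (t + (s + s′)) (suc k) z (y ∷ r′)))))
    ≡⟨ cong (A +ℤ_) (≡.trans (∑-comm (g x) (picks xs) _) (∑-cong (picks xs) (λ (k , x′ , r) →
         ≡.trans (∑-comm (g x) (g x′) _) (∑-cong (g x′) (λ (s , z) →
           ≡.trans (∑-cong (g x) (λ (t , y) → ∑-cong (cw g r) (λ (s′ , r′) → cong (λ i → φ i (suc k) z (y ∷ r′)) (ex t s s′))))
           (sym (∑-cw g x r _))))))) ⟩
  A +ℤ ∑ (picks xs) (λ (k , x′ , r) → ∑ (g x′) (λ (s , z) → ∑ (cw g (x ∷ r)) (λ (s′ , r′) → φ (s + s′) (suc k) z r′)))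
    ≡⟨ sym (∑-picks x xs (λ (k , x , r) → ∑ (g x) (λ (t , y) → ∑ (cw g r) (λ (t′ , r′) → φ (t + t′) k y r′)))) ⟩
  ∑ (picks (x ∷ xs)) (λ (k , x , r) → ∑ (g x) (λ (t , y) → ∑ (cw g r) (λ (t′ , r′) → φ (t + t′) k y r′))) ∎
  where
  open ≡-Reasoning
  A = ∑ (g x) (λ (t , y) → ∑ (cw g xs) (λ (t′ , ys) → φ (t + t′) 0 y ys))
  ex : ∀ t s r → t + (s + r) ≡ s + (t + r)
  ex = ℕSolver.solve-∀

Sym : (List ℕ → ℤ) → Set
Sym H = ∀ {u v} → u ↭ v → H u ≡ H v

-- The alternating sum of H (u + v) over all rearrangements v of vs (up to the order of the arguments
-- of H), signed so that the reversal of vs gets the sign +.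
D : List ℕ → (List ℕ → ℤ) → List ℕ → ℤ
D []       H []      = H []
D []       H (_ ∷ _) = + 0
D (v ∷ vs) H u       = ∑ (picks u) (λ (k , x , r) → sg (length vs + k) *ℤ D vs (λ w → H (x + v ∷ w)) r)

D-cong : ∀ vs {G H} u → (∀ w → G w ≡ H w) → D vs G u ≡ D vs H u
D-cong []       []      h = h []
D-cong []       (_ ∷ _) h = ≡.refl
D-cong (v ∷ vs) u       h = ∑-cong (picks u) (λ (k , x , r) → cong (sg (length vs + k) *ℤ_) (D-cong vs r (λ w → h _)))

D-∑ : ∀ vs (xs : List X) (F : X → List ℕ → ℤ) u → D vs (λ w → ∑ xs (λ x → F x w)) u ≡ ∑ xs (λ x → D vs (F x) u)
D-∑ []       xs F []      = ≡.refl
D-∑ []       xs F (_ ∷ _) = sym (∑-ε xs (λ _ → ≡.refl))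
D-∑ (v ∷ vs) xs F u       = ≡.trans (∑-cong (picks u) (λ (k , x , r) →
    ≡.trans (cong (sg (length vs + k) *ℤ_) (D-∑ vs xs (λ y w → F y (x + v ∷ w)) r)) (∑-*ˡ (sg (length vs + k)) xs _)))
  (∑-comm (picks u) xs _)

D-* : ∀ vs c F u → D vs (λ w → c *ℤ F w) u ≡ c *ℤ D vs F u
D-* []       c F []      = ≡.refl
D-* []       c F (_ ∷ _) = sym (ℤₚ.*-zeroʳ c)
D-* (v ∷ vs) c F u       = ≡.trans (∑-cong (picks u) (λ (k , x , r) →
    ≡.trans (cong (sg (length vs + k) *ℤ_) (D-* vs c (λ w → F (x + v ∷ w)) r)) (lem (sg (length vs + k)) c _)))
  (sym (∑-*ˡ c (picks u) _))
  where
  lem : ∀ a b c → a *ℤ (b *ℤ c) ≡ b *ℤ (a *ℤ c)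
  lem = solve-∀

sg-suc-suc : ∀ m n → sg (suc m + suc n) ≡ sg (m + n)
sg-suc-suc m n = ≡.trans (cong (λ k → - sg k) (ℕₚ.+-suc m n)) (ℤₚ.neg-involutive _)

-- `D` is a determinant in which the products are replaced by values of `H`. By definition it is
-- expanded along `vs`; this is the expansion along the first entry of the other list. Symmetry of
-- `H` makes the order of the two choices irrelevant.
D-laplace : ∀ vs {H} → Sym H → ∀ a us →
  D vs H (a ∷ us) ≡ ∑ (picks vs) (λ (k , v , vs′) → sg (length vs′ + k) *ℤ D vs′ (λ w → H (a + v ∷ w)) us)
D-laplace []       S a us = ≡.refl
D-laplace (v ∷ vs) {H} S a us = begin
  D (v ∷ vs) H (a ∷ us)
    ≡⟨ ∑-picks a us (λ (k , x , r) → sg (length vs + k) *ℤ D vs (λ w → H (x + v ∷ w)) r) ⟩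
  A +ℤ ∑ (picks us) (λ (k , x , r) → sg (length vs + suc k) *ℤ D vs (λ w → H (x + v ∷ w)) (a ∷ r))
    ≡⟨ cong (A +ℤ_) (∑-cong (picks us) (λ (k , x , r) → ≡.trans
         (cong (sg (length vs + suc k) *ℤ_) (D-laplace vs (λ p → S (prep _ p)) a r))
         (≡.trans (∑-*ˡ (sg (length vs + suc k)) (picks vs) _) (∑-cong-All (All.map
           (λ { {k′ , v′ , vs′} e → lem k k′ (length vs) (length vs′) e (D-cong vs′ r (λ w → S (swap _ _ ↭-refl))) }) (picks-length vs)))))) ⟩
  A +ℤ ∑ (picks us) (λ (k , x , r) → ∑ (picks vs) (λ (k′ , v′ , vs′) →
    sg (length (v ∷ vs′) + suc k′) *ℤ (sg (length vs′ + k) *ℤ D vs′ (λ w → H (a + v′ ∷ x + v ∷ w)) r)))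
    ≡⟨ cong (A +ℤ_) (≡.trans (∑-comm (picks us) (picks vs) _) (∑-cong (picks vs) (λ (k′ , v′ , vs′) →
         sym (∑-*ˡ (sg (length (v ∷ vs′) + suc k′)) (picks us) _)))) ⟩
  A +ℤ ∑ (picks vs) (λ (k′ , v′ , vs′) → sg (length (v ∷ vs′) + suc k′) *ℤ D (v ∷ vs′) (λ w → H (a + v′ ∷ w)) us)
    ≡⟨ sym (∑-picks v vs (λ (k , v , vs′) → sg (length vs′ + k) *ℤ D vs′ (λ w → H (a + v ∷ w)) us)) ⟩
  ∑ (picks (v ∷ vs)) (λ (k , v , vs′) → sg (length vs′ + k) *ℤ D vs′ (λ w → H (a + v ∷ w)) us) ∎
  where
  open ≡-Reasoning
  A = sg (length vs + 0) *ℤ D vs (λ w → H (a + v ∷ w)) us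
  ring : ∀ a b c z → a *ℤ b *ℤ (a *ℤ c *ℤ z) ≡ a *ℤ c *ℤ (a *ℤ b *ℤ z)
  ring = solve-∀
  lem : ∀ k k′ n n′ → n ≡ suc n′ → ∀ {z z′} → z ≡ z′ →
    sg (n + suc k) *ℤ (sg (n′ + k′) *ℤ z) ≡ sg (suc n′ + suc k′) *ℤ (sg (n′ + k) *ℤ z′)
  lem k k′ _ n′ ≡.refl {z} ≡.refl rewrite sg-suc-suc n′ k | sg-suc-suc n′ k′ | sg-+ n′ k | sg-+ n′ k′
    = ring (sg n′) (sg k) (sg k′) z

D-anti : ∀ vs {H} → Sym H → ∀ pre a b us → D vs H (pre ++ a ∷ b ∷ us) ≡ - D vs H (pre ++ b ∷ a ∷ us)
D-anti vs S (c ∷ pre) a b us = ≡.trans (D-laplace vs S c (pre ++ a ∷ b ∷ us)) (≡.trans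
  (∑-cong (picks vs) (λ (k , v , vs′) → ≡.trans (cong (sg (length vs′ + k) *ℤ_) (D-anti vs′ (λ p → S (prep _ p)) pre a b us))
    (sym (ℤₚ.neg-distribʳ-* (sg (length vs′ + k)) _))))
  (≡.trans (sym (∑-neg (picks vs) _)) (cong -_ (sym (D-laplace vs S c (pre ++ b ∷ a ∷ us))))))
D-anti vs {H} S [] a b us = begin
  D vs H (a ∷ b ∷ us)
    ≡⟨ twice a b ⟩
  c *ℤ ∑ (picks vs) (λ (k , v , vs₁) → ∑ (picks vs₁) (λ (k′ , v′ , vs₂) → sg (k + k′) *ℤ D vs₂ (λ w → H (a + v ∷ b + v′ ∷ w)) us))
    ≡⟨ cong (c *ℤ_) (picks-anti vs (λ v v′ vs₂ → D vs₂ (λ w → H (a + v ∷ b + v′ ∷ w)) us)) ⟩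
  c *ℤ - ∑ (picks vs) (λ (k , v , vs₁) → ∑ (picks vs₁) (λ (k′ , v′ , vs₂) → sg (k + k′) *ℤ D vs₂ (λ w → H (a + v′ ∷ b + v ∷ w)) us))
    ≡⟨ cong (λ x → c *ℤ - x) (∑-cong (picks vs) (λ (k , v , vs₁) → ∑-cong (picks vs₁) (λ (k′ , v′ , vs₂) →
         cong (sg (k + k′) *ℤ_) (D-cong vs₂ us (λ w → S (swap _ _ ↭-refl)))))) ⟩
  c *ℤ - ∑ (picks vs) (λ (k , v , vs₁) → ∑ (picks vs₁) (λ (k′ , v′ , vs₂) → sg (k + k′) *ℤ D vs₂ (λ w → H (b + v ∷ a + v′ ∷ w)) us))
    ≡⟨ sym (ℤₚ.neg-distribʳ-* c _) ⟩
  - (c *ℤ ∑ (picks vs) (λ (k , v , vs₁) → ∑ (picks vs₁) (λ (k′ , v′ , vs₂) → sg (k + k′) *ℤ D vs₂ (λ w → H (b + v ∷ a + v′ ∷ w)) us)))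
    ≡⟨ cong -_ (sym (twice b a)) ⟩
  - D vs H (b ∷ a ∷ us) ∎
  where
  open ≡-Reasoning
  c = - + 1
  ring : ∀ n k k′ z → n *ℤ n ≡ + 1 → - n *ℤ k *ℤ (n *ℤ k′ *ℤ z) ≡ (- + 1) *ℤ (k *ℤ k′ *ℤ z)
  ring n k k′ z h = ≡.trans (ring₁ n k k′ z) (cong (λ s → - s *ℤ (k *ℤ k′ *ℤ z)) h)
    where
    ring₁ : ∀ n k k′ z → - n *ℤ k *ℤ (n *ℤ k′ *ℤ z) ≡ - (n *ℤ n) *ℤ (k *ℤ k′ *ℤ z)
    ring₁ = solve-∀
  lem : ∀ k k′ n n′ z → n ≡ suc n′ → sg (n + k) *ℤ (sg (n′ + k′) *ℤ z) ≡ c *ℤ (sg (k + k′) *ℤ z)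
  lem k k′ _ n′ z ≡.refl rewrite sg-+ (suc n′) k | sg-+ n′ k′ | sg-+ k k′ = ring (sg n′) (sg k) (sg k′) z (sg² n′)
  twice : ∀ a b → D vs H (a ∷ b ∷ us) ≡
    c *ℤ ∑ (picks vs) (λ (k , v , vs₁) → ∑ (picks vs₁) (λ (k′ , v′ , vs₂) → sg (k + k′) *ℤ D vs₂ (λ w → H (a + v ∷ b + v′ ∷ w)) us))
  twice a b = ≡.trans (D-laplace vs S a (b ∷ us)) (≡.trans
    (∑-cong (picks vs) (λ (k , v , vs₁) → ≡.trans
      (cong (sg (length vs₁ + k) *ℤ_) (D-laplace vs₁ (λ p → S (prep _ p)) b us))
      (≡.trans (∑-*ˡ (sg (length vs₁ + k)) (picks vs₁) _) (≡.trans (∑-cong-All (All.map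
        (λ { {k′ , v′ , vs₂} e → lem k k′ (length vs₁) (length vs₂) _ e }) (picks-length vs₁))) (sym (∑-*ˡ c (picks vs₁) _))))))
    (sym (∑-*ˡ c (picks vs) _)))

D-repeat : ∀ v vs {H} → Sym H → ∀ u → D (v ∷ v ∷ vs) H u ≡ + 0
D-repeat v vs {H} S u = begin
  D (v ∷ v ∷ vs) H u
    ≡⟨ ∑-cong (picks u) (λ (k , x , r) → ≡.trans (∑-*ˡ (sg (suc (length vs) + k)) (picks r) _)
         (≡.trans (∑-cong (picks r) (λ (k′ , y , r′) → lem k k′ (length vs) _)) (sym (∑-*ˡ (- + 1) (picks r) _)))) ⟩
  ∑ (picks u) (λ (k , x , r) → (- + 1) *ℤ ∑ (picks r) (λ (k′ , y , r′) → sg (k + k′) *ℤ φ x y r′))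
    ≡⟨ sym (∑-*ˡ (- + 1) (picks u) _) ⟩
  (- + 1) *ℤ P
    ≡⟨ cong ((- + 1) *ℤ_) (x≡-x⇒x≡0 P (≡.trans (picks-anti u φ) (cong -_ (∑-cong (picks u) (λ (k , x , r) → ∑-cong (picks r)
         (λ (k′ , y , r′) → cong (sg (k + k′) *ℤ_) (D-cong vs r′ (λ w → S (swap _ _ ↭-refl))))))))) ⟩
  + 0 ∎
  where
  open ≡-Reasoning
  φ : ℕ → ℕ → List ℕ → ℤ
  φ x y r = D vs (λ w → H (x + v ∷ y + v ∷ w)) r
  P = ∑ (picks u) (λ (k , x , r) → ∑ (picks r) (λ (k′ , y , r′) → sg (k + k′) *ℤ φ x y r′))
  ring : ∀ n k k′ z → n *ℤ n ≡ + 1 → - n *ℤ k *ℤ (n *ℤ k′ *ℤ z) ≡ (- + 1) *ℤ (k *ℤ k′ *ℤ z)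
  ring n k k′ z h = ≡.trans (ring₁ n k k′ z) (cong (λ s → - s *ℤ (k *ℤ k′ *ℤ z)) h)
    where
    ring₁ : ∀ n k k′ z → - n *ℤ k *ℤ (n *ℤ k′ *ℤ z) ≡ - (n *ℤ n) *ℤ (k *ℤ k′ *ℤ z)
    ring₁ = solve-∀
  lem : ∀ k k′ n z → sg (suc n + k) *ℤ (sg (n + k′) *ℤ z) ≡ (- + 1) *ℤ (sg (k + k′) *ℤ z)
  lem k k′ n z rewrite sg-+ (suc n) k | sg-+ n k′ | sg-+ k k′ = ring (sg n) (sg k) (sg k′) z (sg² n)

desc : ℕ → List ℕ
desc zero    = []
desc (suc n) = n ∷ desc n

length-desc : ∀ n → length (desc n) ≡ n
length-desc zero    = ≡.refl
length-desc (suc n) = cong suc (length-desc n)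

up : ℕ → List (ℕ × ℕ)
up x = (0 , suc x) ∷ (1 , x) ∷ []

-- The labels count the entries that are not raised: this is the product of the alternant with
-- elementary symmetric functions, in which only the exponents 0, …, n without one value survive.
D-up : ∀ n u → length u ≡ n → (H : ℕ → List ℕ → ℤ) → (∀ c → Sym (H c)) →
  ∑ (cw up u) (λ (c , u′) → D (desc n) (H c) u′) ≡ ∑ (picks (desc (suc n))) (λ (k , v , vs) → D vs (H v) u)
D-up zero    []      e H S = ≡.refl
D-up (suc n) u       e H S = begin
  ∑ (cw up u) (λ (c , u′) → D (n ∷ desc n) (H c) u′)
    ≡⟨ picks-cw up u (λ c k x r → sg (length (desc n) + k) *ℤ D (desc n) (λ w → H c (x + n ∷ w)) r) ⟩
  ∑ (picks u) (λ (k , x , r) → ∑ (up x) (λ (t , y) → ∑ (cw up r) (λ (t′ , r′) →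
    sg (length (desc n) + k) *ℤ D (desc n) (λ w → H (t + t′) (y + n ∷ w)) r′)))
    ≡⟨ ∑-cong-All (All.map (λ { {k , x , r} e′ → ∑-cong (up x) (λ (t , y) →
         ≡.trans (sym (∑-*ˡ (sg (length (desc n) + k)) (cw up r) _)) (≡.trans
           (cong (sg (length (desc n) + k) *ℤ_) (D-up n r (ℕₚ.suc-injective (≡.trans (sym e′) e))
             (λ c w → H (t + c) (y + n ∷ w)) (λ c p → S (t + c) (prep _ p))))
           (∑-*ˡ (sg (length (desc n) + k)) (picks (desc (suc n))) (λ (k′ , v , vs) → D vs (λ w → H (t + v) (y + n ∷ w)) r)))) }) (picks-length u)) ⟩
  ∑ (picks u) (λ (k , x , r) → ∑ (up x) (λ (t , y) → ∑ (picks (desc (suc n))) (λ (k′ , v , vs) →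
    sg (length (desc n) + k) *ℤ D vs (λ w → H (t + v) (y + n ∷ w)) r)))
    ≡⟨ ∑-cong (picks u) (λ (k , x , r) → flatten
         (∑ (picks (desc (suc n))) (λ (k′ , v , vs) → sg (length (desc n) + k) *ℤ D vs (λ w → H v (suc x + n ∷ w)) r))
         (∑ (picks (desc (suc n))) (λ (k′ , v , vs) → sg (length (desc n) + k) *ℤ D vs (λ w → H (suc v) (x + n ∷ w)) r))) ⟩
  ∑ (picks u) (λ (k , x , r) →
    ∑ (picks (desc (suc n))) (λ (k′ , v , vs) → sg (length (desc n) + k) *ℤ D vs (λ w → H v (suc x + n ∷ w)) r) +ℤ
    ∑ (picks (desc (suc n))) (λ (k′ , v , vs) → sg (length (desc n) + k) *ℤ D vs (λ w → H (suc v) (x + n ∷ w)) r))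
    ≡⟨ ≡.trans (∑-∙ (picks u) _ _) (cong₂ _+ℤ_ (∑-comm (picks u) (picks (desc (suc n))) _) (∑-comm (picks u) (picks (desc (suc n))) _)) ⟩
  ∑ (picks (desc (suc n))) (λ (k′ , v , vs) → ∑ (picks u) (λ (k , x , r) → sg (length (desc n) + k) *ℤ D vs (λ w → H v (suc x + n ∷ w)) r)) +ℤ
  ∑ (picks (desc (suc n))) (λ (k′ , v , vs) → ∑ (picks u) (λ (k , x , r) → sg (length (desc n) + k) *ℤ D vs (λ w → H (suc v) (x + n ∷ w)) r))
    ≡⟨ cong₂ _+ℤ_
         (∑-cong-All (All.map (λ { {k′ , v , vs} e′ → ∑-cong (picks u) (λ (k , x , r) →
            cong₂ _*ℤ_ (cong (λ i → sg (i + k)) (ℕₚ.suc-injective e′)) (D-cong vs r (λ w → cong (λ i → H v (i ∷ w)) (sym (ℕₚ.+-suc x n))))) })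
            (picks-length (desc (suc n)))))
         (≡.trans (∑-cong-All (All.map (λ { {k′ , v , vs} e′ → ∑-cong (picks u) (λ (k , x , r) →
            cong (λ i → sg (i + k) *ℤ D vs (λ w → H (suc v) (x + n ∷ w)) r) (ℕₚ.suc-injective e′)) })
            (picks-length (desc (suc n)))))
          (∑-picks n (desc n) (λ (k′ , v , vs) → D (n ∷ vs) (H (suc v)) u))) ⟩
  ∑ (picks (desc (suc n))) (λ (k′ , v , vs) → D (suc n ∷ vs) (H v) u) +ℤ
  (D (desc (suc n)) (H (suc n)) u +ℤ ∑ (picks (desc n)) (λ (k′ , v , vs) → D (n ∷ n ∷ vs) (H (suc v)) u))
    ≡⟨ cong (λ z → Q +ℤ (D (desc (suc n)) (H (suc n)) u +ℤ z))
         (∑-ε (picks (desc n)) (λ (k′ , v , vs) → D-repeat n vs (S (suc v)) u)) ⟩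
  Q +ℤ (D (desc (suc n)) (H (suc n)) u +ℤ + 0)
    ≡⟨ ring Q (D (desc (suc n)) (H (suc n)) u) ⟩
  D (desc (suc n)) (H (suc n)) u +ℤ Q
    ≡⟨ sym (∑-picks (suc n) (desc (suc n)) (λ (k , v , vs) → D vs (H v) u)) ⟩
  ∑ (picks (desc (suc (suc n)))) (λ (k , v , vs) → D vs (H v) u) ∎
  where
  open ≡-Reasoning
  Q = ∑ (picks (desc (suc n))) (λ (k′ , v , vs) → D (suc n ∷ vs) (H v) u)
  ring : ∀ q d → q +ℤ (d +ℤ + 0) ≡ d +ℤ q
  ring = solve-∀
  flatten : ∀ (a b : ℤ) → a +ℤ (b +ℤ + 0) ≡ a +ℤ b
  flatten = solve-∀

-- The operation `g` treats all entries alike, so it is compatible with every rearrangement; only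
-- its exchange with "add the exponent `v`, then apply `C`" has to be assumed, for a single entry.
D-cw : ∀ (C g : ℕ → List (ℕ × ℕ)) {vs} →
  All (λ v → ∀ x (f : ℕ → ℕ → ℤ) →
    ∑ (C (x + v)) (λ (_ , y) → ∑ (g y) (λ (t , z) → f t z)) ≡ ∑ (g x) (λ (t , y) → ∑ (C (y + v)) (λ (_ , z) → f t z))) vs →
  ∀ (H : ℕ → List ℕ → ℤ) u →
  D vs (λ w → ∑ (cw C w) (λ (_ , w₁) → ∑ (cw g w₁) (λ (t , w′) → H t w′))) u ≡
  ∑ (cw g u) (λ (t , u′) → D vs (λ w → ∑ (cw C w) (λ (_ , w′) → H t w′)) u′)
D-cw C g []            H []      = ≡.refl
D-cw C g []            H (x ∷ u) = sym (≡.trans (∑-cw g x u _) (∑-ε (g x) (λ _ → ∑-ε (cw g u) (λ _ → ≡.refl))))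
D-cw C g {v ∷ vs} (c ∷ cs) H u = begin
  D (v ∷ vs) (λ w → ∑ (cw C w) (λ (_ , w₁) → ∑ (cw g w₁) (λ (t , w′) → H t w′))) u
    ≡⟨ ∑-cong (picks u) (λ (k , x , r) → cong (sg (length vs + k) *ℤ_) (step x r)) ⟩
  ∑ (picks u) (λ (k , x , r) → sg (length vs + k) *ℤ ∑ (g x) (λ (t , y) → ∑ (cw g r) (λ (t′ , r′) → D vs (λ w → ∑ (cw C (y + v ∷ w)) (λ (_ , w′) → H (t + t′) w′)) r′)))
    ≡⟨ ∑-cong (picks u) (λ (k , x , r) → ≡.trans (∑-*ˡ (sg (length vs + k)) (g x) _) (∑-cong (g x) (λ _ → ∑-*ˡ (sg (length vs + k)) (cw g r) _))) ⟩
  ∑ (picks u) (λ (k , x , r) → ∑ (g x) (λ (t , y) → ∑ (cw g r) (λ (t′ , r′) → sg (length vs + k) *ℤ D vs (λ w → ∑ (cw C (y + v ∷ w)) (λ (_ , w′) → H (t + t′) w′)) r′)))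
    ≡⟨ sym (picks-cw g u (λ t k y r → sg (length vs + k) *ℤ D vs (λ w → ∑ (cw C (y + v ∷ w)) (λ (_ , w′) → H t w′)) r)) ⟩
  ∑ (cw g u) (λ (t , u′) → D (v ∷ vs) (λ w → ∑ (cw C w) (λ (_ , w′) → H t w′)) u′) ∎
  where
  open ≡-Reasoning
  step : ∀ x r → D vs (λ w → ∑ (cw C (x + v ∷ w)) (λ (_ , w₁) → ∑ (cw g w₁) (λ (t , w′) → H t w′))) r ≡
    ∑ (g x) (λ (t , y) → ∑ (cw g r) (λ (t′ , r′) → D vs (λ w → ∑ (cw C (y + v ∷ w)) (λ (_ , w′) → H (t + t′) w′)) r′))
  step x r = begin
    D vs (λ w → ∑ (cw C (x + v ∷ w)) (λ (_ , w₁) → ∑ (cw g w₁) (λ (t , w′) → H t w′))) r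
      ≡⟨ D-cong vs r (λ w → ≡.trans (∑-cw-cw C g (x + v) w (λ _ t w′ → H t w′))
           (≡.trans (c x (λ t z → ∑ (cw C w) (λ (_ , ys) → ∑ (cw g ys) (λ (t′ , zs) → H (t + t′) (z ∷ zs)))))
           (∑-cong (g x) (λ (t , y) → ∑-cong (C (y + v)) (λ (_ , z) → ≡.refl))))) ⟩
    D vs (λ w → ∑ (g x) (λ (t , y) → ∑ (C (y + v)) (λ (_ , z) → ∑ (cw C w) (λ (_ , ys) → ∑ (cw g ys) (λ (t′ , zs) → H (t + t′) (z ∷ zs)))))) r
      ≡⟨ ≡.trans (D-∑ vs (g x) _ r) (∑-cong (g x) (λ (t , y) → ≡.trans (D-∑ vs (C (y + v)) _ r) (∑-cong (C (y + v)) (λ (_ , z) →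
           D-cw C g cs (λ t′ zs → H (t + t′) (z ∷ zs)) r)))) ⟩
    ∑ (g x) (λ (t , y) → ∑ (C (y + v)) (λ (_ , z) → ∑ (cw g r) (λ (t′ , r′) → D vs (λ w → ∑ (cw C w) (λ (_ , w′) → H (t + t′) (z ∷ w′))) r′)))
      ≡⟨ ∑-cong (g x) (λ (t , y) → ≡.trans (∑-comm (C (y + v)) (cw g r) _) (∑-cong (cw g r) (λ (t′ , r′) →
           ≡.trans (sym (D-∑ vs (C (y + v)) _ r′)) (D-cong vs r′ (λ w → sym (∑-cw C (y + v) w (λ (_ , w′) → H (t + t′) w′))))))) ⟩
    ∑ (g x) (λ (t , y) → ∑ (cw g r) (λ (t′ , r′) → D vs (λ w → ∑ (cw C (y + v ∷ w)) (λ (_ , w′) → H (t + t′) w′)) r′)) ∎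

-- x - k, or nothing if this is negative.
sub : ℕ → ℕ → List (ℕ × ℕ)
sub zero    x       = (0 , x) ∷ []
sub (suc k) zero    = []
sub (suc k) (suc x) = sub k x

sub-+ : ∀ k v x → sub (k + v) (x + v) ≡ sub k x
sub-+ k zero    x rewrite ℕₚ.+-identityʳ k | ℕₚ.+-identityʳ x = ≡.refl
sub-+ k (suc v) x rewrite ℕₚ.+-suc k v | ℕₚ.+-suc x v = sub-+ k v x

stair : List ℕ → List ℕ
stair []      = []
stair (a ∷ π) = a + length π ∷ stair π

length-stair : ∀ π → length (stair π) ≡ length π
length-stair []      = ≡.refl
length-stair (_ ∷ π) = cong suc (length-stair π)

∑-cw-sub-0 : ∀ w f → ∑ (cw (sub 0) w) (λ (_ , w′) → f w′) ≡ f w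
∑-cw-sub-0 []      f = ℤₚ.+-identityʳ _
∑-cw-sub-0 (x ∷ w) f = ≡.trans (∑-cw (sub 0) x w (λ (_ , w′) → f w′)) (≡.trans (ℤₚ.+-identityʳ _) (∑-cw-sub-0 w (λ w′ → f (x ∷ w′))))

∑-lowers-evens : ∀ q w (φ : ℕ → Word → ℤ) →
  ∑ (lowers q (evens w)) (λ (t , w′) → φ t w′) ≡ ∑ (cw (take≤ q) w) (λ (t , w′) → φ t (evens w′))
∑-lowers-evens q []      φ = ≡.refl
∑-lowers-evens q (x ∷ w) φ = ≡.trans (∑-lowers q false x (evens w) (λ (t , w′) → φ t w′)) (≡.trans
  (∑-cong (take≤ q x) (λ (i , j) → ∑-lowers-evens q w (λ t w′ → φ (i + t) ((false , j) ∷ w′))))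
  (sym (∑-cw (take≤ q) x w (λ (t , w′) → φ t (evens w′)))))

-- H shifted so that the alternant may be multiplied without negative exponents.
shifted : ℕ → (List ℕ → ℤ) → List ℕ → ℤ
shifted n H v = ∑ (cw (sub (pred n)) v) (λ (_ , w) → H w)

shifted-sym : ∀ n {H} → Sym H → Sym (shifted n H)
shifted-sym n {H} S = cw-↭ (sub (pred n)) (λ _ → H) (λ _ → S)

evens-sym : ∀ {F} → Super F → Sym (λ w → F (evens w))
evens-sym S p = S .perm (Perm.map⁺ (false ,_) p)

alternant : (List ℕ → ℤ) → List ℕ → ℤ
alternant H π = D (desc (length π)) (shifted (length π) H) (stair π)

private
  -- "Lower or not" is rewritten as "do not raise, or raise" at the price of one more unit to
  -- subtract: unlike lowering, raising never meets the boundary at zero, so it commutes with adding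
  -- exponents.
  sub-steps : ∀ n x (f : ℕ → ℕ → ℕ → ℤ) → ∑ (sub n x) (λ (s , y) → ∑ (steps y) (λ (t , z) → f s t z)) ≡
    ∑ (up x) (λ (t , y) → ∑ (sub (suc n) y) (λ (s , z) → f s t z))
  sub-steps zero    zero    f = ≡.refl
  sub-steps zero    (suc x) f = lem (f 0 0 (suc x)) (f 0 1 x)
    where
    lem : ∀ a b → a +ℤ (b +ℤ + 0) +ℤ + 0 ≡ a +ℤ + 0 +ℤ (b +ℤ + 0 +ℤ + 0)
    lem = solve-∀
  sub-steps (suc n) zero    f = ≡.refl
  sub-steps (suc n) (suc x) f = sub-steps n x f

  -- In `desc n` a value and its position add up to `n - 1`, the number of the remaining entries.
  picks-desc-sign : ∀ n → All (λ (k , v , vs) → sg (length vs + k) ≡ sg v) (picks (desc n))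
  picks-desc-sign zero    = []
  picks-desc-sign (suc n) = cong sg (≡.trans (ℕₚ.+-identityʳ _) (length-desc n)) ∷
    AllP.map⁺ (All.map (λ { {k , v , vs} e → ≡.trans (sg-suc-suc (length vs) k) e }) (picks-desc-sign n))

-- The part of the Weyl denominator that belongs to the first row is a product over the later rows,
-- and its factors act as `up` on the alternant of those rows. `D-up` leaves the alternants that
-- miss one exponent `v`, with the first row at `a + v`: this is the larger alternant expanded along
-- its first entry.
Ext-alternant : ∀ {F} → Super F → ∀ π → Ext F (evens π) ≡ alternant (λ w → F (evens w)) π
Ext-alternant {F} S []      = sym (ℤₚ.+-identityʳ _)
Ext-alternant {F} S (a ∷ π) = begin
  Ext (bern false a F) (evens π)
    ≡⟨ Ext-alternant (bern-super false a S) π ⟩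
  D (desc n) (shifted n (λ w → bern false a F (evens w))) (stair π)
    ≡⟨ shape π ⟩
  D (desc n) (λ v → ∑ (cw up v) (λ (c , v′) → H c v′)) (stair π)
    ≡⟨ D-cong (desc n) (stair π) (λ v → sym (∑-cw-sub-0 v _)) ⟩
  D (desc n) (λ v → ∑ (cw (sub 0) v) (λ (_ , v₁) → ∑ (cw up v₁) (λ (c , v′) → H c v′))) (stair π)
    ≡⟨ D-cw (sub 0) up (All.universal (λ v x f → lem (f 0 (suc x + v)) (f 1 (x + v))) (desc n)) H (stair π) ⟩
  ∑ (cw up (stair π)) (λ (c , u′) → D (desc n) (λ w → ∑ (cw (sub 0) w) (λ (_ , w′) → H c w′)) u′)
    ≡⟨ ∑-cong (cw up (stair π)) (λ (c , u′) → D-cong (desc n) u′ (λ w → ∑-cw-sub-0 w (H c))) ⟩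
  ∑ (cw up (stair π)) (λ (c , u′) → D (desc n) (H c) u′)
    ≡⟨ D-up n (stair π) (length-stair π) H H-sym ⟩
  ∑ (picks (desc (suc n))) (λ (k , v , vs) → D vs (H v) (stair π))
    ≡⟨ ∑-cong-All (All.map (λ { {k , v , vs} e → ≡.trans (D-* vs (sg v) (λ w → shifted (suc n) (λ w′ → F ((false , a + v) ∷ evens w′)) w) (stair π))
         (cong₂ _*ℤ_ (sym e) (D-cong vs (stair π) (λ w → sym (cons v w)))) }) (picks-desc-sign (suc n))) ⟩
  ∑ (picks (desc (suc n))) (λ (k , v , vs) → sg (length vs + k) *ℤ D vs (λ w → shifted (suc n) (λ w′ → F (evens w′)) (a + n + v ∷ w)) (stair π))
    ≡⟨ sym (D-laplace (desc (suc n)) (shifted-sym (suc n) (evens-sym S)) (a + n) (stair π)) ⟩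
  D (desc (suc n)) (shifted (suc n) (λ w → F (evens w))) (a + n ∷ stair π) ∎
  where
  open ≡-Reasoning
  n = length π
  H : ℕ → List ℕ → ℤ
  H c v = sg c *ℤ shifted (suc n) (λ w → F ((false , a + c) ∷ evens w)) v
  H-sym : ∀ c → Sym (H c)
  H-sym c p = cong (sg c *ℤ_) (shifted-sym (suc n) (evens-sym (Super-∷ (false , a + c) S)) p)
  lem : ∀ x y → x +ℤ (y +ℤ + 0) +ℤ + 0 ≡ x +ℤ + 0 +ℤ (y +ℤ + 0 +ℤ + 0)
  lem = solve-∀
  cons : ∀ v w → shifted (suc n) (λ w′ → F (evens w′)) (a + n + v ∷ w) ≡ shifted (suc n) (λ w′ → F ((false , a + v) ∷ evens w′)) w
  cons v w = ≡.trans (∑-cw (sub n) (a + n + v) w (λ (_ , w) → F (evens w)))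
    (≡.trans (cong (λ l → ∑ l (λ (t , y) → ∑ (cw (sub n) w) (λ (t′ , ys) → F ((false , y) ∷ evens ys))))
      (≡.trans (cong (sub n) (≡.trans (ℕₚ.+-assoc a n v) (≡.trans (cong (λ i → a + i) (ℕₚ.+-comm n v)) (sym (ℕₚ.+-assoc a v n))))) (sub-+ 0 n (a + v))))
      (ℤₚ.+-identityʳ _))
  shape : ∀ ρ → D (desc (length ρ)) (shifted (length ρ) (λ w → bern false a F (evens w))) (stair π) ≡
          D (desc (length ρ)) (λ v → ∑ (cw up v) (λ (c , v′) → sg c *ℤ shifted (suc (length ρ)) (λ w → F ((false , a + c) ∷ evens w)) v′)) (stair π)
  -- `pred 0` and `pred 1` agree, so without later rows the shift does not change and `sub-steps`
  -- has nothing to say.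
  shape []      with stair π
  ... | []    = lem₂ (F ((false , a + 0) ∷ []))
    where
    lem₂ : ∀ x → + 1 *ℤ x +ℤ + 0 +ℤ + 0 ≡ + 1 *ℤ (x +ℤ + 0) +ℤ + 0
    lem₂ = solve-∀
  ... | _ ∷ _ = ≡.refl
  shape (b ∷ ρ) = D-cong (desc (suc (length ρ))) (stair π) (λ v → ≡.trans
    (∑-cong (cw (sub m) v) (λ (_ , w) → ∑-lowers-evens true w (λ t w′ → sg t *ℤ F ((false , a + t) ∷ w′))))
    (≡.trans (cw-exchange {g = sub m} {steps} {up} {sub (suc m)} (sub-steps m) v (λ _ t w′ → sg t *ℤ F ((false , a + t) ∷ evens w′)))
    (∑-cong (cw up v) (λ (t , v′) → sym (∑-*ˡ (sg t) (cw (sub (suc m)) v′) _)))))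
    where m = length ρ

-- Horizontal strips and the branching rule

hd : List ℕ → ℕ
hd []      = 0
hd (x ∷ _) = x

tl : List ℕ → List ℕ
tl []      = []
tl (_ ∷ π) = π

-- The ζ for which π / ζ is a horizontal strip, labelled by its size: `i` boxes leave a row, and `j`
-- is the excess of the new row over the next row of π.
strips : List ℕ → List (ℕ × List ℕ)
strips []       = (0 , []) ∷ []
strips (p ∷ ps) = concatMap (λ (i , j) → map (λ (t , ζ) → i + t , hd ps + j ∷ ζ) (strips ps)) (antidiag (p ∸ hd ps))

∑-strips : ∀ p ps f → ∑ (strips (p ∷ ps)) f ≡
  ∑ (antidiag (p ∸ hd ps)) (λ (i , j) → ∑ (strips ps) (λ (t , ζ) → f (i + t , hd ps + j ∷ ζ)))
∑-strips p ps f = ≡.trans (∑-concatMap _ (antidiag (p ∸ hd ps)) f) (∑-cong (antidiag (p ∸ hd ps)) (λ _ → ∑-map _ (strips ps) f))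

length-strips : ∀ π → All (λ (t , ζ) → length ζ ≡ length π) (strips π)
length-strips []       = ≡.refl ∷ []
length-strips (p ∷ ps) = All-concatMap _ (All.universal (λ _ → AllP.map⁺ (All.map (cong suc) (length-strips ps))) (antidiag (p ∸ hd ps)))

sub-antidiag : ∀ d x (f : ℕ → ℕ → ℤ) →
  ∑ (sub d x) (λ (_ , y) → ∑ (antidiag y) (λ (t , z) → f t z)) ≡ ∑ (antidiag x) (λ (t , y) → ∑ (sub d y) (λ (_ , z) → f t z))
sub-antidiag zero    x       f = ≡.trans (ℤₚ.+-identityʳ _) (∑-cong (antidiag x) (λ (t , y) → sym (ℤₚ.+-identityʳ (f t y))))
sub-antidiag (suc d) zero    f = ≡.refl
sub-antidiag (suc d) (suc x) f = ≡.trans (sub-antidiag d x f) (≡.trans (sym (ℤₚ.+-identityʳ _))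
  (sym (∑-antidiag-snoc x (λ (t , y) → ∑ (sub (suc d) y) (λ (_ , z) → f t z)))))

private
  Anti : (List ℕ → ℤ) → Set
  Anti A = ∀ pre a b us → A (pre ++ a ∷ b ∷ us) ≡ - A (pre ++ b ∷ a ∷ us)

  -- The part of the box in which the first two entries range over the same interval contributes zero.
  box-to-strips : ∀ π → Linked _≥_ π → (A : ℕ → List ℕ → ℤ) → (∀ t → Anti (A t)) →
    ∑ (cw antidiag (stair π)) (λ (t , u) → A t u) ≡ ∑ (strips π) (λ (t , ζ) → A t (stair ζ))
  box-to-strips [] _ A anti = ≡.refl
  box-to-strips (p ∷ []) _ A anti = ≡.trans (∑-cw antidiag (p + 0) [] (λ (t , u) → A t u)) (≡.trans
    (cong (λ q → ∑ (antidiag q) (λ (i , j) → A (i + 0) (j ∷ []) +ℤ + 0)) (ℕₚ.+-identityʳ p))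
    (≡.trans (∑-cong (antidiag p) (λ (i , j) → cong (λ k → A (i + 0) (k ∷ []) +ℤ + 0) (sym (ℕₚ.+-identityʳ j))))
    (sym (∑-strips p [] (λ (t , ζ) → A t (stair ζ))))))
  box-to-strips (p₁ ∷ p₂ ∷ ps) (p₁≥p₂ ∷ l) A anti = begin
    ∑ (cw antidiag (stair (p₁ ∷ p₂ ∷ ps))) (λ (t , u) → A t u)
      ≡⟨ ∑-cw antidiag (p₁ + suc n) (u₂ ∷ us) (λ (t , u) → A t u) ⟩
    ∑ (antidiag (p₁ + suc n)) (λ (i , j) → tail i j)
      ≡⟨ cong (λ q → ∑ (antidiag q) (λ (i , j) → tail i j)) u₁-eq ⟩
    ∑ (antidiag (suc (e + u₂))) (λ (i , j) → tail i j)
      ≡⟨ ∑-antidiag-split e u₂ (λ (i , j) → tail i j) ⟩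
    ∑ (antidiag u₂) (λ (r , j) → tail (suc (e + r)) j) +ℤ ∑ (antidiag e) (λ (i , r) → tail i (suc (u₂ + r)))
      ≡⟨ cong₂ _+ℤ_ vanish (∑-cong (antidiag e) (λ (i , r) → box-to-strips (p₂ ∷ ps) l (λ t u → A (i + t) (suc (u₂ + r) ∷ u))
           (λ t pre → anti (i + t) (suc (u₂ + r) ∷ pre)))) ⟩
    + 0 +ℤ ∑ (antidiag e) (λ (i , r) → ∑ (strips (p₂ ∷ ps)) (λ (t , ζ) → A (i + t) (suc (u₂ + r) ∷ stair ζ)))
      ≡⟨ ℤₚ.+-identityˡ _ ⟩
    ∑ (antidiag e) (λ (i , r) → ∑ (strips (p₂ ∷ ps)) (λ (t , ζ) → A (i + t) (suc (u₂ + r) ∷ stair ζ)))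
      ≡⟨ ∑-cong (antidiag e) (λ (i , r) → ∑-cong-All (All.map (λ { {t , ζ} q →
           cong (λ k → A (i + t) (k ∷ stair ζ)) (≡.trans (top r) (cong (λ k → p₂ + r + k) (sym q))) }) (length-strips (p₂ ∷ ps)))) ⟩
    ∑ (antidiag e) (λ (i , r) → ∑ (strips (p₂ ∷ ps)) (λ (t , ζ) → A (i + t) (stair (p₂ + r ∷ ζ))))
      ≡⟨ sym (∑-strips p₁ (p₂ ∷ ps) (λ (t , ζ) → A t (stair ζ))) ⟩
    ∑ (strips (p₁ ∷ p₂ ∷ ps)) (λ (t , ζ) → A t (stair ζ)) ∎
    where
    open ≡-Reasoning
    n = length ps
    u₂ = p₂ + n
    us = stair ps
    e = p₁ ∸ p₂
    tail : ℕ → ℕ → ℤ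
    tail i j = ∑ (cw antidiag (u₂ ∷ us)) (λ (t , u) → A (i + t) (j ∷ u))
    u₁-eq : p₁ + suc n ≡ suc (e + u₂)
    u₁-eq = ≡.trans (ℕₚ.+-suc p₁ n) (cong suc (≡.trans (cong (_+ n) (sym (ℕₚ.m∸n+n≡m p₁≥p₂))) (ℕₚ.+-assoc e p₂ n)))
    top : ∀ r → suc (u₂ + r) ≡ p₂ + r + suc n
    top r = go p₂ n r
      where
      go : ∀ p n r → suc (p + n + r) ≡ p + r + suc n
      go = ℕSolver.solve-∀
    vanish : ∑ (antidiag u₂) (λ (r , j) → tail (suc (e + r)) j) ≡ + 0
    vanish = x≡-x⇒x≡0 _ (begin
      ∑ (antidiag u₂) (λ (r , j) → tail (suc (e + r)) j)
        ≡⟨ expand ⟩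
      ∑ (antidiag u₂) (λ (r , j) → ∑ (antidiag u₂) (λ (s , k) → ∑ (cw antidiag us) (λ (t , u) → A (suc (e + r) + (s + t)) (j ∷ k ∷ u))))
        ≡⟨ ∑-comm (antidiag u₂) (antidiag u₂) _ ⟩
      ∑ (antidiag u₂) (λ (s , k) → ∑ (antidiag u₂) (λ (r , j) → ∑ (cw antidiag us) (λ (t , u) → A (suc (e + r) + (s + t)) (j ∷ k ∷ u))))
        ≡⟨ ∑-cong (antidiag u₂) (λ (s , k) → ≡.trans (∑-cong (antidiag u₂) (λ (r , j) → ≡.trans (∑-cong (cw antidiag us) (λ (t , u) →
             ≡.trans (cong (λ q → A q (j ∷ k ∷ u)) (ex e r s t)) (anti _ [] j k u))) (sym (∑-neg (cw antidiag us) _))))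
             (sym (∑-neg (antidiag u₂) _))) ⟩
      ∑ (antidiag u₂) (λ (s , k) → - ∑ (antidiag u₂) (λ (r , j) → ∑ (cw antidiag us) (λ (t , u) → A (suc (e + s) + (r + t)) (k ∷ j ∷ u))))
        ≡⟨ sym (∑-neg (antidiag u₂) _) ⟩
      - ∑ (antidiag u₂) (λ (s , k) → ∑ (antidiag u₂) (λ (r , j) → ∑ (cw antidiag us) (λ (t , u) → A (suc (e + s) + (r + t)) (k ∷ j ∷ u))))
        ≡⟨ cong -_ (sym expand) ⟩
      - ∑ (antidiag u₂) (λ (r , j) → tail (suc (e + r)) j) ∎)
      where
      expand : ∑ (antidiag u₂) (λ (r , j) → tail (suc (e + r)) j) ≡
        ∑ (antidiag u₂) (λ (r , j) → ∑ (antidiag u₂) (λ (s , k) → ∑ (cw antidiag us) (λ (t , u) → A (suc (e + r) + (s + t)) (j ∷ k ∷ u))))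
      expand = ∑-cong (antidiag u₂) (λ (r , j) → ∑-cw antidiag u₂ us (λ (t , u) → A (suc (e + r) + t) (j ∷ u)))
      ex : ∀ e r s t → suc (e + r) + (s + t) ≡ suc (e + s) + (r + t)
      ex = ℕSolver.solve-∀

  -- The bound `v ≤ k` keeps the removal within `x`; otherwise part of the exponent `v` of the
  -- alternant could be taken away as well.
  sub-antidiag-+ : ∀ k v x (f : ℕ → ℕ → ℤ) → v ≤ k →
    ∑ (sub k (x + v)) (λ (_ , y) → ∑ (antidiag y) (λ (t , z) → f t z)) ≡ ∑ (antidiag x) (λ (t , y) → ∑ (sub k (y + v)) (λ (_ , z) → f t z))
  sub-antidiag-+ k v x f v≤k = ≡.trans (cong (λ l → ∑ l (λ (_ , y) → ∑ (antidiag y) (λ (t , z) → f t z))) (shift x))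
    (≡.trans (sub-antidiag (k ∸ v) x f) (∑-cong (antidiag x) (λ (t , y) → cong (λ l → ∑ l (λ (_ , z) → f t z)) (sym (shift y)))))
    where
    shift : ∀ y → sub k (y + v) ≡ sub (k ∸ v) y
    shift y = ≡.trans (cong (λ i → sub i (y + v)) (sym (ℕₚ.m∸n+n≡m v≤k))) (sub-+ (k ∸ v) v y)

  desc-≤ : ∀ n → All (_≤ pred n) (desc n)
  desc-≤ zero    = []
  desc-≤ (suc n) = ℕₚ.≤-refl ∷ All.map (λ v≤ → ℕₚ.≤-trans v≤ ℕₚ.pred[n]≤n) (desc-≤ n)

-- The branching rule: adjoining an even variable x turns s_π into the sum of x^t s_ζ over
-- horizontal strips. On the alternant the removal acts on each entry of `stair π` independently,
-- and antisymmetry cancels everything except the strips.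
Ext-strips : ∀ {G : ℕ → Word → ℤ} → (∀ t → Super (G t)) → ∀ {π} → Linked _≥_ π →
  Ext (λ ξ → ∑ (lowers false ξ) (λ (t , ξ′) → G t ξ′)) (evens π) ≡ ∑ (strips π) (λ (t , ζ) → Ext (G t) (evens ζ))
Ext-strips {G} S {π} l = begin
  Ext (λ ξ → ∑ (lowers false ξ) (λ (t , ξ′) → G t ξ′)) (evens π)
    ≡⟨ Ext-alternant (lowers-super false S) π ⟩
  D (desc n) (shifted n (λ w → ∑ (lowers false (evens w)) (λ (t , ξ′) → G t ξ′))) (stair π)
    ≡⟨ D-cong (desc n) (stair π) (λ v → ∑-cong (cw (sub (pred n)) v) (λ (_ , w) → ∑-lowers-evens false w G)) ⟩
  D (desc n) (λ v → ∑ (cw (sub (pred n)) v) (λ (_ , w) → ∑ (cw antidiag w) (λ (t , w′) → G t (evens w′)))) (stair π)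
    ≡⟨ D-cw (sub (pred n)) antidiag (All.map (λ v≤ x f → sub-antidiag-+ (pred n) _ x f v≤) (desc-≤ n)) (λ t w → G t (evens w)) (stair π) ⟩
  ∑ (cw antidiag (stair π)) (λ (t , u) → D (desc n) (shifted n (λ w → G t (evens w))) u)
    ≡⟨ box-to-strips π l (λ t u → D (desc n) (shifted n (λ w → G t (evens w))) u)
         (λ t pre a b us → D-anti (desc n) (shifted-sym n (evens-sym (S t))) pre a b us) ⟩
  ∑ (strips π) (λ (t , ζ) → D (desc n) (shifted n (λ w → G t (evens w))) (stair ζ))
    ≡⟨ ∑-cong-All (All.map (λ { {t , ζ} q → ≡.trans (cong (λ k → D (desc k) (shifted k (λ w → G t (evens w))) (stair ζ)) (sym q))
         (sym (Ext-alternant (S t) ζ)) }) (length-strips π)) ⟩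
  ∑ (strips π) (λ (t , ζ) → Ext (G t) (evens ζ)) ∎
  where
  open ≡-Reasoning
  n = length π

-- The signed sum over permutations as an alternant

sumℤ-map : ∀ (g : X → ℤ) xs → sumℤ (map g xs) ≡ ∑ xs g
sumℤ-map g []       = ≡.refl
sumℤ-map g (x ∷ xs) = cong (g x +ℤ_) (sumℤ-map g xs)

<⇒<ᵇ≡true : ∀ {m n} → m < n → (m <ᵇ n) ≡ true
<⇒<ᵇ≡true {zero}  (s≤s _)       = ≡.refl
<⇒<ᵇ≡true {suc m} (s≤s m<n)     = <⇒<ᵇ≡true m<n

≥⇒<ᵇ≡false : ∀ {m n} → n ≤ m → (m <ᵇ n) ≡ false
≥⇒<ᵇ≡false {m}     z≤n       = ≡.refl
≥⇒<ᵇ≡false {suc m} (s≤s n≤m) = ≥⇒<ᵇ≡false n≤m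

private
  count< : ℕ → List ℕ → ℕ
  count< y q = length (filterᵇ (λ z → z <ᵇ y) q)

  count<-all : ∀ {N q} → All (_< N) q → count< N q ≡ length q
  count<-all []               = ≡.refl
  count<-all (p ∷ ps) rewrite <⇒<ᵇ≡true p = cong suc (count<-all ps)

  count<-insertions : ∀ {N y} q → y ≤ N → All (λ p → count< y p ≡ count< y q) (insertions N q)
  count<-insertions {N} {y} [] y≤N = lem ∷ []
    where
    lem : count< y (N ∷ []) ≡ 0
    lem rewrite ≥⇒<ᵇ≡false y≤N = ≡.refl
  count<-insertions {N} {y} (z ∷ q) y≤N = lem ∷ AllP.map⁺ (All.map cons (count<-insertions q y≤N))
    where
    lem : count< y (N ∷ z ∷ q) ≡ count< y (z ∷ q)
    lem rewrite ≥⇒<ᵇ≡false y≤N = ≡.refl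
    cons : ∀ {p} → count< y p ≡ count< y q → count< y (z ∷ p) ≡ count< y (z ∷ q)
    cons e with z <ᵇ y
    ... | true  = cong suc e
    ... | false = e

  -- Inserting the largest value `N` at position `k` adds one inversion for each entry behind it,
  -- `length q - k` in all, which has the parity of `length q + k`. Symmetry of `H` brings the entry
  -- of `u` paired with `N` to the front.
  ∑-insertions : ∀ N q u {H} → Sym H → All (_< N) q → length u ≡ suc (length q) →
    ∑ (insertions N q) (λ p → sg (inversions p) *ℤ H (zipWith _+_ u p)) ≡
    ∑ (picks u) (λ (k , x , r) → sg (length q + k) *ℤ (sg (inversions q) *ℤ H (x + N ∷ zipWith _+_ r q)))
  ∑-insertions N [] (x ∷ []) {H} S _ e = lem (H (x + N ∷ []))
    where
    lem : ∀ z → + 1 *ℤ z +ℤ + 0 ≡ + 1 *ℤ (+ 1 *ℤ z) +ℤ + 0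
    lem = solve-∀
  ∑-insertions N (y ∷ ys) (x ∷ us) {H} S (y<N ∷ ys<N) e = begin
    sg (inversions (N ∷ y ∷ ys)) *ℤ H (x + N ∷ zipWith _+_ us (y ∷ ys)) +ℤ
      ∑ (map (y ∷_) (insertions N ys)) (λ p → sg (inversions p) *ℤ H (zipWith _+_ (x ∷ us) p))
      ≡⟨ cong₂ _+ℤ_ head tail ⟩
    φ (0 , x , us) +ℤ ∑ (picks us) (λ (k , x′ , r) → φ (suc k , x′ , x ∷ r))
      ≡⟨ sym (∑-picks x us φ) ⟩
    ∑ (picks (x ∷ us)) φ ∎
    where
    open ≡-Reasoning
    q = y ∷ ys
    φ : ℕ × ℕ × List ℕ → ℤ
    φ (k , x , r) = sg (length q + k) *ℤ (sg (inversions q) *ℤ H (x + N ∷ zipWith _+_ r q))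
    head : sg (inversions (N ∷ q)) *ℤ H (x + N ∷ zipWith _+_ us q) ≡ φ (0 , x , us)
    head = ≡.trans (cong (_*ℤ H (x + N ∷ zipWith _+_ us q)) (≡.trans (cong (λ k → sg (k + inversions q)) (≡.trans (count<-all (y<N ∷ ys<N)) (sym (ℕₚ.+-identityʳ _))))
      (sg-+ (length q + 0) (inversions q)))) (ℤₚ.*-assoc (sg (length q + 0)) (sg (inversions q)) _)
    ring : ∀ c i l h → c *ℤ (l *ℤ (i *ℤ h)) ≡ l *ℤ (c *ℤ i *ℤ h)
    ring = solve-∀
    tail : ∑ (map (y ∷_) (insertions N ys)) (λ p → sg (inversions p) *ℤ H (zipWith _+_ (x ∷ us) p)) ≡
           ∑ (picks us) (λ (k , x′ , r) → φ (suc k , x′ , x ∷ r))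
    tail = begin
      ∑ (map (y ∷_) (insertions N ys)) (λ p → sg (inversions p) *ℤ H (zipWith _+_ (x ∷ us) p))
        ≡⟨ ∑-map (y ∷_) (insertions N ys) _ ⟩
      ∑ (insertions N ys) (λ p → sg (count< y p + inversions p) *ℤ H (x + y ∷ zipWith _+_ us p))
        ≡⟨ ∑-cong-All (All.map (λ {p} c → ≡.trans (cong (_*ℤ H (x + y ∷ zipWith _+_ us p)) (≡.trans (cong (λ k → sg (k + inversions p)) c) (sg-+ (count< y ys) (inversions p))))
             (ℤₚ.*-assoc (sg (count< y ys)) (sg (inversions p)) _)) (count<-insertions ys (ℕₚ.<⇒≤ y<N))) ⟩
      ∑ (insertions N ys) (λ p → sg (count< y ys) *ℤ (sg (inversions p) *ℤ H (x + y ∷ zipWith _+_ us p)))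
        ≡⟨ sym (∑-*ˡ (sg (count< y ys)) (insertions N ys) _) ⟩
      sg (count< y ys) *ℤ ∑ (insertions N ys) (λ p → sg (inversions p) *ℤ H (x + y ∷ zipWith _+_ us p))
        ≡⟨ cong (sg (count< y ys) *ℤ_) (∑-insertions N ys us (λ p → S (prep _ p)) ys<N (ℕₚ.suc-injective e)) ⟩
      sg (count< y ys) *ℤ ∑ (picks us) (λ (k , x′ , r) → sg (length ys + k) *ℤ (sg (inversions ys) *ℤ H (x + y ∷ x′ + N ∷ zipWith _+_ r ys)))
        ≡⟨ ∑-*ˡ (sg (count< y ys)) (picks us) _ ⟩
      ∑ (picks us) (λ (k , x′ , r) → sg (count< y ys) *ℤ (sg (length ys + k) *ℤ (sg (inversions ys) *ℤ H (x + y ∷ x′ + N ∷ zipWith _+_ r ys))))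
        ≡⟨ ∑-cong (picks us) (λ (k , x′ , r) → ≡.trans (cong (λ h → sg (count< y ys) *ℤ (sg (length ys + k) *ℤ (sg (inversions ys) *ℤ h))) (S (swap _ _ ↭-refl)))
             (≡.trans (ring (sg (count< y ys)) (sg (inversions ys)) (sg (length ys + k)) _)
             (cong₂ (λ a b → a *ℤ (b *ℤ H (x′ + N ∷ x + y ∷ zipWith _+_ r ys))) (sym (sg-suc-suc (length ys) k)) (sym (sg-+ (count< y ys) (inversions ys)))))) ⟩
      ∑ (picks us) (λ (k , x′ , r) → φ (suc k , x′ , x ∷ r)) ∎

  insertions-good : ∀ {N} q → All (_< N) q → All (λ p → length p ≡ suc (length q) × All (_< suc N) p) (insertions N q)
  insertions-good {N} []      _        = (≡.refl , ℕₚ.≤-refl ∷ []) ∷ []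
  insertions-good {N} (y ∷ q) (p ∷ ps) = (≡.refl , ℕₚ.≤-refl ∷ All.map ℕₚ.m<n⇒m<1+n (p ∷ ps)) ∷
    AllP.map⁺ (All.map (λ (e , a) → cong suc e , ℕₚ.m<n⇒m<1+n p ∷ a) (insertions-good q ps))

  perms-good : ∀ n → All (λ q → length q ≡ n × All (_< n) q) (perms n)
  perms-good zero    = (≡.refl , []) ∷ []
  perms-good (suc n) = All-concatMap (insertions n) (All.map
    (λ { {q} (e , a) → All.map (λ (e′ , a′) → ≡.trans e′ (cong suc e) , a′) (insertions-good q a) }) (perms-good n))

  ∑-perms : ∀ n u {H} → length u ≡ n → Sym H →
    ∑ (perms n) (λ p → sg (inversions p) *ℤ H (zipWith _+_ u p)) ≡ D (desc n) H u
  ∑-perms zero    [] {H} e S = lem (H [])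
    where
    lem : ∀ z → + 1 *ℤ z +ℤ + 0 ≡ z
    lem = solve-∀
  ∑-perms (suc n) u {H} e S = begin
    ∑ (concatMap (insertions n) (perms n)) (λ p → sg (inversions p) *ℤ H (zipWith _+_ u p))
      ≡⟨ ∑-concatMap (insertions n) (perms n) _ ⟩
    ∑ (perms n) (λ q → ∑ (insertions n q) (λ p → sg (inversions p) *ℤ H (zipWith _+_ u p)))
      ≡⟨ ∑-cong-All (All.map (λ { {q} (eq , a) → ≡.trans (∑-insertions n q u S a (≡.trans e (cong suc (sym eq))))
           (cong (λ m → ∑ (picks u) (λ (k , x , r) → sg (m + k) *ℤ (sg (inversions q) *ℤ H (x + n ∷ zipWith _+_ r q)))) (≡.trans eq (sym (length-desc n)))) })
           (perms-good n)) ⟩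
    ∑ (perms n) (λ q → ∑ (picks u) (λ (k , x , r) → sg (length (desc n) + k) *ℤ (sg (inversions q) *ℤ H (x + n ∷ zipWith _+_ r q))))
      ≡⟨ ∑-comm (perms n) (picks u) _ ⟩
    ∑ (picks u) (λ (k , x , r) → ∑ (perms n) (λ q → sg (length (desc n) + k) *ℤ (sg (inversions q) *ℤ H (x + n ∷ zipWith _+_ r q))))
      ≡⟨ ∑-cong-All (All.map (λ { {k , x , r} er → ≡.trans (sym (∑-*ˡ (sg (length (desc n) + k)) (perms n) _))
           (cong (sg (length (desc n) + k) *ℤ_) (∑-perms n r (ℕₚ.suc-injective (≡.trans (sym er) e)) (λ p → S (prep _ p)))) }) (picks-length u)) ⟩
    D (desc (suc n)) H u ∎
    where open ≡-Reasoning

  ∑-sub : ∀ i x (g : ℕ → ℤ) → ∑ (sub i x) (λ (_ , y) → g y) ≡ (if i ≤ᵇ x then g (x ∸ i) else + 0)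
  ∑-sub zero          x       g = ℤₚ.+-identityʳ _
  ∑-sub (suc i)       zero    g = ≡.refl
  ∑-sub (suc zero)    (suc x) g = ℤₚ.+-identityʳ _
  ∑-sub (suc (suc i)) (suc x) g = ∑-sub (suc i) x g

  -- Row `i` of `stair π` exceeds the row of π by the number of rows below it, so of the uniform
  -- shift `k` exactly `i` remains to be subtracted.
  ∑-expo : ∀ k i π p (f : List ℕ → ℤ) → length p ≡ length π → i + length π ≡ suc k →
    ∑ (cw (sub k) (zipWith _+_ (stair π) p)) (λ (_ , w) → f w) ≡ (if expoOK i π p then f (expo i π p) else + 0)
  ∑-expo k i []      []      f e₁ e₂ = ℤₚ.+-identityʳ _
  ∑-expo k i (a ∷ π) (b ∷ p) f e₁ e₂ = begin
    ∑ (cw (sub k) (a + n + b ∷ zipWith _+_ (stair π) p)) (λ (_ , w) → f w)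
      ≡⟨ ∑-cw (sub k) (a + n + b) (zipWith _+_ (stair π) p) (λ (_ , w) → f w) ⟩
    ∑ (sub k (a + n + b)) (λ (_ , y) → ∑ (cw (sub k) (zipWith _+_ (stair π) p)) (λ (_ , w) → f (y ∷ w)))
      ≡⟨ cong (λ l → ∑ l (λ (_ , y) → ∑ (cw (sub k) (zipWith _+_ (stair π) p)) (λ (_ , w) → f (y ∷ w))))
           (≡.trans (cong₂ sub k≡ (ex a n b)) (sub-+ i n (a + b))) ⟩
    ∑ (sub i (a + b)) (λ (_ , y) → ∑ (cw (sub k) (zipWith _+_ (stair π) p)) (λ (_ , w) → f (y ∷ w)))
      ≡⟨ ∑-cong (sub i (a + b)) (λ (_ , y) → ∑-expo k (suc i) π p (λ w → f (y ∷ w)) (ℕₚ.suc-injective e₁) (cong suc (sym k≡))) ⟩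
    ∑ (sub i (a + b)) (λ (_ , y) → if expoOK (suc i) π p then f (y ∷ expo (suc i) π p) else + 0)
      ≡⟨ ∑-sub i (a + b) _ ⟩
    (if i ≤ᵇ (a + b) then (if expoOK (suc i) π p then f ((a + b ∸ i) ∷ expo (suc i) π p) else + 0) else + 0)
      ≡⟨ if-∧ (i ≤ᵇ (a + b)) ⟩
    (if (i ≤ᵇ (a + b)) ∧ expoOK (suc i) π p then f ((a + b ∸ i) ∷ expo (suc i) π p) else + 0) ∎
    where
    open ≡-Reasoning
    n = length π
    k≡ : k ≡ i + n
    k≡ = ℕₚ.suc-injective (≡.trans (sym e₂) (ℕₚ.+-suc i n))
    ex : ∀ a n b → a + n + b ≡ a + b + n
    ex = ℕSolver.solve-∀
    if-∧ : ∀ b {c} {z : ℤ} → (if b then (if c then z else + 0) else + 0) ≡ (if b ∧ c then z else + 0)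
    if-∧ true  = ≡.refl
    if-∧ false = ≡.refl

  sign≡sg : ∀ n → (if isEven n then + 1 else - (+ 1)) ≡ sg n
  sign≡sg zero          = ≡.refl
  sign≡sg (suc zero)    = ≡.refl
  sign≡sg (suc (suc n)) = ≡.trans (sign≡sg n) (sym (ℤₚ.neg-involutive (sg n)))

schurCoeff-alternant : ∀ {f} → Sym f → ∀ π → schurCoeff f π ≡ alternant f π
schurCoeff-alternant {f} S [] = lem (f [])
  where
  lem : ∀ x → + 1 *ℤ x +ℤ + 0 ≡ x +ℤ + 0
  lem = solve-∀
schurCoeff-alternant {f} S π@(a ∷ π′) = begin
  schurCoeff f π
    ≡⟨ sumℤ-map _ (perms (length π)) ⟩
  ∑ (perms (length π)) (λ p → if expoOK 0 π p then Defs.sign p *ℤ f (expo 0 π p) else + 0)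
    ≡⟨ ∑-cong-All (All.map (λ { {p} (e , _) → ≡.trans (factor p)
         (cong (sg (inversions p) *ℤ_) (sym (∑-expo (length π′) 0 π p f e ≡.refl))) }) (perms-good (length π))) ⟩
  ∑ (perms (length π)) (λ p → sg (inversions p) *ℤ shifted (length π) f (zipWith _+_ (stair π) p))
    ≡⟨ ∑-perms (length π) (stair π) (length-stair π) (shifted-sym (length π) S) ⟩
  alternant f π ∎
  where
  open ≡-Reasoning
  factor : ∀ p → (if expoOK 0 π p then Defs.sign p *ℤ f (expo 0 π p) else + 0) ≡
                 sg (inversions p) *ℤ (if expoOK 0 π p then f (expo 0 π p) else + 0)
  factor p with expoOK 0 π p
  ... | true  = cong (_*ℤ f (expo 0 π p)) (sign≡sg (inversions p))
  ... | false = sym (ℤₚ.*-zeroʳ (sg (inversions p)))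

-- The definitions know monomial coefficients only, that is, words of even letters. Once `f` has a
-- supersymmetric extension `F`, this passage makes odd reflections available.
schurCoeff-Ext : ∀ {f F} → Super F → (∀ γ → f γ ≡ F (evens γ)) → ∀ π → schurCoeff f π ≡ Ext F (evens π)
schurCoeff-Ext {f} {F} S h π = ≡.trans (schurCoeff-alternant (λ p → ≡.trans (h _) (≡.trans (evens-sym S p) (sym (h _)))) π)
  (≡.trans (D-cong (desc (length π)) (stair π) (λ v → ∑-cong (cw (sub (pred (length π))) v) (λ (_ , w) → h w))) (sym (Ext-alternant S π)))

-- Products of complete and elementary symmetric functions of an alphabet

-- γ - v as a list with at most one element; the clause for words that are too short is junk.
subs : List ℕ → Word → List Word
subs []      γ             = γ ∷ []
subs (k ∷ v) []            = [] ∷ []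
subs (k ∷ v) ((p , g) ∷ γ) = concatMap (λ (_ , g′) → map ((p , g′) ∷_) (subs v γ)) (sub k g)

∑-subs : ∀ k v p g γ f → ∑ (subs (k ∷ v) ((p , g) ∷ γ)) f ≡ ∑ (sub k g) (λ (_ , g′) → ∑ (subs v γ) (λ γ′ → f ((p , g′) ∷ γ′)))
∑-subs k v p g γ f = ≡.trans (∑-concatMap _ (sub k g) f) (∑-cong (sub k g) (λ _ → ∑-map _ (subs v γ) f))

∑-sub-sub : ∀ a b g (f : ℕ → ℤ) → ∑ (sub a g) (λ (_ , x) → ∑ (sub b x) (λ (_ , y) → f y)) ≡ ∑ (sub (a + b) g) (λ (_ , y) → f y)
∑-sub-sub zero    b g       f = ℤₚ.+-identityʳ _
∑-sub-sub (suc a) b zero    f = ≡.refl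
∑-sub-sub (suc a) b (suc g) f = ∑-sub-sub a b g f

∑-sub-comm : ∀ a b g (f : ℕ → ℤ) →
  ∑ (sub a g) (λ (_ , x) → ∑ (sub b x) (λ (_ , y) → f y)) ≡ ∑ (sub b g) (λ (_ , x) → ∑ (sub a x) (λ (_ , y) → f y))
∑-sub-comm a b g f = ≡.trans (∑-sub-sub a b g f) (≡.trans (cong (λ k → ∑ (sub k g) (λ (_ , y) → f y)) (ℕₚ.+-comm a b)) (sym (∑-sub-sub b a g f)))

∑-subs-subs : ∀ k l v w p g γ (f : Word → ℤ) →
  ∑ (subs (k ∷ v) ((p , g) ∷ γ)) (λ γ₁ → ∑ (subs (l ∷ w) γ₁) f) ≡
  ∑ (sub k g) (λ (_ , x) → ∑ (sub l x) (λ (_ , y) → ∑ (subs v γ) (λ γ₁ → ∑ (subs w γ₁) (λ γ₂ → f ((p , y) ∷ γ₂)))))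
∑-subs-subs k l v w p g γ f = ≡.trans (∑-subs k v p g γ _) (∑-cong (sub k g) (λ (_ , x) →
  ≡.trans (∑-cong (subs v γ) (λ γ₁ → ∑-subs l w p x γ₁ f)) (∑-comm (subs v γ) (sub l x) _)))

∑-subs-comm : ∀ v w γ (f : Word → ℤ) → ∑ (subs v γ) (λ γ₁ → ∑ (subs w γ₁) f) ≡ ∑ (subs w γ) (λ γ₁ → ∑ (subs v γ₁) f)
∑-subs-comm []      w       γ  f = ≡.trans (ℤₚ.+-identityʳ _) (∑-cong (subs w γ) (λ γ₁ → sym (ℤₚ.+-identityʳ _)))
∑-subs-comm (k ∷ v) []      γ  f = ≡.trans (∑-cong (subs (k ∷ v) γ) (λ γ₁ → ℤₚ.+-identityʳ _)) (sym (ℤₚ.+-identityʳ _))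
∑-subs-comm (k ∷ v) (l ∷ w) [] f = ≡.refl
∑-subs-comm (k ∷ v) (l ∷ w) ((p , g) ∷ γ) f = ≡.trans (∑-subs-subs k l v w p g γ f) (≡.trans
  (≡.trans (∑-sub-comm k l g _) (∑-cong (sub l g) (λ (_ , x) → ∑-cong (sub k x) (λ (_ , y) → ∑-subs-comm v w γ _))))
  (sym (∑-subs-subs l k w v p g γ f)))

scale : ℕ → List ℕ → List ℕ
scale t = map (t *_)

∑-subs-scale : ∀ s t v γ (f : Word → ℤ) →
  ∑ (subs (scale s v) γ) (λ γ₁ → ∑ (subs (scale t v) γ₁) f) ≡ ∑ (subs (scale (s + t) v) γ) f
∑-subs-scale s t []      γ  f = ≡.trans (ℤₚ.+-identityʳ _) ≡.refl
∑-subs-scale s t (k ∷ v) [] f = ℤₚ.+-identityʳ _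
∑-subs-scale s t (k ∷ v) ((p , g) ∷ γ) f = ≡.trans (∑-subs-subs (s * k) (t * k) (scale s v) (scale t v) p g γ f) (≡.trans
  (∑-sub-sub (s * k) (t * k) g _) (≡.trans (cong (λ i → ∑ (sub i g) (λ (_ , y) → ∑ (subs (scale s v) γ) (λ γ₁ → ∑ (subs (scale t v) γ₁) (λ γ₂ → f ((p , y) ∷ γ₂))))) (sym (ℕₚ.*-distribʳ-+ k s t)))
  (≡.trans (∑-cong (sub ((s + t) * k) g) (λ (_ , y) → ∑-subs-scale s t v γ _)) (sym (∑-subs ((s + t) * k) (scale (s + t) v) p g γ f)))))

scale-1 : ∀ v → scale 1 v ≡ v
scale-1 v = ≡.trans (Listₚ.map-cong ℕₚ.*-identityˡ v) (Listₚ.map-id v)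

subs-zero : ∀ v γ → subs (scale 0 v) γ ≡ γ ∷ []
subs-zero []      γ             = ≡.refl
subs-zero (k ∷ v) []            = ≡.refl
subs-zero (k ∷ v) ((p , g) ∷ γ) rewrite subs-zero v γ = ≡.refl

length-subs : ∀ v γ → All (λ γ′ → length γ′ ≡ length γ) (subs v γ)
length-subs []      γ             = ≡.refl ∷ []
length-subs (k ∷ v) []            = ≡.refl ∷ []
length-subs (k ∷ v) ((p , g) ∷ γ) = All-concatMap _ (All.universal (λ _ → AllP.map⁺ (All.map (cong suc) (length-subs v γ))) (sub k g))

-- The functional that belongs to the constant 1: a factor of positive degree makes it vanish.
δ₀ : Word → ℤ
δ₀ []                = + 1
δ₀ ((p , zero)  ∷ w) = δ₀ w
δ₀ ((p , suc _) ∷ w) = + 0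

δ₀-swap : ∀ x y {u v} → δ₀ u ≡ δ₀ v → δ₀ (x ∷ y ∷ u) ≡ δ₀ (y ∷ x ∷ v)
δ₀-swap (p , zero)  (q , zero)  e = e
δ₀-swap (p , zero)  (q , suc _) e = ≡.refl
δ₀-swap (p , suc _) (q , zero)  e = ≡.refl
δ₀-swap (p , suc _) (q , suc _) e = ≡.refl

δ₀-super : Super δ₀
δ₀-super .perm refl             = ≡.refl
δ₀-super .perm (prep (p , zero)  q) = δ₀-super .perm q
δ₀-super .perm (prep (p , suc _) q) = ≡.refl
δ₀-super .perm (swap x y p)     = δ₀-swap x y (δ₀-super .perm p)
δ₀-super .perm (trans p q)      = ≡.trans (δ₀-super .perm p) (δ₀-super .perm q)
δ₀-super .drop p w = ≡.refl
δ₀-super .rel k w = ≡.trans (∑-antidiag-suc k (λ (i , j) → sg j *ℤ δ₀ ((false , i) ∷ (true , j) ∷ w)))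
  (cong₂ _+ℤ_ (ℤₚ.*-zeroʳ (sg (suc k))) (∑-ε (antidiag k) (λ (i , j) → ℤₚ.*-zeroʳ (sg j))))

lowers-at-zero : ∀ q w (φ : ℕ → Word → ℤ) → (∀ t w′ → φ (suc t) w′ ≡ + 0) → ∑ (lowers q w) (λ (t , w′) → φ t w′) ≡ φ 0 w
lowers-at-zero q []            φ h = ℤₚ.+-identityʳ _
lowers-at-zero q ((p , n) ∷ w) φ h = ≡.trans (∑-lowers q p n w (λ (t , w′) → φ t w′)) (go (p xor q) n)
  where
  first : ∀ k → ∑ (lowers q w) (λ (t , w′) → φ t ((p , k) ∷ w′)) ≡ φ 0 ((p , k) ∷ w)
  first k = lowers-at-zero q w (λ t w′ → φ t ((p , k) ∷ w′)) (λ t w′ → h t _)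
  rest : ∀ i k → ∑ (lowers q w) (λ (t , w′) → φ (suc i + t) ((p , k) ∷ w′)) ≡ + 0
  rest i k = ∑-ε (lowers q w) (λ (t , w′) → h _ _)
  go : ∀ b n → ∑ (take≤ b n) (λ (i , j) → ∑ (lowers q w) (λ (t , w′) → φ (i + t) ((p , j) ∷ w′))) ≡ φ 0 ((p , n) ∷ w)
  go true  zero    = ≡.trans (ℤₚ.+-identityʳ _) (first 0)
  go false zero    = ≡.trans (ℤₚ.+-identityʳ _) (first 0)
  go true  (suc n) = ≡.trans (cong₂ (λ a b → a +ℤ (b +ℤ + 0)) (first (suc n)) (rest 0 n)) (ℤₚ.+-identityʳ _)
  go false (suc n) = ≡.trans (∑-antidiag-suc n (λ (i , j) → ∑ (lowers q w) (λ (t , w′) → φ (i + t) ((p , j) ∷ w′))))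
    (≡.trans (cong₂ _+ℤ_ (first (suc n)) (∑-ε (antidiag n) (λ (i , j) → rest i j))) (ℤₚ.+-identityʳ _))

Ext-0 : ∀ w {F} → (∀ u → F u ≡ + 0) → Ext F w ≡ + 0
Ext-0 []            h = h []
Ext-0 ((s , a) ∷ w) h = Ext-0 w (λ u → ∑-ε (lowers (not s) u) (λ (t , _) → ≡.trans (cong (sg t *ℤ_) (h _)) (ℤₚ.*-zeroʳ (sg t))))

Ext-δ₀ : ∀ w → Ext δ₀ w ≡ δ₀ w
Ext-δ₀ []                = ≡.refl
Ext-δ₀ ((p , suc a) ∷ w) = Ext-0 w (λ u → ∑-ε (lowers (not p) u) (λ (t , _) → ℤₚ.*-zeroʳ (sg t)))
Ext-δ₀ ((p , zero) ∷ w)  = ≡.trans (Ext-cong w (λ u → ≡.trans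
  (lowers-at-zero (not p) u (λ t u′ → sg t *ℤ δ₀ ((p , t) ∷ u′)) (λ t _ → ℤₚ.*-zeroʳ (sg (suc t)))) (ℤₚ.*-identityˡ _))) (Ext-δ₀ w)

Mono : Set
Mono = Bool × List ℕ

-- The number of ways to write the pair (ξ, γ) by means of the monomials in Ls, i.e. the coefficient
-- at γ of the product of the h_k (even ξ-letters) and e_k (odd ξ-letters) of the alphabet Ls.
Wl : List Mono → Word → Word → ℤ
Wl []             ξ γ = δ₀ ξ *ℤ δ₀ γ
Wl ((q , v) ∷ Ls) ξ γ = ∑ (lowers q ξ) (λ (t , ξ′) → ∑ (subs (scale t v) γ) (λ γ′ → Wl Ls ξ′ γ′))

-- In a plethysm each monomial behaves towards ξ like a single variable of its own parity, so
-- supersymmetry in ξ comes from `lowers-super`.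
Wl-super : ∀ Ls γ → Super (λ ξ → Wl Ls ξ γ)
Wl-super []             γ .perm p = cong (_*ℤ δ₀ γ) (δ₀-super .perm p)
Wl-super []             γ .drop p w = ≡.refl
Wl-super []             γ .rel k w = ≡.trans (∑-cong (antidiag (suc k)) (λ (i , j) → sym (ℤₚ.*-assoc (sg j) (δ₀ ((false , i) ∷ (true , j) ∷ w)) (δ₀ γ))))
  (≡.trans (sym (∑-*ʳ (δ₀ γ) (antidiag (suc k)) (λ (i , j) → sg j *ℤ δ₀ ((false , i) ∷ (true , j) ∷ w)))) (cong (_*ℤ δ₀ γ) (δ₀-super .rel k w)))
Wl-super ((q , v) ∷ Ls) γ = lowers-super q (λ t → Super-∑ (subs (scale t v) γ) (λ γ′ → Wl-super Ls γ′))

Wl-↭ : ∀ {Ls Ms} → Ls ↭ Ms → ∀ ξ γ → Wl Ls ξ γ ≡ Wl Ms ξ γ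
Wl-↭ refl ξ γ = ≡.refl
Wl-↭ (prep (q , v) p) ξ γ = ∑-cong (lowers q ξ) (λ (t , ξ′) → ∑-cong (subs (scale t v) γ) (λ γ′ → Wl-↭ p ξ′ γ′))
Wl-↭ (swap {Ls} {Ms} (q , v) (r , w) p) ξ γ = begin
  ∑ (lowers q ξ) (λ (s , ξ₁) → ∑ (subs (scale s v) γ) (λ γ₁ → ∑ (lowers r ξ₁) (λ (t , ξ₂) → ∑ (subs (scale t w) γ₁) (Wl Ls ξ₂))))
    ≡⟨ ∑-cong (lowers q ξ) (λ (s , ξ₁) → ∑-comm (subs (scale s v) γ) (lowers r ξ₁) _) ⟩
  ∑ (lowers q ξ) (λ (s , ξ₁) → ∑ (lowers r ξ₁) (λ (t , ξ₂) → ∑ (subs (scale s v) γ) (λ γ₁ → ∑ (subs (scale t w) γ₁) (Wl Ls ξ₂))))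
    ≡⟨ lowers-comm q r ξ (λ s t ξ₂ → ∑ (subs (scale s v) γ) (λ γ₁ → ∑ (subs (scale t w) γ₁) (Wl Ls ξ₂))) ⟩
  ∑ (lowers r ξ) (λ (t , ξ₁) → ∑ (lowers q ξ₁) (λ (s , ξ₂) → ∑ (subs (scale s v) γ) (λ γ₁ → ∑ (subs (scale t w) γ₁) (Wl Ls ξ₂))))
    ≡⟨ ∑-cong (lowers r ξ) (λ (t , ξ₁) → ≡.trans
         (∑-cong (lowers q ξ₁) (λ (s , ξ₂) → ≡.trans (∑-subs-comm (scale s v) (scale t w) γ (Wl Ls ξ₂))
           (∑-cong (subs (scale t w) γ) (λ γ₁ → ∑-cong (subs (scale s v) γ₁) (λ γ₂ → Wl-↭ p ξ₂ γ₂)))))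
         (sym (∑-comm (subs (scale t w) γ) (lowers q ξ₁) _))) ⟩
  ∑ (lowers r ξ) (λ (t , ξ₁) → ∑ (subs (scale t w) γ) (λ γ₁ → ∑ (lowers q ξ₁) (λ (s , ξ₂) → ∑ (subs (scale s v) γ₁) (Wl Ms ξ₂)))) ∎
  where open ≡-Reasoning
Wl-↭ (trans p q) ξ γ = ≡.trans (Wl-↭ p ξ γ) (Wl-↭ q ξ γ)

-- Semistandard tableaux

⟦_⟧ : Bool → ℤ
⟦ b ⟧ = if b then + 1 else + 0

⟦∧⟧ : ∀ a b → ⟦ a ∧ b ⟧ ≡ ⟦ a ⟧ *ℤ ⟦ b ⟧
⟦∧⟧ true  b = sym (ℤₚ.*-identityˡ ⟦ b ⟧)
⟦∧⟧ false b = ≡.refl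

length-filterᵇ : ∀ (P : X → Bool) xs → + length (filterᵇ P xs) ≡ ∑ xs (λ x → ⟦ P x ⟧)
length-filterᵇ P []       = ≡.refl
length-filterᵇ P (x ∷ xs) with P x
... | true  = ≡.trans (ℤₚ.pos-+ 1 _) (cong (+ 1 +ℤ_) (length-filterᵇ P xs))
... | false = ≡.trans (length-filterᵇ P xs) (sym (ℤₚ.+-identityˡ _))

suc-≤ᵇ : ∀ m n → (suc m ≤ᵇ suc n) ≡ (m ≤ᵇ n)
suc-≤ᵇ zero    n = ≡.refl
suc-≤ᵇ (suc m) n = ≡.refl

≤⇒≤ᵇ≡true : ∀ {m n} → m ≤ n → (m ≤ᵇ n) ≡ true
≤⇒≤ᵇ≡true z≤n = ≡.refl
≤⇒≤ᵇ≡true {suc m} {suc n} (s≤s le) = ≡.trans (suc-≤ᵇ m n) (≤⇒≤ᵇ≡true le)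

>⇒≤ᵇ≡false : ∀ {m n} → n < m → (m ≤ᵇ n) ≡ false
>⇒≤ᵇ≡false {suc m} {zero}  _        = ≡.refl
>⇒≤ᵇ≡false {suc m} {suc n} (s≤s lt) = ≡.trans (suc-≤ᵇ m n) (>⇒≤ᵇ≡false lt)

le : ℕ → List ℕ → Bool
le a []      = true
le a (y ∷ _) = a ≤ᵇ y

weakInc-∷ : ∀ a row → weakInc (a ∷ row) ≡ le a row ∧ weakInc row
weakInc-∷ a []      = ≡.refl
weakInc-∷ a (y ∷ _) = ≡.refl

∑-allRows : ∀ r K (f : List ℕ → ℤ) → ∑ (allRows (suc r) K) f ≡ ∑ (upTo K) (λ a → ∑ (allRows r K) (λ row → f (a ∷ row)))
∑-allRows r K f = ≡.trans (∑-concatMap _ (upTo K) f) (∑-cong (upTo K) (λ a → ∑-map _ (allRows r K) f))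

colStrict-[] : ∀ xs → colStrict xs [] ≡ true
colStrict-[] []      = ≡.refl
colStrict-[] (_ ∷ _) = ≡.refl

module _ (k : ℕ) where

  allRows-good : ∀ r → All (λ u → length u ≡ r × All (_< k) u) (allRows r k)
  allRows-good zero    = (≡.refl , []) ∷ []
  allRows-good (suc r) = All-concatMap _ (All.map (λ a<k → AllP.map⁺ (All.map (λ (e , b) → cong suc e , a<k ∷ b) (allRows-good r))) (AllP.all-upTo k))

  -- A weakly increasing row ends in a block of the largest letter k.
  ∑-weakInc : ∀ r (f : List ℕ → ℤ) →
    ∑ (allRows r (suc k)) (λ row → ⟦ weakInc row ⟧ *ℤ f row) ≡
    ∑ (antidiag r) (λ (i , j) → ∑ (allRows j k) (λ u → ⟦ weakInc u ⟧ *ℤ f (u ++ replicate i k)))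
  ∑-weakInc zero    f = lem (f [])
    where
    lem : ∀ x → + 1 *ℤ x +ℤ + 0 ≡ + 1 *ℤ x +ℤ + 0 +ℤ + 0
    lem = solve-∀
  ∑-weakInc (suc r) f = begin
    ∑ (allRows (suc r) (suc k)) (λ row → ⟦ weakInc row ⟧ *ℤ f row)
      ≡⟨ ∑-allRows r (suc k) _ ⟩
    ∑ (upTo (suc k)) (λ a → ∑ (allRows r (suc k)) (λ row → ⟦ weakInc (a ∷ row) ⟧ *ℤ f (a ∷ row)))
      ≡⟨ ∑-cong (upTo (suc k)) (λ a → ≡.trans (∑-cong (allRows r (suc k)) (λ row → peel a row (f (a ∷ row)))) (∑-weakInc r (λ row → ⟦ le a row ⟧ *ℤ f (a ∷ row)))) ⟩
    ∑ (upTo (suc k)) T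
      ≡⟨ cong (λ l → ∑ l T) (sym (Listₚ.upTo-∷ʳ k)) ⟩
    ∑ (upTo k ∷ʳ k) T
      ≡⟨ ∑-++ (upTo k) T ⟩
    ∑ (upTo k) T +ℤ (T k +ℤ + 0)
      ≡⟨ cong₂ _+ℤ_ small (≡.trans (ℤₚ.+-identityʳ (T k)) top) ⟩
    ∑ (antidiag r) (λ (i , j) → R (i , suc j)) +ℤ R (suc r , 0)
      ≡⟨ sym (∑-antidiag-snoc r R) ⟩
    ∑ (antidiag (suc r)) R ∎
    where
    open ≡-Reasoning
    R : ℕ × ℕ → ℤ
    R (i , j) = ∑ (allRows j k) (λ u → ⟦ weakInc u ⟧ *ℤ f (u ++ replicate i k))
    T : ℕ → ℤ
    T a = ∑ (antidiag r) (λ (i , j) → ∑ (allRows j k) (λ u → ⟦ weakInc u ⟧ *ℤ (⟦ le a (u ++ replicate i k) ⟧ *ℤ f (a ∷ u ++ replicate i k))))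
    peel : ∀ a row z → ⟦ weakInc (a ∷ row) ⟧ *ℤ z ≡ ⟦ weakInc row ⟧ *ℤ (⟦ le a row ⟧ *ℤ z)
    peel a row z = ≡.trans (cong (_*ℤ z) (≡.trans (cong ⟦_⟧ (weakInc-∷ a row)) (⟦∧⟧ (le a row) (weakInc row)))) (ring ⟦ le a row ⟧ ⟦ weakInc row ⟧ z)
      where
      ring : ∀ a b c → a *ℤ b *ℤ c ≡ b *ℤ (a *ℤ c)
      ring = solve-∀
    le-++ : ∀ {a} u i → a < k → le a (u ++ replicate i k) ≡ le a u
    le-++ []      zero    a<k = ≡.refl
    le-++ []      (suc i) a<k = ≤⇒≤ᵇ≡true (ℕₚ.<⇒≤ a<k)
    le-++ (y ∷ u) i       a<k = ≡.refl
    small : ∑ (upTo k) T ≡ ∑ (antidiag r) (λ (i , j) → R (i , suc j))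
    small = ≡.trans (∑-cong-All (All.map (λ {a} a<k → ∑-cong (antidiag r) (λ (i , j) → ∑-cong (allRows j k) (λ u →
        ≡.trans (cong (λ b → ⟦ weakInc u ⟧ *ℤ (⟦ b ⟧ *ℤ f (a ∷ u ++ replicate i k))) (le-++ u i a<k)) (sym (peel a u _))))) (AllP.all-upTo k)))
      (≡.trans (∑-comm (upTo k) (antidiag r) _) (∑-cong (antidiag r) (λ (i , j) → sym (∑-allRows j k _))))
    top : T k ≡ R (suc r , 0)
    top = ≡.trans (∑-antidiag-last r (λ i j → ∑ (allRows j k) (λ u → ⟦ weakInc u ⟧ *ℤ (⟦ le k (u ++ replicate i k) ⟧ *ℤ f (k ∷ u ++ replicate i k)))) zeros) (end r)
      where
      zeros : ∀ i j → ∑ (allRows (suc j) k) (λ u → ⟦ weakInc u ⟧ *ℤ (⟦ le k (u ++ replicate i k) ⟧ *ℤ f (k ∷ u ++ replicate i k))) ≡ + 0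
      zeros i j = ≡.trans (∑-allRows j k _) (≡.trans (∑-cong-All (All.map (λ {b} b<k → ∑-ε (allRows j k) (λ row →
        ≡.trans (cong (λ c → ⟦ weakInc (b ∷ row) ⟧ *ℤ (⟦ c ⟧ *ℤ f (k ∷ (b ∷ row) ++ replicate i k))) (>⇒≤ᵇ≡false b<k))
          (ℤₚ.*-zeroʳ ⟦ weakInc (b ∷ row) ⟧))) (AllP.all-upTo k))) (∑-ε (upTo k) (λ _ → ≡.refl)))
      end : ∀ r → + 1 *ℤ (⟦ le k (replicate r k) ⟧ *ℤ f (k ∷ replicate r k)) +ℤ + 0 ≡ + 1 *ℤ f (k ∷ replicate r k) +ℤ + 0
      end zero    = cong (λ z → + 1 *ℤ z +ℤ + 0) (ℤₚ.*-identityˡ (f (k ∷ [])))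
      end (suc r) = cong (λ z → + 1 *ℤ z +ℤ + 0) (≡.trans (cong (λ b → ⟦ b ⟧ *ℤ f (k ∷ k ∷ replicate r k)) (≤⇒≤ᵇ≡true (ℕₚ.≤-refl {k}))) (ℤₚ.*-identityˡ _))

  -- Nothing can stand below the largest letter `k`, so the whole lower row has to fit under `u`;
  -- there its own block of `k` is automatically larger than what is above it.
  colStrict-blocks : ∀ u a u′ i → All (_< k) u → All (_< k) u′ → length u′ + i ≤ length u + a →
    colStrict (u ++ replicate a k) (u′ ++ replicate i k) ≡ colStrict u u′ ∧ (length u′ + i ≤ᵇ length u)
  colStrict-blocks []      a       []       zero    _ _ _ = colStrict-[] (replicate a k)
  colStrict-blocks []      (suc a) []       (suc i) _ _ _ = cong (_∧ colStrict (replicate a k) (replicate i k)) (≥⇒<ᵇ≡false (ℕₚ.≤-refl {k}))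
  colStrict-blocks []      (suc a) (y ∷ u′) i       _ (y<k ∷ _) _ = cong (_∧ colStrict (replicate a k) (u′ ++ replicate i k)) (≥⇒<ᵇ≡false (ℕₚ.<⇒≤ y<k))
  colStrict-blocks (x ∷ u) a       []       zero    _ _ _ = ≡.refl
  colStrict-blocks (x ∷ u) a       []       (suc i) (x<k ∷ bu) bu′ (s≤s h) = ≡.trans
    (cong₂ _∧_ (<⇒<ᵇ≡true x<k) (colStrict-blocks u a [] i bu bu′ h)) (≡.trans (cong (_∧ (i ≤ᵇ length u)) (colStrict-[] u)) (sym (suc-≤ᵇ i (length u))))
  colStrict-blocks (x ∷ u) a       (y ∷ u′) i       (_ ∷ bu) (_ ∷ bu′) (s≤s h) = ≡.trans
    (cong ((x <ᵇ y) ∧_) (≡.trans (colStrict-blocks u a u′ i bu bu′ h) (cong (colStrict u u′ ∧_) (sym (suc-≤ᵇ (length u′ + i) (length u))))))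
    (sym (∧-assoc (x <ᵇ y) (colStrict u u′) _))

-- The sum of φ (reading word) over the tableaux of shape π in K letters that fit below the row p.
tableaux : ℕ → List ℕ → List ℕ → (List ℕ → ℤ) → ℤ
tableaux K p []       φ = φ []
tableaux K p (r ∷ rs) φ = ∑ (allRows r K) (λ row → ⟦ colStrict p row ∧ weakInc row ⟧ *ℤ tableaux K row rs (λ ks → φ (row ++ ks)))

tableaux-cong : ∀ K p π {φ ψ} → (∀ ks → All (_< K) ks → φ ks ≡ ψ ks) → tableaux K p π φ ≡ tableaux K p π ψ
tableaux-cong K p []       h = h [] []
tableaux-cong K p (r ∷ rs) h = ∑-cong-All (All.map (λ { {row} (_ , b) → cong (⟦ colStrict p row ∧ weakInc row ⟧ *ℤ_)
  (tableaux-cong K row rs (λ ks a → h (row ++ ks) (AllP.++⁺ b a))) }) (allRows-good K r))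

tableaux-∑ : ∀ K p π (xs : List X) (φ : X → List ℕ → ℤ) → tableaux K p π (λ ks → ∑ xs (λ x → φ x ks)) ≡ ∑ xs (λ x → tableaux K p π (φ x))
tableaux-∑ K p []       xs φ = ≡.refl
tableaux-∑ K p (r ∷ rs) xs φ = ≡.trans (∑-cong (allRows r K) (λ row → ≡.trans
  (cong (⟦ colStrict p row ∧ weakInc row ⟧ *ℤ_) (tableaux-∑ K row rs xs (λ x ks → φ x (row ++ ks)))) (∑-*ˡ ⟦ colStrict p row ∧ weakInc row ⟧ xs _)))
  (∑-comm (allRows r K) xs _)

∑-antidiag-≥ : ∀ r h (f : ℕ → ℕ → ℤ) → h ≤ r →
  ∑ (antidiag r) (λ (i , j) → ⟦ h ≤ᵇ j ⟧ *ℤ f i j) ≡ ∑ (antidiag (r ∸ h)) (λ (i , j) → f i (h + j))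
∑-antidiag-≥ r       zero    f _       = ∑-cong (antidiag r) (λ (i , j) → ℤₚ.*-identityˡ (f i j))
∑-antidiag-≥ (suc r) (suc h) f (s≤s l) = ≡.trans (∑-antidiag-snoc r (λ (i , j) → ⟦ suc h ≤ᵇ j ⟧ *ℤ f i j)) (≡.trans (ℤₚ.+-identityʳ _)
  (≡.trans (∑-cong (antidiag r) (λ (i , j) → cong (λ b → ⟦ b ⟧ *ℤ f i (suc j)) (suc-≤ᵇ h j))) (∑-antidiag-≥ r h (λ i j → f i (suc j)) l)))

hd-≤ : ∀ {r rs} → Linked _≥_ (r ∷ rs) → hd rs ≤ r
hd-≤ [-]     = z≤n
hd-≤ (p ∷ _) = p

tail-Linked : ∀ {r rs} → Linked _≥_ (r ∷ rs) → Linked _≥_ rs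
tail-Linked [-]     = []
tail-Linked (_ ∷ l) = l

module _ (k : ℕ) where

  private
    Goal : List ℕ → Set
    Goal π = ∀ u a {φ} → All (_< k) u → Linked _≥_ π → hd π ≤ length u + a → Sym φ →
      tableaux (suc k) (u ++ replicate a k) π φ ≡
      ⟦ hd π ≤ᵇ length u ⟧ *ℤ ∑ (strips π) (λ (t , ζ) → tableaux k u ζ (λ ks → φ (replicate t k ++ ks)))

    replicate-++ : ∀ i t → replicate i k ++ replicate t k ≡ replicate (i + t) k
    replicate-++ zero    t = ≡.refl
    replicate-++ (suc i) t = cong (k ∷_) (replicate-++ i t)

    rearrange : ∀ u i t ks → (u ++ replicate i k) ++ replicate t k ++ ks ↭ replicate (i + t) k ++ u ++ ks
    rearrange u i t ks = ↭-trans (↭-reflexive (Listₚ.++-assoc u (replicate i k) _)) (↭-trans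
      (↭-reflexive (cong (u ++_) (≡.trans (sym (Listₚ.++-assoc (replicate i k) (replicate t k) ks)) (cong (_++ ks) (replicate-++ i t)))))
      (↭-trans (↭-reflexive (sym (Listₚ.++-assoc u (replicate (i + t) k) ks))) (↭-trans (Perm.++⁺ʳ ks (Perm.++-comm u (replicate (i + t) k)))
      (↭-reflexive (Listₚ.++-assoc (replicate (i + t) k) u ks)))))

    fits : (List ℕ → Bool) → (List ℕ → ℤ) → ℕ × List ℕ → ℤ
    fits c φ (t , [])    = + 0
    fits c φ (t , z ∷ ζ) = ∑ (allRows z k) (λ u → ⟦ c u ∧ weakInc u ⟧ *ℤ tableaux k u ζ (λ ks → φ (replicate t k ++ u ++ ks)))

    -- The conditions `c`, `c₀`, `b` are abstract so that the same argument serves the first row,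
    -- with nothing above it, and a row below `u ++ replicate a k`. The indicator delivered by the
    -- induction hypothesis is the lower bound that a horizontal strip imposes on the row.
    step : ∀ r rs → Goal rs → Linked _≥_ (r ∷ rs) → ∀ {φ} → Sym φ → (c c₀ : List ℕ → Bool) (b : Bool) →
      (∀ u i → All (_< k) u → length u + i ≡ r → c (u ++ replicate i k) ≡ c₀ u ∧ b) →
      ∑ (allRows r (suc k)) (λ row → ⟦ c row ∧ weakInc row ⟧ *ℤ tableaux (suc k) row rs (λ ks → φ (row ++ ks))) ≡
      ⟦ b ⟧ *ℤ ∑ (strips (r ∷ rs)) (fits c₀ φ)
    step r rs IH l {φ} S c c₀ b hc = begin
      ∑ (allRows r (suc k)) (λ row → ⟦ c row ∧ weakInc row ⟧ *ℤ Tab row)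
        ≡⟨ ∑-cong (allRows r (suc k)) (λ row → ≡.trans (cong (_*ℤ Tab row) (⟦∧⟧ (c row) (weakInc row))) (ring₁ ⟦ c row ⟧ ⟦ weakInc row ⟧ (Tab row))) ⟩
      ∑ (allRows r (suc k)) (λ row → ⟦ weakInc row ⟧ *ℤ (⟦ c row ⟧ *ℤ Tab row))
        ≡⟨ ∑-weakInc k r (λ row → ⟦ c row ⟧ *ℤ Tab row) ⟩
      ∑ (antidiag r) (λ (i , j) → ∑ (allRows j k) (λ u → ⟦ weakInc u ⟧ *ℤ (⟦ c (u ++ replicate i k) ⟧ *ℤ Tab (u ++ replicate i k))))
        ≡⟨ ∑-cong-All (All.map (λ { {i , j} e → ∑-cong-All (All.map (λ { {u} (eu , bu) → inner i j e u eu bu }) (allRows-good k j)) }) (take≤-sum false r)) ⟩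
      ∑ (antidiag r) (λ (i , j) → ∑ (allRows j k) (λ u → ⟦ b ⟧ *ℤ (⟦ hd rs ≤ᵇ j ⟧ *ℤ ∑ (strips rs) (λ (t , ζ) → Z i u t ζ))))
        ≡⟨ ∑-cong (antidiag r) (λ (i , j) → ≡.trans (sym (∑-*ˡ ⟦ b ⟧ (allRows j k) _)) (cong (⟦ b ⟧ *ℤ_) (≡.trans (sym (∑-*ˡ ⟦ hd rs ≤ᵇ j ⟧ (allRows j k) _))
             (cong (⟦ hd rs ≤ᵇ j ⟧ *ℤ_) (∑-comm (allRows j k) (strips rs) _))))) ⟩
      ∑ (antidiag r) (λ (i , j) → ⟦ b ⟧ *ℤ (⟦ hd rs ≤ᵇ j ⟧ *ℤ ∑ (strips rs) (λ (t , ζ) → ∑ (allRows j k) (λ u → Z i u t ζ))))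
        ≡⟨ sym (∑-*ˡ ⟦ b ⟧ (antidiag r) _) ⟩
      ⟦ b ⟧ *ℤ ∑ (antidiag r) (λ (i , j) → ⟦ hd rs ≤ᵇ j ⟧ *ℤ ∑ (strips rs) (λ (t , ζ) → ∑ (allRows j k) (λ u → Z i u t ζ)))
        ≡⟨ cong (⟦ b ⟧ *ℤ_) (≡.trans (∑-antidiag-≥ r (hd rs) _ (hd-≤ l)) (sym (∑-strips r rs (fits c₀ φ)))) ⟩
      ⟦ b ⟧ *ℤ ∑ (strips (r ∷ rs)) (fits c₀ φ) ∎
      where
      open ≡-Reasoning
      Tab : List ℕ → ℤ
      Tab row = tableaux (suc k) row rs (λ ks → φ (row ++ ks))
      Z : ℕ → List ℕ → ℕ → List ℕ → ℤ
      Z i u t ζ = ⟦ c₀ u ∧ weakInc u ⟧ *ℤ tableaux k u ζ (λ ks → φ (replicate (i + t) k ++ u ++ ks))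
      ring₁ : ∀ a b c → a *ℤ b *ℤ c ≡ b *ℤ (a *ℤ c)
      ring₁ = solve-∀
      ring₂ : ∀ w c b h s → w *ℤ (c *ℤ b *ℤ (h *ℤ s)) ≡ b *ℤ (h *ℤ (c *ℤ w *ℤ s))
      ring₂ = solve-∀
      inner : ∀ i j → i + j ≡ r → ∀ u → length u ≡ j → All (_< k) u →
        ⟦ weakInc u ⟧ *ℤ (⟦ c (u ++ replicate i k) ⟧ *ℤ Tab (u ++ replicate i k)) ≡ ⟦ b ⟧ *ℤ (⟦ hd rs ≤ᵇ j ⟧ *ℤ ∑ (strips rs) (λ (t , ζ) → Z i u t ζ))
      inner i j e u eu bu = begin
        ⟦ weakInc u ⟧ *ℤ (⟦ c (u ++ replicate i k) ⟧ *ℤ Tab (u ++ replicate i k))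
          ≡⟨ cong₂ (λ x y → ⟦ weakInc u ⟧ *ℤ (x *ℤ y)) (≡.trans (cong ⟦_⟧ (hc u i bu len)) (⟦∧⟧ (c₀ u) b))
               (IH u i bu (tail-Linked l) (ℕₚ.≤-trans (hd-≤ l) (ℕₚ.≤-reflexive (sym len))) (λ p → S (Perm.++⁺ˡ (u ++ replicate i k) p))) ⟩
        ⟦ weakInc u ⟧ *ℤ (⟦ c₀ u ⟧ *ℤ ⟦ b ⟧ *ℤ (⟦ hd rs ≤ᵇ length u ⟧ *ℤ V))
          ≡⟨ ring₂ ⟦ weakInc u ⟧ ⟦ c₀ u ⟧ ⟦ b ⟧ ⟦ hd rs ≤ᵇ length u ⟧ V ⟩
        ⟦ b ⟧ *ℤ (⟦ hd rs ≤ᵇ length u ⟧ *ℤ (⟦ c₀ u ⟧ *ℤ ⟦ weakInc u ⟧ *ℤ V))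
          ≡⟨ cong₂ (λ x y → ⟦ b ⟧ *ℤ (⟦ hd rs ≤ᵇ x ⟧ *ℤ y)) eu (≡.trans (cong (_*ℤ V) (sym (⟦∧⟧ (c₀ u) (weakInc u))))
               (≡.trans (∑-*ˡ ⟦ c₀ u ∧ weakInc u ⟧ (strips rs) _) (∑-cong (strips rs) (λ (t , ζ) → cong (⟦ c₀ u ∧ weakInc u ⟧ *ℤ_)
                 (tableaux-cong k u ζ (λ ks _ → S (rearrange u i t ks))))))) ⟩
        ⟦ b ⟧ *ℤ (⟦ hd rs ≤ᵇ j ⟧ *ℤ ∑ (strips rs) (λ (t , ζ) → Z i u t ζ)) ∎
        where
        len : length u + i ≡ r
        len = ≡.trans (cong (_+ i) eu) (≡.trans (ℕₚ.+-comm j i) e)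
        V = ∑ (strips rs) (λ (t , ζ) → tableaux k u ζ (λ ks → φ ((u ++ replicate i k) ++ replicate t k ++ ks)))

    unfold : ∀ p r rs φ → ∑ (strips (r ∷ rs)) (fits (colStrict p) φ) ≡
      ∑ (strips (r ∷ rs)) (λ (t , ζ) → tableaux k p ζ (λ ks → φ (replicate t k ++ ks)))
    unfold p r rs φ = ≡.trans (∑-strips r rs (fits (colStrict p) φ)) (sym (∑-strips r rs (λ (t , ζ) → tableaux k p ζ (λ ks → φ (replicate t k ++ ks)))))

    branch : ∀ π → Goal π
    branch []       u a {φ} _  _ _ _ = lem (φ [])
      where
      lem : ∀ x → x ≡ + 1 *ℤ (x +ℤ + 0)
      lem = solve-∀
    branch (r ∷ rs) u a {φ} bu l h S = ≡.trans
      (step r rs (branch rs) l S (colStrict (u ++ replicate a k)) (colStrict u) (r ≤ᵇ length u)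
        (λ u′ i bu′ e → ≡.trans (colStrict-blocks k u a u′ i bu bu′ (ℕₚ.≤-trans (ℕₚ.≤-reflexive e) h)) (cong (λ n → colStrict u u′ ∧ (n ≤ᵇ length u)) e)))
      (cong (⟦ r ≤ᵇ length u ⟧ *ℤ_) (unfold u r rs φ))

  tableaux-branch : ∀ π {φ} → Linked _≥_ π → Sym φ →
    tableaux (suc k) [] π φ ≡ ∑ (strips π) (λ (t , ζ) → tableaux k [] ζ (λ ks → φ (replicate t k ++ ks)))
  tableaux-branch []       {φ} l S = sym (ℤₚ.+-identityʳ _)
  tableaux-branch (r ∷ rs) {φ} l S = ≡.trans (step r rs (branch rs) l S (colStrict []) (colStrict []) true (λ _ _ _ _ → ≡.refl))
    (≡.trans (ℤₚ.*-identityˡ _) (unfold [] r rs φ))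

private
  fit : List ℕ → List (List ℕ) → Bool
  fit p []       = true
  fit p (r ∷ rs) = (colStrict p r ∧ weakInc r) ∧ fit r rs

  isSSYT-∷ : ∀ r rs → isSSYT (r ∷ rs) ≡ weakInc r ∧ fit r rs
  isSSYT-∷ r []        = sym (∧-identityʳ (weakInc r))
  isSSYT-∷ r (r′ ∷ rs) = cong (weakInc r ∧_) (≡.trans (cong (colStrict r r′ ∧_) (isSSYT-∷ r′ rs)) (sym (∧-assoc (colStrict r r′) (weakInc r′) (fit r′ rs))))

  isSSYT-fit : ∀ T → isSSYT T ≡ fit [] T
  isSSYT-fit []       = ≡.refl
  isSSYT-fit (r ∷ rs) = isSSYT-∷ r rs

  ∑-fillings : ∀ K p π φ → ∑ (fillings π K) (λ T → ⟦ fit p T ⟧ *ℤ φ (concat T)) ≡ tableaux K p π φ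
  ∑-fillings K p []       φ = lem (φ [])
    where
    lem : ∀ x → + 1 *ℤ x +ℤ + 0 ≡ x
    lem = solve-∀
  ∑-fillings K p (r ∷ rs) φ = ≡.trans (∑-concatMap _ (allRows r K) _) (∑-cong (allRows r K) (λ row →
    ≡.trans (∑-map _ (fillings rs K) _) (≡.trans (∑-cong (fillings rs K) (λ T → ≡.trans
      (cong (_*ℤ φ (row ++ concat T)) (⟦∧⟧ (colStrict p row ∧ weakInc row) (fit row T))) (ℤₚ.*-assoc ⟦ colStrict p row ∧ weakInc row ⟧ ⟦ fit row T ⟧ _)))
    (≡.trans (sym (∑-*ˡ ⟦ colStrict p row ∧ weakInc row ⟧ (fillings rs K) _)) (cong (⟦ colStrict p row ∧ weakInc row ⟧ *ℤ_)
      (∑-fillings K row rs (λ ks → φ (row ++ ks))))))))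

-- For exponent vectors of matching length this is 1 if the letters multiply to the monomial `γ` and
-- 0 otherwise; it is phrased by subtraction to be comparable with `Wl`.
content : List (List ℕ) → List ℕ → Word → ℤ
content alph []       γ = δ₀ γ
content alph (k ∷ ks) γ = ∑ (subs (lookupD alph k) γ) (content alph ks)

private
  ∑-sub-≡ᵇ : ∀ x a g b → ∑ (sub x g) (λ (_ , g′) → ⟦ (a ≡ᵇ g′) ∧ b ⟧) ≡ ⟦ (x + a ≡ᵇ g) ∧ b ⟧
  ∑-sub-≡ᵇ zero    a g       b = ℤₚ.+-identityʳ _
  ∑-sub-≡ᵇ (suc x) a zero    b = ≡.refl
  ∑-sub-≡ᵇ (suc x) a (suc g) b = ∑-sub-≡ᵇ x a g b

  exps : Word → List ℕ
  exps = map proj₂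

  eqL-⊕ : ∀ x acc w → length x ≡ length w → length acc ≡ length w →
    ⟦ eqL (x ⊕ acc) (exps w) ⟧ ≡ ∑ (subs x w) (λ w′ → ⟦ eqL acc (exps w′) ⟧)
  eqL-⊕ []      []        []            _  _  = ≡.refl
  eqL-⊕ (x ∷ v) (a ∷ acc) ((p , g) ∷ w) e₁ e₂ = begin
    ⟦ (x + a ≡ᵇ g) ∧ eqL (v ⊕ acc) (exps w) ⟧
      ≡⟨ sym (∑-sub-≡ᵇ x a g _) ⟩
    ∑ (sub x g) (λ (_ , g′) → ⟦ (a ≡ᵇ g′) ∧ eqL (v ⊕ acc) (exps w) ⟧)
      ≡⟨ ∑-cong (sub x g) (λ (_ , g′) → ≡.trans (⟦∧⟧ (a ≡ᵇ g′) _) (≡.trans (cong (⟦ a ≡ᵇ g′ ⟧ *ℤ_) (eqL-⊕ v acc w (ℕₚ.suc-injective e₁) (ℕₚ.suc-injective e₂)))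
           (≡.trans (∑-*ˡ ⟦ a ≡ᵇ g′ ⟧ (subs v w) _) (∑-cong (subs v w) (λ w′ → sym (⟦∧⟧ (a ≡ᵇ g′) (eqL acc (exps w′)))))))) ⟩
    ∑ (sub x g) (λ (_ , g′) → ∑ (subs v w) (λ w′ → ⟦ (a ≡ᵇ g′) ∧ eqL acc (exps w′) ⟧))
      ≡⟨ sym (∑-subs x v p g w _) ⟩
    ∑ (subs (x ∷ v) ((p , g) ∷ w)) (λ w′ → ⟦ eqL (a ∷ acc) (exps w′) ⟧) ∎
    where open ≡-Reasoning

  length-⊕ : ∀ x y → length x ≡ length y → length (x ⊕ y) ≡ length y
  length-⊕ []      y       e = ≡.refl
  length-⊕ (x ∷ v) (y ∷ w) e = cong suc (length-⊕ v w (ℕₚ.suc-injective e))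

  length-lookupD : ∀ {n} alph k → All (λ v → length v ≡ n) alph → k < length alph → length (lookupD alph k) ≡ n
  length-lookupD (v ∷ alph) zero    (p ∷ _)  _        = p
  length-lookupD (v ∷ alph) (suc k) (_ ∷ ps) (s≤s lt) = length-lookupD alph k ps lt

  fold : ℕ → List (List ℕ) → List ℕ → List ℕ
  fold n alph = foldr (λ k acc → lookupD alph k ⊕ acc) (replicate n 0)

  length-fold : ∀ {n} alph ks → All (λ v → length v ≡ n) alph → All (_< length alph) ks → length (fold n alph ks) ≡ n
  length-fold {n} alph []       a _        = Listₚ.length-replicate n
  length-fold {n} alph (k ∷ ks) a (b ∷ bs) = ≡.trans (length-⊕ (lookupD alph k) (fold n alph ks)
    (≡.trans (length-lookupD alph k a b) (sym (length-fold alph ks a bs)))) (length-fold alph ks a bs)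

  eqL-zeros : ∀ w → ⟦ eqL (replicate (length w) 0) (exps w) ⟧ ≡ δ₀ w
  eqL-zeros []                = ≡.refl
  eqL-zeros ((p , zero) ∷ w)  = eqL-zeros w
  eqL-zeros ((p , suc _) ∷ w) = ≡.refl

  eqL-content : ∀ alph ks w → All (λ v → length v ≡ length w) alph → All (_< length alph) ks →
    ⟦ eqL (fold (length w) alph ks) (exps w) ⟧ ≡ content alph ks w
  eqL-content alph []       w a _        = eqL-zeros w
  eqL-content alph (k ∷ ks) w a (b ∷ bs) = ≡.trans
    (eqL-⊕ (lookupD alph k) (fold (length w) alph ks) w (length-lookupD alph k a b) (length-fold alph ks a bs))
    (∑-cong-All (All.map (λ {w′} e → ≡.trans (cong (λ n → ⟦ eqL (fold n alph ks) (exps w′) ⟧) (sym e))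
      (eqL-content alph ks w′ (All.map (λ q → ≡.trans q (sym e)) a) bs)) (length-subs (lookupD alph k) w)))

  content-↭ : ∀ alph {ks ls} → ks ↭ ls → ∀ γ → content alph ks γ ≡ content alph ls γ
  content-↭ alph refl         γ = ≡.refl
  content-↭ alph (prep k p)   γ = ∑-cong (subs (lookupD alph k) γ) (content-↭ alph p)
  content-↭ alph (swap k l p) γ = ≡.trans (∑-subs-comm (lookupD alph k) (lookupD alph l) γ _)
    (∑-cong (subs (lookupD alph l) γ) (λ γ₁ → ∑-cong (subs (lookupD alph k) γ₁) (content-↭ alph p)))
  content-↭ alph (trans p q)  γ = ≡.trans (content-↭ alph p γ) (content-↭ alph q γ)

  content-replicate : ∀ alph t k ks γ → content alph (replicate t k ++ ks) γ ≡ ∑ (subs (scale t (lookupD alph k)) γ) (content alph ks)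
  content-replicate alph zero    k ks γ = sym (≡.trans (cong (λ l → ∑ l (content alph ks)) (subs-zero (lookupD alph k) γ)) (ℤₚ.+-identityʳ _))
  content-replicate alph (suc t) k ks γ = ≡.trans (∑-cong (subs v γ) (content-replicate alph t k ks))
    (≡.trans (cong (λ u → ∑ (subs u γ) (λ γ₁ → ∑ (subs (scale t v) γ₁) (content alph ks))) (sym (scale-1 v))) (∑-subs-scale 1 t v γ (content alph ks)))
    where
    v = lookupD alph k

  lookupD-∷ʳ : ∀ alph v k → k < length alph → lookupD (alph ∷ʳ v) k ≡ lookupD alph k
  lookupD-∷ʳ (u ∷ alph) v zero    _        = ≡.refl
  lookupD-∷ʳ (u ∷ alph) v (suc k) (s≤s lt) = lookupD-∷ʳ alph v k lt

  lookupD-last : ∀ alph v → lookupD (alph ∷ʳ v) (length alph) ≡ v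
  lookupD-last []         v = ≡.refl
  lookupD-last (u ∷ alph) v = lookupD-last alph v

  content-∷ʳ : ∀ alph v ks → All (_< length alph) ks → ∀ γ → content (alph ∷ʳ v) ks γ ≡ content alph ks γ
  content-∷ʳ alph v []       _        γ = ≡.refl
  content-∷ʳ alph v (k ∷ ks) (b ∷ bs) γ rewrite lookupD-∷ʳ alph v k b = ∑-cong (subs (lookupD alph k) γ) (content-∷ʳ alph v ks bs)

strips-Linked : ∀ {π} → Linked _≥_ π → All (λ (t , ζ) → Linked _≥_ ζ × hd ζ ≤ hd π) (strips π)
strips-Linked {[]}     l = ([] , z≤n) ∷ []
strips-Linked {p ∷ ps} l = All-concatMap _ (All.map (λ { {i , j} e → AllP.map⁺ (All.map (λ { {t , ζ} (lζ , h) →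
    cons ζ (ℕₚ.≤-trans h (ℕₚ.m≤m+n (hd ps) j)) lζ ,
    ℕₚ.≤-trans (ℕₚ.+-monoʳ-≤ (hd ps) (ℕₚ.≤-trans (ℕₚ.m≤n+m j i) (ℕₚ.≤-reflexive e))) (ℕₚ.≤-reflexive (ℕₚ.m+[n∸m]≡n (hd-≤ l))) })
    (strips-Linked (tail-Linked l))) }) (take≤-sum false (p ∸ hd ps)))
  where
  cons : ∀ {x} ζ → hd ζ ≤ x → Linked _≥_ ζ → Linked _≥_ (x ∷ ζ)
  cons []      _ _ = [-]
  cons (z ∷ ζ) h l = h ∷ l

Alphabet : List (List ℕ) → List Mono
Alphabet = map (false ,_)

-- Induction over the alphabet from its end, because branching strips the largest letter off a
-- tableau. On the other side `Ext-strips` adjoins one monomial to `Wl`, and both give the same sum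
-- over horizontal strips; `Wl-↭` moves the new monomial from the front to the end.
tableaux-Ext : ∀ {alph} → Reverse alph → ∀ {π} → Linked _≥_ π → ∀ γ →
  tableaux (length alph) [] π (λ ks → content alph ks γ) ≡ Ext (λ ξ → Wl (Alphabet alph) ξ γ) (evens π)
tableaux-Ext [] {π} l γ = ≡.trans (base π) (≡.trans (ℤₚ.*-comm (δ₀ (evens π)) (δ₀ γ)) (≡.trans (cong (δ₀ γ *ℤ_) (sym (Ext-δ₀ (evens π))))
  (≡.trans (sym (Ext-* (δ₀ γ) δ₀ (evens π))) (Ext-cong (evens π) (λ ξ → ℤₚ.*-comm (δ₀ γ) (δ₀ ξ))))))
  where
  base : ∀ π → tableaux 0 [] π (λ ks → content [] ks γ) ≡ δ₀ (evens π) *ℤ δ₀ γ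
  base []           = sym (ℤₚ.*-identityˡ _)
  base (zero ∷ π)   = ≡.trans (lem _) (base π)
    where
    lem : ∀ x → + 1 *ℤ x +ℤ + 0 ≡ x
    lem = solve-∀
  base (suc r ∷ π)  = ≡.refl
tableaux-Ext (alph ∶ rev ∶ʳ v) {π} l γ = begin
  tableaux (length (alph ∷ʳ v)) [] π (λ ks → content (alph ∷ʳ v) ks γ)
    ≡⟨ cong (λ n → tableaux n [] π (λ ks → content (alph ∷ʳ v) ks γ)) (≡.trans (Listₚ.length-++ alph) (ℕₚ.+-comm k 1)) ⟩
  tableaux (suc k) [] π (λ ks → content (alph ∷ʳ v) ks γ)
    ≡⟨ tableaux-branch k π l (λ p → content-↭ (alph ∷ʳ v) p γ) ⟩
  ∑ (strips π) (λ (t , ζ) → tableaux k [] ζ (λ ks → content (alph ∷ʳ v) (replicate t k ++ ks) γ))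
    ≡⟨ ∑-cong (strips π) (λ (t , ζ) → tableaux-cong k [] ζ (λ ks b → ≡.trans (content-replicate (alph ∷ʳ v) t k ks γ)
         (≡.trans (cong (λ u → ∑ (subs (scale t u) γ) (content (alph ∷ʳ v) ks)) (lookupD-last alph v))
         (∑-cong (subs (scale t v) γ) (content-∷ʳ alph v ks b))))) ⟩
  ∑ (strips π) (λ (t , ζ) → tableaux k [] ζ (λ ks → ∑ (subs (scale t v) γ) (content alph ks)))
    ≡⟨ ∑-cong-All (All.map (λ { {t , ζ} (lζ , _) → ≡.trans (tableaux-∑ k [] ζ (subs (scale t v) γ) (λ γ′ ks → content alph ks γ′))
         (≡.trans (∑-cong (subs (scale t v) γ) (λ γ′ → tableaux-Ext rev lζ γ′)) (sym (Ext-∑ (subs (scale t v) γ) (λ γ′ ξ → Wl (Alphabet alph) ξ γ′) (evens ζ)))) })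
         (strips-Linked l)) ⟩
  ∑ (strips π) (λ (t , ζ) → Ext (λ ξ → ∑ (subs (scale t v) γ) (λ γ′ → Wl (Alphabet alph) ξ γ′)) (evens ζ))
    ≡⟨ sym (Ext-strips (λ t → Super-∑ (subs (scale t v) γ) (λ γ′ → Wl-super (Alphabet alph) γ′)) l) ⟩
  Ext (λ ξ → Wl ((false , v) ∷ Alphabet alph) ξ γ) (evens π)
    ≡⟨ Ext-cong (evens π) (λ ξ → Wl-↭ (Perm.map⁺ (false ,_) (Perm.∷↭∷ʳ v alph)) ξ γ) ⟩
  Ext (λ ξ → Wl (Alphabet (alph ∷ʳ v)) ξ γ) (evens π) ∎
  where
  open ≡-Reasoning
  k = length alph

countSSYT-Ext : ∀ {π} → Linked _≥_ π → ∀ alph γ → All (λ v → length v ≡ length γ) alph →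
  + countSSYT π alph γ ≡ Ext (λ ξ → Wl (Alphabet alph) ξ (evens γ)) (evens π)
countSSYT-Ext {π} l alph γ a = begin
  + countSSYT π alph γ
    ≡⟨ length-filterᵇ _ (fillings π (length alph)) ⟩
  ∑ (fillings π (length alph)) (λ T → ⟦ isSSYT T ∧ eqL (weight (length γ) alph T) γ ⟧)
    ≡⟨ ∑-cong (fillings π (length alph)) (λ T → ≡.trans (⟦∧⟧ (isSSYT T) _) (cong (λ b → ⟦ b ⟧ *ℤ ⟦ eqL (weight (length γ) alph T) γ ⟧) (isSSYT-fit T))) ⟩
  ∑ (fillings π (length alph)) (λ T → ⟦ fit [] T ⟧ *ℤ ⟦ eqL (fold (length γ) alph (concat T)) γ ⟧)
    ≡⟨ ∑-fillings (length alph) [] π (λ ks → ⟦ eqL (fold (length γ) alph ks) γ ⟧) ⟩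
  tableaux (length alph) [] π (λ ks → ⟦ eqL (fold (length γ) alph ks) γ ⟧)
    ≡⟨ tableaux-cong (length alph) [] π (λ ks b → ≡.trans (cong₂ (λ n g → ⟦ eqL (fold n alph ks) g ⟧) (sym (length-evens γ)) (sym (exps-evens γ)))
         (eqL-content alph ks (evens γ) (All.map (λ q → ≡.trans q (sym (length-evens γ))) a) b)) ⟩
  tableaux (length alph) [] π (λ ks → content alph ks (evens γ))
    ≡⟨ tableaux-Ext (reverseView alph) l (evens γ) ⟩
  Ext (λ ξ → Wl (Alphabet alph) ξ (evens γ)) (evens π) ∎
  where
  open ≡-Reasoning
  exps-evens : ∀ γ → exps (evens γ) ≡ γ
  exps-evens []      = ≡.refl
  exps-evens (g ∷ γ) = cong (g ∷_) (exps-evens γ)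

-- Monomials in even and odd variables

-- Lists of monomials up to permutation are a commutative monoid under `_++_`, so the identities for
-- sums of integers also describe how the list of all monomials is rearranged when variables are
-- exchanged.
private module L = Sums (Perm.++-commutativeMonoid {A = Mono})

twist : Bool → ℕ → Bool → Bool
twist false _       q = q
twist true  zero    q = q
twist true  (suc _) q = not q

-- The monomials of degree m in variables of parities ps, each with its own parity; odd variables
-- are square free.
letters : List Bool → ℕ → List Mono
letters []       zero    = (false , []) ∷ []
letters []       (suc _) = []
letters (p ∷ ps) m       = concatMap (λ (a , r) → map (λ (q , v) → twist p a q , a ∷ v) (letters ps r)) (take≤ p m)

letters-length : ∀ ps m → All (λ (q , v) → length v ≡ length ps) (letters ps m)
letters-length []       zero    = ≡.refl ∷ []
letters-length []       (suc _) = []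
letters-length (p ∷ ps) m       = All-concatMap _ (All.universal (λ (a , r) → AllP.map⁺ (All.map (cong suc) (letters-length ps r))) (take≤ p m))

parities : Word → List Bool
parities = map proj₁

W : ℕ → Word → Word → ℤ
W m ξ γ = Wl (letters (parities γ) m) ξ γ

concatMap≡∑ : ∀ (f : X → List Mono) xs → concatMap f xs ≡ L.∑ xs f
concatMap≡∑ f []       = ≡.refl
concatMap≡∑ f (x ∷ xs) = cong (f x ++_) (concatMap≡∑ f xs)

map-∑ : ∀ (h : Mono → Mono) (xs : List X) f → map h (L.∑ xs f) ≡ L.∑ xs (λ x → map h (f x))
map-∑ h []       f = ≡.refl
map-∑ h (x ∷ xs) f = ≡.trans (Listₚ.map-++ h (f x) (L.∑ xs f)) (cong (map h (f x) ++_) (map-∑ h xs f))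

letters-∑ : ∀ p ps m → letters (p ∷ ps) m ≡ L.∑ (take≤ p m) (λ (a , r) → map (λ (q , v) → twist p a q , a ∷ v) (letters ps r))
letters-∑ p ps m = concatMap≡∑ _ (take≤ p m)

letters-∑∑ : ∀ p p′ ps m → letters (p ∷ p′ ∷ ps) m ≡
  L.∑ (take≤ p m) (λ (a , r) → L.∑ (take≤ p′ r) (λ (b , s) → map (λ (q , v) → twist p a (twist p′ b q) , a ∷ b ∷ v) (letters ps s)))
letters-∑∑ p p′ ps m = ≡.trans (letters-∑ p (p′ ∷ ps) m) (∑-≡ (take≤ p m) (λ (a , r) →
  ≡.trans (cong (map _) (letters-∑ p′ ps r)) (≡.trans (map-∑ _ (take≤ p′ r) _) (∑-≡ (take≤ p′ r) (λ (b , s) → sym (Listₚ.map-∘ (letters ps s)))))))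
  where
  ∑-≡ : ∀ (xs : List X) {f g : X → List Mono} → (∀ x → f x ≡ g x) → L.∑ xs f ≡ L.∑ xs g
  ∑-≡ []       h = ≡.refl
  ∑-≡ (x ∷ xs) h = cong₂ _++_ (h x) (∑-≡ xs h)

swapAt : ℕ → List X → List X
swapAt zero    []           = []
swapAt zero    (x ∷ [])     = x ∷ []
swapAt zero    (x ∷ y ∷ xs) = y ∷ x ∷ xs
swapAt (suc d) []           = []
swapAt (suc d) (x ∷ xs)     = x ∷ swapAt d xs

swapAt-↭ : ∀ d (xs : List X) → swapAt d xs ↭ xs
swapAt-↭ zero    []           = ↭-refl
swapAt-↭ zero    (x ∷ [])     = ↭-refl
swapAt-↭ zero    (x ∷ y ∷ xs) = swap y x ↭-refl
swapAt-↭ (suc d) []           = ↭-refl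
swapAt-↭ (suc d) (x ∷ xs)     = prep x (swapAt-↭ d xs)

map-swapAt : ∀ (f : X → Y) d xs → map f (swapAt d xs) ≡ swapAt d (map f xs)
map-swapAt f zero    []           = ≡.refl
map-swapAt f zero    (x ∷ [])     = ≡.refl
map-swapAt f zero    (x ∷ y ∷ xs) = ≡.refl
map-swapAt f (suc d) []           = ≡.refl
map-swapAt f (suc d) (x ∷ xs)     = cong (f x ∷_) (map-swapAt f d xs)

swapAt-++ : ∀ (pre : List X) x y xs → swapAt (length pre) (pre ++ x ∷ y ∷ xs) ≡ pre ++ y ∷ x ∷ xs
swapAt-++ []        x y xs = ≡.refl
swapAt-++ (z ∷ pre) x y xs = cong (z ∷_) (swapAt-++ pre x y xs)

swapMono : ℕ → Mono → Mono
swapMono d (q , v) = q , swapAt d v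

private
  twist-comm : ∀ p a p′ b q → twist p a (twist p′ b q) ≡ twist p′ b (twist p a q)
  twist-comm false a       p′    b       q = ≡.refl
  twist-comm true  zero    p′    b       q = ≡.refl
  twist-comm true  (suc a) false b       q = ≡.refl
  twist-comm true  (suc a) true  zero    q = ≡.refl
  twist-comm true  (suc a) true  (suc b) q = ≡.refl

letters-swap : ∀ pp p p′ ps m → letters (pp ++ p′ ∷ p ∷ ps) m ↭ map (swapMono (length pp)) (letters (pp ++ p ∷ p′ ∷ ps) m)
letters-swap [] p p′ ps m = ↭-trans (↭-reflexive (letters-∑∑ p′ p ps m)) (↭-trans
  (↭-sym (L.∑-take≤-comm p p′ m (λ a b k → map (λ (q , v) → twist p′ b (twist p a q) , b ∷ a ∷ v) (letters ps k)))) (↭-trans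
  (L.∑-cong (take≤ p m) (λ (a , r) → ↭-trans (L.∑-cong (take≤ p′ r) (λ (b , k) → ↭-reflexive (≡.trans
    (Listₚ.map-cong (λ (q , v) → cong (_, b ∷ a ∷ v) (twist-comm p′ b p a q)) (letters ps k)) (Listₚ.map-∘ (letters ps k)))))
    (↭-reflexive (sym (map-∑ (swapMono 0) (take≤ p′ r) _))))) (↭-trans
  (↭-reflexive (sym (map-∑ (swapMono 0) (take≤ p m) _))) (↭-reflexive (cong (map (swapMono 0)) (sym (letters-∑∑ p p′ ps m)))))))
letters-swap (r ∷ pp) p p′ ps m = ↭-trans (↭-reflexive (letters-∑ r (pp ++ p′ ∷ p ∷ ps) m)) (↭-trans
  (L.∑-cong (take≤ r m) (λ (a , k) → ↭-trans (Perm.map⁺ _ (letters-swap pp p p′ ps k))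
    (↭-reflexive (≡.trans (sym (Listₚ.map-∘ (letters (pp ++ p ∷ p′ ∷ ps) k))) (Listₚ.map-∘ (letters (pp ++ p ∷ p′ ∷ ps) k))))))
  (↭-reflexive (≡.trans (sym (map-∑ (swapMono (suc (length pp))) (take≤ r m) _)) (cong (map (swapMono (suc (length pp)))) (sym (letters-∑ r (pp ++ p ∷ p′ ∷ ps) m))))))

∑-subs-swap : ∀ d v γ (f : Word → ℤ) → length v ≡ length γ →
  ∑ (subs (swapAt d v) (swapAt d γ)) f ≡ ∑ (subs v γ) (λ γ′ → f (swapAt d γ′))
∑-subs-swap zero    []      []      f e = ≡.refl
∑-subs-swap zero    (k ∷ []) ((p , g) ∷ []) f e = ≡.trans (∑-subs k [] p g [] f) (sym (∑-subs k [] p g [] (λ γ′ → f (swapAt 0 γ′))))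
∑-subs-swap zero    (k ∷ l ∷ v) ((p , g) ∷ (r , h) ∷ γ) f e = ≡.trans (two l k r h p g f) (≡.trans (∑-comm (sub l h) (sub k g) _)
  (sym (two k l p g r h (λ γ′ → f (swapAt 0 γ′)))))
  where
  two : ∀ k l p g r h f → ∑ (subs (k ∷ l ∷ v) ((p , g) ∷ (r , h) ∷ γ)) f ≡
    ∑ (sub k g) (λ (_ , x) → ∑ (sub l h) (λ (_ , y) → ∑ (subs v γ) (λ γ′ → f ((p , x) ∷ (r , y) ∷ γ′))))
  two k l p g r h f = ≡.trans (∑-subs k (l ∷ v) p g ((r , h) ∷ γ) f) (∑-cong (sub k g) (λ (_ , x) → ∑-subs l v r h γ (λ γ′ → f ((p , x) ∷ γ′))))
∑-subs-swap (suc d) []      []      f e = ≡.refl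
∑-subs-swap (suc d) (k ∷ v) ((p , g) ∷ γ) f e = ≡.trans (∑-subs k (swapAt d v) p g (swapAt d γ) f) (≡.trans
  (∑-cong (sub k g) (λ (_ , x) → ∑-subs-swap d v γ (λ γ′ → f ((p , x) ∷ γ′)) (ℕₚ.suc-injective e)))
  (sym (∑-subs k v p g γ (λ γ′ → f (swapAt (suc d) γ′)))))

Wl-swap : ∀ d Ls ξ γ → All (λ (q , v) → length v ≡ length γ) Ls → Wl (map (swapMono d) Ls) ξ (swapAt d γ) ≡ Wl Ls ξ γ
Wl-swap d []             ξ γ a = cong (δ₀ ξ *ℤ_) (δ₀-super .perm (swapAt-↭ d γ))
Wl-swap d ((q , v) ∷ Ls) ξ γ (e ∷ a) = ∑-cong (lowers q ξ) (λ (t , ξ′) → ≡.trans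
  (cong (λ u → ∑ (subs u (swapAt d γ)) (Wl (map (swapMono d) Ls) ξ′)) (map-swapAt (t *_) d v)) (≡.trans
  (∑-subs-swap d (scale t v) γ (Wl (map (swapMono d) Ls) ξ′) (≡.trans (Listₚ.length-map (t *_) v) e))
  (∑-cong-All (All.map (λ {γ′} e′ → Wl-swap d Ls ξ′ γ′ (All.map (λ r → ≡.trans r (sym e′)) a)) (length-subs (scale t v) γ)))))

W-swap : ∀ m ξ pre x y w → W m ξ (pre ++ x ∷ y ∷ w) ≡ W m ξ (pre ++ y ∷ x ∷ w)
W-swap m ξ pre x y w = begin
  Wl (letters (parities u) m) ξ u
    ≡⟨ sym (Wl-swap d (letters (parities u) m) ξ u (All.map (λ e → ≡.trans e (Listₚ.length-map proj₁ u)) (letters-length (parities u) m))) ⟩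
  Wl (map (swapMono d) (letters (parities u) m)) ξ (swapAt d u)
    ≡⟨ cong (Wl (map (swapMono d) (letters (parities u) m)) ξ) (swapAt-++ pre x y w) ⟩
  Wl (map (swapMono d) (letters (parities u) m)) ξ u′
    ≡⟨ Wl-↭ (↭-sym (↭-trans (↭-reflexive (cong (λ ps → letters ps m) (Listₚ.map-++ proj₁ pre (y ∷ x ∷ w))))
         (↭-trans (letters-swap (parities pre) (proj₁ x) (proj₁ y) (parities w) m)
         (↭-reflexive (cong₂ (λ k ps → map (swapMono k) (letters ps m)) (Listₚ.length-map proj₁ pre) (sym (Listₚ.map-++ proj₁ pre (x ∷ y ∷ w)))))))) ξ u′ ⟩
  Wl (letters (parities u′) m) ξ u′ ∎
  where
  open ≡-Reasoning
  d = length pre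
  u = pre ++ x ∷ y ∷ w
  u′ = pre ++ y ∷ x ∷ w

perm-from-swaps : ∀ (F : Word → ℤ) → (∀ pre x y w → F (pre ++ x ∷ y ∷ w) ≡ F (pre ++ y ∷ x ∷ w)) → ∀ {u v} → u ↭ v → F u ≡ F v
perm-from-swaps F h refl         = ≡.refl
perm-from-swaps F h (prep x p)   = perm-from-swaps (λ w → F (x ∷ w)) (λ pre → h (x ∷ pre)) p
perm-from-swaps F h (swap x y p) = ≡.trans (h [] x y _) (perm-from-swaps (λ w → F (y ∷ x ∷ w)) (λ pre → h (y ∷ x ∷ pre)) p)
perm-from-swaps F h (trans p q)  = ≡.trans (perm-from-swaps F h p) (perm-from-swaps F h q)

zero∷ : Mono → Mono
zero∷ (q , v) = q , 0 ∷ v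

Wl-zero∷ : ∀ Ls ξ p g γ → Wl (map zero∷ Ls) ξ ((p , g) ∷ γ) ≡ δ₀ ((p , g) ∷ []) *ℤ Wl Ls ξ γ
Wl-zero∷ []             ξ p zero    γ = sym (ℤₚ.*-identityˡ _)
Wl-zero∷ []             ξ p (suc g) γ = ℤₚ.*-zeroʳ (δ₀ ξ)
Wl-zero∷ ((q , v) ∷ Ls) ξ p g       γ = ≡.trans
  (∑-cong (lowers q ξ) (λ (t , ξ′) → ≡.trans (∑-subs (t * 0) (scale t v) p g γ _) (≡.trans
    (cong (λ k → ∑ (sub k g) (λ (_ , g′) → ∑ (subs (scale t v) γ) (λ γ′ → Wl (map zero∷ Ls) ξ′ ((p , g′) ∷ γ′)))) (ℕₚ.*-zeroʳ t)) (≡.trans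
    (ℤₚ.+-identityʳ _) (≡.trans (∑-cong (subs (scale t v) γ) (Wl-zero∷ Ls ξ′ p g)) (sym (∑-*ˡ (δ₀ ((p , g) ∷ [])) (subs (scale t v) γ) _)))))))
  (sym (∑-*ˡ (δ₀ ((p , g) ∷ [])) (lowers q ξ) _))

private
  Divisible : Mono → Set
  Divisible (q , v) = ∃ λ a → ∃ λ u → v ≡ suc a ∷ u

  -- A monomial that contains a variable of exponent 0 can only be used zero times.
  Wl-drop : ∀ Ls Rs ξ p γ → All Divisible Rs → Wl (map zero∷ Ls ++ Rs) ξ ((p , 0) ∷ γ) ≡ Wl Ls ξ γ
  Wl-drop [] [] ξ p γ a = ≡.refl
  Wl-drop [] ((q , _) ∷ Rs) ξ p γ ((b , u , ≡.refl) ∷ a) = ≡.trans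
    (lowers-at-zero q ξ (λ t ξ′ → ∑ (subs (scale t (suc b ∷ u)) ((p , 0) ∷ γ)) (Wl Rs ξ′)) (λ t ξ′ → ∑-subs (suc t * suc b) (scale (suc t) u) p 0 γ (Wl Rs ξ′)))
    (≡.trans (cong (λ l → ∑ l (Wl Rs ξ)) (subs-zero (suc b ∷ u) ((p , 0) ∷ γ))) (≡.trans (ℤₚ.+-identityʳ _) (Wl-drop [] Rs ξ p γ a)))
  Wl-drop ((q , v) ∷ Ls) Rs ξ p γ a = ∑-cong (lowers q ξ) (λ (t , ξ′) → ≡.trans (∑-subs (t * 0) (scale t v) p 0 γ _) (≡.trans
    (cong (λ k → ∑ (sub k 0) (λ (_ , g′) → ∑ (subs (scale t v) γ) (λ γ′ → Wl (map zero∷ Ls ++ Rs) ξ′ ((p , g′) ∷ γ′)))) (ℕₚ.*-zeroʳ t)) (≡.trans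
    (ℤₚ.+-identityʳ _) (∑-cong (subs (scale t v) γ) (λ γ′ → Wl-drop Ls Rs ξ′ p γ′ a)))))

  letters-drop : ∀ p ps m → ∃ λ Rs → letters (p ∷ ps) m ≡ map zero∷ (letters ps m) ++ Rs × All Divisible Rs
  letters-drop p ps m = split p m {≡.refl}
    where
    F : Bool → ℕ × ℕ → List Mono
    F p (a , r) = map (λ (q , v) → twist p a q , a ∷ v) (letters ps r)
    zeros : ∀ p → F p (0 , m) ≡ map zero∷ (letters ps m)
    zeros false = ≡.refl
    zeros true  = ≡.refl
    div : ∀ p a r → All Divisible (F p (suc a , r))
    div p a r = AllP.map⁺ (All.universal (λ (q , v) → a , v , ≡.refl) (letters ps r))
    split : ∀ p m′ → {m ≡ m′} → ∃ λ Rs → concatMap (F p) (take≤ p m′) ≡ map zero∷ (letters ps m) ++ Rs × All Divisible Rs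
    split false zero    {≡.refl} = [] , cong (_++ []) (zeros false) , []
    split true  zero    {≡.refl} = [] , cong (_++ []) (zeros true) , []
    split true  (suc k) {≡.refl} = F true (1 , k) ++ [] , cong (_++ (F true (1 , k) ++ [])) (zeros true) , AllP.++⁺ (div true 0 k) []
    split false (suc k) {≡.refl} = _ , cong (_++ concatMap (F false) (map (λ (i , j) → suc i , j) (antidiag k))) (zeros false) ,
      All-concatMap (F false) (AllP.map⁺ (All.universal (λ (i , j) → div false i j) (antidiag k)))

W-drop : ∀ m ξ p w → W m ξ ((p , 0) ∷ w) ≡ W m ξ w
W-drop m ξ p w with letters-drop p (parities w) m
... | Rs , e , a = ≡.trans (cong (λ l → Wl l ξ ((p , 0) ∷ w)) e) (Wl-drop (letters (parities w) m) Rs ξ p w a)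

sub-sum : ∀ b j → All (λ (_ , y) → j ≡ b + y) (sub b j)
sub-sum zero    j       = ≡.refl ∷ []
sub-sum (suc b) zero    = []
sub-sum (suc b) (suc j) = All.map (cong suc) (sub-sum b j)

private
  -- With x even and y odd, the monomials that involve x or y come in pairs x^(c+1) v and x^c y v of
  -- opposite parity.
  pairs : List Bool → ℕ → List Mono
  pairs ps zero    = []
  pairs ps (suc m) = L.∑ (antidiag m) (λ (c , r) → L.∑ (letters ps r) (λ (q , v) → (q , suc c ∷ 0 ∷ v) ∷ (not q , c ∷ 1 ∷ v) ∷ []))

  zip-pairs : ∀ c (Ls : List Mono) → map (λ (q , v) → q , suc c ∷ 0 ∷ v) Ls ++ map (λ (q , v) → not q , c ∷ 1 ∷ v) Ls ↭
    L.∑ Ls (λ (q , v) → (q , suc c ∷ 0 ∷ v) ∷ (not q , c ∷ 1 ∷ v) ∷ [])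
  zip-pairs c Ls = ↭-trans (Perm.++⁺ (↭-reflexive (single-∑ _ Ls)) (↭-reflexive (single-∑ _ Ls))) (↭-sym (L.∑-∙ Ls _ _))
    where
    single-∑ : ∀ (h : Mono → Mono) Ls → map h Ls ≡ L.∑ Ls (λ x → h x ∷ [])
    single-∑ h []       = ≡.refl
    single-∑ h (x ∷ Ls) = cong (h x ∷_) (single-∑ h Ls)

  letters-pairs : ∀ ps m → letters (false ∷ true ∷ ps) m ↭ pairs ps m ++ map zero∷ (map zero∷ (letters ps m))
  letters-pairs ps zero    = ↭-reflexive (≡.trans (letters-∑∑ false true ps 0) (≡.trans (Listₚ.++-identityʳ _) (≡.trans (Listₚ.++-identityʳ _) (Listₚ.map-∘ (letters ps 0)))))
  letters-pairs ps (suc m) = ↭-trans (↭-reflexive (letters-∑∑ false true ps (suc m))) (↭-trans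
    (L.∑-antidiag-snoc m (λ (a , r) → L.∑ (steps r) (λ (b , s) → h a b s))) (↭-trans
    (Perm.++⁺ (↭-trans (L.∑-cong (antidiag m) (λ (a , r) → Perm.++⁺ˡ (h a 0 (suc r)) (↭-reflexive (Listₚ.++-identityʳ (h a 1 r)))))
      (L.∑-∙ (antidiag m) (λ (a , r) → h a 0 (suc r)) (λ (a , r) → h a 1 r))) (↭-reflexive (Listₚ.++-identityʳ (h (suc m) 0 0)))) (↭-trans
    (rot (L.∑ (antidiag m) (λ (a , r) → h a 0 (suc r))) (L.∑ (antidiag m) (λ (a , r) → h a 1 r)) (h (suc m) 0 0)) (↭-trans
    (Perm.++⁺ʳ (L.∑ (antidiag m) (λ (a , r) → h a 1 r)) (↭-trans (↭-sym (L.∑-antidiag-snoc m (λ (a , r) → h a 0 r))) (L.∑-antidiag-suc m (λ (a , r) → h a 0 r)))) (↭-trans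
    (Perm.++-comm (h 0 0 (suc m) ++ L.∑ (antidiag m) (λ (a , r) → h (suc a) 0 r)) _) (↭-trans
    (↭-trans (Perm.++⁺ˡ (L.∑ (antidiag m) (λ (a , r) → h a 1 r)) (Perm.++-comm (h 0 0 (suc m)) (L.∑ (antidiag m) (λ (a , r) → h (suc a) 0 r))))
      (↭-reflexive (sym (Listₚ.++-assoc (L.∑ (antidiag m) (λ (a , r) → h a 1 r)) (L.∑ (antidiag m) (λ (a , r) → h (suc a) 0 r)) (h 0 0 (suc m))))))
    (Perm.++⁺ (↭-trans (Perm.++-comm (L.∑ (antidiag m) (λ (a , r) → h a 1 r)) _) (↭-trans (↭-sym (L.∑-∙ (antidiag m) (λ (a , r) → h (suc a) 0 r) (λ (a , r) → h a 1 r)))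
      (L.∑-cong (antidiag m) (λ (a , r) → zip-pairs a (letters ps r))))) (↭-reflexive (Listₚ.map-∘ (letters ps (suc m)))))))))))
    where
    h : ℕ → ℕ → ℕ → List Mono
    h a b s = map (λ (q , v) → twist true b q , a ∷ b ∷ v) (letters ps s)
    rot : ∀ (x y z : List Mono) → (x ++ y) ++ z ↭ (x ++ z) ++ y
    rot x y z = ↭-trans (↭-reflexive (Listₚ.++-assoc x y z)) (↭-trans (Perm.++⁺ˡ x (Perm.++-comm y z)) (↭-reflexive (sym (Listₚ.++-assoc x z y))))

  relΣ : ℕ → Word → (Word → ℤ) → ℤ
  relΣ k γ G = ∑ (antidiag k) (λ (i , j) → sg j *ℤ G ((false , i) ∷ (true , j) ∷ γ))

  -- The sign of the relation follows the odd letter, so subtracting `b` from it costs `sg b`; the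
  -- antidiagonal is shortened by `a + b`.
  relΣ-sub : ∀ k a b (H : ℕ → ℕ → ℤ) →
    ∑ (antidiag k) (λ (i , j) → sg j *ℤ ∑ (sub a i) (λ (_ , x) → ∑ (sub b j) (λ (_ , y) → H x y))) ≡
    sg b *ℤ ∑ (sub (a + b) k) (λ (_ , k′) → ∑ (antidiag k′) (λ (i , j) → sg j *ℤ H i j))
  relΣ-sub k a b H = begin
    ∑ (antidiag k) (λ (i , j) → sg j *ℤ ∑ (sub a i) (λ (_ , x) → ∑ (sub b j) (λ (_ , y) → H x y)))
      ≡⟨ ∑-cong (antidiag k) (λ (i , j) → ≡.trans (cong (sg j *ℤ_) (∑-comm (sub a i) (sub b j) _)) (≡.trans (∑-*ˡ (sg j) (sub b j) _)
           (∑-cong-All (All.map (λ { {_ , y} ≡.refl → ≡.trans (cong (_*ℤ ∑ (sub a i) (λ (_ , x) → H x y)) (sg-+ b y)) (ℤₚ.*-assoc (sg b) (sg y) _) }) (sub-sum b j))))) ⟩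
    ∑ (antidiag k) (λ (i , j) → ∑ (sub b j) (λ (_ , y) → sg b *ℤ (sg y *ℤ ∑ (sub a i) (λ (_ , x) → H x y))))
      ≡⟨ sym (sub-antidiag b k (λ i y → sg b *ℤ (sg y *ℤ ∑ (sub a i) (λ (_ , x) → H x y)))) ⟩
    ∑ (sub b k) (λ (_ , k₁) → ∑ (antidiag k₁) (λ (i , y) → sg b *ℤ (sg y *ℤ ∑ (sub a i) (λ (_ , x) → H x y))))
      ≡⟨ ∑-cong (sub b k) (λ (_ , k₁) → ≡.trans (sym (∑-*ˡ (sg b) (antidiag k₁) _)) (cong (sg b *ℤ_) (≡.trans (∑-antidiag-flip k₁ _) (≡.trans
           (∑-cong (antidiag k₁) (λ (y , i) → ∑-*ˡ (sg y) (sub a i) _)) (≡.trans (sym (sub-antidiag a k₁ (λ y x → sg y *ℤ H x y)))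
           (∑-cong (sub a k₁) (λ (_ , k₂) → ∑-antidiag-flip k₂ _))))))) ⟩
    ∑ (sub b k) (λ (_ , k₁) → sg b *ℤ ∑ (sub a k₁) (λ (_ , k₂) → ∑ (antidiag k₂) (λ (x , y) → sg y *ℤ H x y)))
      ≡⟨ sym (∑-*ˡ (sg b) (sub b k) _) ⟩
    sg b *ℤ ∑ (sub b k) (λ (_ , k₁) → ∑ (sub a k₁) (λ (_ , k₂) → ∑ (antidiag k₂) (λ (x , y) → sg y *ℤ H x y)))
      ≡⟨ cong (sg b *ℤ_) (≡.trans (∑-sub-sub b a k _) (cong (λ l → ∑ (sub l k) (λ (_ , k₂) → ∑ (antidiag k₂) (λ (x , y) → sg y *ℤ H x y))) (ℕₚ.+-comm b a))) ⟩
    sg b *ℤ ∑ (sub (a + b) k) (λ (_ , k′) → ∑ (antidiag k′) (λ (i , j) → sg j *ℤ H i j)) ∎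
    where open ≡-Reasoning

  -- Setting y = - x, the factors of the two monomials x^(c+1) v and x^c y v cancel.
  relΣ-pair : ∀ k γ q c v Ls ξ → relΣ k γ (Wl ((q , suc c ∷ 0 ∷ v) ∷ (not q , c ∷ 1 ∷ v) ∷ Ls) ξ) ≡ relΣ k γ (Wl Ls ξ)
  relΣ-pair k γ q c v Ls ξ = begin
    ∑ (antidiag k) (λ (i , j) → sg j *ℤ ∑ (lowers q ξ) (λ (t , ξ₁) → ∑ (subs (scale t v₁) (γ′ i j)) (λ γ₁ →
      ∑ (lowers (not q) ξ₁) (λ (t′ , ξ₂) → ∑ (subs (scale t′ v₂) γ₁) (Wl Ls ξ₂)))))
      ≡⟨ ∑-cong (antidiag k) (λ (i , j) → ≡.trans (cong (sg j *ℤ_) (∑-cong (lowers q ξ) (λ (t , ξ₁) → ∑-comm (subs (scale t v₁) (γ′ i j)) (lowers (not q) ξ₁) _)))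
           (≡.trans (∑-*ˡ (sg j) (lowers q ξ) _) (∑-cong (lowers q ξ) (λ (t , ξ₁) → ∑-*ˡ (sg j) (lowers (not q) ξ₁) _)))) ⟩
    ∑ (antidiag k) (λ (i , j) → ∑ (lowers q ξ) (λ (t , ξ₁) → ∑ (lowers (not q) ξ₁) (λ (t′ , ξ₂) →
      sg j *ℤ ∑ (subs (scale t v₁) (γ′ i j)) (λ γ₁ → ∑ (subs (scale t′ v₂) γ₁) (Wl Ls ξ₂)))))
      ≡⟨ ≡.trans (∑-comm (antidiag k) (lowers q ξ) _) (∑-cong (lowers q ξ) (λ (t , ξ₁) → ∑-comm (antidiag k) (lowers (not q) ξ₁) _)) ⟩
    ∑ (lowers q ξ) (λ (t , ξ₁) → ∑ (lowers (not q) ξ₁) (λ (t′ , ξ₂) → ∑ (antidiag k) (λ (i , j) →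
      sg j *ℤ ∑ (subs (scale t v₁) (γ′ i j)) (λ γ₁ → ∑ (subs (scale t′ v₂) γ₁) (Wl Ls ξ₂)))))
      ≡⟨ ∑-cong (lowers q ξ) (λ (t , ξ₁) → ∑-cong (lowers (not q) ξ₁) (λ (t′ , ξ₂) → inner t t′ (Wl Ls ξ₂))) ⟩
    ∑ (lowers q ξ) (λ (t , ξ₁) → ∑ (lowers (not q) ξ₁) (λ (t′ , ξ₂) → sg t′ *ℤ ψ (t + t′) ξ₂))
      ≡⟨ lowers-inverse q ξ ψ ⟩
    ψ 0 ξ
      ≡⟨ ≡.trans (ℤₚ.+-identityʳ _) (∑-cong (antidiag k) (λ (i , j) → cong (sg j *ℤ_) (≡.trans
           (cong (λ l → ∑ l (λ γ₂ → Wl Ls ξ ((false , i) ∷ (true , j) ∷ γ₂))) (subs-zero v γ)) (ℤₚ.+-identityʳ _)))) ⟩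
    relΣ k γ (Wl Ls ξ) ∎
    where
    open ≡-Reasoning
    v₁ = suc c ∷ 0 ∷ v
    v₂ = c ∷ 1 ∷ v
    γ′ : ℕ → ℕ → Word
    γ′ i j = (false , i) ∷ (true , j) ∷ γ
    ψ : ℕ → Word → ℤ
    ψ r ξ₂ = ∑ (sub (r * suc c) k) (λ (_ , k′) → ∑ (antidiag k′) (λ (i , j) → sg j *ℤ ∑ (subs (scale r v) γ) (λ γ₂ → Wl Ls ξ₂ ((false , i) ∷ (true , j) ∷ γ₂))))
    total : ∀ t t′ c → t * suc c + t′ * c + (t * 0 + t′ * 1) ≡ (t + t′) * suc c
    total = ℕSolver.solve-∀
    odd-total : ∀ t t′ → t * 0 + t′ * 1 ≡ t′
    odd-total = ℕSolver.solve-∀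
    inner : ∀ t t′ (G : Word → ℤ) →
      ∑ (antidiag k) (λ (i , j) → sg j *ℤ ∑ (subs (scale t v₁) (γ′ i j)) (λ γ₁ → ∑ (subs (scale t′ v₂) γ₁) G)) ≡
      sg t′ *ℤ ∑ (sub ((t + t′) * suc c) k) (λ (_ , k′) → ∑ (antidiag k′) (λ (i , j) → sg j *ℤ ∑ (subs (scale (t + t′) v) γ) (λ γ₂ → G ((false , i) ∷ (true , j) ∷ γ₂))))
    inner t t′ G = ≡.trans (∑-cong (antidiag k) (λ (i , j) → cong (sg j *ℤ_) (≡.trans
        (∑-subs-subs (t * suc c) (t′ * c) (t * 0 ∷ scale t v) (t′ * 1 ∷ scale t′ v) false i ((true , j) ∷ γ) G) (≡.trans
        (∑-sub-sub (t * suc c) (t′ * c) i _) (∑-cong (sub (t * suc c + t′ * c) i) (λ (_ , x) → ≡.trans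
        (∑-subs-subs (t * 0) (t′ * 1) (scale t v) (scale t′ v) true j γ (λ γ₂ → G ((false , x) ∷ γ₂))) (≡.trans
        (∑-sub-sub (t * 0) (t′ * 1) j _) (∑-cong (sub (t * 0 + t′ * 1) j) (λ (_ , y) → ∑-subs-scale t t′ v γ (λ γ₂ → G ((false , x) ∷ (true , y) ∷ γ₂)))))))))))
      (≡.trans (relΣ-sub k (t * suc c + t′ * c) (t * 0 + t′ * 1) (λ x y → ∑ (subs (scale (t + t′) v) γ) (λ γ₂ → G ((false , x) ∷ (true , y) ∷ γ₂))))
      (cong₂ (λ b l → sg b *ℤ ∑ (sub l k) (λ (_ , k′) → ∑ (antidiag k′) (λ (i , j) → sg j *ℤ ∑ (subs (scale (t + t′) v) γ) (λ γ₂ → G ((false , i) ∷ (true , j) ∷ γ₂)))))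
        (odd-total t t′) (total t t′ c)))

  relΣ-pairs : ∀ ps m k γ Ls ξ → relΣ k γ (Wl (pairs ps m ++ Ls) ξ) ≡ relΣ k γ (Wl Ls ξ)
  relΣ-pairs ps zero    k γ Ls ξ = ≡.refl
  relΣ-pairs ps (suc m) k γ Ls ξ = outer (antidiag m) Ls
    where
    two : ℕ → Mono → List Mono
    two c (q , v) = (q , suc c ∷ 0 ∷ v) ∷ (not q , c ∷ 1 ∷ v) ∷ []
    inner : ∀ c Ms Ls → relΣ k γ (Wl (L.∑ Ms (two c) ++ Ls) ξ) ≡ relΣ k γ (Wl Ls ξ)
    inner c []             Ls = ≡.refl
    inner c ((q , v) ∷ Ms) Ls = ≡.trans (relΣ-pair k γ q c v (L.∑ Ms (two c) ++ Ls) ξ) (inner c Ms Ls)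
    block : ℕ × ℕ → List Mono
    block (c , r) = L.∑ (letters ps r) (two c)
    outer : ∀ xs Ls → relΣ k γ (Wl (L.∑ xs block ++ Ls) ξ) ≡ relΣ k γ (Wl Ls ξ)
    outer []             Ls = ≡.refl
    outer ((c , r) ∷ xs) Ls = ≡.trans (cong (λ l → relΣ k γ (Wl l ξ)) (Listₚ.++-assoc (block (c , r)) (L.∑ xs block) Ls)) (≡.trans (inner c (letters ps r) (L.∑ xs block ++ Ls)) (outer xs Ls))

-- Plethysm with h_m preserves supersymmetry in the inner variables. In `rel` the paired monomials
-- cancel; the remaining ones are free of both variables, whose exponents have positive sum and
-- therefore cannot be produced.
W-super : ∀ m ξ → Super (W m ξ)
W-super m ξ .perm = perm-from-swaps (W m ξ) (W-swap m ξ)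
W-super m ξ .drop = W-drop m ξ
W-super m ξ .rel k w = begin
  relΣ (suc k) w (Wl (letters (false ∷ true ∷ parities w) m) ξ)
    ≡⟨ ∑-cong (antidiag (suc k)) (λ (i , j) → cong (sg j *ℤ_) (Wl-↭ (letters-pairs (parities w) m) ξ _)) ⟩
  relΣ (suc k) w (Wl (pairs (parities w) m ++ map zero∷ (map zero∷ (letters (parities w) m))) ξ)
    ≡⟨ relΣ-pairs (parities w) m (suc k) w _ ξ ⟩
  relΣ (suc k) w (Wl (map zero∷ (map zero∷ (letters (parities w) m))) ξ)
    ≡⟨ ∑-cong (antidiag (suc k)) (λ (i , j) → ≡.trans (cong (sg j *ℤ_) (≡.trans (Wl-zero∷ (map zero∷ (letters (parities w) m)) ξ false i ((true , j) ∷ w))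
         (≡.trans (cong (δ₀ ((false , i) ∷ []) *ℤ_) (Wl-zero∷ (letters (parities w) m) ξ true j w)) (δ₀-two i j (W m ξ w)))))
         (sym (ℤₚ.*-assoc (sg j) (δ₀ ((false , i) ∷ (true , j) ∷ [])) (W m ξ w)))) ⟩
  ∑ (antidiag (suc k)) (λ (i , j) → sg j *ℤ δ₀ ((false , i) ∷ (true , j) ∷ []) *ℤ W m ξ w)
    ≡⟨ sym (∑-*ʳ (W m ξ w) (antidiag (suc k)) (λ (i , j) → sg j *ℤ δ₀ ((false , i) ∷ (true , j) ∷ []))) ⟩
  ∑ (antidiag (suc k)) (λ (i , j) → sg j *ℤ δ₀ ((false , i) ∷ (true , j) ∷ [])) *ℤ W m ξ w
    ≡⟨ cong (_*ℤ W m ξ w) (δ₀-super .rel k []) ⟩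
  + 0 ∎
  where
  open ≡-Reasoning
  δ₀-two : ∀ i j z → δ₀ ((false , i) ∷ []) *ℤ (δ₀ ((true , j) ∷ []) *ℤ z) ≡ δ₀ ((false , i) ∷ (true , j) ∷ []) *ℤ z
  δ₀-two zero    j z = ℤₚ.*-identityˡ _
  δ₀-two (suc i) j z = ≡.refl

-- Kostka numbers

antidiag-upTo : ∀ m → antidiag m ≡ map (λ a → a , m ∸ a) (upTo (suc m))
antidiag-upTo zero    = ≡.refl
antidiag-upTo (suc m) = cong ((0 , suc m) ∷_) (≡.trans (cong (map (λ (i , j) → suc i , j)) (antidiag-upTo m))
  (≡.trans (sym (Listₚ.map-∘ (upTo (suc m)))) (≡.trans (Listₚ.map-∘ (upTo (suc m))) (cong (map (λ a → a , suc m ∸ a)) (Listₚ.map-upTo suc (suc m))))))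

comps-antidiag : ∀ n m → comps (suc n) m ≡ concatMap (λ (a , r) → map (a ∷_) (comps n r)) (antidiag m)
comps-antidiag n m = cong concat (≡.trans (Listₚ.map-∘ (upTo (suc m))) (cong (map (λ (a , r) → map (a ∷_) (comps n r))) (sym (antidiag-upTo m))))

∑-comps : ∀ n m f → ∑ (comps (suc n) m) f ≡ ∑ (antidiag m) (λ (a , r) → ∑ (comps n r) (λ w → f (a ∷ w)))
∑-comps n m f = ≡.trans (cong (λ l → ∑ l f) (comps-antidiag n m)) (≡.trans (∑-concatMap _ (antidiag m) f) (∑-cong (antidiag m) (λ (a , r) → ∑-map _ (comps n r) f)))

comps-good : ∀ n m → All (λ v → length v ≡ n × sum v ≡ m) (comps n m)
comps-good zero    zero    = (≡.refl , ≡.refl) ∷ []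
comps-good zero    (suc m) = []
comps-good (suc n) m       = subst (All _) (sym (comps-antidiag n m)) (All-concatMap _ (All.map (λ { {a , r} e → AllP.map⁺ (All.map
  (λ (l , s) → cong suc l , ≡.trans (cong (λ k → a + k) s) e) (comps-good n r)) }) (take≤-sum false m)))

Alphabet-comps : ∀ n m → Alphabet (comps n m) ≡ letters (replicate n false) m
Alphabet-comps zero    zero    = ≡.refl
Alphabet-comps zero    (suc m) = ≡.refl
Alphabet-comps (suc n) m       = ≡.trans (cong Alphabet (comps-antidiag n m)) (go (antidiag m))
  where
  go : ∀ xs → Alphabet (concatMap (λ (a , r) → map (a ∷_) (comps n r)) xs) ≡
    concatMap (λ (a , r) → map (λ (q , v) → twist false a q , a ∷ v) (letters (replicate n false) r)) xs
  go []             = ≡.refl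
  go ((a , r) ∷ xs) = ≡.trans (Listₚ.map-++ (false ,_) (map (a ∷_) (comps n r)) _) (cong₂ _++_
    (≡.trans (sym (Listₚ.map-∘ (comps n r))) (≡.trans (Listₚ.map-∘ (comps n r)) (cong (map (λ (q , v) → twist false a q , a ∷ v)) (Alphabet-comps n r)))) (go xs))

parities-evens : ∀ γ → parities (evens γ) ≡ replicate (length γ) false
parities-evens []      = ≡.refl
parities-evens (_ ∷ γ) = cong (false ∷_) (parities-evens γ)

countSSYT-W : ∀ {π} → Linked _≥_ π → ∀ m γ → + countSSYT π (comps (length γ) m) γ ≡ Ext (λ ξ → W m ξ (evens γ)) (evens π)
countSSYT-W {π} l m γ = ≡.trans (countSSYT-Ext l (comps (length γ) m) γ (All.map proj₁ (comps-good (length γ) m)))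
  (Ext-cong (evens π) (λ ξ → cong (λ Ls → Wl Ls ξ (evens γ)) (≡.trans (Alphabet-comps (length γ) m) (cong (λ ps → letters ps m) (sym (parities-evens γ))))))

letters-0 : ∀ ps → letters ps 0 ≡ (false , replicate (length ps) 0) ∷ []
letters-0 []           = ≡.refl
letters-0 (false ∷ ps) rewrite letters-0 ps = ≡.refl
letters-0 (true ∷ ps)  rewrite letters-0 ps = ≡.refl

letters-1 : ∀ ps → letters (false ∷ ps) 1 ↭ (false , 1 ∷ replicate (length ps) 0) ∷ map zero∷ (letters ps 1)
letters-1 ps = ↭-trans (↭-reflexive (cong (λ l → map zero∷ (letters ps 1) ++ map (λ (q , v) → q , 1 ∷ v) l ++ []) (letters-0 ps)))
  (Perm.++-comm (map zero∷ (letters ps 1)) _)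

unitVecs-suc : ∀ n → unitVecs (suc n) ≡ (1 ∷ replicate n 0) ∷ map (0 ∷_) (unitVecs n)
unitVecs-suc n = cong₂ _∷_ (cong (1 ∷_) (≡.trans (cong (map _) (sym (Listₚ.map-upTo suc n))) (≡.trans (sym (Listₚ.map-∘ (upTo n))) (zeros (upTo n) (Listₚ.length-upTo n)))))
  (≡.trans (cong (map _) (sym (Listₚ.map-upTo suc n))) (≡.trans (sym (Listₚ.map-∘ (upTo n))) (≡.trans (Listₚ.map-cong (λ i → cong (0 ∷_)
    (≡.trans (cong (map _) (sym (Listₚ.map-upTo suc n))) (sym (Listₚ.map-∘ (upTo n))))) (upTo n)) (Listₚ.map-∘ (upTo n)))))
  where
  zeros : ∀ xs {n} → length xs ≡ n → map (λ j → if 0 ≡ᵇ suc j then 1 else 0) xs ≡ replicate n 0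
  zeros []       ≡.refl = ≡.refl
  zeros (x ∷ xs) ≡.refl = cong (0 ∷_) (zeros xs ≡.refl)

Alphabet-unitVecs : ∀ n → Alphabet (unitVecs n) ↭ letters (replicate n false) 1
Alphabet-unitVecs zero    = ↭-refl
Alphabet-unitVecs (suc n) = ↭-trans (↭-reflexive (cong Alphabet (unitVecs-suc n))) (↭-trans
  (↭-trans (↭-reflexive (cong₂ (λ k l → (false , 1 ∷ replicate k 0) ∷ l) (sym (Listₚ.length-replicate n))
    (≡.trans (sym (Listₚ.map-∘ (unitVecs n))) (Listₚ.map-∘ (unitVecs n)))))
    (prep _ (Perm.map⁺ zero∷ (Alphabet-unitVecs n))))
  (↭-sym (letters-1 (replicate n false))))

unitVecs-length : ∀ n → All (λ v → length v ≡ n) (unitVecs n)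
unitVecs-length zero    = []
unitVecs-length (suc n) = subst (All _) (sym (unitVecs-suc n)) (cong suc (Listₚ.length-replicate n) ∷ AllP.map⁺ (All.map (cong suc) (unitVecs-length n)))

-- In degree one the monomials are the variables themselves. For a partition π this is the Kostka
-- number extended to words with odd letters: the coefficient of s_π in a product of h's and e's.
K : List ℕ → Word → ℤ
K π γ = Ext (λ ξ → W 1 ξ γ) (evens π)

K-super : ∀ π → Super (K π)
K-super π = Ext-super (evens π) (λ ξ → W-super 1 ξ)

kostka-K : ∀ {π} → Linked _≥_ π → ∀ γ → + kostka π γ ≡ K π (evens γ)
kostka-K {π} l γ = ≡.trans (countSSYT-Ext l (unitVecs (length γ)) γ (unitVecs-length (length γ)))
  (Ext-cong (evens π) (λ ξ → ≡.trans (Wl-↭ (Alphabet-unitVecs (length γ)) ξ (evens γ)) (cong (λ ps → Wl (letters ps 1) ξ (evens γ)) (sym (parities-evens γ)))))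

private
  scale-zeros : ∀ t n → scale t (replicate n 0) ≡ scale 0 (replicate n 0)
  scale-zeros t zero    = ≡.refl
  scale-zeros t (suc n) = cong₂ _∷_ (ℕₚ.*-zeroʳ t) (scale-zeros t n)

  ∑-sub-δ₀ : ∀ t g z → ∑ (sub t g) (λ (_ , g′) → δ₀ ((false , g′) ∷ []) *ℤ z) ≡ ⟦ t ≡ᵇ g ⟧ *ℤ z
  ∑-sub-δ₀ zero    zero    z = ℤₚ.+-identityʳ _
  ∑-sub-δ₀ zero    (suc g) z = ≡.refl
  ∑-sub-δ₀ (suc t) zero    z = ≡.refl
  ∑-sub-δ₀ (suc t) (suc g) z = ∑-sub-δ₀ t g z

-- Only one monomial of degree one contains the first variable, so the exponent `g` forces its
-- multiplicity.
W-1-∷ : ∀ ξ g γ → W 1 ξ ((false , g) ∷ γ) ≡ ∑ (lowers false ξ) (λ (t , ξ′) → ⟦ t ≡ᵇ g ⟧ *ℤ W 1 ξ′ γ)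
W-1-∷ ξ g γ = ≡.trans (Wl-↭ (letters-1 (parities γ)) ξ ((false , g) ∷ γ)) (∑-cong (lowers false ξ) (λ (t , ξ′) → begin
  ∑ (subs (t * 1 ∷ scale t z) ((false , g) ∷ γ)) (Wl (map zero∷ Ls) ξ′)
    ≡⟨ ∑-subs (t * 1) (scale t z) false g γ (Wl (map zero∷ Ls) ξ′) ⟩
  ∑ (sub (t * 1) g) (λ (_ , g′) → ∑ (subs (scale t z) γ) (λ γ′ → Wl (map zero∷ Ls) ξ′ ((false , g′) ∷ γ′)))
    ≡⟨ cong₂ (λ k l → ∑ (sub k g) (λ (_ , g′) → ∑ l (λ γ′ → Wl (map zero∷ Ls) ξ′ ((false , g′) ∷ γ′)))) (ℕₚ.*-identityʳ t)
         (≡.trans (cong (λ v → subs v γ) (scale-zeros t (length (parities γ)))) (subs-zero z γ)) ⟩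
  ∑ (sub t g) (λ (_ , g′) → Wl (map zero∷ Ls) ξ′ ((false , g′) ∷ γ) +ℤ + 0)
    ≡⟨ ∑-cong (sub t g) (λ (_ , g′) → ≡.trans (ℤₚ.+-identityʳ _) (Wl-zero∷ Ls ξ′ false g′ γ)) ⟩
  ∑ (sub t g) (λ (_ , g′) → δ₀ ((false , g′) ∷ []) *ℤ W 1 ξ′ γ)
    ≡⟨ ∑-sub-δ₀ t g (W 1 ξ′ γ) ⟩
  ⟦ t ≡ᵇ g ⟧ *ℤ W 1 ξ′ γ ∎))
  where
  open ≡-Reasoning
  z = replicate (length (parities γ)) 0
  Ls = letters (parities γ) 1

K-∷ : ∀ {π} → Linked _≥_ π → ∀ g γ → K π ((false , g) ∷ γ) ≡ ∑ (strips π) (λ (t , ζ) → ⟦ t ≡ᵇ g ⟧ *ℤ K ζ γ)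
K-∷ {π} l g γ = ≡.trans (Ext-cong (evens π) (λ ξ → W-1-∷ ξ g γ)) (≡.trans
  (Ext-strips (λ t → Super-* ⟦ t ≡ᵇ g ⟧ (Wl-super (letters (parities γ) 1) γ)) l)
  (∑-cong (strips π) (λ (t , ζ) → Ext-* ⟦ t ≡ᵇ g ⟧ (λ ξ → W 1 ξ γ) (evens ζ))))

K-[] : ∀ π → K π [] ≡ δ₀ (evens π)
K-[] π = ≡.trans (Ext-cong (evens π) (λ ξ → ℤₚ.*-identityʳ (δ₀ ξ))) (Ext-δ₀ (evens π))

K-∷ʳ0 : ∀ π γ → K (π ∷ʳ 0) γ ≡ K π γ
K-∷ʳ0 π γ = ≡.trans (cong (Ext (λ ξ → W 1 ξ γ)) (Listₚ.map-++ (false ,_) π (0 ∷ []))) (Ext-snoc-zero (Wl-super (letters (parities γ) 1) γ) (evens π) false)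

npos : List ℕ → ℕ
npos []          = 0
npos (zero ∷ π)  = npos π
npos (suc _ ∷ π) = suc (npos π)

private
  npos-zero : ∀ {π} → Linked _≥_ (0 ∷ π) → npos π ≡ 0
  npos-zero [-]                 = ≡.refl
  npos-zero {zero ∷ π} (p ∷ l)  = npos-zero l
  npos-zero {suc _ ∷ π} (() ∷ l)

  npos-∷≤ : ∀ x π → npos (x ∷ π) ≤ suc (npos π)
  npos-∷≤ zero    π = ℕₚ.n≤1+n _
  npos-∷≤ (suc x) π = ℕₚ.≤-refl

  npos-strips : ∀ {π} → Linked _≥_ π → All (λ (t , ζ) → npos π ≤ suc (npos ζ)) (strips π)
  npos-strips {[]}     l = z≤n ∷ []
  npos-strips {p ∷ ps} l = All-concatMap _ (All.universal (λ (i , j) → AllP.map⁺ (All.map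
    (λ { {t , ζ} h → ℕₚ.≤-trans (npos-∷≤ p ps) (s≤s (go ps j ζ (tail-Linked l) h)) }) (npos-strips (tail-Linked l)))) (antidiag (p ∸ hd ps)))
    where
    go : ∀ ps j ζ → Linked _≥_ ps → npos ps ≤ suc (npos ζ) → npos ps ≤ npos (hd ps + j ∷ ζ)
    go []            j ζ l h = z≤n
    go (zero ∷ ps)   j ζ l h = ℕₚ.≤-trans (ℕₚ.≤-reflexive (npos-zero l)) z≤n
    go (suc p ∷ ps)  j ζ l h = h

  δ₀-npos : ∀ π → 0 < npos π → δ₀ (evens π) ≡ + 0
  δ₀-npos (zero ∷ π)  h = δ₀-npos π h
  δ₀-npos (suc _ ∷ π) h = ≡.refl

-- Each letter of γ removes a horizontal strip, and that empties at most one row.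
K-vanish : ∀ γ {π} → Linked _≥_ π → length γ < npos π → K π (evens γ) ≡ + 0
K-vanish []      {π} l h = ≡.trans (K-[] π) (δ₀-npos π h)
K-vanish (g ∷ γ) {π} l h = ≡.trans (K-∷ l g (evens γ)) (≡.trans (∑-cong-All (All.zipWith (λ { {t , ζ} (lζ , hζ) →
    ≡.trans (cong (⟦ t ≡ᵇ g ⟧ *ℤ_) (K-vanish γ (proj₁ lζ) (s≤s⁻¹ (ℕₚ.≤-trans h hζ)))) (ℤₚ.*-zeroʳ ⟦ t ≡ᵇ g ⟧) }) (strips-Linked l , npos-strips l)))
  (∑-ε (strips π) (λ _ → ≡.refl)))

-- On the right, `bern` lowers the letter `(false , j)` by at most one unit with a sign, and the sum
-- over `i` is the inverse operation. In terms of operators, this moves multiplication by h_k past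
-- one row.
bern-telescope : ∀ {F} → Super F → ∀ z k w →
  bern false z (λ u → F ((false , k) ∷ u)) w ≡ ∑ (antidiag k) (λ (i , j) → bern false (z + i) F ((false , j) ∷ w))
bern-telescope {F} S z k w = sym (begin
  ∑ (antidiag k) (λ (i , j) → bern false (z + i) F ((false , j) ∷ w))
    ≡⟨ ∑-cong (antidiag k) (λ (i , j) → ≡.trans (∑-lowers true false j w (λ (t , w′) → sg t *ℤ F ((false , z + i + t) ∷ w′)))
         (∑-cong (steps j) (λ (e , j′) → ≡.trans (∑-cong (lowers true w) (λ (t , w′) → term i e t j′ w′)) (sym (∑-*ˡ (sg e) (lowers true w) _))))) ⟩
  ∑ (antidiag k) (λ (i , j) → ∑ (steps j) (λ (e , j′) → sg e *ℤ T (i + e) j′))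
    ≡⟨ antidiag-inverse k T ⟩
  T 0 k
    ≡⟨ ∑-cong (lowers true w) (λ (t , w′) → cong (sg t *ℤ_) (≡.trans (cong (λ n → F ((false , n + t) ∷ (false , k) ∷ w′)) (ℕₚ.+-identityʳ z)) (S .perm (swap _ _ ↭-refl)))) ⟩
  bern false z (λ u → F ((false , k) ∷ u)) w ∎)
  where
  open ≡-Reasoning
  T : ℕ → ℕ → ℤ
  T r j = ∑ (lowers true w) (λ (t , w′) → sg t *ℤ F ((false , z + r + t) ∷ (false , j) ∷ w′))
  ex : ∀ z i e t → z + i + (e + t) ≡ z + (i + e) + t
  ex = ℕSolver.solve-∀
  term : ∀ i e t j w′ → sg (e + t) *ℤ F ((false , z + i + (e + t)) ∷ (false , j) ∷ w′) ≡ sg e *ℤ (sg t *ℤ F ((false , z + (i + e) + t) ∷ (false , j) ∷ w′))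
  term i e t j w′ rewrite ex z i e t | sg-+ e t = ℤₚ.*-assoc (sg e) (sg t) _

-- The commutation relation of Bernstein's operators, which gives the straightening rule s_(p, q+1)
-- = - s_(q, p+1). Both sides expand into `M`, whose antisymmetry rests on F not seeing the order of
-- its letters.
bern-anti : ∀ {F} → Super F → ∀ p q w → bern false (suc q) (bern false p F) w ≡ - bern false (suc p) (bern false q F) w
bern-anti {F} S p q w = begin
  bern false (suc q) (bern false p F) w
    ≡⟨ expand p q ⟩
  ∑ (lowers true w) (λ (c , w₁) → ∑ (lowers true w₁) (λ (d , w₂) → M p q c d w₂))
    ≡⟨ lowers-comm true true w (M p q) ⟩
  ∑ (lowers true w) (λ (d , w₁) → ∑ (lowers true w₁) (λ (c , w₂) → M p q c d w₂))
    ≡⟨ ∑-cong (lowers true w) (λ (d , w₁) → ≡.trans (∑-cong (lowers true w₁) (λ (c , w₂) → M-anti c d w₂)) (sym (∑-neg (lowers true w₁) _))) ⟩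
  ∑ (lowers true w) (λ (d , w₁) → - ∑ (lowers true w₁) (λ (c , w₂) → M q p d c w₂))
    ≡⟨ sym (∑-neg (lowers true w) _) ⟩
  - ∑ (lowers true w) (λ (d , w₁) → ∑ (lowers true w₁) (λ (c , w₂) → M q p d c w₂))
    ≡⟨ cong -_ (sym (expand q p)) ⟩
  - bern false (suc p) (bern false q F) w ∎
  where
  open ≡-Reasoning
  T : ℕ → ℕ → Word → ℤ
  T i j u = F ((false , i) ∷ (false , j) ∷ u)
  M : ℕ → ℕ → ℕ → ℕ → Word → ℤ
  M p q c d u = sg c *ℤ (sg d *ℤ T (p + d) (suc (q + c)) u +ℤ - sg d *ℤ T (p + suc d) (q + c) u)
  ring : ∀ c d x y → c *ℤ (d *ℤ x +ℤ - d *ℤ y) ≡ - (d *ℤ (c *ℤ y +ℤ - c *ℤ x))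
  ring = solve-∀
  M-anti : ∀ c d u → M p q c d u ≡ - M q p d c u
  M-anti c d u rewrite ℕₚ.+-suc p d | ℕₚ.+-suc q c | S .perm (swap (false , p + d) (false , suc (q + c)) (↭-refl {x = u}))
    | S .perm (swap (false , suc (p + d)) (false , q + c) (↭-refl {x = u})) = ring (sg c) (sg d) _ _
  expand : ∀ p q → bern false (suc q) (bern false p F) w ≡ ∑ (lowers true w) (λ (c , w₁) → ∑ (lowers true w₁) (λ (d , w₂) → M p q c d w₂))
  expand p q = ∑-cong (lowers true w) (λ (c , w₁) → ≡.trans (cong (sg c *ℤ_) (≡.trans
      (∑-lowers true false (suc (q + c)) w₁ (λ (t , w′) → sg t *ℤ F ((false , p + t) ∷ w′)))
      (≡.trans (cong (∑ (lowers true w₁) (λ (d , w₂) → sg d *ℤ T (p + d) (suc (q + c)) w₂) +ℤ_) (ℤₚ.+-identityʳ _)) (sym (∑-∙ (lowers true w₁) _ _)))))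
    (∑-*ˡ (sg c) (lowers true w₁) _))

Ext-anti : ∀ {F} → Super F → ∀ pre p q w → Ext F (evens (pre ++ p ∷ suc q ∷ w)) ≡ - Ext F (evens (pre ++ q ∷ suc p ∷ w))
Ext-anti S (a ∷ pre) p q w = Ext-anti (bern-super false a S) pre p q w
Ext-anti {F} S []    p q w = ≡.trans (Ext-cong (evens w) (λ u → ≡.trans (bern-anti S p q u) (sym (ℤₚ.-1*i≡-i _))))
  (≡.trans (Ext-* (- + 1) (bern false (suc p) (bern false q F)) (evens w)) (ℤₚ.-1*i≡-i _))

-- Pieri's rule and the Schur expansion

∧-true : ∀ {a b} → (a ∧ b) ≡ true → a ≡ true × b ≡ true
∧-true {true} {true} _ = ≡.refl , ≡.refl

≤ᵇ⇒≤′ : ∀ m n → (m ≤ᵇ n) ≡ true → m ≤ n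
≤ᵇ⇒≤′ m n e = ℕₚ.≤ᵇ⇒≤ m n (subst Data.Bool.T (sym e) _)

⟦⟧-guard : ∀ b c z → (b ≡ true → c ≡ true) → ⟦ b ⟧ *ℤ z ≡ ⟦ c ⟧ *ℤ (⟦ b ⟧ *ℤ z)
⟦⟧-guard false c z h = sym (ℤₚ.*-zeroʳ ⟦ c ⟧)
⟦⟧-guard true  c z h rewrite h ≡.refl = sym (ℤₚ.*-identityˡ _)

⟦∧⟧* : ∀ a b z → ⟦ a ∧ b ⟧ *ℤ z ≡ ⟦ a ⟧ *ℤ (⟦ b ⟧ *ℤ z)
⟦∧⟧* a b z = ≡.trans (cong (_*ℤ z) (⟦∧⟧ a b)) (ℤₚ.*-assoc ⟦ a ⟧ ⟦ b ⟧ z)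

-- π₁ ≥ η₁ ≥ π₂ ≥ η₂ ≥ …, i.e. π / η is a horizontal strip.
interlace : List ℕ → List ℕ → Bool
interlace []      _        = true
interlace (e ∷ η) []       = false
interlace (e ∷ η) (p ∷ ps) = (e ≤ᵇ p) ∧ ((hd ps ≤ᵇ e) ∧ interlace η ps)

inside : List ℕ → List ℕ → Bool
inside []      _        = true
inside (e ∷ η) []       = false
inside (e ∷ η) (p ∷ ps) = (e ≤ᵇ p) ∧ inside η ps

inside-sum : ∀ η π → inside η π ≡ true → sum η ≤ sum π
inside-sum []      π        _ = z≤n
inside-sum (e ∷ η) (p ∷ ps) h = ℕₚ.+-mono-≤ (≤ᵇ⇒≤′ e p (proj₁ (∧-true h))) (inside-sum η ps (proj₂ (∧-true h)))

interlace-sum : ∀ η π → interlace η π ≡ true → sum η ≤ sum π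
interlace-sum []      π        _ = z≤n
interlace-sum (e ∷ η) (p ∷ ps) h = ℕₚ.+-mono-≤ (≤ᵇ⇒≤′ e p (proj₁ (∧-true h))) (interlace-sum η ps (proj₂ (∧-true {hd ps ≤ᵇ e} (proj₂ (∧-true {e ≤ᵇ p} h)))))

sum-∷ʳ0 : ∀ ζ → sum (ζ ∷ʳ 0) ≡ sum ζ
sum-∷ʳ0 []      = ≡.refl
sum-∷ʳ0 (z ∷ ζ) = cong (λ k → z + k) (sum-∷ʳ0 ζ)

∑-antidiag-≥ˡ : ∀ k h (f : ℕ → ℕ → ℤ) →
  ∑ (antidiag (h + k)) (λ (i , j) → ⟦ h ≤ᵇ i ⟧ *ℤ f i j) ≡ ∑ (antidiag k) (λ (i , j) → f (h + i) j)
∑-antidiag-≥ˡ k h f = ≡.trans (∑-antidiag-flip (h + k) _) (≡.trans (∑-antidiag-≥ (h + k) h (λ j i → f i j) (ℕₚ.m≤m+n h k))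
  (≡.trans (cong (λ n → ∑ (antidiag n) (λ (j , i) → f (h + i) j)) (ℕₚ.m+n∸m≡n h k)) (∑-antidiag-flip k _)))

∑-antidiag-≥ʳ : ∀ k h (f : ℕ → ℕ → ℤ) →
  ∑ (antidiag (h + k)) (λ (i , j) → ⟦ h ≤ᵇ j ⟧ *ℤ f i j) ≡ ∑ (antidiag k) (λ (i , j) → f i (h + j))
∑-antidiag-≥ʳ k h f = ≡.trans (∑-antidiag-≥ (h + k) h f (ℕₚ.m≤m+n h k)) (cong (λ n → ∑ (antidiag n) (λ (i , j) → f i (h + j))) (ℕₚ.m+n∸m≡n h k))

-- Moving h_k past the rows one at a time adds any number of boxes to each, and what is left over
-- becomes a new last row. The terms that are not horizontal strips are still present here;
-- straightening cancels them afterwards.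
pieri-free : ∀ {F} → Super F → ∀ k ζ →
  Ext (λ w → F ((false , k) ∷ w)) (evens ζ) ≡ ∑ (comps (suc (length ζ)) (sum ζ + k)) (λ π → ⟦ inside (ζ ∷ʳ 0) π ⟧ *ℤ Ext F (evens π))
pieri-free {F} S k [] = sym (≡.trans (∑-comps 0 k (λ π → ⟦ inside (0 ∷ []) π ⟧ *ℤ Ext F (evens π))) (≡.trans
  (∑-antidiag-last k (λ a r → ∑ (comps 0 r) (λ w → ⟦ inside (0 ∷ []) (a ∷ w) ⟧ *ℤ Ext F (evens (a ∷ w)))) (λ _ _ → ≡.refl))
  (≡.trans (ring (F ((false , k + 0) ∷ []))) (cong (λ n → F ((false , n) ∷ [])) (ℕₚ.+-identityʳ k)))))
  where
  ring : ∀ x → + 1 *ℤ (+ 1 *ℤ x +ℤ + 0) +ℤ + 0 ≡ x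
  ring = solve-∀
pieri-free {F} S k (z ∷ zs) = begin
  Ext (bern false z (λ w → F ((false , k) ∷ w))) (evens zs)
    ≡⟨ Ext-cong (evens zs) (bern-telescope S z k) ⟩
  Ext (λ w → ∑ (antidiag k) (λ (i , j) → bern false (z + i) F ((false , j) ∷ w))) (evens zs)
    ≡⟨ Ext-∑ (antidiag k) (λ (i , j) w → bern false (z + i) F ((false , j) ∷ w)) (evens zs) ⟩
  ∑ (antidiag k) (λ (i , j) → Ext (λ w → bern false (z + i) F ((false , j) ∷ w)) (evens zs))
    ≡⟨ ∑-cong (antidiag k) (λ (i , j) → pieri-free (bern-super false (z + i) S) j zs) ⟩
  ∑ (antidiag k) (λ (i , j) → Φ (z + i) (s + j))
    ≡⟨ sym (∑-antidiag-≥ʳ k s (λ i r → Φ (z + i) r)) ⟩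
  ∑ (antidiag (s + k)) (λ (i , r) → ⟦ s ≤ᵇ r ⟧ *ℤ Φ (z + i) r)
    ≡⟨ ∑-cong (antidiag (s + k)) (λ (i , r) → sym (guard (z + i) r)) ⟩
  ∑ (antidiag (s + k)) (λ (i , r) → Φ (z + i) r)
    ≡⟨ sym (∑-antidiag-≥ˡ (s + k) z Φ) ⟩
  ∑ (antidiag (z + (s + k))) (λ (a , r) → ⟦ z ≤ᵇ a ⟧ *ℤ Φ a r)
    ≡⟨ cong (λ n → ∑ (antidiag n) (λ (a , r) → ⟦ z ≤ᵇ a ⟧ *ℤ Φ a r)) (sym (ℕₚ.+-assoc z s k)) ⟩
  ∑ (antidiag (z + s + k)) (λ (a , r) → ⟦ z ≤ᵇ a ⟧ *ℤ Φ a r)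
    ≡⟨ ∑-cong (antidiag (z + s + k)) (λ (a , r) → ≡.trans (∑-*ˡ ⟦ z ≤ᵇ a ⟧ (comps n r) _) (∑-cong (comps n r) (λ π → sym (⟦∧⟧* (z ≤ᵇ a) (inside (zs ∷ʳ 0) π) _)))) ⟩
  ∑ (antidiag (z + s + k)) (λ (a , r) → ∑ (comps n r) (λ π → ⟦ inside (z ∷ zs ∷ʳ 0) (a ∷ π) ⟧ *ℤ Ext F (evens (a ∷ π))))
    ≡⟨ sym (∑-comps n (z + s + k) (λ π → ⟦ inside (z ∷ zs ∷ʳ 0) π ⟧ *ℤ Ext F (evens π))) ⟩
  ∑ (comps (suc n) (z + s + k)) (λ π → ⟦ inside (z ∷ zs ∷ʳ 0) π ⟧ *ℤ Ext F (evens π)) ∎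
  where
  open ≡-Reasoning
  n = suc (length zs)
  s = sum zs
  Φ : ℕ → ℕ → ℤ
  Φ a r = ∑ (comps n r) (λ π → ⟦ inside (zs ∷ʳ 0) π ⟧ *ℤ Ext F (evens (a ∷ π)))
  guard : ∀ a r → Φ a r ≡ ⟦ s ≤ᵇ r ⟧ *ℤ Φ a r
  guard a r = ≡.trans (∑-cong-All (All.map (λ { {π} (_ , e) → ⟦⟧-guard (inside (zs ∷ʳ 0) π) (s ≤ᵇ r) (Ext F (evens (a ∷ π)))
      (λ h → ≤⇒≤ᵇ≡true (≡.subst₂ _≤_ (sum-∷ʳ0 zs) e (inside-sum (zs ∷ʳ 0) π h))) }) (comps-good n r)))
    (sym (∑-*ˡ ⟦ s ≤ᵇ r ⟧ (comps n r) _))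

<ᵇ-suc : ∀ m n → (m <ᵇ suc n) ≡ (m ≤ᵇ n)
<ᵇ-suc zero    n = ≡.refl
<ᵇ-suc (suc m) n = ≡.refl

≤ᵇ-split : ∀ x e z → z ≡ ⟦ x ≤ᵇ e ⟧ *ℤ z +ℤ ⟦ e <ᵇ x ⟧ *ℤ z
≤ᵇ-split zero    e       z = ring z
  where
  ring : ∀ z → z ≡ + 1 *ℤ z +ℤ + 0 *ℤ z
  ring = solve-∀
≤ᵇ-split (suc x) zero    z = ring z
  where
  ring : ∀ z → z ≡ + 0 *ℤ z +ℤ + 1 *ℤ z
  ring = solve-∀
≤ᵇ-split (suc x) (suc e) z rewrite suc-≤ᵇ x e = ≤ᵇ-split x e z

-- The surplus terms have a second row longer than `e`. Exchanging the rows (p, q + 1) with (q, p +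
-- 1) preserves the conditions `e ≤ p` and `e ≤ q`, fixes all later rows and reverses the sign.
inside-interlace : ∀ {η} → Linked _≥_ η → (A : List ℕ → ℤ) →
  (∀ pre p q w → A (pre ++ p ∷ suc q ∷ w) ≡ - A (pre ++ q ∷ suc p ∷ w)) → ∀ T →
  ∑ (comps (length η) T) (λ π → ⟦ inside η π ⟧ *ℤ A π) ≡ ∑ (comps (length η) T) (λ π → ⟦ interlace η π ⟧ *ℤ A π)
inside-interlace {[]}    l A anti T = ≡.refl
inside-interlace {e ∷ η} l A anti T = begin
  ∑ (comps (suc n) T) (λ π → ⟦ inside (e ∷ η) π ⟧ *ℤ A π)
    ≡⟨ ∑-comps n T (λ π → ⟦ inside (e ∷ η) π ⟧ *ℤ A π) ⟩
  ∑ (antidiag T) (λ (a , r) → ∑ (comps n r) (λ π → ⟦ (e ≤ᵇ a) ∧ inside η π ⟧ *ℤ A (a ∷ π)))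
    ≡⟨ ∑-cong (antidiag T) (λ (a , r) → ≡.trans (factor a r (inside η)) (cong (⟦ e ≤ᵇ a ⟧ *ℤ_)
         (inside-interlace (tail-Linked l) (λ π → A (a ∷ π)) (λ pre → anti (a ∷ pre)) r))) ⟩
  ∑ (antidiag T) (λ (a , r) → ⟦ e ≤ᵇ a ⟧ *ℤ ∑ (comps n r) (λ π → ⟦ interlace η π ⟧ *ℤ A (a ∷ π)))
    ≡⟨ ∑-cong (antidiag T) (λ (a , r) → ≡.trans (cong (⟦ e ≤ᵇ a ⟧ *ℤ_) (≡.trans (∑-cong (comps n r) (λ π → ≤ᵇ-split (hd π) e _)) (∑-∙ (comps n r) _ _)))
         (ℤₚ.*-distribˡ-+ ⟦ e ≤ᵇ a ⟧ (good a r) (bad a r))) ⟩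
  ∑ (antidiag T) (λ (a , r) → ⟦ e ≤ᵇ a ⟧ *ℤ good a r +ℤ ⟦ e ≤ᵇ a ⟧ *ℤ bad a r)
    ≡⟨ ∑-∙ (antidiag T) _ _ ⟩
  ∑ (antidiag T) (λ (a , r) → ⟦ e ≤ᵇ a ⟧ *ℤ good a r) +ℤ ∑ (antidiag T) (λ (a , r) → ⟦ e ≤ᵇ a ⟧ *ℤ bad a r)
    ≡⟨ cong (∑ (antidiag T) (λ (a , r) → ⟦ e ≤ᵇ a ⟧ *ℤ good a r) +ℤ_) (bad-vanish η l A anti) ⟩
  ∑ (antidiag T) (λ (a , r) → ⟦ e ≤ᵇ a ⟧ *ℤ good a r) +ℤ + 0
    ≡⟨ ℤₚ.+-identityʳ _ ⟩
  ∑ (antidiag T) (λ (a , r) → ⟦ e ≤ᵇ a ⟧ *ℤ good a r)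
    ≡⟨ ∑-cong (antidiag T) (λ (a , r) → ≡.trans (cong (⟦ e ≤ᵇ a ⟧ *ℤ_) (∑-cong (comps n r) (λ π → sym (⟦∧⟧* (hd π ≤ᵇ e) (interlace η π) _))))
         (sym (factor a r (λ π → (hd π ≤ᵇ e) ∧ interlace η π)))) ⟩
  ∑ (antidiag T) (λ (a , r) → ∑ (comps n r) (λ π → ⟦ (e ≤ᵇ a) ∧ ((hd π ≤ᵇ e) ∧ interlace η π) ⟧ *ℤ A (a ∷ π)))
    ≡⟨ sym (∑-comps n T (λ π → ⟦ interlace (e ∷ η) π ⟧ *ℤ A π)) ⟩
  ∑ (comps (suc n) T) (λ π → ⟦ interlace (e ∷ η) π ⟧ *ℤ A π) ∎
  where
  open ≡-Reasoning
  n = length η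
  good bad : ℕ → ℕ → ℤ
  good a r = ∑ (comps n r) (λ π → ⟦ hd π ≤ᵇ e ⟧ *ℤ (⟦ interlace η π ⟧ *ℤ A (a ∷ π)))
  bad  a r = ∑ (comps n r) (λ π → ⟦ e <ᵇ hd π ⟧ *ℤ (⟦ interlace η π ⟧ *ℤ A (a ∷ π)))
  factor : ∀ a r (P : List ℕ → Bool) → ∑ (comps n r) (λ π → ⟦ (e ≤ᵇ a) ∧ P π ⟧ *ℤ A (a ∷ π)) ≡ ⟦ e ≤ᵇ a ⟧ *ℤ ∑ (comps n r) (λ π → ⟦ P π ⟧ *ℤ A (a ∷ π))
  factor a r P = ≡.trans (∑-cong (comps n r) (λ π → ⟦∧⟧* (e ≤ᵇ a) (P π) _)) (sym (∑-*ˡ ⟦ e ≤ᵇ a ⟧ (comps n r) _))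
  bad-vanish : ∀ η → Linked _≥_ (e ∷ η) → (A : List ℕ → ℤ) → (∀ pre p q w → A (pre ++ p ∷ suc q ∷ w) ≡ - A (pre ++ q ∷ suc p ∷ w)) →
    ∑ (antidiag T) (λ (a , r) → ⟦ e ≤ᵇ a ⟧ *ℤ ∑ (comps (length η) r) (λ π → ⟦ e <ᵇ hd π ⟧ *ℤ (⟦ interlace η π ⟧ *ℤ A (a ∷ π)))) ≡ + 0
  bad-vanish [] l A anti = ∑-ε (antidiag T) (λ { (a , zero) → ℤₚ.*-zeroʳ ⟦ e ≤ᵇ a ⟧ ; (a , suc r) → ℤₚ.*-zeroʳ ⟦ e ≤ᵇ a ⟧ })
  bad-vanish (e₂ ∷ η₂) (e≥e₂ ∷ _) A anti = begin
    ∑ (antidiag T) (λ (a , r) → ⟦ e ≤ᵇ a ⟧ *ℤ ∑ (comps (suc n₂) r) (λ π → ⟦ e <ᵇ hd π ⟧ *ℤ (⟦ interlace (e₂ ∷ η₂) π ⟧ *ℤ A (a ∷ π))))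
      ≡⟨ ∑-cong (antidiag T) (λ (a , r) → ≡.trans (cong (⟦ e ≤ᵇ a ⟧ *ℤ_) (≡.trans
           (∑-comps n₂ r (λ π → ⟦ e <ᵇ hd π ⟧ *ℤ (⟦ interlace (e₂ ∷ η₂) π ⟧ *ℤ A (a ∷ π))))
           (∑-cong (antidiag r) (λ (q , s) → ≡.trans (∑-cong (comps n₂ s) (λ π → first q (rest π) (A (a ∷ q ∷ π)))) (sym (∑-*ˡ ⟦ e <ᵇ q ⟧ (comps n₂ s) _))))))
           (≡.trans (∑-*ˡ ⟦ e ≤ᵇ a ⟧ (antidiag r) _) (∑-antidiag-flip r _))) ⟩
    ∑ (antidiag T) (λ (a , r) → ∑ (antidiag r) (λ (s , q) → ⟦ e ≤ᵇ a ⟧ *ℤ (⟦ e <ᵇ q ⟧ *ℤ Z s a q)))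
      ≡⟨ ∑-take≤-comm false false T (λ a s q → ⟦ e ≤ᵇ a ⟧ *ℤ (⟦ e <ᵇ q ⟧ *ℤ Z s a q)) ⟩
    ∑ (antidiag T) (λ (s , r) → ∑ (antidiag r) (λ (a , q) → ⟦ e ≤ᵇ a ⟧ *ℤ (⟦ e <ᵇ q ⟧ *ℤ Z s a q)))
      ≡⟨ ∑-ε (antidiag T) (λ (s , r) → vanish s r) ⟩
    + 0 ∎
    where
    n₂ = length η₂
    rest : List ℕ → Bool
    rest π = (hd π ≤ᵇ e₂) ∧ interlace η₂ π
    Z : ℕ → ℕ → ℕ → ℤ
    Z s a q = ∑ (comps n₂ s) (λ π → ⟦ rest π ⟧ *ℤ A (a ∷ q ∷ π))
    first : ∀ q b z → ⟦ e <ᵇ q ⟧ *ℤ (⟦ (e₂ ≤ᵇ q) ∧ b ⟧ *ℤ z) ≡ ⟦ e <ᵇ q ⟧ *ℤ (⟦ b ⟧ *ℤ z)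
    first q b z with e ℕₚ.<? q
    ... | yes e<q rewrite ≤⇒≤ᵇ≡true (ℕₚ.≤-trans e≥e₂ (ℕₚ.<⇒≤ e<q)) = ≡.refl
    ... | no  e≮q rewrite ≥⇒<ᵇ≡false (ℕₚ.≮⇒≥ e≮q) = ≡.refl
    Z-anti : ∀ s a q → Z s a (suc q) ≡ - Z s q (suc a)
    Z-anti s a q = ≡.trans (∑-cong (comps n₂ s) (λ π → ≡.trans (cong (⟦ rest π ⟧ *ℤ_) (anti [] a q π)) (sym (ℤₚ.neg-distribʳ-* ⟦ rest π ⟧ _)))) (sym (∑-neg (comps n₂ s) _))
    vanish : ∀ s r → ∑ (antidiag r) (λ (a , q) → ⟦ e ≤ᵇ a ⟧ *ℤ (⟦ e <ᵇ q ⟧ *ℤ Z s a q)) ≡ + 0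
    vanish s zero    = ≡.trans (ℤₚ.+-identityʳ _) (ℤₚ.*-zeroʳ ⟦ e ≤ᵇ 0 ⟧)
    vanish s (suc r) = ≡.trans (∑-antidiag-snoc r (λ (a , q) → ⟦ e ≤ᵇ a ⟧ *ℤ (⟦ e <ᵇ q ⟧ *ℤ Z s a q))) (cong₂ _+ℤ_
      (x≡-x⇒x≡0 _ (≡.trans (∑-antidiag-flip r _) (≡.trans (∑-cong (antidiag r) (λ (q , a) → B-anti a q)) (sym (∑-neg (antidiag r) _))))) (ℤₚ.*-zeroʳ ⟦ e ≤ᵇ suc r ⟧))
      where
      ring : ∀ x y z → x *ℤ (y *ℤ - z) ≡ - (y *ℤ (x *ℤ z))
      ring = solve-∀
      B-anti : ∀ a q → ⟦ e ≤ᵇ a ⟧ *ℤ (⟦ e <ᵇ suc q ⟧ *ℤ Z s a (suc q)) ≡ - (⟦ e ≤ᵇ q ⟧ *ℤ (⟦ e <ᵇ suc a ⟧ *ℤ Z s q (suc a)))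
      B-anti a q rewrite <ᵇ-suc e q | <ᵇ-suc e a | Z-anti s a q = ring ⟦ e ≤ᵇ a ⟧ ⟦ e ≤ᵇ q ⟧ (Z s q (suc a))

-- Branching lists strips by row differences, Pieri's rule by compositions of a given size. The
-- bounds on the rows are turned into indicators, so that the antidiagonals can be lengthened and
-- interchanged freely.
∑-strips-interlace : ∀ {π} → Linked _≥_ π → (G : ℕ → List ℕ → ℤ) →
  ∑ (strips π) (λ (t , η) → G t η) ≡ ∑ (antidiag (sum π)) (λ (d , t) → ∑ (comps (length π) d) (λ η → ⟦ interlace η π ⟧ *ℤ G t η))
∑-strips-interlace {[]} l G = ring (G 0 [])
  where
  ring : ∀ x → x +ℤ + 0 ≡ + 1 *ℤ x +ℤ + 0 +ℤ + 0
  ring = solve-∀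
∑-strips-interlace {p ∷ ps} l G = begin
  ∑ (strips (p ∷ ps)) (λ (t , η) → G t η)
    ≡⟨ ∑-strips p ps (λ (t , η) → G t η) ⟩
  ∑ (antidiag (p ∸ h)) (λ (i , j) → ∑ (strips ps) (λ (t , η) → G (i + t) (h + j ∷ η)))
    ≡⟨ ∑-cong (antidiag (p ∸ h)) (λ (i , j) → ∑-strips-interlace (tail-Linked l) (λ t η → G (i + t) (h + j ∷ η))) ⟩
  ∑ (antidiag (p ∸ h)) (λ (i , j) → Q i (h + j))
    ≡⟨ sym (∑-antidiag-≥ p h Q (hd-≤ l)) ⟩
  ∑ (antidiag p) (λ (i , e) → ⟦ h ≤ᵇ e ⟧ *ℤ Q i e)
    ≡⟨ ∑-antidiag-flip p _ ⟩
  ∑ (antidiag p) (λ (e , i) → ⟦ h ≤ᵇ e ⟧ *ℤ Q i e)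
    ≡⟨ ∑-cong (antidiag p) (λ (e , i) → cong (⟦ h ≤ᵇ e ⟧ *ℤ_) (Q-eq e i)) ⟩
  ∑ (antidiag p) (λ (e , i) → ⟦ h ≤ᵇ e ⟧ *ℤ ∑ (antidiag (S + i)) (λ (t , d) → V e d t))
    ≡⟨ sym (∑-antidiag-≥ʳ p S (λ e R → ⟦ h ≤ᵇ e ⟧ *ℤ ∑ (antidiag R) (λ (t , d) → V e d t))) ⟩
  ∑ (antidiag (S + p)) (λ (e , R) → ⟦ S ≤ᵇ R ⟧ *ℤ (⟦ h ≤ᵇ e ⟧ *ℤ ∑ (antidiag R) (λ (t , d) → V e d t)))
    ≡⟨ ∑-cong-All (All.map (λ { {e , R} q → ≡.trans (cong (λ b → ⟦ b ⟧ *ℤ (⟦ h ≤ᵇ e ⟧ *ℤ ∑ (antidiag R) (λ (t , d) → V e d t))) (same e R q))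
         (≡.trans (cong (⟦ e ≤ᵇ p ⟧ *ℤ_) (∑-*ˡ ⟦ h ≤ᵇ e ⟧ (antidiag R) _)) (∑-*ˡ ⟦ e ≤ᵇ p ⟧ (antidiag R) _)) }) (take≤-sum false (S + p))) ⟩
  ∑ (antidiag (S + p)) (λ (e , R) → ∑ (antidiag R) (λ (t , d) → ⟦ e ≤ᵇ p ⟧ *ℤ (⟦ h ≤ᵇ e ⟧ *ℤ V e d t)))
    ≡⟨ ∑-take≤-comm false false (S + p) (λ e t d → ⟦ e ≤ᵇ p ⟧ *ℤ (⟦ h ≤ᵇ e ⟧ *ℤ V e d t)) ⟩
  ∑ (antidiag (S + p)) (λ (t , D) → ∑ (antidiag D) (λ (e , d) → ⟦ e ≤ᵇ p ⟧ *ℤ (⟦ h ≤ᵇ e ⟧ *ℤ V e d t)))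
    ≡⟨ ∑-antidiag-flip (S + p) _ ⟩
  ∑ (antidiag (S + p)) (λ (D , t) → ∑ (antidiag D) (λ (e , d) → ⟦ e ≤ᵇ p ⟧ *ℤ (⟦ h ≤ᵇ e ⟧ *ℤ V e d t)))
    ≡⟨ cong (λ m → ∑ (antidiag m) (λ (D , t) → ∑ (antidiag D) (λ (e , d) → ⟦ e ≤ᵇ p ⟧ *ℤ (⟦ h ≤ᵇ e ⟧ *ℤ V e d t)))) (ℕₚ.+-comm S p) ⟩
  ∑ (antidiag (p + S)) (λ (D , t) → ∑ (antidiag D) (λ (e , d) → ⟦ e ≤ᵇ p ⟧ *ℤ (⟦ h ≤ᵇ e ⟧ *ℤ V e d t)))
    ≡⟨ ∑-cong (antidiag (p + S)) (λ (D , t) → sym (≡.trans (∑-comps n D (λ η → ⟦ interlace η (p ∷ ps) ⟧ *ℤ G t η)) (∑-cong (antidiag D) (λ (e , d) →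
         ≡.trans (∑-cong (comps n d) (λ η → ≡.trans (⟦∧⟧* (e ≤ᵇ p) _ _) (cong (⟦ e ≤ᵇ p ⟧ *ℤ_) (⟦∧⟧* (h ≤ᵇ e) (interlace η ps) (G t (e ∷ η))))))
         (≡.trans (sym (∑-*ˡ ⟦ e ≤ᵇ p ⟧ (comps n d) _)) (cong (⟦ e ≤ᵇ p ⟧ *ℤ_) (sym (∑-*ˡ ⟦ h ≤ᵇ e ⟧ (comps n d) _)))))))) ⟩
  ∑ (antidiag (p + S)) (λ (D , t) → ∑ (comps (suc n) D) (λ η → ⟦ interlace η (p ∷ ps) ⟧ *ℤ G t η)) ∎
  where
  open ≡-Reasoning
  h = hd ps
  S = sum ps
  n = length ps
  V : ℕ → ℕ → ℕ → ℤ
  V e d t = ∑ (comps n d) (λ η → ⟦ interlace η ps ⟧ *ℤ G t (e ∷ η))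
  Q : ℕ → ℕ → ℤ
  Q i e = ∑ (antidiag S) (λ (d , t) → V e d (i + t))
  bool-ext : ∀ a b → (a ≡ true → b ≡ true) → (b ≡ true → a ≡ true) → a ≡ b
  bool-ext true  b     f g = sym (f ≡.refl)
  bool-ext false true  f g = g ≡.refl
  bool-ext false false f g = ≡.refl
  same : ∀ e R → e + R ≡ S + p → (S ≤ᵇ R) ≡ (e ≤ᵇ p)
  same e R q = bool-ext (S ≤ᵇ R) (e ≤ᵇ p)
    (λ hb → ≤⇒≤ᵇ≡true (ℕₚ.+-cancelˡ-≤ S e p (ℕₚ.≤-trans (ℕₚ.≤-reflexive (ℕₚ.+-comm S e)) (ℕₚ.≤-trans (ℕₚ.+-monoʳ-≤ e (≤ᵇ⇒≤′ S R hb)) (ℕₚ.≤-reflexive q)))))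
    (λ hb → ≤⇒≤ᵇ≡true (ℕₚ.+-cancelʳ-≤ e S R (ℕₚ.≤-trans (ℕₚ.+-monoʳ-≤ S (≤ᵇ⇒≤′ e p hb)) (ℕₚ.≤-reflexive (≡.trans (sym q) (ℕₚ.+-comm e R))))))
  guard : ∀ e i d t → d + t ≡ i + S → V e d t ≡ ⟦ i ≤ᵇ t ⟧ *ℤ V e d t
  guard e i d t q = ≡.trans (∑-cong-All (All.map (λ { {η} (_ , s) → ⟦⟧-guard (interlace η ps) (i ≤ᵇ t) (G t (e ∷ η)) (λ hb →
      ≤⇒≤ᵇ≡true (ℕₚ.+-cancelʳ-≤ S i t (ℕₚ.≤-trans (ℕₚ.≤-reflexive (≡.trans (sym q) (ℕₚ.+-comm d t)))
        (ℕₚ.+-monoʳ-≤ t (ℕₚ.≤-trans (ℕₚ.≤-reflexive (sym s)) (interlace-sum η ps hb)))))) }) (comps-good n d))) (sym (∑-*ˡ ⟦ i ≤ᵇ t ⟧ (comps n d) _))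
  Q-eq : ∀ e i → Q i e ≡ ∑ (antidiag (S + i)) (λ (t , d) → V e d t)
  Q-eq e i = ≡.trans (sym (∑-antidiag-≥ʳ S i (λ d t → V e d t))) (≡.trans
    (∑-cong-All (All.map (λ { {d , t} q → sym (guard e i d t q) }) (take≤-sum false (i + S)))) (≡.trans
    (cong (λ m → ∑ (antidiag m) (λ (d , t) → V e d t)) (ℕₚ.+-comm i S)) (∑-antidiag-flip (S + i) _)))

weakDec⇒Linked : ∀ π → weakDec π ≡ true → Linked _≥_ π
weakDec⇒Linked []           _ = []
weakDec⇒Linked (x ∷ [])     _ = [-]
weakDec⇒Linked (x ∷ y ∷ π)  h = ≤ᵇ⇒≤′ y x (proj₁ (∧-true h)) ∷ weakDec⇒Linked (y ∷ π) (proj₂ (∧-true {y ≤ᵇ x} h))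

Linked⇒weakDec : ∀ {π} → Linked _≥_ π → weakDec π ≡ true
Linked⇒weakDec []      = ≡.refl
Linked⇒weakDec [-]     = ≡.refl
Linked⇒weakDec (h ∷ l) rewrite ≤⇒≤ᵇ≡true h = Linked⇒weakDec l

Linked-∷ʳ0 : ∀ {π} → Linked _≥_ π → Linked _≥_ (π ∷ʳ 0)
Linked-∷ʳ0 []      = [-]
Linked-∷ʳ0 [-]     = z≤n ∷ [-]
Linked-∷ʳ0 (h ∷ l) = h ∷ Linked-∷ʳ0 l

Linked-init : ∀ π {x} → Linked _≥_ (π ∷ʳ x) → Linked _≥_ π
Linked-init []          l       = []
Linked-init (y ∷ [])    l       = [-]
Linked-init (y ∷ z ∷ π) (h ∷ l) = h ∷ Linked-init (z ∷ π) l

weakDec-∷ʳ0 : ∀ π → weakDec (π ∷ʳ 0) ≡ weakDec π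
weakDec-∷ʳ0 []          = ≡.refl
weakDec-∷ʳ0 (x ∷ [])    = ≡.refl
weakDec-∷ʳ0 (x ∷ y ∷ π) = cong ((y ≤ᵇ x) ∧_) (weakDec-∷ʳ0 (y ∷ π))

interlace-Linked : ∀ η π → length η ≡ length π → interlace η π ≡ true → Linked _≥_ η × Linked _≥_ π
interlace-Linked []      []       _ _ = [] , []
interlace-Linked (e ∷ η) (p ∷ ps) q h with ∧-true {e ≤ᵇ p} h
... | e≤p , h′ with ∧-true {hd ps ≤ᵇ e} h′
... | h≤e , h″ with interlace-Linked η ps (ℕₚ.suc-injective q) h″
... | lη , lps = cons₁ η ps (ℕₚ.suc-injective q) h″ lη {≤ᵇ⇒≤′ (hd ps) e h≤e} ,
  cons₂ ps lps {ℕₚ.≤-trans (≤ᵇ⇒≤′ (hd ps) e h≤e) (≤ᵇ⇒≤′ e p e≤p)}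
  where
  cons₁ : ∀ η ps → length η ≡ length ps → interlace η ps ≡ true → Linked _≥_ η → {hd ps ≤ e} → Linked _≥_ (e ∷ η)
  cons₁ []       []        _ _ _ = [-]
  cons₁ (e₂ ∷ η) (p₂ ∷ ps) _ h l {p₂≤e} = ℕₚ.≤-trans (≤ᵇ⇒≤′ e₂ p₂ (proj₁ (∧-true h))) p₂≤e ∷ l
  cons₂ : ∀ ps → Linked _≥_ ps → {hd ps ≤ p} → Linked _≥_ (p ∷ ps)
  cons₂ []       l = [-]
  cons₂ (_ ∷ ps) l {p₂≤p} = p₂≤p ∷ l

npos-last : ∀ η x → Linked _≥_ (η ∷ʳ suc x) → npos (η ∷ʳ suc x) ≡ suc (length η)
npos-last []          x l = ≡.refl
npos-last (zero ∷ η)  x l = ⊥-elim (go η l)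
  where
  go : ∀ η → Linked _≥_ (0 ∷ (η ∷ʳ suc x)) → ⊥
  go []          (() ∷ l)
  go (zero ∷ η)  (_ ∷ l) = go η l
npos-last (suc y ∷ η) x l = cong suc (npos-last η x (tail-Linked l))

npos≤sum : ∀ π → npos π ≤ sum π
npos≤sum []          = z≤n
npos≤sum (zero ∷ π)  = npos≤sum π
npos≤sum (suc x ∷ π) = s≤s (ℕₚ.≤-trans (npos≤sum π) (ℕₚ.m≤n+m (sum π) x))

∑-comps-last : ∀ n d φ → (∀ η x → length η ≡ n → sum (η ∷ʳ suc x) ≡ d → φ (η ∷ʳ suc x) ≡ + 0) →
  ∑ (comps (suc n) d) φ ≡ ∑ (comps n d) (λ η → φ (η ∷ʳ 0))
∑-comps-last zero d φ h = ≡.trans (∑-comps 0 d φ) (≡.trans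
  (∑-antidiag-last d (λ a r → ∑ (comps 0 r) (λ w → φ (a ∷ w))) (λ _ _ → ≡.refl)) (end d h))
  where
  end : ∀ d → (∀ η x → length η ≡ 0 → sum (η ∷ʳ suc x) ≡ d → φ (η ∷ʳ suc x) ≡ + 0) → φ (d ∷ []) +ℤ + 0 ≡ ∑ (comps 0 d) (λ η → φ (η ∷ʳ 0))
  end zero    h = ≡.refl
  end (suc d) h = ≡.trans (ℤₚ.+-identityʳ _) (h [] d ≡.refl (ℕₚ.+-identityʳ (suc d)))
∑-comps-last (suc n) d φ h = ≡.trans (∑-comps (suc n) d φ) (≡.trans (∑-cong-All (All.map (λ { {a , r} e →
    ∑-comps-last n r (λ η → φ (a ∷ η)) (λ η x l s → h (a ∷ η) x (cong suc l) (≡.trans (cong (λ k → a + k) s) e)) }) (take≤-sum false d)))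
  (sym (∑-comps n d (λ η → φ (η ∷ʳ 0)))))

∑-antidiag-≡ : ∀ d g (f : ℕ → ℤ) → ∑ (antidiag (d + g)) (λ (i , t) → ⟦ t ≡ᵇ g ⟧ *ℤ f i) ≡ f d
∑-antidiag-≡ d zero    f = ≡.trans (∑-antidiag-last (d + 0) (λ i t → ⟦ t ≡ᵇ 0 ⟧ *ℤ f i) (λ i j → ≡.refl)) (≡.trans (ℤₚ.*-identityˡ _) (cong f (ℕₚ.+-identityʳ d)))
∑-antidiag-≡ d (suc g) f = ≡.trans (cong (λ n → ∑ (antidiag n) (λ (i , t) → ⟦ t ≡ᵇ suc g ⟧ *ℤ f i)) (ℕₚ.+-suc d g))
  (≡.trans (∑-antidiag-snoc (d + g) (λ (i , t) → ⟦ t ≡ᵇ suc g ⟧ *ℤ f i)) (≡.trans (ℤₚ.+-identityʳ _) (∑-antidiag-≡ d g f)))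

length-∷ʳ : ∀ (η : List ℕ) x → length (η ∷ʳ x) ≡ suc (length η)
length-∷ʳ []      x = ≡.refl
length-∷ʳ (_ ∷ η) x = cong suc (length-∷ʳ η x)

-- The recursion of the Kostka numbers in the form that meets Pieri's rule: the same
-- `interlace (ζ ∷ʳ 0) π` governs both. A positive last row of the smaller partition is excluded by
-- `K-vanish`, since only `length γ` letters remain.
K-interlace : ∀ {π} → Linked _≥_ π → ∀ g γ d → length π ≡ suc (length γ) → sum π ≡ d + g →
  K π (evens (g ∷ γ)) ≡ ∑ (comps (length γ) d) (λ ζ → ⟦ interlace (ζ ∷ʳ 0) π ⟧ *ℤ K ζ (evens γ))
K-interlace {π} l g γ d len s = begin
  K π (evens (g ∷ γ))
    ≡⟨ K-∷ l g (evens γ) ⟩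
  ∑ (strips π) (λ (t , η) → ⟦ t ≡ᵇ g ⟧ *ℤ K η (evens γ))
    ≡⟨ ∑-strips-interlace l (λ t η → ⟦ t ≡ᵇ g ⟧ *ℤ K η (evens γ)) ⟩
  ∑ (antidiag (sum π)) (λ (d , t) → ∑ (comps (length π) d) (λ η → ⟦ interlace η π ⟧ *ℤ (⟦ t ≡ᵇ g ⟧ *ℤ K η (evens γ))))
    ≡⟨ ∑-cong (antidiag (sum π)) (λ (d , t) → ≡.trans (∑-cong (comps (length π) d) (λ η → ring ⟦ interlace η π ⟧ ⟦ t ≡ᵇ g ⟧ _)) (sym (∑-*ˡ ⟦ t ≡ᵇ g ⟧ (comps (length π) d) _))) ⟩
  ∑ (antidiag (sum π)) (λ (d , t) → ⟦ t ≡ᵇ g ⟧ *ℤ ∑ (comps (length π) d) (λ η → ⟦ interlace η π ⟧ *ℤ K η (evens γ)))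
    ≡⟨ cong₂ (λ m k → ∑ (antidiag m) (λ (d , t) → ⟦ t ≡ᵇ g ⟧ *ℤ ∑ (comps k d) (λ η → ⟦ interlace η π ⟧ *ℤ K η (evens γ)))) s len ⟩
  ∑ (antidiag (d + g)) (λ (d , t) → ⟦ t ≡ᵇ g ⟧ *ℤ ∑ (comps (suc (length γ)) d) (λ η → ⟦ interlace η π ⟧ *ℤ K η (evens γ)))
    ≡⟨ ∑-antidiag-≡ d g (λ d → ∑ (comps (suc (length γ)) d) (λ η → ⟦ interlace η π ⟧ *ℤ K η (evens γ))) ⟩
  ∑ (comps (suc (length γ)) d) (λ η → ⟦ interlace η π ⟧ *ℤ K η (evens γ))
    ≡⟨ ∑-comps-last (length γ) d (λ η → ⟦ interlace η π ⟧ *ℤ K η (evens γ)) (λ η x lη _ → vanish η x lη) ⟩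
  ∑ (comps (length γ) d) (λ ζ → ⟦ interlace (ζ ∷ʳ 0) π ⟧ *ℤ K (ζ ∷ʳ 0) (evens γ))
    ≡⟨ ∑-cong (comps (length γ) d) (λ ζ → cong (⟦ interlace (ζ ∷ʳ 0) π ⟧ *ℤ_) (K-∷ʳ0 ζ (evens γ))) ⟩
  ∑ (comps (length γ) d) (λ ζ → ⟦ interlace (ζ ∷ʳ 0) π ⟧ *ℤ K ζ (evens γ)) ∎
  where
  open ≡-Reasoning
  ring : ∀ a b c → a *ℤ (b *ℤ c) ≡ b *ℤ (a *ℤ c)
  ring = solve-∀
  vanish : ∀ η x → length η ≡ length γ → ⟦ interlace (η ∷ʳ suc x) π ⟧ *ℤ K (η ∷ʳ suc x) (evens γ) ≡ + 0
  vanish η x lη with interlace (η ∷ʳ suc x) π in eq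
  ... | false = ≡.refl
  ... | true  = ≡.trans (ℤₚ.*-identityˡ _) (K-vanish γ lin (ℕₚ.≤-reflexive (sym (≡.trans (npos-last η x lin) (cong suc lη)))))
    where
    lin : Linked _≥_ (η ∷ʳ suc x)
    lin = proj₁ (interlace-Linked (η ∷ʳ suc x) π (≡.trans (length-∷ʳ η (suc x)) (≡.trans (cong suc lη) (sym len))) eq)

-- h_γ is the sum of the Schur functions s_π with Kostka coefficients.
expansion : ∀ γ {F} → Super F →
  F (evens γ) ≡ ∑ (comps (length γ) (sum γ)) (λ π → ⟦ weakDec π ⟧ *ℤ (K π (evens γ) *ℤ Ext F (evens π)))
expansion []      {F} S = ring (F [])
  where
  ring : ∀ x → x ≡ + 1 *ℤ (+ 1 *ℤ x) +ℤ + 0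
  ring = solve-∀
expansion (g ∷ γ) {F} S = begin
  F (evens (g ∷ γ))
    ≡⟨ expansion γ (Super-∷ (false , g) S) ⟩
  ∑ (comps n d) (λ ζ → ⟦ weakDec ζ ⟧ *ℤ (K ζ (evens γ) *ℤ Ext (λ w → F ((false , g) ∷ w)) (evens ζ)))
    ≡⟨ ∑-cong-All (All.map (λ { {ζ} (lζ , sζ) → left ζ lζ sζ }) (comps-good n d)) ⟩
  ∑ (comps n d) (λ ζ → ∑ (comps (suc n) (d + g)) (λ π → ⟦ weakDec ζ ⟧ *ℤ (K ζ (evens γ) *ℤ (⟦ interlace (ζ ∷ʳ 0) π ⟧ *ℤ A π))))
    ≡⟨ ∑-comm (comps n d) (comps (suc n) (d + g)) _ ⟩
  ∑ (comps (suc n) (d + g)) (λ π → ∑ (comps n d) (λ ζ → ⟦ weakDec ζ ⟧ *ℤ (K ζ (evens γ) *ℤ (⟦ interlace (ζ ∷ʳ 0) π ⟧ *ℤ A π))))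
    ≡⟨ ∑-cong-All (All.map (λ { {π} (lπ , sπ) → right π lπ sπ }) (comps-good (suc n) (d + g))) ⟩
  ∑ (comps (suc n) (d + g)) (λ π → ⟦ weakDec π ⟧ *ℤ (K π (evens (g ∷ γ)) *ℤ A π))
    ≡⟨ cong (λ m → ∑ (comps (suc n) m) (λ π → ⟦ weakDec π ⟧ *ℤ (K π (evens (g ∷ γ)) *ℤ A π))) (ℕₚ.+-comm d g) ⟩
  ∑ (comps (suc n) (g + d)) (λ π → ⟦ weakDec π ⟧ *ℤ (K π (evens (g ∷ γ)) *ℤ A π)) ∎
  where
  open ≡-Reasoning
  n = length γ
  d = sum γ
  A : List ℕ → ℤ
  A π = Ext F (evens π)
  left : ∀ ζ → length ζ ≡ n → sum ζ ≡ d → ⟦ weakDec ζ ⟧ *ℤ (K ζ (evens γ) *ℤ Ext (λ w → F ((false , g) ∷ w)) (evens ζ)) ≡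
    ∑ (comps (suc n) (d + g)) (λ π → ⟦ weakDec ζ ⟧ *ℤ (K ζ (evens γ) *ℤ (⟦ interlace (ζ ∷ʳ 0) π ⟧ *ℤ A π)))
  left ζ lζ sζ with weakDec ζ in eq
  ... | false = sym (∑-ε (comps (suc n) (d + g)) (λ _ → ≡.refl))
  ... | true  = ≡.trans (cong (λ x → + 1 *ℤ (K ζ (evens γ) *ℤ x)) pieri) (≡.trans (cong (+ 1 *ℤ_) (∑-*ˡ (K ζ (evens γ)) (comps (suc n) (d + g)) _)) (∑-*ˡ (+ 1) (comps (suc n) (d + g)) _))
    where
    pieri : Ext (λ w → F ((false , g) ∷ w)) (evens ζ) ≡ ∑ (comps (suc n) (d + g)) (λ π → ⟦ interlace (ζ ∷ʳ 0) π ⟧ *ℤ A π)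
    pieri = ≡.trans (pieri-free S g ζ) (≡.trans (cong₂ (λ k m → ∑ (comps k (m + g)) (λ π → ⟦ inside (ζ ∷ʳ 0) π ⟧ *ℤ A π)) (sym (length-∷ʳ ζ 0)) sζ)
      (≡.trans (inside-interlace (Linked-∷ʳ0 (weakDec⇒Linked ζ eq)) A (Ext-anti S) (d + g))
      (cong (λ k → ∑ (comps k (d + g)) (λ π → ⟦ interlace (ζ ∷ʳ 0) π ⟧ *ℤ A π)) (≡.trans (length-∷ʳ ζ 0) (cong suc lζ)))))
  ring : ∀ i k a → + 1 *ℤ (k *ℤ (i *ℤ a)) ≡ i *ℤ k *ℤ a
  ring = solve-∀
  right : ∀ π → length π ≡ suc n → sum π ≡ d + g →
    ∑ (comps n d) (λ ζ → ⟦ weakDec ζ ⟧ *ℤ (K ζ (evens γ) *ℤ (⟦ interlace (ζ ∷ʳ 0) π ⟧ *ℤ A π))) ≡ ⟦ weakDec π ⟧ *ℤ (K π (evens (g ∷ γ)) *ℤ A π)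
  right π lπ sπ with weakDec π in eq
  ... | false = ≡.trans (∑-cong-All (All.map (λ { {ζ} (lζ , _) → none ζ lζ }) (comps-good n d))) (∑-ε (comps n d) (λ _ → ≡.refl))
    where
    none : ∀ ζ → length ζ ≡ n → ⟦ weakDec ζ ⟧ *ℤ (K ζ (evens γ) *ℤ (⟦ interlace (ζ ∷ʳ 0) π ⟧ *ℤ A π)) ≡ + 0
    none ζ lζ with interlace (ζ ∷ʳ 0) π in eq′
    ... | false = ≡.trans (cong (⟦ weakDec ζ ⟧ *ℤ_) (ℤₚ.*-zeroʳ (K ζ (evens γ)))) (ℤₚ.*-zeroʳ ⟦ weakDec ζ ⟧)
    ... | true  with ≡.trans (sym eq) (Linked⇒weakDec (proj₂ (interlace-Linked (ζ ∷ʳ 0) π (≡.trans (length-∷ʳ ζ 0) (≡.trans (cong suc lζ) (sym lπ))) eq′)))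
    ... | ()
  ... | true  = ≡.trans (∑-cong-All (All.map (λ { {ζ} (lζ , _) → term ζ lζ }) (comps-good n d))) (≡.trans (sym (∑-*ʳ (A π) (comps n d) _))
      (≡.trans (cong (_*ℤ A π) (sym (K-interlace (weakDec⇒Linked π eq) g γ d lπ sπ))) (sym (ℤₚ.*-identityˡ _))))
    where
    term : ∀ ζ → length ζ ≡ n → ⟦ weakDec ζ ⟧ *ℤ (K ζ (evens γ) *ℤ (⟦ interlace (ζ ∷ʳ 0) π ⟧ *ℤ A π)) ≡ ⟦ interlace (ζ ∷ʳ 0) π ⟧ *ℤ K ζ (evens γ) *ℤ A π
    term ζ lζ with interlace (ζ ∷ʳ 0) π in eq′
    ... | false = ≡.trans (cong (⟦ weakDec ζ ⟧ *ℤ_) (ℤₚ.*-zeroʳ (K ζ (evens γ)))) (ℤₚ.*-zeroʳ ⟦ weakDec ζ ⟧)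
    ... | true  = ≡.trans (cong (λ b → ⟦ b ⟧ *ℤ (K ζ (evens γ) *ℤ (+ 1 *ℤ A π)))
        (Linked⇒weakDec (Linked-init ζ (proj₁ (interlace-Linked (ζ ∷ʳ 0) π (≡.trans (length-∷ʳ ζ 0) (≡.trans (cong suc lζ) (sym lπ))) eq′)))))
      (ring (+ 1) (K ζ (evens γ)) (A π))

Ext-∷ʳ0 : ∀ {F} → Super F → ∀ π → Ext F (evens (π ∷ʳ 0)) ≡ Ext F (evens π)
Ext-∷ʳ0 {F} S π = ≡.trans (cong (Ext F) (Listₚ.map-++ (false ,_) π (0 ∷ []))) (Ext-snoc-zero S (evens π) false)

nonzero : ℕ → Bool
nonzero x = not (isZero x)

strip : List ℕ → List ℕ
strip = filterᵇ nonzero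

strip-zeros : ∀ {π} → Linked _≥_ (0 ∷ π) → strip π ≡ []
strip-zeros [-]                  = ≡.refl
strip-zeros {zero ∷ π}  (_ ∷ l)  = strip-zeros l
strip-zeros {suc _ ∷ π} (() ∷ l)

Ext-strip : ∀ {F} → Super F → ∀ {π} → Linked _≥_ π → Ext F (evens (strip π)) ≡ Ext F (evens π)
Ext-strip S {[]}        l = ≡.refl
Ext-strip S {suc x ∷ π} l = Ext-strip (bern-super false (suc x) S) (tail-Linked l)
Ext-strip {F} S {zero ∷ π}  l = ≡.trans (cong (λ u → Ext F (evens u)) (strip-zeros l)) (sym (zeros S l))
  where
  zeros : ∀ {F} → Super F → ∀ {π} → Linked _≥_ (0 ∷ π) → Ext F (evens (0 ∷ π)) ≡ F []
  zeros S [-] = Ext-snoc-zero S [] false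
  zeros {F} S {zero ∷ π} (_ ∷ l) = ≡.trans (zeros (bern-super false 0 S) l) (zeros S [-])
  zeros S {suc _ ∷ π} (() ∷ l)

∑-parts : ∀ d f → ∑ (parts d) f ≡ ∑ (comps d d) (λ π → ⟦ weakDec π ⟧ *ℤ f (strip π))
∑-parts d f = ≡.trans (∑-map strip (filterᵇ weakDec (comps d d)) f) (go (comps d d))
  where
  go : ∀ xs → ∑ (filterᵇ weakDec xs) (λ π → f (strip π)) ≡ ∑ xs (λ π → ⟦ weakDec π ⟧ *ℤ f (strip π))
  go []       = ≡.refl
  go (π ∷ xs) with weakDec π
  ... | true  = cong₂ _+ℤ_ (sym (ℤₚ.*-identityˡ (f (strip π)))) (go xs)
  ... | false = ≡.trans (go xs) (sym (ℤₚ.+-identityˡ _))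

strip-Linked : ∀ {π} → Linked _≥_ π → Linked _≥_ (strip π)
strip-Linked {[]}              l       = []
strip-Linked {zero ∷ π}        l       = subst (Linked _≥_) (sym (strip-zeros l)) []
strip-Linked {suc x ∷ []}      l       = [-]
strip-Linked {suc x ∷ zero ∷ π} (_ ∷ l) = subst (λ u → Linked _≥_ (suc x ∷ u)) (sym (strip-zeros l)) [-]
strip-Linked {suc x ∷ suc y ∷ π} (h ∷ l) = h ∷ strip-Linked l

parts-Linked : ∀ d → All (Linked _≥_) (parts d)
parts-Linked d = AllP.map⁺ (go (comps d d))
  where
  go : ∀ xs → All (λ π → Linked _≥_ (strip π)) (filterᵇ weakDec xs)
  go []       = []
  go (π ∷ xs) with weakDec π in eq
  ... | true  = strip-Linked (weakDec⇒Linked π eq) ∷ go xs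
  ... | false = go xs

-- `expansion` has as many rows as there are letters, `parts` as many as there are boxes. Both
-- numbers are raised to their sum: further rows contribute nothing, in the first case by
-- `K-vanish`, in the second because `d` boxes cannot fill more than `d` rows.
expansion-parts : ∀ γ {F} → Super F → F (evens γ) ≡ ∑ (parts (sum γ)) (λ π → K π (evens γ) *ℤ Ext F (evens π))
expansion-parts γ {F} S = begin
  F (evens γ)       ≡⟨ expansion γ S ⟩
  P n               ≡⟨ sym (pad n (λ N n≤N η x lη sη lin → ≡.trans (cong (_*ℤ Ext F (evens (η ∷ʳ suc x)))
                         (K-vanish γ lin (ℕₚ.≤-trans (s≤s n≤N) (ℕₚ.≤-reflexive (sym (≡.trans (npos-last η x lin) (cong suc lη))))))) ≡.refl) d) ⟩
  P (d + n)         ≡⟨ cong P (ℕₚ.+-comm d n) ⟩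
  P (n + d)         ≡⟨ pad d (λ N d≤N η x lη sη lin → ⊥-elim (ℕₚ.<-irrefl ≡.refl (ℕₚ.≤-trans (s≤s d≤N)
                         (ℕₚ.≤-trans (ℕₚ.≤-reflexive (sym (≡.trans (npos-last η x lin) (cong suc lη)))) (ℕₚ.≤-trans (npos≤sum (η ∷ʳ suc x)) (ℕₚ.≤-reflexive sη)))))) n ⟩
  P d               ≡⟨ ∑-cong (comps d d) stripped ⟩
  ∑ (comps d d) (λ π → ⟦ weakDec π ⟧ *ℤ (K (strip π) (evens γ) *ℤ Ext F (evens (strip π))))
                    ≡⟨ sym (∑-parts d (λ π → K π (evens γ) *ℤ Ext F (evens π))) ⟩
  ∑ (parts d) (λ π → K π (evens γ) *ℤ Ext F (evens π)) ∎
  where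
  open ≡-Reasoning
  n = length γ
  d = sum γ
  ψ : List ℕ → ℤ
  ψ π = K π (evens γ) *ℤ Ext F (evens π)
  P : ℕ → ℤ
  P N = ∑ (comps N d) (λ π → ⟦ weakDec π ⟧ *ℤ ψ π)
  stripped : ∀ π → ⟦ weakDec π ⟧ *ℤ ψ π ≡ ⟦ weakDec π ⟧ *ℤ ψ (strip π)
  stripped π with weakDec π in eq
  ... | false = ≡.refl
  ... | true  = cong (+ 1 *ℤ_) (sym (cong₂ _*ℤ_ (Ext-strip (Wl-super (letters (parities (evens γ)) 1) (evens γ)) (weakDec⇒Linked π eq)) (Ext-strip S (weakDec⇒Linked π eq))))
  step : ∀ N → (∀ η x → length η ≡ N → sum (η ∷ʳ suc x) ≡ d → Linked _≥_ (η ∷ʳ suc x) → ψ (η ∷ʳ suc x) ≡ + 0) → P (suc N) ≡ P N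
  step N h = ≡.trans (∑-comps-last N d (λ π → ⟦ weakDec π ⟧ *ℤ ψ π) zero-last)
    (∑-cong (comps N d) (λ η → cong₂ (λ b z → ⟦ b ⟧ *ℤ z) (weakDec-∷ʳ0 η) (cong₂ _*ℤ_ (K-∷ʳ0 η (evens γ)) (Ext-∷ʳ0 S η))))
    where
    zero-last : ∀ η x → length η ≡ N → sum (η ∷ʳ suc x) ≡ d → ⟦ weakDec (η ∷ʳ suc x) ⟧ *ℤ ψ (η ∷ʳ suc x) ≡ + 0
    zero-last η x lη sη with weakDec (η ∷ʳ suc x) in eq
    ... | false = ≡.refl
    ... | true  = ≡.trans (ℤₚ.*-identityˡ _) (h η x lη sη (weakDec⇒Linked (η ∷ʳ suc x) eq))
  pad : ∀ N₀ → (∀ N → N₀ ≤ N → ∀ η x → length η ≡ N → sum (η ∷ʳ suc x) ≡ d → Linked _≥_ (η ∷ʳ suc x) → ψ (η ∷ʳ suc x) ≡ + 0) → ∀ k → P (k + N₀) ≡ P N₀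
  pad N₀ h zero    = ≡.refl
  pad N₀ h (suc k) = ≡.trans (step (k + N₀) (h (k + N₀) (ℕₚ.m≤n+m N₀ k))) (pad N₀ h k)

-- Skew shapes

-- The coproduct on products of h's and e's, so that `conv` becomes the functional of a product of
-- symmetric functions.
splitsW : Word → List (Word × Word)
splitsW []            = ([] , []) ∷ []
splitsW ((p , n) ∷ w) = concatMap (λ (i , j) → map (λ (u , v) → (p , i) ∷ u , (p , j) ∷ v) (splitsW w)) (antidiag n)

∑-splitsW : ∀ p n w f → ∑ (splitsW ((p , n) ∷ w)) f ≡ ∑ (antidiag n) (λ (i , j) → ∑ (splitsW w) (λ (u , v) → f ((p , i) ∷ u , (p , j) ∷ v)))
∑-splitsW p n w f = ≡.trans (∑-concatMap _ (antidiag n) f) (∑-cong (antidiag n) (λ _ → ∑-map _ (splitsW w) f))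

∑-splitsW₂ : ∀ p m q n w f → ∑ (splitsW ((p , m) ∷ (q , n) ∷ w)) f ≡
  ∑ (antidiag m) (λ (i , j) → ∑ (antidiag n) (λ (k , l) → ∑ (splitsW w) (λ (u , v) → f ((p , i) ∷ (q , k) ∷ u , (p , j) ∷ (q , l) ∷ v))))
∑-splitsW₂ p m q n w f = ≡.trans (∑-splitsW p m ((q , n) ∷ w) f) (∑-cong (antidiag m) (λ (i , j) → ∑-splitsW q n w (λ (u , v) → f ((p , i) ∷ u , (p , j) ∷ v))))

splitsW-↭ : ∀ (φ : Word → Word → ℤ) → (∀ {u u′ v v′} → u ↭ u′ → v ↭ v′ → φ u v ≡ φ u′ v′) → ∀ {w w′} → w ↭ w′ →
  ∑ (splitsW w) (λ (u , v) → φ u v) ≡ ∑ (splitsW w′) (λ (u , v) → φ u v)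
splitsW-↭ φ h refl = ≡.refl
splitsW-↭ φ h (prep {w} {w′} (p , n) q) = ≡.trans (∑-splitsW p n w (λ (u , v) → φ u v)) (≡.trans
  (∑-cong (antidiag n) (λ (i , j) → splitsW-↭ (λ u v → φ ((p , i) ∷ u) ((p , j) ∷ v)) (λ a b → h (prep _ a) (prep _ b)) q)) (sym (∑-splitsW p n w′ (λ (u , v) → φ u v))))
splitsW-↭ φ h (swap {w} {w′} (p , m) (q , n) s) = ≡.trans (∑-splitsW₂ p m q n w (λ (u , v) → φ u v)) (≡.trans (∑-comm (antidiag m) (antidiag n) _) (≡.trans
  (∑-cong (antidiag n) (λ (k , l) → ∑-cong (antidiag m) (λ (i , j) → ≡.trans (∑-cong (splitsW w) (λ (u , v) → h (swap _ _ ↭-refl) (swap _ _ ↭-refl)))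
    (splitsW-↭ (λ u v → φ ((q , k) ∷ (p , i) ∷ u) ((q , l) ∷ (p , j) ∷ v)) (λ a b → h (prep _ (prep _ a)) (prep _ (prep _ b))) s))))
  (sym (∑-splitsW₂ q n p m w′ (λ (u , v) → φ u v)))))
splitsW-↭ φ h (trans p q) = ≡.trans (splitsW-↭ φ h p) (splitsW-↭ φ h q)

∑-antidiag-assoc : ∀ k (f : ℕ → ℕ → ℕ → ℤ) →
  ∑ (antidiag k) (λ (i , j) → ∑ (antidiag i) (λ (a , b) → f a b j)) ≡ ∑ (antidiag k) (λ (a , r) → ∑ (antidiag r) (λ (b , j) → f a b j))
∑-antidiag-assoc k f = ≡.trans (∑-antidiag-flip k _) (≡.trans (∑-take≤-comm false false k (λ j a b → f a b j)) (∑-cong (antidiag k) (λ (a , r) → ∑-antidiag-flip r _)))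

∑-antidiag-interchange : ∀ k (f : ℕ → ℕ → ℕ → ℕ → ℤ) →
  ∑ (antidiag k) (λ (i , j) → ∑ (antidiag i) (λ (i₁ , i₂) → ∑ (antidiag j) (λ (j₁ , j₂) → f i₁ i₂ j₁ j₂))) ≡
  ∑ (antidiag k) (λ (k₁ , k₂) → ∑ (antidiag k₁) (λ (i₁ , j₁) → ∑ (antidiag k₂) (λ (i₂ , j₂) → f i₁ i₂ j₁ j₂)))
∑-antidiag-interchange k f = ≡.trans (∑-antidiag-assoc k (λ i₁ i₂ j → ∑ (antidiag j) (λ (j₁ , j₂) → f i₁ i₂ j₁ j₂))) (≡.trans
  (∑-cong (antidiag k) (λ (i₁ , r) → ∑-take≤-comm false false r (λ i₂ j₁ j₂ → f i₁ i₂ j₁ j₂)))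
  (sym (∑-antidiag-assoc k (λ i₁ j₁ s → ∑ (antidiag s) (λ (i₂ , j₂) → f i₁ i₂ j₁ j₂)))))

-- The coproduct of a relation of degree k + 1 is a sum of products of relations of degrees k₁ and
-- k₂ with k₁ + k₂ = k + 1. One of these degrees is positive, and that factor vanishes.
splitsW-super : ∀ {H : Word → Word → ℤ} → (∀ v → Super (λ u → H u v)) → (∀ u → Super (H u)) → Super (λ w → ∑ (splitsW w) (λ (u , v) → H u v))
splitsW-super {H} S₁ S₂ .perm = splitsW-↭ H (λ p q → ≡.trans (S₁ _ .perm p) (S₂ _ .perm q))
splitsW-super {H} S₁ S₂ .drop p w = ≡.trans (∑-splitsW p 0 w (λ (u , v) → H u v)) (≡.trans (ℤₚ.+-identityʳ _)
  (∑-cong (splitsW w) (λ (u , v) → ≡.trans (S₁ _ .drop p u) (S₂ u .drop p v))))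
splitsW-super {H} S₁ S₂ .rel k w = begin
  ∑ (antidiag (suc k)) (λ (i , j) → sg j *ℤ ∑ (splitsW ((false , i) ∷ (true , j) ∷ w)) (λ (u , v) → H u v))
    ≡⟨ ∑-cong (antidiag (suc k)) (λ (i , j) → ≡.trans (cong (sg j *ℤ_) (∑-splitsW₂ false i true j w (λ (u , v) → H u v)))
         (≡.trans (∑-*ˡ (sg j) (antidiag i) _) (∑-cong (antidiag i) (λ (i₁ , i₂) → ≡.trans (∑-*ˡ (sg j) (antidiag j) _)
         (∑-cong-All (All.map (λ { {j₁ , j₂} e → cong (λ s → s *ℤ h i₁ i₂ j₁ j₂) (≡.trans (cong sg (sym e)) (sg-+ j₁ j₂)) }) (take≤-sum false j))))))) ⟩
  ∑ (antidiag (suc k)) (λ (i , j) → ∑ (antidiag i) (λ (i₁ , i₂) → ∑ (antidiag j) (λ (j₁ , j₂) → sg j₁ *ℤ sg j₂ *ℤ h i₁ i₂ j₁ j₂)))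
    ≡⟨ ∑-antidiag-interchange (suc k) (λ i₁ i₂ j₁ j₂ → sg j₁ *ℤ sg j₂ *ℤ h i₁ i₂ j₁ j₂) ⟩
  ∑ (antidiag (suc k)) (λ (k₁ , k₂) → R k₁ k₂)
    ≡⟨ ≡.trans (∑-antidiag-suc k (λ (k₁ , k₂) → R k₁ k₂)) (cong₂ _+ℤ_ (second k) (∑-ε (antidiag k) (λ (k₁ , k₂) → first k₁ k₂))) ⟩
  + 0 ∎
  where
  open ≡-Reasoning
  h : ℕ → ℕ → ℕ → ℕ → ℤ
  h i₁ i₂ j₁ j₂ = ∑ (splitsW w) (λ (u , v) → H ((false , i₁) ∷ (true , j₁) ∷ u) ((false , i₂) ∷ (true , j₂) ∷ v))
  R : ℕ → ℕ → ℤ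
  R k₁ k₂ = ∑ (antidiag k₁) (λ (i₁ , j₁) → ∑ (antidiag k₂) (λ (i₂ , j₂) → sg j₁ *ℤ sg j₂ *ℤ h i₁ i₂ j₁ j₂))
  ring₁ : ∀ a b c → a *ℤ b *ℤ c ≡ b *ℤ (a *ℤ c)
  ring₁ = solve-∀
  first : ∀ k₁ k₂ → R (suc k₁) k₂ ≡ + 0
  first k₁ k₂ = ≡.trans (∑-comm (antidiag (suc k₁)) (antidiag k₂) _) (∑-ε (antidiag k₂) (λ (i₂ , j₂) → ≡.trans
    (∑-cong (antidiag (suc k₁)) (λ (i₁ , j₁) → ring₁ (sg j₁) (sg j₂) (h i₁ i₂ j₁ j₂))) (≡.trans (sym (∑-*ˡ (sg j₂) (antidiag (suc k₁)) (λ (i₁ , j₁) → sg j₁ *ℤ h i₁ i₂ j₁ j₂)))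
    (≡.trans (cong (sg j₂ *ℤ_) (≡.trans (∑-cong (antidiag (suc k₁)) (λ (i₁ , j₁) → ∑-*ˡ (sg j₁) (splitsW w) _)) (≡.trans (∑-comm (antidiag (suc k₁)) (splitsW w) _)
      (∑-ε (splitsW w) (λ (u , v) → S₁ ((false , i₂) ∷ (true , j₂) ∷ v) .rel k₁ u))))) (ℤₚ.*-zeroʳ (sg j₂))))))
  second : ∀ k → R 0 (suc k) ≡ + 0
  second k = ≡.trans (ℤₚ.+-identityʳ _) (≡.trans (∑-cong (antidiag (suc k)) (λ (i₂ , j₂) → ≡.trans (cong (_*ℤ h 0 i₂ 0 j₂) (ℤₚ.*-identityˡ (sg j₂))) (∑-*ˡ (sg j₂) (splitsW w) _)))
    (≡.trans (∑-comm (antidiag (suc k)) (splitsW w) _) (∑-ε (splitsW w) (λ (u , v) → S₂ ((false , 0) ∷ (true , 0) ∷ u) .rel k v))))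

conv : (Word → ℤ) → (Word → ℤ) → Word → ℤ
conv F G w = ∑ (splitsW w) (λ (u , v) → F u *ℤ G v)

conv-super : ∀ {F G} → Super F → Super G → Super (conv F G)
conv-super {F} {G} S T = splitsW-super {H = λ u v → F u *ℤ G v} (λ v → cst v) (λ u → Super-* (F u) T)
  where
  cst : ∀ v → Super (λ u → F u *ℤ G v)
  cst v .perm p   = cong (_*ℤ G v) (S .perm p)
  cst v .drop p w = cong (_*ℤ G v) (S .drop p w)
  cst v .rel k w  = ≡.trans (∑-cong (antidiag (suc k)) (λ (i , j) → sym (ℤₚ.*-assoc (sg j) _ (G v)))) (≡.trans
    (sym (∑-*ʳ (G v) (antidiag (suc k)) (λ (i , j) → sg j *ℤ F ((false , i) ∷ (true , j) ∷ w)))) (cong (_*ℤ G v) (S .rel k w)))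

-- Degrees and dominance of weights

total : Word → ℕ
total []            = 0
total ((p , n) ∷ w) = n + total w

psum : ℕ → Word → ℕ
psum zero    w             = 0
psum (suc k) []            = 0
psum (suc k) ((p , n) ∷ w) = n + psum k w

record Dominates (u w : Word) : Set where
  constructor dominates
  field
    parities≡ : parities u ≡ parities w
    total≡    : total u ≡ total w
    psum≥     : ∀ k → psum k w ≤ psum k u
open Dominates

lowers-good : ∀ q w → All (λ (t , u) → parities u ≡ parities w × t + total u ≡ total w × (∀ k → psum k w ≤ t + psum k u)) (lowers q w)
lowers-good q []            = (≡.refl , ≡.refl , λ { zero → z≤n ; (suc k) → z≤n }) ∷ []
lowers-good q ((p , n) ∷ w) = All-concatMap _ (AllP.map⁺ (All.map (λ { {i , j} e → AllP.map⁺ (All.map (λ { {t , u} (a , b , c) →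
    cong (p ∷_) a , ≡.trans (+-interchange i t j (total u)) (cong₂ _+_ e b) ,
    λ { zero → z≤n ; (suc k) → ℕₚ.≤-trans (ℕₚ.+-mono-≤ (ℕₚ.≤-reflexive (sym e)) (c k)) (ℕₚ.≤-reflexive (sym (+-interchange i t j (psum k u)))) } })
    (lowers-good q w)) }) (take≤-sum (p xor q) n)))

-- The Weyl denominator only moves exponents from later to earlier variables, so `Ext` evaluates its
-- function at no weights other than those dominating `w`.
Ext-cong-≥ : ∀ w {F G} → (∀ u → Dominates u w → F u ≡ G u) → Ext F w ≡ Ext G w
Ext-cong-≥ []            h = h [] (dominates ≡.refl ≡.refl (λ _ → ℕₚ.≤-refl))
Ext-cong-≥ ((s , a) ∷ w) {F} {G} h = Ext-cong-≥ w (λ u d → ∑-cong-All (All.map (λ { {t , u′} (x , y , z) → cong (sg t *ℤ_)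
  (h ((s , a + t) ∷ u′) (dominates (cong (s ∷_) (≡.trans x (parities≡ d)))
    (≡.trans (ℕₚ.+-assoc a t (total u′)) (cong (λ k → a + k) (≡.trans y (total≡ d))))
    (λ { zero → z≤n ; (suc k) → ℕₚ.≤-trans (ℕₚ.+-monoʳ-≤ a (ℕₚ.≤-trans (psum≥ d k) (z k))) (ℕₚ.≤-reflexive (sym (ℕₚ.+-assoc a t (psum k u′)))) }))) }) (lowers-good (not s) u)))

subs-total : ∀ v γ → length v ≡ length γ → All (λ γ′ → sum v + total γ′ ≡ total γ) (subs v γ)
subs-total []      []            e = ≡.refl ∷ []
subs-total (k ∷ v) ((p , g) ∷ γ) e = All-concatMap _ (All.map (λ { {_ , g′} q → AllP.map⁺ (All.map (λ {γ′} r →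
    ≡.trans (+-interchange k (sum v) g′ (total γ′)) (cong₂ _+_ (sym q) r)) (subs-total v γ (ℕₚ.suc-injective e))) }) (sub-sum k g))

sum-scale : ∀ t v → sum (scale t v) ≡ t * sum v
sum-scale t []      = sym (ℕₚ.*-zeroʳ t)
sum-scale t (x ∷ v) = ≡.trans (cong (λ k → t * x + k) (sum-scale t v)) (sym (ℕₚ.*-distribˡ-+ t x (sum v)))

δ₀-total : ∀ w → ¬ total w ≡ 0 → δ₀ w ≡ + 0
δ₀-total []                h = ⊥-elim (h ≡.refl)
δ₀-total ((p , zero) ∷ w)  h = δ₀-total w h
δ₀-total ((p , suc _) ∷ w) h = ≡.refl

Wl-degree : ∀ m Ls ξ γ → All (λ (q , v) → length v ≡ length γ × sum v ≡ m) Ls → ¬ total γ ≡ total ξ * m → Wl Ls ξ γ ≡ + 0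
Wl-degree m [] ξ γ a h with total ξ ℕₚ.≟ 0
... | yes e = ≡.trans (cong (δ₀ ξ *ℤ_) (δ₀-total γ (λ e′ → h (≡.trans e′ (sym (cong (_* m) e)))))) (ℤₚ.*-zeroʳ (δ₀ ξ))
... | no ne = cong (_*ℤ δ₀ γ) (δ₀-total ξ ne)
Wl-degree m ((q , v) ∷ Ls) ξ γ ((lv , sv) ∷ a) h = ≡.trans (∑-cong-All (All.map (λ { {t , ξ′} (_ , tot , _) → ≡.trans
    (∑-cong-All (All.zipWith (λ { {γ′} (lγ , sγ) → Wl-degree m Ls ξ′ γ′ (All.map (λ (x , y) → ≡.trans x (sym lγ) , y) a)
      (λ e → h (≡.trans (sym sγ) (≡.trans (cong₂ _+_ (≡.trans (sum-scale t v) (cong (t *_) sv)) e) (≡.trans (sym (ℕₚ.*-distribʳ-+ m t (total ξ′))) (cong (_* m) tot))))) })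
      (length-subs (scale t v) γ , subs-total (scale t v) γ (≡.trans (Listₚ.length-map (t *_) v) lv)))) (∑-ε (subs (scale t v) γ) (λ _ → ≡.refl)) }) (lowers-good q ξ)))
  (∑-ε (lowers q ξ) (λ _ → ≡.refl))

letters-sum : ∀ ps m → All (λ (q , v) → sum v ≡ m) (letters ps m)
letters-sum []       zero    = ≡.refl ∷ []
letters-sum []       (suc _) = []
letters-sum (p ∷ ps) m       = All-concatMap _ (All.map (λ { {a , r} e → AllP.map⁺ (All.map (λ s → ≡.trans (cong (λ k → a + k) s) e) (letters-sum ps r)) }) (take≤-sum p m))

letters-good : ∀ γ m → All (λ (q , v) → length v ≡ length γ × sum v ≡ m) (letters (parities γ) m)
letters-good γ m = All.zipWith (λ (x , y) → ≡.trans x (Listₚ.length-map proj₁ γ) , y) (letters-length (parities γ) m , letters-sum (parities γ) m)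

total-evens : ∀ γ → total (evens γ) ≡ sum γ
total-evens []      = ≡.refl
total-evens (g ∷ γ) = cong (λ k → g + k) (total-evens γ)

K-degree : ∀ π γ → ¬ total γ ≡ sum π → K π γ ≡ + 0
K-degree π γ h = ≡.trans (Ext-cong-≥ (evens π) {G = λ _ → + 0} (λ u d → Wl-degree 1 (letters (parities γ) 1) u γ (letters-good γ 1)
  (λ e → h (≡.trans e (≡.trans (ℕₚ.*-identityʳ _) (≡.trans (total≡ d) (total-evens π))))))) (Ext-0 (evens π) (λ _ → ≡.refl))

splitsW-good : ∀ w → All (λ (u , v) → parities u ≡ parities w × parities v ≡ parities w × total u + total v ≡ total w × (∀ k → psum k u + psum k v ≡ psum k w)) (splitsW w)
splitsW-good []            = (≡.refl , ≡.refl , ≡.refl , λ { zero → ≡.refl ; (suc k) → ≡.refl }) ∷ []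
splitsW-good ((p , n) ∷ w) = All-concatMap _ (All.map (λ { {i , j} e → AllP.map⁺ (All.map (λ { {u , v} (a , b , c , d) → cong (p ∷_) a , cong (p ∷_) b ,
    ≡.trans (+-interchange i (total u) j (total v)) (cong₂ _+_ e c) , λ { zero → ≡.refl ; (suc k) → ≡.trans (+-interchange i (psum k u) j (psum k v)) (cong₂ _+_ e (d k)) } })
    (splitsW-good w)) }) (take≤-sum false n))

private
  all-even : ∀ u γ → parities u ≡ parities (evens γ) → evens (map proj₂ u) ≡ u
  all-even []              []      e = ≡.refl
  all-even ((false , n) ∷ u) (g ∷ γ) e = cong ((false , n) ∷_) (all-even u γ (Listₚ.∷-injectiveʳ e))

  ∑-splits : ∀ γ (f : Word → Word → ℤ) → ∑ (splits γ) (λ (a , b) → f (evens a) (evens b)) ≡ ∑ (splitsW (evens γ)) (λ (u , v) → f u v)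
  ∑-splits []      f = ≡.refl
  ∑-splits (g ∷ γ) f = ≡.trans (∑-concatMap (λ a → map (cons a) (splits γ)) (upTo (suc g)) (λ (a , b) → f (evens a) (evens b))) (≡.trans
    (∑-cong (upTo (suc g)) (λ a → ∑-map (cons a) (splits γ) (λ (a , b) → f (evens a) (evens b)))) (≡.trans
    (sym (∑-map (λ a → a , g ∸ a) (upTo (suc g)) (λ (i , j) → ∑ (splits γ) (λ (a , b) → f ((false , i) ∷ evens a) ((false , j) ∷ evens b))))) (≡.trans
    (cong (λ l → ∑ l (λ (i , j) → ∑ (splits γ) (λ (a , b) → f ((false , i) ∷ evens a) ((false , j) ∷ evens b)))) (sym (antidiag-upTo g))) (≡.trans
    (∑-cong (antidiag g) (λ (i , j) → ∑-splits γ (λ u v → f ((false , i) ∷ u) ((false , j) ∷ v)))) (sym (∑-splitsW false g (evens γ) (λ (u , v) → f u v)))))))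
    where
    cons : ℕ → List ℕ × List ℕ → List ℕ × List ℕ
    cons a p = a ∷ proj₁ p , (g ∸ a) ∷ proj₂ p

  pos-sum : ∀ (xs : List X) (f : X → ℕ) → + sum (map f xs) ≡ ∑ xs (λ x → + f x)
  pos-sum []       f = ≡.refl
  pos-sum (x ∷ xs) f = ≡.trans (ℤₚ.pos-+ (f x) _) (cong (+ f x +ℤ_) (pos-sum xs f))

LR-Ext : ∀ α {κ μ} → Linked _≥_ κ → Linked _≥_ μ → LR α κ μ ≡ Ext (conv (K κ) (K μ)) (evens α)
LR-Ext α {κ} {μ} lκ lμ = schurCoeff-Ext (conv-super (K-super κ) (K-super μ)) (λ γ → ≡.trans (pos-sum (splits γ) _) (≡.trans
  (∑-cong (splits γ) (λ (a , b) → ≡.trans (ℤₚ.pos-* (kostka κ a) (kostka μ b)) (cong₂ _*ℤ_ (kostka-K lκ a) (kostka-K lμ b))))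
  (∑-splits γ (λ u v → K κ u *ℤ K μ v)))) α

-- Skewing is adjoint to multiplication: pairing F with the skew Schur function of α / κ is pairing
-- the product of s_κ and F with s_α. Expanding F in Schur functions makes the sum over μ disappear.
LR-expansion : ∀ α {κ} → Linked _≥_ κ → ∀ {F} → Super F →
  ∑ (parts (size α ∸ size κ)) (λ μ → LR α κ μ *ℤ Ext F (evens μ)) ≡ Ext (conv (K κ) F) (evens α)
LR-expansion α {κ} lκ {F} S = begin
  ∑ P (λ μ → LR α κ μ *ℤ Ext F (evens μ))
    ≡⟨ ∑-cong-All (All.map (λ {μ} lμ → ≡.trans (ℤₚ.*-comm (LR α κ μ) _) (≡.trans (cong (Ext F (evens μ) *ℤ_) (LR-Ext α lκ lμ))
         (sym (Ext-* (Ext F (evens μ)) (conv (K κ) (K μ)) (evens α))))) (parts-Linked (size α ∸ size κ))) ⟩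
  ∑ P (λ μ → Ext (λ ξ → Ext F (evens μ) *ℤ conv (K κ) (K μ) ξ) (evens α))
    ≡⟨ sym (Ext-∑ P (λ μ ξ → Ext F (evens μ) *ℤ conv (K κ) (K μ) ξ) (evens α)) ⟩
  Ext (λ ξ → ∑ P (λ μ → Ext F (evens μ) *ℤ conv (K κ) (K μ) ξ)) (evens α)
    ≡⟨ Ext-cong-≥ (evens α) (λ ξ d → begin
         ∑ P (λ μ → Ext F (evens μ) *ℤ conv (K κ) (K μ) ξ)
           ≡⟨ ∑-cong P (λ μ → ∑-*ˡ (Ext F (evens μ)) (splitsW ξ) _) ⟩
         ∑ P (λ μ → ∑ (splitsW ξ) (λ (u , v) → Ext F (evens μ) *ℤ (K κ u *ℤ K μ v)))
           ≡⟨ ∑-comm P (splitsW ξ) _ ⟩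
         ∑ (splitsW ξ) (λ (u , v) → ∑ P (λ μ → Ext F (evens μ) *ℤ (K κ u *ℤ K μ v)))
           ≡⟨ ∑-cong-All (All.map (λ { {u , v} (pu , pv , tot , _) → ≡.trans (∑-cong P (λ μ → ring (Ext F (evens μ)) (K κ u) (K μ v)))
                (≡.trans (sym (∑-*ˡ (K κ u) P _)) (term u v (≡.trans pv (parities≡ d)) (≡.trans tot (≡.trans (total≡ d) (total-evens α))))) }) (splitsW-good ξ)) ⟩
         conv (K κ) F ξ ∎) ⟩
  Ext (conv (K κ) F) (evens α) ∎
  where
  open ≡-Reasoning
  P = parts (size α ∸ size κ)
  ring : ∀ a b c → a *ℤ (b *ℤ c) ≡ b *ℤ (c *ℤ a)
  ring = solve-∀
  term : ∀ u v → parities v ≡ parities (evens α) → total u + total v ≡ sum α →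
    K κ u *ℤ ∑ P (λ μ → K μ v *ℤ Ext F (evens μ)) ≡ K κ u *ℤ F v
  -- `K κ u` vanishes unless u has the size of κ. In that case the truncated difference of sizes is
  -- a true one and equals the size of v.
  term u v pv tot with total u ℕₚ.≟ sum κ
  ... | no  ne rewrite K-degree κ u ne = ≡.refl
  ... | yes e  = cong (K κ u *ℤ_) (sym (≡.trans (cong F (sym ev)) (≡.trans (expansion-parts (map proj₂ v) S)
      (cong₂ (λ n w → ∑ (parts n) (λ μ → K μ w *ℤ Ext F (evens μ))) size≡ ev))))
    where
    ev : evens (map proj₂ v) ≡ v
    ev = all-even v α pv
    size≡ : sum (map proj₂ v) ≡ size α ∸ size κ
    size≡ = ≡.trans (≡.trans (sym (total-evens (map proj₂ v))) (cong total ev))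
      (sym (≡.trans (cong (_∸ sum κ) (≡.trans (sym tot) (cong (_+ total v) e))) (ℕₚ.m+n∸m≡n (sum κ) (total v))))

-- Both sums over partitions are absorbed, the one over μ by an expansion in ξ and the one over π by
-- an expansion in γ; this is where `W m ξ γ` must be supersymmetric in either word.
plethCoeff-Ext : ∀ lam {ν} → Linked _≥_ ν → ∀ α {κ} → Linked _≥_ κ → ∀ m →
  plethCoeff lam ν α κ m ≡ Ext (conv (K ν) (λ γ → Ext (conv (K κ) (λ ξ → W m ξ γ)) (evens α))) (evens lam)
plethCoeff-Ext lam {ν} lν α {κ} lκ m = begin
  plethCoeff lam ν α κ m
    ≡⟨ sumℤ-map _ (parts (size lam ∸ size ν)) ⟩
  ∑ (parts (size lam ∸ size ν)) (λ π → sumℤ (map (λ μ → LR α κ μ *ℤ plethHm μ m π) Q) *ℤ LR lam ν π)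
    ≡⟨ ∑-cong (parts (size lam ∸ size ν)) (λ π → ≡.trans (ℤₚ.*-comm _ (LR lam ν π)) (cong (LR lam ν π *ℤ_) (inner π))) ⟩
  ∑ (parts (size lam ∸ size ν)) (λ π → LR lam ν π *ℤ Ext Φ (evens π))
    ≡⟨ LR-expansion lam lν Φ-super ⟩
  Ext (conv (K ν) Φ) (evens lam) ∎
  where
  open ≡-Reasoning
  Q = parts (size α ∸ size κ)
  Φ : Word → ℤ
  Φ γ = Ext (conv (K κ) (λ ξ → W m ξ γ)) (evens α)
  Φ-super : Super Φ
  Φ-super = Ext-super (evens α) (λ ξ → Super-∑ (splitsW ξ) (λ (u , v) → Super-* (K κ u) (W-super m v)))
  inner : ∀ π → sumℤ (map (λ μ → LR α κ μ *ℤ plethHm μ m π) Q) ≡ Ext Φ (evens π)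
  inner π = begin
    sumℤ (map (λ μ → LR α κ μ *ℤ plethHm μ m π) Q)
      ≡⟨ sumℤ-map _ Q ⟩
    ∑ Q (λ μ → LR α κ μ *ℤ plethHm μ m π)
      ≡⟨ ∑-cong-All (All.map (λ {μ} lμ → ≡.trans (cong (LR α κ μ *ℤ_) (schurCoeff-Ext (Ext-super (evens μ) (W-super m)) (countSSYT-W lμ m) π))
           (sym (Ext-* (LR α κ μ) (λ γ → Ext (λ ξ → W m ξ γ) (evens μ)) (evens π)))) (parts-Linked (size α ∸ size κ))) ⟩
    ∑ Q (λ μ → Ext (λ γ → LR α κ μ *ℤ Ext (λ ξ → W m ξ γ) (evens μ)) (evens π))
      ≡⟨ sym (Ext-∑ Q (λ μ γ → LR α κ μ *ℤ Ext (λ ξ → W m ξ γ) (evens μ)) (evens π)) ⟩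
    Ext (λ γ → ∑ Q (λ μ → LR α κ μ *ℤ Ext (λ ξ → W m ξ γ) (evens μ))) (evens π)
      ≡⟨ Ext-cong (evens π) (λ γ → LR-expansion α lκ (Wl-super (letters (parities γ) m) γ)) ⟩
    Ext Φ (evens π) ∎

-- Highest weights of the growing shapes

cut : ℕ → List ℕ → List ℕ
cut c lam = strip (map (_∸ c) lam)

cut-∷-≤ : ∀ {c x} xs → x ≤ c → cut c (x ∷ xs) ≡ cut c xs
cut-∷-≤ {c} {x} xs h rewrite ℕₚ.m≤n⇒m∸n≡0 h = ≡.refl

cut-∷-> : ∀ {c x} xs → c < x → cut c (x ∷ xs) ≡ x ∸ c ∷ cut c xs
cut-∷-> {c} {x} xs h with x ∸ c | ℕₚ.m>n⇒m∸n≢0 h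
... | zero  | ne = ⊥-elim (ne ≡.refl)
... | suc _ | _  = ≡.refl

cut-suc : ∀ c lam → strip (map pred (cut c lam)) ≡ cut (suc c) lam
cut-suc c []        = ≡.refl
cut-suc c (x ∷ lam) with c ℕₚ.<? x
... | no  c≮x = ≡.trans (cong (λ l → strip (map pred l)) (cut-∷-≤ lam (ℕₚ.≮⇒≥ c≮x))) (≡.trans (cut-suc c lam) (sym (cut-∷-≤ lam (ℕₚ.m≤n⇒m≤1+n (ℕₚ.≮⇒≥ c≮x)))))
... | yes c<x rewrite cut-∷-> lam c<x | ℕₚ.pred[m∸n]≡m∸[1+n] x c with x ∸ suc c
... | zero  = cut-suc c lam
... | suc y = cong (suc y ∷_) (cut-suc c lam)

map-∸-Linked : ∀ c {lam} → Linked _≥_ lam → Linked _≥_ (map (_∸ c) lam)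
map-∸-Linked c l = Linkedₚ.map⁺ (go l)
  where
  go : ∀ {lam} → Linked _≥_ lam → Linked (λ x y → x ∸ c ≥ y ∸ c) lam
  go []      = []
  go [-]     = [-]
  go (h ∷ l) = ℕₚ.∸-monoˡ-≤ c h ∷ go l

cut-Linked : ∀ c {lam} → Linked _≥_ lam → Linked _≥_ (cut c lam)
cut-Linked c l = strip-Linked (map-∸-Linked c l)

map-suc-pred : ∀ xs → map suc (map pred (strip xs)) ≡ strip xs
map-suc-pred []           = ≡.refl
map-suc-pred (zero ∷ xs)  = map-suc-pred xs
map-suc-pred (suc x ∷ xs) = cong (suc x ∷_) (map-suc-pred xs)

-- The lengths of the columns c + 1, …, c + M, followed by what is left of the rows.
colWord : ℕ → ℕ → List ℕ → Word
colWord c zero    lam = evens (cut c lam)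
colWord c (suc M) lam = (true , length (cut c lam)) ∷ colWord (suc c) M lam

Ext-colWord : ∀ M {lam} → Linked _≥_ lam → ∀ {F} → Super F → Ext F (evens lam) ≡ Ext F (colWord 0 M lam)
Ext-colWord M {lam} l {F} S = ≡.trans (sym (Ext-strip S l)) (≡.trans (cong (λ u → Ext F (evens (strip u))) (sym (Listₚ.map-id lam))) (go 0 M S))
  where
  go : ∀ c M {F} → Super F → Ext F (evens (cut c lam)) ≡ Ext F (colWord c M lam)
  go c zero    S = ≡.refl
  go c (suc M) {F} S = begin
    Ext F (evens (cut c lam))
      ≡⟨ cong (λ u → Ext F (evens u)) (sym (map-suc-pred (map (_∸ c) lam))) ⟩
    Ext F (evens (map suc (map pred (cut c lam))))
      ≡⟨ Ext-column S (map pred (cut c lam)) ⟩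
    Ext F ((true , length (map pred (cut c lam))) ∷ evens (map pred (cut c lam)))
      ≡⟨ cong (λ k → Ext F ((true , k) ∷ evens (map pred (cut c lam)))) (Listₚ.length-map pred (cut c lam)) ⟩
    Ext F′ (evens (map pred (cut c lam)))
      ≡⟨ sym (Ext-strip S′ (map-pred-Linked (cut-Linked c l))) ⟩
    Ext F′ (evens (strip (map pred (cut c lam))))
      ≡⟨ cong (λ u → Ext F′ (evens u)) (cut-suc c lam) ⟩
    Ext F′ (evens (cut (suc c) lam))
      ≡⟨ go (suc c) M S′ ⟩
    Ext F (colWord c (suc M) lam) ∎
    where
    open ≡-Reasoning
    F′ = bern true (length (cut c lam)) F
    S′ : Super F′
    S′ = bern-super true (length (cut c lam)) S
    map-pred-Linked : ∀ {xs} → Linked _≥_ xs → Linked _≥_ (map pred xs)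
    map-pred-Linked []      = []
    map-pred-Linked [-]     = [-]
    map-pred-Linked (h ∷ l) = ℕₚ.pred-mono-≤ h ∷ map-pred-Linked l

insertD-↭ : ∀ x ys → insertD x ys ↭ x ∷ ys
insertD-↭ x []       = ↭-refl
insertD-↭ x (y ∷ ys) with y <ᵇ x
... | true  = ↭-refl
... | false = ↭-trans (prep y (insertD-↭ x ys)) (swap y x ↭-refl)

sortD-↭ : ∀ xs → sortD xs ↭ xs
sortD-↭ []       = ↭-refl
sortD-↭ (x ∷ xs) = ↭-trans (insertD-↭ x (sortD xs)) (prep x (sortD-↭ xs))

insertD-Linked : ∀ x {ys} → Linked _≥_ ys → Linked _≥_ (insertD x ys)
insertD-Linked x {[]}     l = [-]
insertD-Linked x {y ∷ ys} l with y <ᵇ x in eq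
... | true  = ℕₚ.<⇒≤ (ℕₚ.<ᵇ⇒< y x (subst Data.Bool.T (sym eq) _)) ∷ l
... | false = cons ys l
  where
  x≤y : x ≤ y
  x≤y = ℕₚ.≮⇒≥ (λ y<x → case (≡.trans (sym eq) (<⇒<ᵇ≡true y<x)))
    where
    case : ¬ false ≡ true
    case ()
  cons : ∀ ys → Linked _≥_ (y ∷ ys) → Linked _≥_ (y ∷ insertD x ys)
  cons []       l = x≤y ∷ [-]
  cons (z ∷ ys) (y≥z ∷ l) with z <ᵇ x | insertD-Linked x l
  ... | true  | l′ = x≤y ∷ l′
  ... | false | l′ = y≥z ∷ l′

sortD-Linked : ∀ xs → Linked _≥_ (sortD xs)
sortD-Linked []       = []
sortD-Linked (x ∷ xs) = insertD-Linked x (sortD-Linked xs)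

Linked-↭⇒≡ : ∀ {xs ys : List ℕ} → Linked _≥_ xs → Linked _≥_ ys → xs ↭ ys → xs ≡ ys
Linked-↭⇒≡ {[]}     {[]}     _ _ _ = ≡.refl
Linked-↭⇒≡ {[]}     {y ∷ ys} _ _ p with Perm.↭-empty-inv (↭-sym p)
... | ()
Linked-↭⇒≡ {x ∷ xs} {[]}     _ _ p with Perm.↭-empty-inv p
... | ()
Linked-↭⇒≡ {x ∷ xs} {y ∷ ys} lx ly p with ℕₚ.≤-antisym (head-max ly (Perm.∈-resp-↭ p (here ≡.refl))) (head-max lx (Perm.∈-resp-↭ (↭-sym p) (here ≡.refl)))
  where
  head-max : ∀ {x y ys} → Linked _≥_ (y ∷ ys) → x ∈ y ∷ ys → x ≤ y
  head-max l       (here ≡.refl) = ℕₚ.≤-refl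
  head-max (h ∷ l) (there m)     = ℕₚ.≤-trans (head-max l m) h
... | ≡.refl = cong (x ∷_) (Linked-↭⇒≡ (tail-Linked lx) (tail-Linked ly) (Perm.drop-∷ p))

strip-++ : ∀ xs ys → strip (xs ++ ys) ≡ strip xs ++ strip ys
strip-++ []           ys = ≡.refl
strip-++ (zero ∷ xs)  ys = strip-++ xs ys
strip-++ (suc x ∷ xs) ys = cong (suc x ∷_) (strip-++ xs ys)

strip-↭ : ∀ {xs ys} → xs ↭ ys → strip xs ↭ strip ys
strip-↭ refl = ↭-refl
strip-↭ (prep zero p)    = strip-↭ p
strip-↭ (prep (suc x) p) = prep (suc x) (strip-↭ p)
strip-↭ (swap zero zero p)       = strip-↭ p
strip-↭ (swap zero (suc y) p)    = prep (suc y) (strip-↭ p)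
strip-↭ (swap (suc x) zero p)    = prep (suc x) (strip-↭ p)
strip-↭ (swap (suc x) (suc y) p) = swap (suc x) (suc y) (strip-↭ p)
strip-↭ (trans p q) = ↭-trans (strip-↭ p) (strip-↭ q)

cut-↭ : ∀ c {xs ys} → xs ↭ ys → cut c xs ↭ cut c ys
cut-↭ c p = strip-↭ (Perm.map⁺ (_∸ c) p)

cut-strip : ∀ c xs → cut c (strip xs) ≡ cut c xs
cut-strip c []           = ≡.refl
cut-strip c (zero ∷ xs)  = ≡.trans (cut-strip c xs) (sym (cut-∷-≤ {c} {0} xs z≤n))
cut-strip c (suc x ∷ xs) with suc x ∸ c
... | zero  = cut-strip c xs
... | suc y = cong (suc y ∷_) (cut-strip c xs)

cut-⊔ : ∀ c xs ys → cut c (xs ⊔ ys) ↭ cut c xs ++ cut c ys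
cut-⊔ c xs ys = ↭-trans (cut-↭ c (sortD-↭ (strip (xs ++ ys)))) (↭-reflexive (≡.trans (cut-strip c (xs ++ ys))
  (≡.trans (cong strip (Listₚ.map-++ (_∸ c) xs ys)) (strip-++ (map (_∸ c) xs) (map (_∸ c) ys)))))

length-cut-replicate : ∀ {c M} j → c < M → length (cut c (replicate j M)) ≡ j
length-cut-replicate zero    h = ≡.refl
length-cut-replicate {c} {M} (suc j) h = ≡.trans (cong length (cut-∷-> (replicate j M) h)) (cong suc (length-cut-replicate j h))

cut-replicate : ∀ M j → cut M (replicate j M) ≡ []
cut-replicate M zero    = ≡.refl
cut-replicate M (suc j) = ≡.trans (cut-∷-≤ (replicate j M) (ℕₚ.≤-refl {M})) (cut-replicate M j)

length-cut-⊔ : ∀ {c M} xs j → c < M → length (cut c (xs ⊔ replicate j M)) ≡ length (cut c xs) + j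
length-cut-⊔ {c} {M} xs j h = ≡.trans (Perm.↭-length (cut-⊔ c xs (replicate j M))) (≡.trans (Listₚ.length-++ (cut c xs)) (cong (λ k → length (cut c xs) + k) (length-cut-replicate j h)))

⊔-Linked : ∀ xs ys → Linked _≥_ (xs ⊔ ys)
⊔-Linked xs ys = sortD-Linked (strip (xs ++ ys))

cut-⊔-replicate : ∀ M {xs} j → Linked _≥_ xs → cut M (xs ⊔ replicate j M) ≡ cut M xs
cut-⊔-replicate M {xs} j l = Linked-↭⇒≡ (cut-Linked M (⊔-Linked xs (replicate j M))) (cut-Linked M l)
  (↭-trans (cut-⊔ M xs (replicate j M)) (↭-reflexive (≡.trans (cong (cut M xs ++_) (cut-replicate M j)) (Listₚ.++-identityʳ _))))

⊕-[] : ∀ xs → xs ⊕ [] ≡ xs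
⊕-[] []       = ≡.refl
⊕-[] (_ ∷ xs) = ≡.refl

⊕-single-Linked : ∀ {μ} k → Linked _≥_ μ → Linked _≥_ (μ ⊕ single k)
⊕-single-Linked {μ} zero l = subst (Linked _≥_) (sym (⊕-[] μ)) l
⊕-single-Linked {[]} (suc k) l = [-]
⊕-single-Linked {x ∷ μ} (suc k) l = subst (λ u → Linked _≥_ (x + suc k ∷ u)) (sym (⊕-[] μ)) (cons μ l)
  where
  cons : ∀ μ → Linked _≥_ (x ∷ μ) → Linked _≥_ (x + suc k ∷ μ)
  cons []      l       = [-]
  cons (y ∷ μ) (h ∷ l) = ℕₚ.≤-trans h (ℕₚ.m≤m+n x (suc k)) ∷ l

⊕-single-∷ : ∀ μ k → μ ⊕ single (suc k) ≡ hd μ + suc k ∷ tl μ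
⊕-single-∷ []      k = ≡.refl
⊕-single-∷ (x ∷ μ) k = cong (x + suc k ∷_) (⊕-[] μ)

addW : List ℕ → Word → Word
addW []      w             = w
addW (k ∷ z) []            = []
addW (k ∷ z) ((p , n) ∷ w) = (p , k + n) ∷ addW z w

-- The exponents of the monomial y₁ ⋯ y_M x₁^l in M odd and n even variables.
zvec : ℕ → ℕ → ℕ → List ℕ
zvec (suc M) l n       = 1 ∷ zvec M l n
zvec zero    l zero    = []
zvec zero    l (suc n) = l ∷ replicate n 0

addW-zeros : ∀ w → addW (replicate (length w) 0) w ≡ w
addW-zeros []            = ≡.refl
addW-zeros ((p , n) ∷ w) = cong ((p , n) ∷_) (addW-zeros w)

-- A new row of length M adds a box to each of the first M columns. If l is positive and `M < j`,
-- the first row already reaches beyond column M, so its l new boxes lie there, and an even variable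
-- exists that can carry the exponent l.
curly-word : ∀ l M {μ} → Linked _≥_ μ → ∀ j → M < j →
  let w = colWord 0 M ((μ ⊕ single (l * j)) ⊔ rect M j)
      n = length (cut M (μ ⊕ single (l * j))) in
  colWord 0 M ((μ ⊕ single (l * suc j)) ⊔ rect M (suc j)) ≡ addW (zvec M l n) w ×
  parities w ≡ replicate M true ++ replicate n false × (1 ≤ l → 1 ≤ n)
curly-word l M {μ} lin j M<j = go 0 M ≡.refl , par 0 M ≡.refl , pos
  where
  open ≡-Reasoning
  base : ℕ → List ℕ
  base j = μ ⊕ single (l * j)
  lam : ℕ → List ℕ
  lam j = base j ⊔ rect M j
  n = length (cut M (base j))
  -- As soon as the first row is longer than M, only its length depends on j.
  shape : 1 ≤ l → ∀ c → c ≤ M → ∀ j → M < j → cut c (base j) ≡ hd μ + l * j ∸ c ∷ cut c (tl μ)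
  shape 1≤l c c≤M (suc j) h with l * suc j | ℕₚ.≤-trans h (ℕₚ.≤-trans (ℕₚ.≤-reflexive (sym (ℕₚ.*-identityˡ (suc j)))) (ℕₚ.*-monoˡ-≤ (suc j) 1≤l))
  ... | suc k | M<k = ≡.trans (cong (cut c) (⊕-single-∷ μ k)) (cut-∷-> (tl μ) (ℕₚ.≤-trans (s≤s c≤M) (ℕₚ.≤-trans M<k (ℕₚ.m≤n+m (suc k) (hd μ)))))
  M<sj : M < suc j
  M<sj = ℕₚ.m<n⇒m<1+n M<j
  length-const : ∀ c → c ≤ M → length (cut c (base (suc j))) ≡ length (cut c (base j))
  length-const c c≤M with l ℕₚ.≟ 0
  ... | yes ≡.refl = ≡.refl
  ... | no  l≢0    = ≡.trans (cong length (shape (ℕₚ.n≢0⇒n>0 l≢0) c c≤M (suc j) M<sj)) (sym (cong length (shape (ℕₚ.n≢0⇒n>0 l≢0) c c≤M j M<j)))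
  pos : 1 ≤ l → 1 ≤ n
  pos 1≤l = ℕₚ.≤-trans (s≤s z≤n) (ℕₚ.≤-reflexive (sym (cong length (shape 1≤l M ℕₚ.≤-refl j M<j))))
  rows : evens (cut M (lam (suc j))) ≡ addW (zvec 0 l n) (evens (cut M (lam j)))
  rows = ≡.trans (cong evens (cut-⊔-replicate M (suc j) (⊕-single-Linked (l * suc j) lin)))
    (≡.trans rows′ (cong (λ u → addW (zvec 0 l n) (evens u)) (sym (cut-⊔-replicate M j (⊕-single-Linked (l * j) lin)))))
    where
    rows′ : evens (cut M (base (suc j))) ≡ addW (zvec 0 l n) (evens (cut M (base j)))
    rows′ with l ℕₚ.≟ 0
    ... | yes ≡.refl = sym (zeros (cut M (base j)))
      where
      zeros : ∀ u → addW (zvec 0 0 (length u)) (evens u) ≡ evens u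
      zeros []      = ≡.refl
      zeros (x ∷ u) = cong ((false , x) ∷_) (≡.trans (cong (λ k → addW (replicate k 0) (evens u)) (sym (length-evens u))) (addW-zeros (evens u)))
    ... | no l≢0 rewrite shape (ℕₚ.n≢0⇒n>0 l≢0) M ℕₚ.≤-refl (suc j) M<sj | shape (ℕₚ.n≢0⇒n>0 l≢0) M ℕₚ.≤-refl j M<j =
      cong₂ (λ x u → (false , x) ∷ u) head (sym (≡.trans (cong (λ k → addW (replicate k 0) (evens u)) (sym (length-evens u))) (addW-zeros (evens u))))
      where
      u = cut M (tl μ)
      big : M ≤ hd μ + l * j
      big = ℕₚ.≤-trans (ℕₚ.<⇒≤ M<j) (ℕₚ.≤-trans (ℕₚ.≤-trans (ℕₚ.≤-reflexive (sym (ℕₚ.*-identityˡ j))) (ℕₚ.*-monoˡ-≤ j (ℕₚ.n≢0⇒n>0 l≢0))) (ℕₚ.m≤n+m (l * j) (hd μ)))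
      head : hd μ + l * suc j ∸ M ≡ l + (hd μ + l * j ∸ M)
      head = ≡.trans (cong (_∸ M) (ex (hd μ) l j)) (ℕₚ.+-∸-assoc l big)
        where
        ex : ∀ a l j → a + l * suc j ≡ l + (a + l * j)
        ex = ℕSolver.solve-∀
  go : ∀ c M′ → c + M′ ≡ M → colWord c M′ (lam (suc j)) ≡ addW (zvec M′ l n) (colWord c M′ (lam j))
  go c zero     e = subst (λ k → evens (cut k (lam (suc j))) ≡ addW (zvec 0 l n) (evens (cut k (lam j)))) (≡.trans (sym e) (ℕₚ.+-identityʳ c)) rows
  go c (suc M′) e = cong₂ (λ k w → (true , k) ∷ w) (begin
      length (cut c (lam (suc j)))            ≡⟨ length-cut-⊔ (base (suc j)) (suc j) c<M ⟩
      length (cut c (base (suc j))) + suc j   ≡⟨ cong (_+ suc j) (length-const c (ℕₚ.<⇒≤ c<M)) ⟩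
      length (cut c (base j)) + suc j         ≡⟨ ℕₚ.+-suc _ j ⟩
      suc (length (cut c (base j)) + j)       ≡⟨ cong suc (sym (length-cut-⊔ (base j) j c<M)) ⟩
      suc (length (cut c (lam j)))            ∎) (go (suc c) M′ (≡.trans (sym (ℕₚ.+-suc c M′)) e))
    where
    c<M : c < M
    c<M = ℕₚ.≤-trans (ℕₚ.m≤m+n (suc c) M′) (ℕₚ.≤-reflexive (≡.trans (sym (ℕₚ.+-suc c M′)) e))
  par : ∀ c M′ → c + M′ ≡ M → parities (colWord c M′ (lam j)) ≡ replicate M′ true ++ replicate n false
  par c zero     e = ≡.trans (parities-evens (cut c (lam j))) (cong (λ k → replicate k false)
    (≡.trans (cong (λ k → length (cut k (lam j))) (≡.trans (sym (ℕₚ.+-identityʳ c)) e)) (cong length (cut-⊔-replicate M j (⊕-single-Linked (l * j) lin)))))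
  par c (suc M′) e = cong (true ∷_) (par (suc c) M′ (≡.trans (sym (ℕₚ.+-suc c M′)) e))

-- Stability

subs-lowers : ∀ q z u (f : ℕ → Word → ℤ) →
  ∑ (lowers q u) (λ (t , u′) → ∑ (subs z u′) (f t)) ≡ ∑ (subs z u) (λ v → ∑ (lowers q v) (λ (t , v′) → f t v′))
subs-lowers q []      u  f = ≡.trans (∑-cong (lowers q u) (λ _ → ℤₚ.+-identityʳ _)) (sym (ℤₚ.+-identityʳ _))
subs-lowers q (k ∷ z) [] f = ≡.refl
subs-lowers q (k ∷ z) ((p , n) ∷ u) f = begin
  ∑ (lowers q ((p , n) ∷ u)) (λ (t , u′) → ∑ (subs (k ∷ z) u′) (f t))
    ≡⟨ ∑-lowers q p n u _ ⟩
  ∑ (take≤ (p xor q) n) (λ (i , j) → ∑ (lowers q u) (λ (t , u′) → ∑ (subs (k ∷ z) ((p , j) ∷ u′)) (f (i + t))))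
    ≡⟨ ∑-cong (take≤ (p xor q) n) (λ (i , j) → ≡.trans (∑-cong (lowers q u) (λ (t , u′) → ∑-subs k z p j u′ (f (i + t)))) (≡.trans (∑-comm (lowers q u) (sub k j) _)
         (∑-cong (sub k j) (λ (_ , x) → subs-lowers q z u (λ t v → f (i + t) ((p , x) ∷ v)))))) ⟩
  ∑ (take≤ (p xor q) n) (λ (i , j) → ∑ (sub k j) (λ (_ , x) → ∑ (subs z u) (λ v → ∑ (lowers q v) (λ (t , v′) → f (i + t) ((p , x) ∷ v′)))))
    ≡⟨ sub-take≤ (p xor q) k n (λ i x → ∑ (subs z u) (λ v → ∑ (lowers q v) (λ (t , v′) → f (i + t) ((p , x) ∷ v′)))) ⟩
  ∑ (sub k n) (λ (_ , y) → ∑ (take≤ (p xor q) y) (λ (i , x) → ∑ (subs z u) (λ v → ∑ (lowers q v) (λ (t , v′) → f (i + t) ((p , x) ∷ v′)))))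
    ≡⟨ ∑-cong (sub k n) (λ (_ , y) → ≡.trans (∑-comm (take≤ (p xor q) y) (subs z u) _) (∑-cong (subs z u) (λ v → sym (∑-lowers q p y v (λ (t , v′) → f t v′))))) ⟩
  ∑ (sub k n) (λ (_ , y) → ∑ (subs z u) (λ v → ∑ (lowers q ((p , y) ∷ v)) (λ (t , v′) → f t v′)))
    ≡⟨ sym (∑-subs k z p n u (λ v → ∑ (lowers q v) (λ (t , v′) → f t v′))) ⟩
  ∑ (subs (k ∷ z) ((p , n) ∷ u)) (λ v → ∑ (lowers q v) (λ (t , v′) → f t v′)) ∎
  where
  open ≡-Reasoning
  sub-take≤ : ∀ b k n (g : ℕ → ℕ → ℤ) → ∑ (take≤ b n) (λ (i , j) → ∑ (sub k j) (λ (_ , x) → g i x)) ≡ ∑ (sub k n) (λ (_ , y) → ∑ (take≤ b y) (λ (i , x) → g i x))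
  sub-take≤ false k       n       g = sym (sub-antidiag k n g)
  sub-take≤ true  zero    n       g = ≡.trans (∑-cong (steps n) (λ _ → ℤₚ.+-identityʳ _)) (sym (ℤₚ.+-identityʳ _))
  sub-take≤ true  (suc k) zero    g = ≡.refl
  sub-take≤ true  (suc k) (suc zero)    g = ≡.trans (ℤₚ.+-identityʳ _) (lem k)
    where
    lem : ∀ k → ∑ (sub k 0) (λ (_ , x) → g 0 x) ≡ ∑ (sub k 0) (λ (_ , y) → ∑ (steps y) (λ (i , x) → g i x))
    lem zero    = sym (ℤₚ.+-identityʳ _)
    lem (suc k) = ≡.refl
  sub-take≤ true  (suc k) (suc (suc n)) g = sub-take≤ true k (suc n) g

-- `subs z` is multiplication by a monomial. It commutes with multiplication by the Weyl
-- denominator, hence merely shifts the weight at which the coefficient is read.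
Ext-shift : ∀ z w F → Ext (λ u → ∑ (subs z u) F) (addW z w) ≡ Ext F w
Ext-shift []      w             F = Ext-cong w (λ u → ℤₚ.+-identityʳ _)
Ext-shift (k ∷ z) []            F = ℤₚ.+-identityʳ _
Ext-shift (k ∷ z) ((s , a) ∷ w) F = ≡.trans (Ext-cong (addW z w) (λ u → ≡.trans
    (∑-cong (lowers (not s) u) (λ (t , u′) → ≡.trans (cong (sg t *ℤ_) (≡.trans (∑-subs k z s (k + a + t) u′ F)
      (≡.trans (cong (λ l → ∑ l (λ (_ , x) → ∑ (subs z u′) (λ v → F ((s , x) ∷ v)))) (≡.trans (cong (sub k) (≡.trans (ℕₚ.+-assoc k a t) (ℕₚ.+-comm k (a + t)))) (sub-+ 0 k (a + t)))) (ℤₚ.+-identityʳ _))))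
      (∑-*ˡ (sg t) (subs z u′) _)))
    (subs-lowers (not s) z u (λ t v → sg t *ℤ F ((s , a + t) ∷ v)))))
  (Ext-shift z w (bern s a F))

conv-shift : ∀ z K Φ u → conv K (λ v → ∑ (subs z v) Φ) u ≡ ∑ (subs z u) (conv K Φ)
conv-shift z K Φ u = ≡.trans (∑-cong (splitsW u) (λ (u₁ , u₂) → ∑-*ˡ (K u₁) (subs z u₂) Φ)) (go z u (λ u₁ v → K u₁ *ℤ Φ v))
  where
  go : ∀ z u (H : Word → Word → ℤ) → ∑ (splitsW u) (λ (u₁ , u₂) → ∑ (subs z u₂) (H u₁)) ≡ ∑ (subs z u) (λ y → ∑ (splitsW y) (λ (u₁ , v) → H u₁ v))
  go []      u  H = ≡.trans (∑-cong (splitsW u) (λ _ → ℤₚ.+-identityʳ _)) (sym (ℤₚ.+-identityʳ _))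
  go (k ∷ z) [] H = ≡.refl
  go (k ∷ z) ((p , n) ∷ u) H = ≡.trans (∑-splitsW p n u (λ (u₁ , u₂) → ∑ (subs (k ∷ z) u₂) (H u₁))) (≡.trans
    (∑-cong (antidiag n) (λ (i , j) → ≡.trans (∑-cong (splitsW u) (λ (u₁ , u₂) → ∑-subs k z p j u₂ (H ((p , i) ∷ u₁)))) (≡.trans (∑-comm (splitsW u) (sub k j) _)
      (∑-cong (sub k j) (λ (_ , x) → go z u (λ u₁ v → H ((p , i) ∷ u₁) ((p , x) ∷ v))))))) (≡.trans
    (sym (sub-antidiag k n (λ i x → ∑ (subs z u) (λ y → ∑ (splitsW y) (λ (u₁ , v) → H ((p , i) ∷ u₁) ((p , x) ∷ v)))))) (≡.trans
    (∑-cong (sub k n) (λ (_ , y) → ≡.trans (∑-comm (antidiag y) (subs z u) _) (∑-cong (subs z u) (λ v → sym (∑-splitsW p y v (λ (u₁ , v) → H u₁ v))))))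
    (sym (∑-subs k z p n u (λ y → ∑ (splitsW y) (λ (u₁ , v) → H u₁ v)))))))

zpar : ℕ → Bool
zpar zero    = false
zpar (suc M) = not (zpar M)

-- For a monomial of degree M + l in the variables used, the first summand is at most M and the
-- second at most M + l. In general neither bound alone singles out a monomial; together they are
-- attained by y_1 ⋯ y_M x_1^l only.
weightOf : ℕ → Word → ℕ
weightOf M w = psum M w + psum (suc M) w

psum≤total : ∀ k w → psum k w ≤ total w
psum≤total zero    w             = z≤n
psum≤total (suc k) []            = z≤n
psum≤total (suc k) ((p , n) ∷ w) = ℕₚ.+-monoʳ-≤ n (psum≤total k w)

psum-scale : ∀ k t v → psum k (evens (scale t v)) ≡ t * psum k (evens v)
psum-scale zero    t v       = sym (ℕₚ.*-zeroʳ t)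
psum-scale (suc k) t []      = sym (ℕₚ.*-zeroʳ t)
psum-scale (suc k) t (x ∷ v) = ≡.trans (cong (λ i → t * x + i) (psum-scale k t v)) (sym (ℕₚ.*-distribˡ-+ t x _))

subs-good : ∀ v γ → length v ≡ length γ → All (λ γ′ → parities γ′ ≡ parities γ × (∀ k → psum k (evens v) + psum k γ′ ≡ psum k γ)) (subs v γ)
subs-good []      []            e = (≡.refl , λ { zero → ≡.refl ; (suc k) → ≡.refl }) ∷ []
subs-good (x ∷ v) ((p , g) ∷ γ) e = All-concatMap _ (All.map (λ { {_ , g′} q → AllP.map⁺ (All.map (λ { {γ′} (a , b) → cong (p ∷_) a ,
    λ { zero → ≡.refl ; (suc k) → ≡.trans (+-interchange x (psum k (evens v)) g′ (psum k γ′)) (cong₂ _+_ (sym q) (b k)) } }) (subs-good v γ (ℕₚ.suc-injective e))) }) (sub-sum x g))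

subs-weight : ∀ M t v γ → length v ≡ length γ → All (λ γ′ → parities γ′ ≡ parities γ × t * weightOf M (evens v) + weightOf M γ′ ≡ weightOf M γ) (subs (scale t v) γ)
subs-weight M t v γ e = All.map (λ { {γ′} (a , b) → a , ≡.trans (cong (_+ weightOf M γ′) (≡.trans (ℕₚ.*-distribˡ-+ t _ _) (cong₂ _+_ (sym (psum-scale M t v)) (sym (psum-scale (suc M) t v)))))
    (≡.trans (+-interchange (psum M (evens (scale t v))) (psum (suc M) (evens (scale t v))) (psum M γ′) (psum (suc M) γ′)) (cong₂ _+_ (b M) (b (suc M)))) })
  (subs-good (scale t v) γ (≡.trans (Listₚ.length-map (t *_) v) e))

-- If every monomial has weight less than Q, then so has the average monomial of every contribution.
Wl-light : ∀ M Q Ls ξ γ → All (λ (q , v) → length v ≡ length γ × weightOf M (evens v) < Q) Ls →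
  Q * total ξ < total ξ + weightOf M γ → Wl Ls ξ γ ≡ + 0
Wl-light M Q [] ξ γ a h with total ξ ℕₚ.≟ 0
... | no  ne = cong (_*ℤ δ₀ γ) (δ₀-total ξ ne)
... | yes e  = ≡.trans (cong (δ₀ ξ *ℤ_) (δ₀-total γ (λ z → ℕₚ.<-irrefl ≡.refl (ℕₚ.≤-trans (s≤s z≤n) (ℕₚ.≤-trans h (ℕₚ.≤-reflexive (cong₂ _+_ e (zero-weight z)))))))) (ℤₚ.*-zeroʳ (δ₀ ξ))
  where
  zero-weight : total γ ≡ 0 → weightOf M γ ≡ 0
  zero-weight z = ℕₚ.n≤0⇒n≡0 (ℕₚ.≤-trans (ℕₚ.+-mono-≤ (psum≤total M γ) (psum≤total (suc M) γ)) (ℕₚ.≤-reflexive (cong₂ _+_ z z)))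
Wl-light M Q ((q , v) ∷ Ls) ξ γ ((lv , wv) ∷ a) h = ≡.trans (∑-cong-All (All.map (λ { {t , ξ′} (_ , tot , _) → ≡.trans
    (∑-cong-All (All.zipWith (λ { {γ′} (lγ , (_ , wγ)) → Wl-light M Q Ls ξ′ γ′ (All.map (λ (x , y) → ≡.trans x (sym lγ) , y) a) (bound t (total ξ′) (weightOf M γ′) tot wγ) })
      (length-subs (scale t v) γ , subs-weight M t v γ lv))) (∑-ε (subs (scale t v) γ) (λ _ → ≡.refl)) }) (lowers-good q ξ)))
  (∑-ε (lowers q ξ) (λ _ → ≡.refl))
  where
  x = weightOf M (evens v)
  bound : ∀ t X G → t + X ≡ total ξ → t * x + G ≡ weightOf M γ → Q * X < X + G
  bound t X G e₁ e₂ = ℕₚ.+-cancelˡ-< (t * Q) (Q * X) (X + G) (ℕₚ.<-≤-trans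
    (ℕₚ.≤-trans (ℕₚ.≤-reflexive (cong suc (≡.trans (ex₁ t Q X) (cong (Q *_) e₁)))) h)
    (ℕₚ.≤-trans (ℕₚ.≤-reflexive (≡.trans (cong₂ _+_ (sym e₁) (sym e₂)) (ex₂ t X x G))) (ℕₚ.+-monoˡ-≤ (X + G) (ℕₚ.*-monoʳ-≤ t wv))))
    where
    ex₁ : ∀ t Q X → t * Q + Q * X ≡ Q * (t + X)
    ex₁ = ℕSolver.solve-∀
    ex₂ : ∀ t X x G → t + X + (t * x + G) ≡ t * suc x + (X + G)
    ex₂ = ℕSolver.solve-∀

vars : ℕ → ℕ → List Bool
vars M n = replicate M true ++ replicate n false

private
  psum≤sum : ∀ k v → psum k (evens v) ≤ sum v
  psum≤sum k v = ℕₚ.≤-trans (psum≤total k (evens v)) (ℕₚ.≤-reflexive (total-evens v))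

  letters-psum : ∀ M n m → All (λ (q , v) → psum M (evens v) ≤ M) (letters (vars M n) m)
  letters-psum zero    n m = All.universal (λ _ → z≤n) (letters (vars 0 n) m)
  letters-psum (suc M) n m = All-concatMap _ (All.map (λ { {a , r} h → AllP.map⁺ (All.map (λ le → ℕₚ.+-mono-≤ h le) (letters-psum M n r)) }) (steps≤1 m))
    where
    steps≤1 : ∀ m → All (λ (a , r) → a ≤ 1) (steps m)
    steps≤1 zero    = z≤n ∷ []
    steps≤1 (suc m) = z≤n ∷ s≤s z≤n ∷ []

  antidiag-init : ∀ l → ∃ λ xs → antidiag l ≡ xs ++ (l , 0) ∷ [] × All (λ (a , r) → a < l) xs
  antidiag-init zero    = [] , ≡.refl , []
  antidiag-init (suc l) with antidiag-init l
  ... | xs , e , a = (0 , suc l) ∷ map (λ (i , j) → suc i , j) xs ,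
    cong ((0 , suc l) ∷_) (≡.trans (cong (map _) e) (Listₚ.map-++ _ xs ((l , 0) ∷ []))) , s≤s z≤n ∷ AllP.map⁺ (All.map s≤s a)

-- y₁ ⋯ y_M x₁^l is the only monomial of maximal weight.
letters-heaviest : ∀ M l n → (1 ≤ l → 1 ≤ n) → ∃ λ Ls →
  letters (vars M n) (M + l) ↭ (zpar M , zvec M l n) ∷ Ls × All (λ (q , v) → weightOf M (evens v) < M + (M + l)) Ls
letters-heaviest zero zero    zero    h = [] , ↭-refl , []
letters-heaviest zero (suc l) zero    h = ⊥-elim (ℕₚ.<-irrefl ≡.refl (h (s≤s z≤n)))
letters-heaviest zero l       (suc n) h with antidiag-init l
... | xs , e , a = concatMap F xs , ↭-trans (↭-reflexive (≡.trans (cong (concatMap F) e) (≡.trans (Listₚ.concatMap-++ F xs ((l , 0) ∷ [])) (cong (concatMap F xs ++_) (cong (_++ []) last)))))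
    (Perm.++-comm (concatMap F xs) _) ,
  All-concatMap F (All.map (λ { {b , r} b<l → AllP.map⁺ (All.universal (λ _ → ℕₚ.≤-trans (s≤s (ℕₚ.≤-reflexive (ℕₚ.+-identityʳ b))) b<l) (letters (replicate n false) r)) }) a)
  where
  F : ℕ × ℕ → List Mono
  F (a , r) = map (λ (q , v) → twist false a q , a ∷ v) (letters (replicate n false) r)
  last : F (l , 0) ≡ (false , l ∷ replicate n 0) ∷ []
  last = ≡.trans (cong (map (λ (q , v) → q , l ∷ v)) (letters-0 (replicate n false))) (cong (λ k → (false , l ∷ replicate k 0) ∷ []) (Listₚ.length-replicate n))
letters-heaviest (suc M) l n h with letters-heaviest M l n h
... | Ls , p , a = map odd∷ Ls ++ map even∷ (letters (vars M n) (suc (M + l))) ,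
  ↭-trans (Perm.++-comm (map even∷ (letters (vars M n) (suc (M + l)))) (map odd∷ (letters (vars M n) (M + l)) ++ []))
    (↭-trans (Perm.++⁺ʳ (map even∷ (letters (vars M n) (suc (M + l)))) (↭-trans (↭-reflexive (Listₚ.++-identityʳ _)) (Perm.map⁺ odd∷ p))) ↭-refl) ,
  AllP.++⁺ (AllP.map⁺ (All.map (λ { {q , v} b → ℕₚ.≤-trans (ℕₚ.≤-reflexive (ex₁ (psum M (evens v)) (psum (suc M) (evens v)))) (ℕₚ.≤-trans (s≤s (s≤s b)) (ℕₚ.≤-reflexive (ex₂ M l))) }) a))
    -- Without y_1 the first partial sum is at most M instead of M + 1, and the second is bounded by
    -- the degree, so the maximum is missed.
    (AllP.map⁺ (All.zipWith (λ { {q , v} (b , s) → s≤s (ℕₚ.+-mono-≤ b (ℕₚ.≤-trans (psum≤sum (suc M) v) (ℕₚ.≤-reflexive s))) })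
      (letters-psum M n (suc (M + l)) , letters-sum (vars M n) (suc (M + l)))))
  where
  even∷ odd∷ : Mono → Mono
  even∷ (q , v) = q , 0 ∷ v
  odd∷  (q , v) = not q , 1 ∷ v
  ex₁ : ∀ a b → suc (suc a + suc b) ≡ suc (suc (suc (a + b)))
  ex₁ = ℕSolver.solve-∀
  ex₂ : ∀ M l → suc (suc (M + (M + l))) ≡ suc M + (suc M + l)
  ex₂ = ℕSolver.solve-∀

length-zvec : ∀ M l n → length (zvec M l n) ≡ M + n
length-zvec (suc M) l n       = cong suc (length-zvec M l n)
length-zvec zero    l zero    = ≡.refl
length-zvec zero    l (suc n) = cong suc (Listₚ.length-replicate n)

weight-zvec : ∀ M l n → (1 ≤ l → 1 ≤ n) → weightOf M (evens (zvec M l n)) ≡ M + (M + l)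
weight-zvec M l n h = cong₂ _+_ (first M) (second M l n h)
  where
  first : ∀ M → psum M (evens (zvec M l n)) ≡ M
  first zero    = ≡.refl
  first (suc M) = cong suc (first M)
  second : ∀ M l n → (1 ≤ l → 1 ≤ n) → psum (suc M) (evens (zvec M l n)) ≡ M + l
  second (suc M) l       n       h = cong suc (second M l n h)
  second zero    zero    zero    h = ≡.refl
  second zero    (suc l) zero    h = ⊥-elim (ℕₚ.<-irrefl ≡.refl (h (s≤s z≤n)))
  second zero    l       (suc n) h = ℕₚ.+-identityʳ l

length-parities : ∀ w {M n} → parities w ≡ vars M n → length w ≡ M + n
length-parities w {M} {n} e = ≡.trans (sym (Listₚ.length-map proj₁ w)) (≡.trans (cong length e)
  (≡.trans (Listₚ.length-++ (replicate M true)) (cong₂ _+_ (Listₚ.length-replicate M) (Listₚ.length-replicate n))))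

xor-same : ∀ p → p xor p ≡ false
xor-same true  = ≡.refl
xor-same false = ≡.refl

-- Once N is large, every contribution contains the heaviest monomial in its first part.
W-heaviest : ∀ M l n → (1 ≤ l → 1 ≤ n) → ∀ N ξ γ → parities γ ≡ vars M n →
  (M + (M + l)) * (N + total ξ) < N + weightOf M γ →
  W (M + l) ((zpar M , N) ∷ ξ) γ ≡ ∑ (subs (1 ∷ []) ((zpar M , N) ∷ ξ)) (λ ξ′ → ∑ (subs (zvec M l n) γ) (W (M + l) ξ′))
W-heaviest M l n h N ξ γ pγ big with letters-heaviest M l n h
... | Ls , perm′ , light = begin
  W (M + l) ((s , N) ∷ ξ) γ
    ≡⟨ W-as ((s , N) ∷ ξ) γ pγ ⟩
  Wl ((s , z) ∷ Ls) ((s , N) ∷ ξ) γ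
    ≡⟨ unfold N γ ⟩
  ∑ (antidiag N) (λ (i , j) → T i j γ)
    ≡⟨ split N big ⟩
  ∑ (sub 1 N) (λ (_ , N′) → ∑ (subs z γ) (λ γ₁ → ∑ (antidiag N′) (λ (i , j) → T i j γ₁)))
    ≡⟨ ∑-cong (sub 1 N) (λ (_ , N′) → ≡.trans (∑-cong-All (All.map (λ { {γ₁} (p₁ , _) → sym (≡.trans (W-as ((s , N′) ∷ ξ) γ₁ (≡.trans p₁ pγ)) (unfold N′ γ₁)) }) (subs-good z γ lz)))
         (sym (ℤₚ.+-identityʳ _))) ⟩
  ∑ (sub 1 N) (λ (_ , N′) → ∑ (subs z γ) (W (M + l) ((s , N′) ∷ ξ)) +ℤ + 0)
    ≡⟨ sym (∑-subs 1 [] s N ξ (λ ξ′ → ∑ (subs z γ) (W (M + l) ξ′))) ⟩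
  ∑ (subs (1 ∷ []) ((s , N) ∷ ξ)) (λ ξ′ → ∑ (subs z γ) (W (M + l) ξ′)) ∎
  where
  open ≡-Reasoning
  s = zpar M
  z = zvec M l n
  Q = M + (M + l)
  lz : length z ≡ length γ
  lz = ≡.trans (length-zvec M l n) (sym (length-parities γ {M} {n} pγ))
  W-as : ∀ ξ γ → parities γ ≡ vars M n → W (M + l) ξ γ ≡ Wl ((s , z) ∷ Ls) ξ γ
  W-as ξ γ p = Wl-↭ (↭-trans (↭-reflexive (cong (λ ps → letters ps (M + l)) p)) perm′) ξ γ
  T : ℕ → ℕ → Word → ℤ
  T i j γ = ∑ (lowers s ξ) (λ (t , ξ′) → ∑ (subs (scale (i + t) z) γ) (Wl Ls ((s , j) ∷ ξ′)))
  unfold : ∀ N γ → Wl ((s , z) ∷ Ls) ((s , N) ∷ ξ) γ ≡ ∑ (antidiag N) (λ (i , j) → T i j γ)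
  -- The first letter has the parity of z, so z may occur in it any number of times.
  unfold N γ = ≡.trans (∑-lowers s s N ξ _) (cong (λ b → ∑ (take≤ b N) (λ (i , j) → T i j γ)) (xor-same s))
  light′ : All (λ (q , v) → length v ≡ length γ × weightOf M (evens v) < Q) Ls
  light′ with Perm.All-resp-↭ perm′ (letters-length (vars M n) (M + l))
  ... | _ ∷ lens = All.zipWith (λ (x , y) → ≡.trans x (sym (≡.trans (sym (Listₚ.length-map proj₁ γ)) (cong length pγ))) , y) (lens , light)
  -- If z does not occur in the first letter, the N monomials there weigh less than Q each and the
  -- other `total ξ` at most Q each; by the hypothesis this is too little for γ.
  first : ∀ N → Q * (N + total ξ) < N + weightOf M γ → T 0 N γ ≡ + 0
  first N big = ≡.trans (∑-cong-All (All.map (λ { {t , ξ′} (_ , tot , _) → ≡.trans (∑-cong-All (All.zipWith (λ { {γ′} (lγ , (_ , wγ)) →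
      Wl-light M Q Ls ((s , N) ∷ ξ′) γ′ (All.map (λ (x , y) → ≡.trans x (sym lγ) , y) light′)
        (bound t (total ξ′) (weightOf M γ′) tot (≡.trans (cong (λ k → t * k + weightOf M γ′) (sym (weight-zvec M l n h))) wγ)) })
      (length-subs (scale t z) γ , subs-weight M t z γ lz))) (∑-ε (subs (scale t z) γ) (λ _ → ≡.refl)) }) (lowers-good s ξ))) (∑-ε (lowers s ξ) (λ _ → ≡.refl))
    where
    bound : ∀ t X G → t + X ≡ total ξ → t * Q + G ≡ weightOf M γ → Q * (N + X) < N + X + G
    bound t X G e₁ e₂ = ℕₚ.<-≤-trans (ℕₚ.+-cancelˡ-< (t * Q) (Q * (N + X)) (N + G)
        (ℕₚ.≤-trans (ℕₚ.≤-reflexive (cong suc (≡.trans (ex₁ t Q N X) (cong (λ k → Q * (N + k)) e₁)))) (ℕₚ.≤-trans big (ℕₚ.≤-reflexive (≡.trans (cong (λ k → N + k) (sym e₂)) (ex₂ N (t * Q) G))))))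
      (ℕₚ.+-monoˡ-≤ G (ℕₚ.m≤m+n N X))
      where
      ex₁ : ∀ t Q N X → t * Q + Q * (N + X) ≡ Q * (N + (t + X))
      ex₁ = ℕSolver.solve-∀
      ex₂ : ∀ N a G → N + (a + G) ≡ a + (N + G)
      ex₂ = ℕSolver.solve-∀
  split : ∀ N → Q * (N + total ξ) < N + weightOf M γ →
    ∑ (antidiag N) (λ (i , j) → T i j γ) ≡ ∑ (sub 1 N) (λ (_ , N′) → ∑ (subs z γ) (λ γ₁ → ∑ (antidiag N′) (λ (i , j) → T i j γ₁)))
  split zero    big = ≡.trans (ℤₚ.+-identityʳ _) (first 0 big)
  split (suc N) big = ≡.trans (∑-antidiag-suc N (λ (i , j) → T i j γ)) (≡.trans (cong₂ _+ℤ_ (first (suc N) big) rest)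
    (ℤₚ.+-comm (+ 0) (∑ (subs z γ) (λ γ₁ → ∑ (antidiag N) (λ (i , j) → T i j γ₁)))))
    where
    rest : ∑ (antidiag N) (λ (i , j) → T (suc i) j γ) ≡ ∑ (subs z γ) (λ γ₁ → ∑ (antidiag N) (λ (i , j) → T i j γ₁))
    rest = ≡.trans (∑-cong (antidiag N) (λ (i , j) → ≡.trans (∑-cong (lowers s ξ) (λ (t , ξ′) → ≡.trans (sym (∑-subs-scale 1 (i + t) z γ (Wl Ls ((s , j) ∷ ξ′))))
        (cong (λ v → ∑ (subs v γ) (λ γ₁ → ∑ (subs (scale (i + t) z) γ₁) (Wl Ls ((s , j) ∷ ξ′)))) (scale-1 z)))) (∑-comm (lowers s ξ) (subs z γ) _)))
      (∑-comm (antidiag N) (subs z γ) _)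

outer : List ℕ → ℕ → Word → Word → ℤ
outer κ m Ξ γ = Ext (conv (K κ) (λ ξ → W m ξ γ)) Ξ

coefficient : List ℕ → List ℕ → ℕ → Word → Word → ℤ
coefficient ν κ m Λ Ξ = Ext (conv (K ν) (outer κ m Ξ)) Λ

-- `K π` vanishes outside degree `sum π`, so F and G are compared only on the complements of words
-- of that degree.
conv-cong : ∀ π {F G : Word → ℤ} w → (∀ u v → total u ≡ sum π → parities v ≡ parities w → total u + total v ≡ total w → (∀ k → psum k u + psum k v ≡ psum k w) → F v ≡ G v) →
  conv (K π) F w ≡ conv (K π) G w
conv-cong π {F} {G} w h = ∑-cong-All (All.map (λ { {u , v} (_ , pv , t , s) → term u v pv t s }) (splitsW-good w))
  where
  term : ∀ u v → parities v ≡ parities w → total u + total v ≡ total w → (∀ k → psum k u + psum k v ≡ psum k w) → K π u *ℤ F v ≡ K π u *ℤ G v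
  term u v pv t s with total u ℕₚ.≟ sum π
  ... | yes e  = cong (K π u *ℤ_) (h u v e pv t s)
  ... | no  ne rewrite K-degree π u ne = ≡.refl

-- The summand `sum κ + (sum ν + sum ν)` pays for the skewing: a factor of the size of κ takes at
-- most `sum κ` from the first letter of ξ, and one of the size of ν at most `sum ν` from each of
-- the two partial sums in `weightOf`. Dominance bounds the rest from below, so `W-heaviest` applies
-- to every term; the shifts it produces then pass through `conv` and `Ext`.
coefficient-step : ∀ ν κ M l n → (1 ≤ l → 1 ≤ n) → ∀ Λ a Ξ → parities Λ ≡ vars M n →
  (M + (M + l)) * (suc a + total Ξ) + (sum κ + (sum ν + sum ν)) < suc a + weightOf M (addW (zvec M l n) Λ) →
  coefficient ν κ (M + l) (addW (zvec M l n) Λ) ((zpar M , suc a) ∷ Ξ) ≡ coefficient ν κ (M + l) Λ ((zpar M , a) ∷ Ξ)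
coefficient-step ν κ M l n h Λ a Ξ pΛ big = begin
  Ext (conv (K ν) (outer κ m Ξ⁺)) Λ⁺
    ≡⟨ Ext-cong-≥ Λ⁺ (λ u d → ≡.trans (conv-cong ν u (λ u₁ u₂ e pu _ s → outer-step u u₁ u₂ d e pu s)) (conv-shift z (K ν) (outer κ m Ξ⁰) u)) ⟩
  Ext (λ u → ∑ (subs z u) (conv (K ν) (outer κ m Ξ⁰))) Λ⁺
    ≡⟨ Ext-shift z Λ (conv (K ν) (outer κ m Ξ⁰)) ⟩
  Ext (conv (K ν) (outer κ m Ξ⁰)) Λ ∎
  where
  open ≡-Reasoning
  m = M + l
  Q = M + (M + l)
  z = zvec M l n
  Λ⁺ = addW z Λ
  Ξ⁰ = (zpar M , a) ∷ Ξ
  Ξ⁺ = (zpar M , suc a) ∷ Ξ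
  parities-addW : ∀ z w → parities (addW z w) ≡ parities w
  parities-addW []      w             = ≡.refl
  parities-addW (k ∷ z) []            = ≡.refl
  parities-addW (k ∷ z) ((p , n) ∷ w) = cong (p ∷_) (parities-addW z w)
  outer-step : ∀ u u₁ u₂ → Dominates u Λ⁺ → total u₁ ≡ sum ν → parities u₂ ≡ parities u → (∀ k → psum k u₁ + psum k u₂ ≡ psum k u) →
    outer κ m Ξ⁺ u₂ ≡ ∑ (subs z u₂) (outer κ m Ξ⁰)
  outer-step u u₁ u₂ du eν pu su = begin
    Ext (conv (K κ) (λ ξ → W m ξ u₂)) Ξ⁺
      ≡⟨ Ext-cong-≥ Ξ⁺ (λ ξ dξ → ≡.trans (conv-cong κ ξ (λ ξ₁ ξ₂ e pξ t s → inner ξ ξ₁ ξ₂ dξ e (≡.trans pξ (parities≡ dξ)) t s))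
           (conv-shift (1 ∷ []) (K κ) (λ ξ → ∑ (subs z u₂) (W m ξ)) ξ)) ⟩
    Ext (λ ξ → ∑ (subs (1 ∷ []) ξ) (conv (K κ) (λ ξ → ∑ (subs z u₂) (W m ξ)))) Ξ⁺
      ≡⟨ Ext-shift (1 ∷ []) Ξ⁰ (conv (K κ) (λ ξ → ∑ (subs z u₂) (W m ξ))) ⟩
    Ext (conv (K κ) (λ ξ → ∑ (subs z u₂) (W m ξ))) Ξ⁰
      ≡⟨ Ext-cong Ξ⁰ (λ ξ → ≡.trans (∑-cong (splitsW ξ) (λ (ξ₁ , ξ₂) → ∑-*ˡ (K κ ξ₁) (subs z u₂) (W m ξ₂))) (∑-comm (splitsW ξ) (subs z u₂) _)) ⟩
    Ext (λ ξ → ∑ (subs z u₂) (λ γ → conv (K κ) (λ ξ → W m ξ γ) ξ)) Ξ⁰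
      ≡⟨ Ext-∑ (subs z u₂) (λ γ → conv (K κ) (λ ξ → W m ξ γ)) Ξ⁰ ⟩
    ∑ (subs z u₂) (outer κ m Ξ⁰) ∎
    where
    inner : ∀ ξ ξ₁ ξ₂ → Dominates ξ Ξ⁺ → total ξ₁ ≡ sum κ → parities ξ₂ ≡ parities Ξ⁺ → total ξ₁ + total ξ₂ ≡ total ξ → (∀ k → psum k ξ₁ + psum k ξ₂ ≡ psum k ξ) →
      W m ξ₂ u₂ ≡ ∑ (subs (1 ∷ []) ξ₂) (λ ξ′ → ∑ (subs z u₂) (W m ξ′))
    inner ξ ξ₁ ((s , N) ∷ ξ₂) dξ eκ pξ t sξ with Listₚ.∷-injectiveˡ pξ
    ... | ≡.refl = W-heaviest M l n h N ξ₂ u₂ (≡.trans pu (≡.trans (parities≡ du) (≡.trans (parities-addW z Λ) pΛ)))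
      (ℕₚ.+-cancelʳ-< c _ _ (ℕₚ.≤-<-trans (ℕₚ.+-monoˡ-≤ c (ℕₚ.*-monoʳ-≤ Q sizes)) (ℕₚ.<-≤-trans big weights)))
      where
      c = sum κ + (sum ν + sum ν)
      sizes : N + total ξ₂ ≤ suc a + total Ξ
      sizes = ℕₚ.≤-trans (ℕₚ.m≤n+m (N + total ξ₂) (total ξ₁)) (ℕₚ.≤-reflexive (≡.trans t (total≡ dξ)))
      first : suc a ≤ sum κ + N
      first = ℕₚ.≤-trans (ℕₚ.≤-reflexive (sym (ℕₚ.+-identityʳ (suc a)))) (ℕₚ.≤-trans (psum≥ dξ 1) (ℕₚ.≤-trans (ℕₚ.≤-reflexive (sym (sξ 1)))
        (ℕₚ.+-mono-≤ (ℕₚ.≤-trans (psum≤total 1 ξ₁) (ℕₚ.≤-reflexive eκ)) (ℕₚ.≤-reflexive (ℕₚ.+-identityʳ N)))))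
      part : ∀ k → psum k Λ⁺ ≤ sum ν + psum k u₂
      part k = ℕₚ.≤-trans (psum≥ du k) (ℕₚ.≤-trans (ℕₚ.≤-reflexive (sym (su k))) (ℕₚ.+-monoˡ-≤ (psum k u₂) (ℕₚ.≤-trans (psum≤total k u₁) (ℕₚ.≤-reflexive eν))))
      weights : suc a + weightOf M Λ⁺ ≤ N + weightOf M u₂ + c
      weights = ℕₚ.≤-trans (ℕₚ.+-mono-≤ first (ℕₚ.+-mono-≤ (part M) (part (suc M)))) (ℕₚ.≤-reflexive (ex (sum κ) N (sum ν) (psum M u₂) (psum (suc M) u₂)))
        where
        ex : ∀ k N v x y → k + N + (v + x + (v + y)) ≡ N + (x + y) + (k + (v + v))
        ex = ℕSolver.solve-∀

outer-super : ∀ κ m Ξ → Super (outer κ m Ξ)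
outer-super κ m Ξ = Ext-super Ξ (λ ξ → Super-∑ (splitsW ξ) (λ (u , v) → Super-* (K κ u) (W-super m v)))

isEven-zpar : ∀ M → isEven M ≡ not (zpar M)
isEven-zpar zero          = ≡.refl
isEven-zpar (suc zero)    = ≡.refl
isEven-zpar (suc (suc M)) rewrite isEven-zpar M with zpar M
... | true  = ≡.refl
... | false = ≡.refl

isEven-+ : ∀ M l → isEven (M + l + l) ≡ isEven M
isEven-+ M zero    = cong isEven (≡.trans (ℕₚ.+-identityʳ (M + 0)) (ℕₚ.+-identityʳ M))
isEven-+ M (suc l) = ≡.trans (cong isEven (ex M l)) (isEven-+ M l)
  where
  ex : ∀ M l → M + suc l + suc l ≡ suc (suc (M + l + l))
  ex = ℕSolver.solve-∀

-- With m = M + l the number m + l has the parity of M, hence that of z. In the odd case the first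
-- column is split off, where the boxes of `rect 1 j` go; in the even case the first row is the
-- growing part.
square-word : ∀ l M {ρ} → Linked _≥_ ρ → ∃ λ a → ∃ λ Ξ → ∀ j → 1 ≤ j → ∀ {F} → Super F →
  Ext F (evens (square l (M + l) ρ j)) ≡ Ext F ((zpar M , a + j) ∷ Ξ)
square-word l M {ρ} lin rewrite isEven-+ M l | isEven-zpar M with zpar M
... | false = hd ρ , evens (tl ρ) , λ { (suc j) _ {F} S → cong (λ u → Ext F (evens u)) (⊕-single-∷ ρ j) }
... | true  = length (cut 0 ρ) , evens (cut 1 ρ) , λ j _ {F} S → ≡.trans (Ext-colWord 1 (⊔-Linked ρ (rect 1 j)) S)
  (cong₂ (λ k u → Ext F ((true , k) ∷ evens u)) (length-cut-⊔ ρ j (s≤s z≤n)) (cut-⊔-replicate 1 j lin))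

psum-addW : ∀ k z w → length z ≡ length w → psum k (addW z w) ≡ psum k (evens z) + psum k w
psum-addW zero    z       w             e = ≡.refl
psum-addW (suc k) []      []            e = ≡.refl
psum-addW (suc k) (x ∷ z) ((p , n) ∷ w) e = ≡.trans (cong (λ i → x + n + i) (psum-addW k z w (ℕₚ.suc-injective e))) (+-interchange x n (psum k (evens z)) (psum k w))

module Stability (μ ν ρ κ : List ℕ) (lμ : Linked _≥_ μ) (lν : Linked _≥_ ν) (lρ : Linked _≥_ ρ) (lκ : Linked _≥_ κ) (M l : ℕ) where

  private
    m = M + l
    Q = M + (M + l)
    a₀ = proj₁ (square-word l M lρ)
    Ξ  = proj₁ (proj₂ (square-word l M lρ))
    lam : ℕ → List ℕ
    lam j = (μ ⊕ single (l * j)) ⊔ rect M j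
    Λ : ℕ → Word
    Λ j = colWord 0 M (lam j)
    n : ℕ → ℕ
    n j = length (cut M (μ ⊕ single (l * j)))
    A : ℕ → ℤ
    A j = seqA l m μ ν ρ κ j

    A-coefficient : ∀ j → 1 ≤ j → A j ≡ coefficient ν κ m (Λ j) ((zpar M , a₀ + j) ∷ Ξ)
    A-coefficient j 1≤j = begin
      plethCoeff (curly l m μ j) ν (square l m ρ j) κ m
        ≡⟨ plethCoeff-Ext (curly l m μ j) lν (square l m ρ j) lκ m ⟩
      Ext (conv (K ν) (outer κ m (evens (square l m ρ j)))) (evens (curly l m μ j))
        ≡⟨ cong (λ k → Ext (conv (K ν) (outer κ m (evens (square l m ρ j)))) (evens ((μ ⊕ single (l * j)) ⊔ rect k j))) (ℕₚ.m+n∸n≡m M l) ⟩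
      Ext (conv (K ν) (outer κ m (evens (square l m ρ j)))) (evens (lam j))
        ≡⟨ Ext-cong (evens (lam j)) (λ u → ∑-cong (splitsW u) (λ (u₁ , u₂) → cong (K ν u₁ *ℤ_)
             (proj₂ (proj₂ (square-word l M lρ)) j 1≤j (conv-super (K-super κ) (Wl-super (letters (parities u₂) m) u₂))))) ⟩
      Ext (conv (K ν) (outer κ m ((zpar M , a₀ + j) ∷ Ξ))) (evens (lam j))
        ≡⟨ Ext-colWord M (⊔-Linked (μ ⊕ single (l * j)) (rect M j)) (conv-super (K-super ν) (outer-super κ m ((zpar M , a₀ + j) ∷ Ξ))) ⟩
      coefficient ν κ m (Λ j) ((zpar M , a₀ + j) ∷ Ξ) ∎
      where open ≡-Reasoning

    weight-step : ∀ j → M < j → weightOf M (addW (zvec M l (n j)) (Λ j)) ≡ Q + weightOf M (Λ j)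
    weight-step j h with curly-word l M lμ j h
    ... | _ , p , pos = ≡.trans (cong₂ _+_ (psum-addW M (zvec M l (n j)) (Λ j) len) (psum-addW (suc M) (zvec M l (n j)) (Λ j) len))
        (≡.trans (+-interchange (psum M z) (psum M (Λ j)) (psum (suc M) z) (psum (suc M) (Λ j))) (cong (_+ weightOf M (Λ j)) (weight-zvec M l (n j) pos)))
      where
      z = evens (zvec M l (n j))
      len : length (zvec M l (n j)) ≡ length (Λ j)
      len = ≡.trans (length-zvec M l (n j)) (sym (length-parities (Λ j) {M} {n j} p))

    weight-growth : ∀ i → i * Q ≤ weightOf M (Λ (i + suc M))
    weight-growth zero    = z≤n
    weight-growth (suc i) = ℕₚ.≤-trans (ℕₚ.+-monoʳ-≤ Q (weight-growth i)) (ℕₚ.≤-reflexive (sym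
      (≡.trans (cong (weightOf M) (proj₁ (curly-word l M lμ (i + suc M) h))) (weight-step (i + suc M) h))))
      where
      h : M < i + suc M
      h = ℕₚ.m≤n+m (suc M) i

    c = sum κ + (sum ν + sum ν)
    -- `suc M` is the least index to which `curly-word` applies. At j = i + suc M, Q times the outer
    -- size is Q * (a₀ + suc M + total Ξ) + i * Q, while the weight is at least i * Q. The growing
    -- terms cancel, and it suffices that the first part exceeds what is left.
    bound = Q * (a₀ + suc M + total Ξ) + c

    step : ∀ i → bound ≤ i → A (suc (i + suc M)) ≡ A (i + suc M)
    step i b≤i = begin
      A (suc j)
        ≡⟨ A-coefficient (suc j) (s≤s z≤n) ⟩
      coefficient ν κ m (Λ (suc j)) ((zpar M , a₀ + suc j) ∷ Ξ)
        ≡⟨ cong₂ (λ w k → coefficient ν κ m w ((zpar M , k) ∷ Ξ)) (proj₁ cw′) (ℕₚ.+-suc a₀ j) ⟩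
      coefficient ν κ m (addW (zvec M l (n j)) (Λ j)) ((zpar M , suc (a₀ + j)) ∷ Ξ)
        ≡⟨ coefficient-step ν κ M l (n j) (proj₂ (proj₂ cw′)) (Λ j) (a₀ + j) Ξ (proj₁ (proj₂ cw′)) big ⟩
      coefficient ν κ m (Λ j) ((zpar M , a₀ + j) ∷ Ξ)
        ≡⟨ sym (A-coefficient j (ℕₚ.≤-trans (s≤s z≤n) M<j)) ⟩
      A j ∎
      where
      open ≡-Reasoning
      j = i + suc M
      M<j : M < j
      M<j = ℕₚ.m≤n+m (suc M) i
      cw′ = curly-word l M lμ j M<j
      big : Q * (suc (a₀ + j) + total Ξ) + c < suc (a₀ + j) + weightOf M (addW (zvec M l (n j)) (Λ j))
      big = ℕₚ.≤-<-trans (ℕₚ.≤-reflexive (ex Q a₀ i (suc M) (total Ξ) c)) (ℕₚ.+-mono-<-≤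
          (s≤s (ℕₚ.≤-trans b≤i (ℕₚ.≤-trans (ℕₚ.m≤m+n i (suc M)) (ℕₚ.m≤n+m j a₀))))
          (ℕₚ.≤-trans (ℕₚ.+-monoʳ-≤ Q (weight-growth i)) (ℕₚ.≤-reflexive (sym (weight-step j M<j)))))
        where
        ex : ∀ Q a i J t c → Q * (suc (a + (i + J)) + t) + c ≡ Q * (a + J + t) + c + (Q + i * Q)
        ex = ℕSolver.solve-∀

  stable : Σ ℕ (λ N → (j : ℕ) → N ≤ j → A j ≡ A N)
  stable = bound + suc M , λ j h → subst (λ k → A k ≡ A (bound + suc M)) (≡.trans (ℕₚ.+-assoc (j ∸ (bound + suc M)) bound (suc M)) (ℕₚ.m∸n+n≡m h)) (go (j ∸ (bound + suc M)))
    where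
    go : ∀ i → A (i + bound + suc M) ≡ A (bound + suc M)
    go zero    = ≡.refl
    go (suc i) = ≡.trans (step (i + bound) (ℕₚ.m≤n+m bound i)) (go i)

theorem1p3 : (μ ν ρ κ : List ℕ) → IsPartition μ → IsPartition ν → IsPartition ρ → IsPartition κ →
    (m : ℕ) → 1 ≤ m → (l : ℕ) → l ≤ m →
    Σ ℕ (λ N → (j : ℕ) → N ≤ j → seqA l m μ ν ρ κ j ≡ seqA l m μ ν ρ κ N)
theorem1p3 μ ν ρ κ (lμ , _) (lν , _) (lρ , _) (lκ , _) m _ l l≤m =
  subst (λ m → Σ ℕ (λ N → (j : ℕ) → N ≤ j → seqA l m μ ν ρ κ j ≡ seqA l m μ ν ρ κ N)) (ℕₚ.m∸n+n≡m l≤m)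
    (Stability.stable μ ν ρ κ lμ lν lρ lκ (m ∸ l) l)
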